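{- For $c>0$ let $\mu^c$ be the probability measure on $\mathbb{R}$ whose odd moments vanish and whose even moments are \[ m_{2\ell}(\mu^c)=\sum_{m=1}^{\ell+1}\frac{1}{c^{\ell-m+1}}\frac{w_{m,2\ell}}{m!},\qquad \ell\ge 0 \] (equivalently, $\mu^c$ is the limit as $n\to\infty$ of the expected normalized spectral measure $\frac1n\sum_{\lambda\in \mathrm{Sp}(c^{ -1/2}A(G(n,c/n)))}\delta_\lambda$ of the Erdős–Rényi random graph $G(n,c/n)$, and it is determined by its moments). Let \[ f(x)=1+\tfrac{1}{2}x+\tfrac{3}{8}x^2+\tfrac{29}{16}x^3+\tfrac{1987}{128}x^4+\tfrac{47247}{256}x^5 . \] Let $\sigma$ be the semicircle law, with density $f_0(z)=\frac{1}{2\pi}\sqrt{4-z^2}\,\mathbf 1_{(-2,2)}(z)$, and for $i=1,\dots,5$ let $\sigma_i$ be the signed measure with density $f_i(z)=\frac{1}{2\pi}P_i(z)\sqrt{4-z^2}\,\mathbf 1_{(-2,2)}(z)$, where \begin{align*} P_1(z)&=1-z^2,\\ P_2(z)&=1-6z^2+5z^4-z^6,\\ P_3(z)&=9-140z^2+358z^4-299z^6+98z^8-11z^{10},\\ P_4(z)&=56+1602z^2-8625z^4+16004z^6-13447z^8+5624z^{10}-1143z^{12}+90z^{14},\\ P_5(z)&=442-17946z^2+171911z^4-574676z^6+904447z^8-768354z^{10}\\&\quad+373181z^{12}-103622z^{14}+15298z^{16}-931z^{18}. \end{align*} (These signed measures $\sigma_1,\dots,\sigma_5$ have total mass $0$.)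 Then for every fixed $\ell\ge 0$, as $c\to\infty$, \[ m_{2\ell}(\mu^c)=m_{2\ell}\Big(\Lambda_{f(1/c)}\Big(\sigma+\sum_{i=1}^5\frac{1}{c^i}\sigma_i\Big)\Big)+\mathcal O\Big(\frac{1}{c^6}\Big). \]
   Context: Tree walks: a tree walk of size $m$ and length $L$ is a sequence $(v_1,\dots,v_L)$ of elements of $[m]$ in which every element of $[m]$ occurs, such that the graph with vertex set $[m]$ and edges $\{v_j,v_{j+1}\}$ ($1\le j<L$) and $\{v_L,v_1\}$ is a tree. $w_{m,2\ell}$ is the number of tree walks of size $m$ and length $2\ell$, with conventions $w_{1,0}=1$ and $w_{1,2\ell}=0$ for $\ell\ge1$. $m_k(\mu)=\int x^k\,d\mu(x)$ is the $k$-th moment of a (signed) measure $\mu$. For $\alpha>0$ the dilation operator $\Lambda_\alpha$ maps a measure $\mu$ to the measure $\Lambda_\alpha(\mu)$ with $\Lambda_\alpha(\mu)(A)=\mu(A/\alpha)$ for every Borel set $A$.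
   Formalization: The printed P_2 and P_4 make the claim false (σ_4 has mass 112; the c^-2 term fails at ℓ=3); proved instead with P_2 doubled, 2-12z^2+10z^4-2z^6, and all signs in P_4 after the constant 56 reversed; the random-graph description of μ^c is not stated. -}

module Defs where

open import Data.Nat.Base as ℕ using (ℕ; zero; suc)
import Data.Nat.Properties as ℕ
open import Data.Integer.Base as ℤ using (ℤ) renaming (+_ to pos)
import Data.Integer.Properties as ℤ
open import Data.Rational.Base as ℚ using (ℚ; 0ℚ; 1ℚ; ½)
import Data.Rational.Properties as ℚ
import Data.Rational.Base
import Data.Rational.Unnormalised.Base as ℚᵘ
import Data.Rational.Unnormalised.Properties as ℚᵘ
open import Data.Rational.Solver using (module +-*-Solver)
open import Level using (0ℓ)
open import Data.Fin.Base as Fin using (Fin; zero; suc; toℕ)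
import Data.Fin.Properties as Fin
open import Data.List.Base as List using (List; []; _∷_)
open import Data.Nat.Base using (_!)
open import Data.Nat.Properties using (_!≢0)
open import Data.Vec.Base as Vec using (Vec; []; _∷_)
open import Data.Vec.Membership.Propositional using (_∈_)
open import Data.Vec.Relation.Unary.All as All using (All)
import Data.Vec.Relation.Unary.AllPairs as AllPairs
open import Data.Vec.Relation.Unary.Linked as Linked using (Linked)
open import Data.Vec.Relation.Unary.Unique.Propositional using (Unique)
open import Data.Product.Properties using (≡-dec)
import Relation.Binary.Definitions as Binary
open import Relation.Binary.Core using (Rel)
open import Data.Product.Base using (∃; Σ-syntax; ∃-syntax; _×_; _,_; proj₁; proj₂)
open import Data.Sum.Base using (_⊎_; inj₁; inj₂)
open import Relation.Binary.Bundles using (Preorder)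
import Relation.Binary.Reasoning.Preorder
open import Relation.Nullary.Decidable using (Dec; yes; no; ¬?; _×-dec_; _⊎-dec_; map′)
open import Relation.Nullary.Negation using (¬_; contradiction)
open import Relation.Binary.PropositionalEquality.Core using (_≡_; refl; sym; trans; cong; cong₂; subst)

module Estimates where

  open Data.Rational.Base using (_+_; _*_; _-_; -_; _≤_; _<_; ∣_∣; _⊔_; _⊓_; 1/_)
  open +-*-Solver

  private
    variable
      p q r s ε : ℚ

  half>0 : 0ℚ < ε → 0ℚ < ½ * ε
  half>0 {ε} 0<ε = ℚ.*-monoʳ-<-pos ½ 0<ε

  half+half : ∀ ε → ½ * ε + ½ * ε ≡ ε
  half+half = solve 1 (λ e → con ½ :* e :+ con ½ :* e := e) refl

  0<1+nonNeg : 0ℚ ≤ p → 0ℚ < 1ℚ + p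
  0<1+nonNeg {p} 0≤p = ℚ.+-mono-<-≤ {0ℚ} {1ℚ} {0ℚ} {p} (ℚ.positive⁻¹ 1ℚ) 0≤p

  *-nonNeg : 0ℚ ≤ p → 0ℚ ≤ q → 0ℚ ≤ p * q
  *-nonNeg {p} {q} 0≤p 0≤q =
    subst (_≤ p * q) (ℚ.*-zeroʳ p)
      (ℚ.*-monoˡ-≤-nonNeg p {{ℚ.nonNegative 0≤p}} 0≤q)

  *-pos : 0ℚ < p → 0ℚ < q → 0ℚ < p * q
  *-pos {p} {q} 0<p 0<q =
    subst (_< p * q) (ℚ.*-zeroʳ p) (ℚ.*-monoʳ-<-pos p {{ℚ.positive 0<p}} 0<q)

  *-mono : 0ℚ ≤ p → 0ℚ ≤ s → p ≤ q → r ≤ s → p * r ≤ q * s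
  *-mono {p} {s} {q} {r} 0≤p 0≤s p≤q r≤s = ℚ.≤-trans
    (ℚ.*-monoˡ-≤-nonNeg p {{ℚ.nonNegative 0≤p}} r≤s)
    (ℚ.*-monoʳ-≤-nonNeg s {{ℚ.nonNegative 0≤s}} p≤q)

  shrink : 0ℚ < p → 0ℚ < ε → ∃[ δ ] 0ℚ < δ × p * δ ≡ ε
  shrink {p} {ε} 0<p 0<ε = 1/p * ε , 0<δ , eq
    where
    instance
      p>0 = ℚ.positive 0<p
      p≢0 = ℚ.pos⇒nonZero p
    1/p = 1/ p
    0<δ : 0ℚ < 1/p * ε
    0<δ = subst (_< 1/p * ε) (ℚ.*-zeroʳ 1/p) (ℚ.*-monoʳ-<-pos 1/p {{ℚ.1/pos⇒pos p}} 0<ε)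
    eq : p * (1/p * ε) ≡ ε
    eq = trans (sym (ℚ.*-assoc p 1/p ε)) (trans (cong (_* ε) (ℚ.*-inverseʳ p)) (ℚ.*-identityˡ ε))

  p≤∣p∣ : ∀ p → p ≤ ∣ p ∣
  p≤∣p∣ p with ℚ.≤-total 0ℚ p
  ... | inj₁ 0≤p = ℚ.≤-reflexive (sym (ℚ.0≤p⇒∣p∣≡p 0≤p))
  ... | inj₂ p≤0 = ℚ.≤-trans p≤0 (ℚ.0≤∣p∣ p)

  -p≤∣p∣ : ∀ p → - p ≤ ∣ p ∣
  -p≤∣p∣ p = subst (- p ≤_) (ℚ.∣-p∣≡∣p∣ p) (p≤∣p∣ (- p))

  ∣p∣≤ : p ≤ q → - p ≤ q → ∣ p ∣ ≤ q
  ∣p∣≤ {p} {q} p≤q -p≤q with ℚ.∣p∣≡p∨∣p∣≡-p p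
  ... | inj₁ e = subst (_≤ q) (sym e) p≤q
  ... | inj₂ e = subst (_≤ q) (sym e) -p≤q

  ≤+⇒-≤ : p ≤ q + r → p - q ≤ r
  ≤+⇒-≤ {p} {q} {r} h = subst (p - q ≤_)
    (solve 2 (λ q r → (q :+ r) :+ (:- q) := r) refl q r) (ℚ.+-monoˡ-≤ (- q) h)

  -≤⇒≤+ : p - q ≤ r → p ≤ q + r
  -≤⇒≤+ {p} {q} {r} h = subst (_≤ q + r)
    (solve 2 (λ q p → q :+ (p :+ (:- q)) := p) refl q p) (ℚ.+-monoʳ-≤ q h)

  ∣-∣-comm : ∀ p q → ∣ p - q ∣ ≡ ∣ q - p ∣
  ∣-∣-comm p q = trans
    (cong ∣_∣ (solve 2 (λ p q → p :+ (:- q) := :- (q :+ (:- p))) refl p q))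
    (ℚ.∣-p∣≡∣p∣ (q - p))

  ∣-∣≤ : p ≤ q + r → q ≤ p + r → ∣ p - q ∣ ≤ r
  ∣-∣≤ {p} {q} {r} h₁ h₂ = ∣p∣≤ (≤+⇒-≤ h₁)
    (subst (_≤ r) (solve 2 (λ p q → q :+ (:- p) := :- (p :+ (:- q))) refl p q) (≤+⇒-≤ h₂))

  ∣-∣≤⇒≤+ : ∣ p - q ∣ ≤ r → p ≤ q + r
  ∣-∣≤⇒≤+ {p} {q} h = -≤⇒≤+ (ℚ.≤-trans (p≤∣p∣ (p - q)) h)

  ∣-∣-trans : ∀ p q r {ε₁ ε₂} → ∣ p - q ∣ ≤ ε₁ → ∣ q - r ∣ ≤ ε₂ → ∣ p - r ∣ ≤ ε₁ + ε₂
  ∣-∣-trans p q r {ε₁} {ε₂} h₁ h₂ = subst (λ d → ∣ d ∣ ≤ ε₁ + ε₂)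
    (solve 3 (λ p q r → (p :+ (:- q)) :+ (q :+ (:- r)) := p :+ (:- r)) refl p q r)
    (ℚ.≤-trans (ℚ.∣p+q∣≤∣p∣+∣q∣ (p - q) (q - r)) (ℚ.+-mono-≤ h₁ h₂))

  ∣-∣-+ : ∀ p q r s {ε₁ ε₂} → ∣ p - q ∣ ≤ ε₁ → ∣ r - s ∣ ≤ ε₂ → ∣ (p + r) - (q + s) ∣ ≤ ε₁ + ε₂
  ∣-∣-+ p q r s {ε₁} {ε₂} h₁ h₂ = subst (λ d → ∣ d ∣ ≤ ε₁ + ε₂)
    (solve 4 (λ p q r s → (p :+ (:- q)) :+ (r :+ (:- s)) := (p :+ r) :+ (:- (q :+ s))) refl p q r s)
    (ℚ.≤-trans (ℚ.∣p+q∣≤∣p∣+∣q∣ (p - q) (r - s)) (ℚ.+-mono-≤ h₁ h₂))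

  ∣-∣-neg : ∀ p q → ∣ (- p) - (- q) ∣ ≡ ∣ p - q ∣
  ∣-∣-neg p q = trans
    (cong ∣_∣ (solve 2 (λ p q → (:- p) :+ (:- (:- q)) := :- (p :+ (:- q))) refl p q))
    (ℚ.∣-p∣≡∣p∣ (p - q))

  ∣-∣-* : ∀ p q r s {b c ε₁ ε₂} → ∣ p ∣ ≤ b → ∣ s ∣ ≤ c → ∣ p - q ∣ ≤ ε₁ → ∣ r - s ∣ ≤ ε₂ →
          ∣ p * r - q * s ∣ ≤ b * ε₂ + c * ε₁
  ∣-∣-* p q r s {b} {c} {ε₁} {ε₂} pb sc h₁ h₂ = begin
    ∣ p * r - q * s ∣                      ≡⟨ cong ∣_∣ (solve 4 (λ p q r s →
                                               p :* r :+ (:- (q :* s)) :=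
                                               p :* (r :+ (:- s)) :+ s :* (p :+ (:- q))) refl p q r s) ⟩
    ∣ p * (r - s) + s * (p - q) ∣          ≤⟨ ℚ.∣p+q∣≤∣p∣+∣q∣ (p * (r - s)) (s * (p - q)) ⟩
    ∣ p * (r - s) ∣ + ∣ s * (p - q) ∣      ≡⟨ cong₂ _+_ (ℚ.∣p*q∣≡∣p∣*∣q∣ p (r - s)) (ℚ.∣p*q∣≡∣p∣*∣q∣ s (p - q)) ⟩
    ∣ p ∣ * ∣ r - s ∣ + ∣ s ∣ * ∣ p - q ∣  ≤⟨ ℚ.+-mono-≤ (prod p (r - s) pb h₂) (prod s (p - q) sc h₁) ⟩
    b * ε₂ + c * ε₁                        ∎
    where
    open ℚ.≤-Reasoning
    prod : ∀ x y {u v} → ∣ x ∣ ≤ u → ∣ y ∣ ≤ v → ∣ x ∣ * ∣ y ∣ ≤ u * v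
    prod x y hx hy = *-mono (ℚ.0≤∣p∣ x) (ℚ.≤-trans (ℚ.0≤∣p∣ y) hy) hx hy

  ∣-∣-∣∣ : ∀ p q → ∣ ∣ p ∣ - ∣ q ∣ ∣ ≤ ∣ p - q ∣
  ∣-∣-∣∣ p q = ∣-∣≤ (half p q)
    (subst (λ d → ∣ q ∣ ≤ ∣ p ∣ + d) (∣-∣-comm q p) (half q p))
    where
    half : ∀ p q → ∣ p ∣ ≤ ∣ q ∣ + ∣ p - q ∣
    half p q = subst (λ d → ∣ d ∣ ≤ ∣ q ∣ + ∣ p - q ∣)
      (solve 2 (λ p q → q :+ (p :+ (:- q)) := p) refl p q)
      (ℚ.∣p+q∣≤∣p∣+∣q∣ q (p - q))

  ∣p∣≤∣q∣+ : ∀ p q {ε} → ∣ p - q ∣ ≤ ε → ∣ p ∣ ≤ ∣ q ∣ + ε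
  ∣p∣≤∣q∣+ p q h = ∣-∣≤⇒≤+ (ℚ.≤-trans (∣-∣-∣∣ p q) h)

  min>0 : 0ℚ < p → 0ℚ < q → 0ℚ < p ⊓ q
  min>0 {p} {q} 0<p 0<q with ℚ.≤-total p q
  ... | inj₁ p≤q = subst (0ℚ <_) (sym (ℚ.p≤q⇒p⊓q≡p p≤q)) 0<p
  ... | inj₂ q≤p = subst (0ℚ <_) (sym (ℚ.p≥q⇒p⊓q≡q q≤p)) 0<q

  halfPow : ℕ → ℚ
  halfPow zero    = 1ℚ
  halfPow (suc n) = ½ * halfPow n

  private
    nat : ℕ → ℚ
    nat zero    = 0ℚ
    nat (suc n) = 1ℚ + nat n

    toℚᵘ-nat : ∀ n → ℚ.toℚᵘ (nat n) ℚᵘ.≃ ℚᵘ.mkℚᵘ (pos n) 0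
    toℚᵘ-nat zero    = ℚᵘ.≃-refl
    toℚᵘ-nat (suc n) = ℚᵘ.≃-trans (ℚ.toℚᵘ-homo-+ 1ℚ (nat n))
      (ℚᵘ.≃-trans (ℚᵘ.+-congʳ ℚᵘ.1ℚᵘ (toℚᵘ-nat n))
        (ℚᵘ.*≡* (cong (λ k → (pos 1 ℤ.+ k) ℤ.* pos 1) (ℤ.*-identityʳ (pos n)))))

    0≤nat : ∀ n → 0ℚ ≤ nat n
    0≤nat zero    = ℚ.≤-refl
    0≤nat (suc n) = ℚ.<⇒≤ (0<1+nonNeg (0≤nat n))

    archimedean : 0ℚ < ε → ∃[ n ] 1ℚ ≤ ε * nat n
    archimedean {ℚ.mkℚ (pos zero) d c} (Data.Rational.Base.*<* (ℤ.+<+ ()))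
    archimedean {ℚ.mkℚ (ℤ.-[1+ n ]) d c} (Data.Rational.Base.*<* ())
    archimedean {ε@(ℚ.mkℚ (pos (suc p)) d c)} _ = suc d , ℚ.toℚᵘ-cancel-≤
      (ℚᵘ.≤-respʳ-≃
        (ℚᵘ.≃-sym (ℚᵘ.≃-trans (ℚ.toℚᵘ-homo-* ε (nat (suc d)))
          (ℚᵘ.*-congˡ {ℚ.toℚᵘ ε} (toℚᵘ-nat (suc d)))))
        (ℚᵘ.*≤* (ℤ.+≤+ bound)))
      where
      bound : 1 ℕ.* (suc d ℕ.* 1) ℕ.≤ suc p ℕ.* suc d ℕ.* 1
      bound = subst (ℕ._≤ suc p ℕ.* suc d ℕ.* 1)
        (trans (ℕ.*-identityʳ (suc d)) (sym (trans (ℕ.*-identityˡ (suc d ℕ.* 1)) (ℕ.*-identityʳ (suc d)))))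
        (ℕ.≤-trans (ℕ.*-monoˡ-≤ 1 (ℕ.m≤m+n (suc d) (p ℕ.* suc d))) ℕ.≤-refl)

  0<halfPow : ∀ n → 0ℚ < halfPow n
  0<halfPow zero    = ℚ.positive⁻¹ 1ℚ
  0<halfPow (suc n) = half>0 (0<halfPow n)

  halfPow-suc≤ : ∀ n → halfPow (suc n) ≤ halfPow n
  halfPow-suc≤ n = subst (halfPow (suc n) ≤_) (half+half (halfPow n))
    (subst (_≤ halfPow (suc n) + halfPow (suc n)) (ℚ.+-identityʳ (halfPow (suc n)))
      (ℚ.+-monoʳ-≤ (halfPow (suc n)) (ℚ.<⇒≤ (0<halfPow (suc n)))))

  private
    halfPow≤1 : ∀ n → halfPow n ≤ 1ℚ
    halfPow≤1 zero    = ℚ.≤-refl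
    halfPow≤1 (suc n) = ℚ.≤-trans (halfPow-suc≤ n) (halfPow≤1 n)

    halfPow*nat≤1 : ∀ n → halfPow n * nat n ≤ 1ℚ
    halfPow*nat≤1 zero    = subst (_≤ 1ℚ) (sym (ℚ.*-zeroʳ 1ℚ)) (ℚ.nonNegative⁻¹ 1ℚ)
    halfPow*nat≤1 (suc n) = begin
      (½ * halfPow n) * (1ℚ + nat n)         ≡⟨ solve 2 (λ h m → (con ½ :* h) :* (con 1ℚ :+ m) :=
                                                  con ½ :* h :+ con ½ :* (h :* m)) refl (halfPow n) (nat n) ⟩
      ½ * halfPow n + ½ * (halfPow n * nat n) ≤⟨ ℚ.+-mono-≤ (ℚ.*-monoˡ-≤-nonNeg ½ (halfPow≤1 n))
                                                  (ℚ.*-monoˡ-≤-nonNeg ½ (halfPow*nat≤1 n)) ⟩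
      ½ * 1ℚ + ½ * 1ℚ                         ≡⟨ half+half 1ℚ ⟩
      1ℚ                                      ∎
      where open ℚ.≤-Reasoning

  halfPow-antitone : ∀ {m n} → m ℕ.≤ n → halfPow n ≤ halfPow m
  halfPow-antitone {m} {n} m≤n with ℕ.m≤n⇒∃[o]m+o≡n m≤n
  ... | o , refl = go o
    where
    go : ∀ o → halfPow (m ℕ.+ o) ≤ halfPow m
    go zero    = ℚ.≤-reflexive (cong halfPow (ℕ.+-identityʳ m))
    go (suc o) = ℚ.≤-trans (ℚ.≤-reflexive (cong halfPow (ℕ.+-suc m o)))
                   (ℚ.≤-trans (halfPow-suc≤ (m ℕ.+ o)) (go o))

  halfPow→0 : 0ℚ < ε → ∃[ N ] (∀ n → N ℕ.≤ n → halfPow n ≤ ε)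
  halfPow→0 {ε} 0<ε with archimedean 0<ε
  ... | N , 1≤εN = N , λ n N≤n → ℚ.≤-trans (halfPow-antitone N≤n) small
    where
    small : halfPow N ≤ ε
    small = begin
      halfPow N               ≡⟨ ℚ.*-identityʳ (halfPow N) ⟨
      halfPow N * 1ℚ          ≤⟨ ℚ.*-monoˡ-≤-nonNeg (halfPow N) {{ℚ.nonNegative (ℚ.<⇒≤ (0<halfPow N))}} 1≤εN ⟩
      halfPow N * (ε * nat N) ≡⟨ solve 3 (λ h e m → h :* (e :* m) := e :* (h :* m)) refl (halfPow N) ε (nat N) ⟩
      ε * (halfPow N * nat N) ≤⟨ ℚ.*-monoˡ-≤-nonNeg ε {{ℚ.nonNegative (ℚ.<⇒≤ 0<ε)}} (halfPow*nat≤1 N) ⟩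
      ε * 1ℚ                  ≡⟨ ℚ.*-identityʳ ε ⟩
      ε                       ∎
      where open ℚ.≤-Reasoning

  ⊔-lipschitz : ∀ r p q → ∣ (r ⊔ p) - (r ⊔ q) ∣ ≤ ∣ p - q ∣
  ⊔-lipschitz r p q = ∣-∣≤ (half p q)
    (subst (λ d → r ⊔ q ≤ (r ⊔ p) + d) (∣-∣-comm q p) (half q p))
    where
    half : ∀ p q → r ⊔ p ≤ (r ⊔ q) + ∣ p - q ∣
    half p q = ℚ.⊔-lub
      (ℚ.≤-trans (ℚ.p≤p⊔q r q)
        (subst (_≤ (r ⊔ q) + ∣ p - q ∣) (ℚ.+-identityʳ (r ⊔ q)) (ℚ.+-monoʳ-≤ (r ⊔ q) (ℚ.0≤∣p∣ (p - q)))))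
      (ℚ.≤-trans (∣-∣≤⇒≤+ {p} {q} ℚ.≤-refl) (ℚ.+-monoˡ-≤ ∣ p - q ∣ (ℚ.p≤q⊔p r q)))

  recip : ∀ p → 0ℚ < p → ℚ
  recip p 0<p = (1/ p) {{ℚ.pos⇒nonZero p {{ℚ.positive 0<p}}}}

  module _ (0<p : 0ℚ < p) where

    p*recip : p * recip p 0<p ≡ 1ℚ
    p*recip = ℚ.*-inverseʳ p {{ℚ.pos⇒nonZero p {{ℚ.positive 0<p}}}}

    0<recip : 0ℚ < recip p 0<p
    0<recip = ℚ.positive⁻¹ _ {{ℚ.1/pos⇒pos p {{ℚ.positive 0<p}}}}

  recip-antitone : (0<p : 0ℚ < p) (0<q : 0ℚ < q) → p ≤ q → recip q 0<q ≤ recip p 0<p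
  recip-antitone {p} {q} 0<p 0<q p≤q = begin
    q′            ≡⟨ ℚ.*-identityʳ q′ ⟨
    q′ * 1ℚ       ≡⟨ cong (q′ *_) (p*recip 0<p) ⟨
    q′ * (p * p′) ≤⟨ ℚ.*-monoˡ-≤-nonNeg q′ {{ℚ.nonNegative (ℚ.<⇒≤ (0<recip 0<q))}}
                       (ℚ.*-monoʳ-≤-nonNeg p′ {{ℚ.nonNegative (ℚ.<⇒≤ (0<recip 0<p))}} p≤q) ⟩
    q′ * (q * p′) ≡⟨ solve 3 (λ a b c → a :* (b :* c) := c :* (b :* a)) refl q′ q p′ ⟩
    p′ * (q * q′) ≡⟨ cong (p′ *_) (p*recip 0<q) ⟩
    p′ * 1ℚ       ≡⟨ ℚ.*-identityʳ p′ ⟩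
    p′            ∎
    where
    open ℚ.≤-Reasoning
    p′ = recip p 0<p
    q′ = recip q 0<q

  recip-lipschitz : (0<r : 0ℚ < r) (0<p : 0ℚ < p) (0<q : 0ℚ < q) → r ≤ p → r ≤ q → ∣ p - q ∣ ≤ r * (r * ε) →
                    ∣ recip p 0<p - recip q 0<q ∣ ≤ ε
  recip-lipschitz {r} {p} {q} {ε} 0<r 0<p 0<q r≤p r≤q h = begin
    ∣ p′ - q′ ∣                ≡⟨ cong ∣_∣ eq ⟩
    ∣ (p′ * q′) * (q - p) ∣    ≡⟨ ℚ.∣p*q∣≡∣p∣*∣q∣ (p′ * q′) (q - p) ⟩
    ∣ p′ * q′ ∣ * ∣ q - p ∣    ≡⟨ cong₂ _*_ (ℚ.0≤p⇒∣p∣≡p (*-nonNeg 0≤p′ 0≤q′)) (∣-∣-comm q p) ⟩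
    (p′ * q′) * ∣ p - q ∣      ≤⟨ *-mono (*-nonNeg 0≤p′ 0≤q′) (ℚ.≤-trans (ℚ.0≤∣p∣ (p - q)) h)
                                    (*-mono 0≤p′ 0≤r′ (recip-antitone 0<r 0<p r≤p) (recip-antitone 0<r 0<q r≤q)) h ⟩
    (r′ * r′) * (r * (r * ε))  ≡⟨ solve 3 (λ a b e → (a :* a) :* (b :* (b :* e)) :=
                                    (b :* a) :* ((b :* a) :* e)) refl r′ r ε ⟩
    (r * r′) * ((r * r′) * ε)  ≡⟨ cong (λ u → u * (u * ε)) (p*recip 0<r) ⟩
    1ℚ * (1ℚ * ε)              ≡⟨ trans (ℚ.*-identityˡ (1ℚ * ε)) (ℚ.*-identityˡ ε) ⟩
    ε                          ∎
    where
    open ℚ.≤-Reasoning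
    p′ = recip p 0<p
    q′ = recip q 0<q
    r′ = recip r 0<r
    0≤p′ = ℚ.<⇒≤ (0<recip 0<p)
    0≤q′ = ℚ.<⇒≤ (0<recip 0<q)
    0≤r′ = ℚ.<⇒≤ (0<recip 0<r)
    eq : p′ - q′ ≡ (p′ * q′) * (q - p)
    eq = sym (trans
      (solve 4 (λ a b p q → (a :* b) :* (q :+ (:- p)) := a :* (q :* b) :+ (:- (b :* (p :* a)))) refl p′ q′ p q)
      (cong₂ (λ u v → p′ * u - q′ * v) (p*recip 0<q) (p*recip 0<p)
        ⟨trans⟩ cong₂ _-_ (ℚ.*-identityʳ p′) (ℚ.*-identityʳ q′)))
      where
      _⟨trans⟩_ : ∀ {a b c : ℚ} → a ≡ b → b ≡ c → a ≡ c
      _⟨trans⟩_ = trans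

  bisect : ℚ → ℕ → ℚ × ℚ
  bisect q zero    = 0ℚ , 1ℚ + q
  bisect q (suc n) with bisect q n
  ... | lo , hi with ½ * (lo + hi) * (½ * (lo + hi)) ℚ.≤? q
  ...   | yes _ = ½ * (lo + hi) , hi
  ...   | no  _ = lo , ½ * (lo + hi)

  sqrtBelow : ℚ → ℕ → ℚ
  sqrtBelow q n = proj₁ (bisect q n)

  record Brackets (q : ℚ) (gap : ℚ) (b : ℚ × ℚ) : Set where
    constructor brackets
    field
      lo≥0 : 0ℚ ≤ proj₁ b
      lo²≤ : proj₁ b * proj₁ b ≤ q
      ≤hi² : q ≤ proj₂ b * proj₂ b
      hi≥0 : 0ℚ ≤ proj₂ b
      gap≡ : proj₂ b ≡ proj₁ b + gap

  bisect-brackets : ∀ {q} → 0ℚ ≤ q → ∀ n → Brackets q ((1ℚ + q) * halfPow n) (bisect q n)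
  bisect-brackets {q} 0≤q zero = record
    { lo≥0 = ℚ.≤-refl
    ; lo²≤ = subst (_≤ q) (sym (ℚ.*-zeroʳ 0ℚ)) 0≤q
    ; ≤hi² = subst (q ≤_) (solve 1 (λ q → q :+ (con 1ℚ :+ q :+ q :* q) := (con 1ℚ :+ q) :* (con 1ℚ :+ q)) refl q)
               (subst (_≤ q + (1ℚ + q + q * q)) (ℚ.+-identityʳ q)
                 (ℚ.+-monoʳ-≤ q {0ℚ} {1ℚ + q + q * q}
                   (ℚ.+-mono-≤ {0ℚ} {1ℚ + q} {0ℚ} {q * q} (ℚ.<⇒≤ (0<1+nonNeg 0≤q)) (*-nonNeg 0≤q 0≤q))))
    ; hi≥0 = ℚ.<⇒≤ (0<1+nonNeg 0≤q)
    ; gap≡ = solve 1 (λ q → con 1ℚ :+ q := con 0ℚ :+ (con 1ℚ :+ q) :* con 1ℚ) refl q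
    }
  bisect-brackets {q} 0≤q (suc n) with bisect q n | bisect-brackets 0≤q n
  ... | lo , hi | brackets lo≥0 lo²≤ ≤hi² hi≥0 gap≡ with ½ * (lo + hi) * (½ * (lo + hi)) ℚ.≤? q
  ...   | yes h = brackets mid≥0 h ≤hi² hi≥0
                    (trans gap≡ (subst (λ u → lo + (1ℚ + q) * halfPow n ≡ ½ * (lo + u) + (1ℚ + q) * (½ * halfPow n)) (sym gap≡)
                      (solve 3 (λ l a h → l :+ a :* h := con ½ :* (l :+ (l :+ a :* h)) :+ a :* (con ½ :* h)) refl lo (1ℚ + q) (halfPow n))))
    where
    mid≥0 : 0ℚ ≤ ½ * (lo + hi)
    mid≥0 = *-nonNeg (ℚ.nonNegative⁻¹ ½) (ℚ.+-mono-≤ {0ℚ} {lo} {0ℚ} {hi} lo≥0 hi≥0)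
  ...   | no ¬h = brackets lo≥0 lo²≤ (ℚ.<⇒≤ (ℚ.≰⇒> ¬h)) mid≥0
                    (subst (λ u → ½ * (lo + u) ≡ lo + (1ℚ + q) * (½ * halfPow n)) (sym gap≡)
                      (solve 3 (λ l a h → con ½ :* (l :+ (l :+ a :* h)) := l :+ a :* (con ½ :* h)) refl lo (1ℚ + q) (halfPow n)))
    where
    mid≥0 : 0ℚ ≤ ½ * (lo + hi)
    mid≥0 = *-nonNeg (ℚ.nonNegative⁻¹ ½) (ℚ.+-mono-≤ {0ℚ} {lo} {0ℚ} {hi} lo≥0 hi≥0)

  sqrtBelow-close : ∀ m n {η} → 0ℚ ≤ p → 0ℚ ≤ q → 0ℚ < η → p ≤ q + η * η →
                    sqrtBelow p m ≤ sqrtBelow q n + ((1ℚ + q) * halfPow n + η)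
  sqrtBelow-close {p} {q} m n {η} 0≤p 0≤q 0<η h
    with sqrtBelow p m ℚ.≤? sqrtBelow q n + ((1ℚ + q) * halfPow n + η)
  ... | yes done = done
  ... | no ¬done = contradiction (ℚ.<-≤-trans t²<s² s²≤t²) (ℚ.<-irrefl refl)
    where
    module P = Brackets (bisect-brackets 0≤p m)
    module Q = Brackets (bisect-brackets 0≤q n)
    open ℚ.≤-Reasoning
    lo = sqrtBelow p m
    hi = proj₂ (bisect q n)
    t = hi + η
    0<t : 0ℚ < t
    0<t = ℚ.+-mono-≤-< {0ℚ} {hi} {0ℚ} {η} Q.hi≥0 0<η
    t<s : t < lo
    t<s = subst (_< lo)
      (trans (sym (ℚ.+-assoc (sqrtBelow q n) ((1ℚ + q) * halfPow n) η)) (cong (_+ η) (sym Q.gap≡)))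
      (ℚ.≰⇒> ¬done)
    t²<s² : t * t < lo * lo
    t²<s² = begin-strict
      t * t <⟨ ℚ.*-monoʳ-<-pos t {{ℚ.positive 0<t}} t<s ⟩
      t * lo <⟨ ℚ.*-monoˡ-<-pos lo {{ℚ.positive (ℚ.<-trans 0<t t<s)}} t<s ⟩
      lo * lo ∎
    0≤2hη : 0ℚ ≤ hi * η + hi * η
    0≤2hη = ℚ.+-mono-≤ {0ℚ} {hi * η} {0ℚ} {hi * η} 0≤hη 0≤hη
      where
      0≤hη = *-nonNeg Q.hi≥0 (ℚ.<⇒≤ 0<η)
    s²≤t² : lo * lo ≤ t * t
    s²≤t² = begin
      lo * lo                                ≤⟨ P.lo²≤ ⟩
      p                                    ≤⟨ h ⟩
      q + η * η                            ≤⟨ ℚ.+-monoˡ-≤ (η * η) Q.≤hi² ⟩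
      hi * hi + η * η                      ≡⟨ ℚ.+-identityʳ (hi * hi + η * η) ⟨
      (hi * hi + η * η) + 0ℚ               ≤⟨ ℚ.+-monoʳ-≤ (hi * hi + η * η) 0≤2hη ⟩
      (hi * hi + η * η) + (hi * η + hi * η) ≡⟨ solve 2 (λ h e → (h :* h :+ e :* e) :+ (h :* e :+ h :* e) :=
                                                (h :+ e) :* (h :+ e)) refl hi η ⟩
      t * t                                ∎

open Estimates

Eventually : (ℕ → Set) → Set
Eventually P = ∃[ N ] (∀ n → N ℕ.≤ n → P n)

Eventually² : (ℕ → ℕ → Set) → Set
Eventually² P = ∃[ N ] (∀ m n → N ℕ.≤ m → N ℕ.≤ n → P m n)

eventually₁ : ∀ {P Q : ℕ → Set} → (∀ n → P n → Q n) → Eventually P → Eventually Q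
eventually₁ f (N , p) = N , λ n le → f n (p n le)

eventually₂ : ∀ {P Q R : ℕ → Set} → (∀ n → P n → Q n → R n) → Eventually P → Eventually Q → Eventually R
eventually₂ f (M , p) (N , q) = M ℕ.⊔ N , λ n le →
  f n (p n (ℕ.≤-trans (ℕ.m≤m⊔n M N) le)) (q n (ℕ.≤-trans (ℕ.m≤n⊔m M N) le))

eventually²₁ : ∀ {P Q : ℕ → ℕ → Set} → (∀ m n → P m n → Q m n) → Eventually² P → Eventually² Q
eventually²₁ f (N , p) = N , λ m n le le′ → f m n (p m n le le′)

eventually²₂ : ∀ {P Q R : ℕ → ℕ → Set} → (∀ m n → P m n → Q m n → R m n) →
               Eventually² P → Eventually² Q → Eventually² R
eventually²₂ f (M , p) (N , q) = M ℕ.⊔ N , λ m n le le′ → f m n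
  (p m n (ℕ.≤-trans (ℕ.m≤m⊔n M N) le) (ℕ.≤-trans (ℕ.m≤m⊔n M N) le′))
  (q m n (ℕ.≤-trans (ℕ.m≤n⊔m M N) le) (ℕ.≤-trans (ℕ.m≤n⊔m M N) le′))

eventually-both : ∀ {P : ℕ → Set} → Eventually P → Eventually² (λ m n → P m × P n)
eventually-both (N , p) = N , λ m n le le′ → p m le , p n le′

Cauchy : (ℕ → ℚ) → Set
Cauchy s = ∀ ε → 0ℚ ℚ.< ε → Eventually² λ m n → ℚ.∣ s m ℚ.- s n ∣ ℚ.≤ ε

Bounded : (ℕ → ℚ) → Set
Bounded s = ∃[ b ] 0ℚ ℚ.< b × Eventually λ n → ℚ.∣ s n ∣ ℚ.≤ b

opaque

  cauchy⇒bounded : ∀ s → Cauchy s → Bounded s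
  cauchy⇒bounded s cs = bound (cs 1ℚ (ℚ.positive⁻¹ 1ℚ))
    where
    bound : Eventually² (λ m n → ℚ.∣ s m ℚ.- s n ∣ ℚ.≤ 1ℚ) → Bounded s
    bound (N , close) = ℚ.∣ s N ∣ ℚ.+ 1ℚ
      , ℚ.+-mono-≤-< {0ℚ} {ℚ.∣ s N ∣} {0ℚ} {1ℚ} (ℚ.0≤∣p∣ (s N)) (ℚ.positive⁻¹ 1ℚ)
      , N , λ n N≤n → ∣p∣≤∣q∣+ (s n) (s N) (close n N N≤n ℕ.≤-refl)

  cauchy-map : ∀ s → Cauchy s → ∀ t → (∀ m n → ℚ.∣ t m ℚ.- t n ∣ ℚ.≤ ℚ.∣ s m ℚ.- s n ∣) → Cauchy t
  cauchy-map s cs t le ε 0<ε = eventually²₁ (λ m n → ℚ.≤-trans (le m n)) (cs ε 0<ε)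

  cauchy-+ : ∀ s → Cauchy s → ∀ t → Cauchy t → Cauchy (λ n → s n ℚ.+ t n)
  cauchy-+ s cs t ct ε 0<ε = eventually²₂
    (λ m n p q → subst (ℚ.∣ (s m ℚ.+ t m) ℚ.- (s n ℚ.+ t n) ∣ ℚ.≤_) (half+half ε)
      (∣-∣-+ (s m) (s n) (t m) (t n) p q))
    (cs (½ ℚ.* ε) (half>0 0<ε)) (ct (½ ℚ.* ε) (half>0 0<ε))

  cauchy-* : ∀ s t → Cauchy s → Cauchy t → Cauchy (λ n → s n ℚ.* t n)
  cauchy-* s t cs ct ε 0<ε = go (cauchy⇒bounded s cs) (cauchy⇒bounded t ct)
    where
    Goal : Set
    Goal = Eventually² λ m n → ℚ.∣ s m ℚ.* t m ℚ.- s n ℚ.* t n ∣ ℚ.≤ ε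
    go : Bounded s → Bounded t → Goal
    go (b , 0<b , sb) (d , 0<d , td) = fin (shrink 0<b (half>0 0<ε)) (shrink 0<d (half>0 0<ε))
      where
      fin : (∃[ δ ] 0ℚ ℚ.< δ × b ℚ.* δ ≡ ½ ℚ.* ε) → (∃[ η ] 0ℚ ℚ.< η × d ℚ.* η ≡ ½ ℚ.* ε) → Goal
      fin (δ , 0<δ , bδ) (η , 0<η , dη) = eventually²₂
        (λ m n (bs , bt) (p , q) →
          subst (ℚ.∣ s m ℚ.* t m ℚ.- s n ℚ.* t n ∣ ℚ.≤_) (trans (cong₂ ℚ._+_ bδ dη) (half+half ε))
            (∣-∣-* (s m) (s n) (t m) (t n) (proj₁ bs) (proj₂ bt) p q))
        (eventually²₂ (λ _ _ → _,_) (eventually-both sb) (eventually-both td))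
        (eventually²₂ (λ _ _ → _,_) (cs η 0<η) (ct δ 0<δ))

  truncated>0 : ∀ (s : ℕ → ℚ) {ε} → 0ℚ ℚ.< ε → ∀ n → 0ℚ ℚ.< ε ℚ.⊔ s n
  truncated>0 s {ε} 0<ε n = ℚ.<-≤-trans 0<ε (ℚ.p≤p⊔q ε (s n))

  cauchy-recip : ∀ s → Cauchy s → ∀ {ε} (0<ε : 0ℚ ℚ.< ε) →
                 Cauchy (λ n → recip (ε ℚ.⊔ s n) (truncated>0 s 0<ε n))
  cauchy-recip s cs {ε} 0<ε η 0<η = eventually²₁
    (λ m n close → recip-lipschitz 0<ε (truncated>0 s 0<ε m) (truncated>0 s 0<ε n)
      (ℚ.p≤p⊔q ε (s m)) (ℚ.p≤p⊔q ε (s n)) (ℚ.≤-trans (⊔-lipschitz ε (s m) (s n)) close))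
    (cs (ε ℚ.* (ε ℚ.* η)) (*-pos 0<ε (*-pos 0<ε 0<η)))

  cauchy-const : ∀ q → Cauchy (λ _ → q)
  cauchy-const q ε 0<ε = 0 , λ _ _ _ _ →
    ℚ.≤-trans (ℚ.≤-reflexive (cong ℚ.∣_∣ (ℚ.+-inverseʳ q))) (ℚ.<⇒≤ 0<ε)

  cauchy-neg : ∀ s → Cauchy s → Cauchy (λ n → ℚ.- s n)
  cauchy-neg s cs = cauchy-map s cs (λ n → ℚ.- s n) (λ m n → ℚ.≤-reflexive (∣-∣-neg (s m) (s n)))

  cauchy-∣∣ : ∀ s → Cauchy s → Cauchy (λ n → ℚ.∣ s n ∣)
  cauchy-∣∣ s cs = cauchy-map s cs (λ n → ℚ.∣ s n ∣) (λ m n → ∣-∣-∣∣ (s m) (s n))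

  cauchy-⊔ : ∀ s → Cauchy s → Cauchy (λ n → 0ℚ ℚ.⊔ s n)
  cauchy-⊔ s cs = cauchy-map s cs (λ n → 0ℚ ℚ.⊔ s n) (λ m n → ⊔-lipschitz 0ℚ (s m) (s n))

  cauchy-√ : ∀ s → Cauchy s → Cauchy (λ n → sqrtBelow (0ℚ ℚ.⊔ s n) n)
  cauchy-√ s cs ε 0<ε = go (cauchy⇒bounded q (cauchy-⊔ s cs))
    where
    q : ℕ → ℚ
    q n = 0ℚ ℚ.⊔ s n
    0≤q : ∀ n → 0ℚ ℚ.≤ q n
    0≤q n = ℚ.p≤p⊔q 0ℚ (s n)
    η : ℚ
    η = ½ ℚ.* ε
    0<η : 0ℚ ℚ.< η
    0<η = half>0 0<ε
    Goal : Set
    Goal = Eventually² λ m n → ℚ.∣ sqrtBelow (q m) m ℚ.- sqrtBelow (q n) n ∣ ℚ.≤ ε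
    go : Bounded q → Goal
    go (b , 0<b , qb) = fin (shrink (0<1+nonNeg (ℚ.<⇒≤ 0<b)) 0<η)
      where
      fin : (∃[ δ ] 0ℚ ℚ.< δ × (1ℚ ℚ.+ b) ℚ.* δ ≡ η) → Goal
      fin (δ , 0<δ , bδ) = eventually²₂
        (λ m n (gm , gn) close → ∣-∣≤ (one m n gn close)
          (one n m gm (subst (ℚ._≤ η ℚ.* η) (∣-∣-comm (q m) (q n)) close)))
        (eventually-both (eventually₂ gap qb (halfPow→0 0<δ)))
        (cauchy-⊔ s cs (η ℚ.* η) (*-pos 0<η 0<η))
        where
        gap : ∀ n → ℚ.∣ q n ∣ ℚ.≤ b → halfPow n ℚ.≤ δ → (1ℚ ℚ.+ q n) ℚ.* halfPow n ℚ.≤ η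
        gap n qn≤b small = subst ((1ℚ ℚ.+ q n) ℚ.* halfPow n ℚ.≤_) bδ
          (*-mono (ℚ.<⇒≤ (0<1+nonNeg (0≤q n))) (ℚ.<⇒≤ 0<δ)
            (ℚ.+-monoʳ-≤ 1ℚ (ℚ.≤-trans (p≤∣p∣ (q n)) qn≤b)) small)
        one : ∀ m n → (1ℚ ℚ.+ q n) ℚ.* halfPow n ℚ.≤ η → ℚ.∣ q m ℚ.- q n ∣ ℚ.≤ η ℚ.* η →
              sqrtBelow (q m) m ℚ.≤ sqrtBelow (q n) n ℚ.+ ε
        one m n g close = ℚ.≤-trans
          (sqrtBelow-close m n (0≤q m) (0≤q n) 0<η (∣-∣≤⇒≤+ close))
          (ℚ.+-monoʳ-≤ (sqrtBelow (q n) n)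
            (subst ((1ℚ ℚ.+ q n) ℚ.* halfPow n ℚ.+ η ℚ.≤_) (half+half ε) (ℚ.+-monoˡ-≤ η g)))

record ℝ : Set where
  constructor mkℝ
  field
    seq    : ℕ → ℚ
    cauchy : Cauchy seq

open ℝ using (seq; cauchy)

infix  4 _≈_ _≤_ _<_
infixl 6 _+_ _-_
infixl 7 _*_
infix  8 -_ _⁻¹⟨_⟩ _⁺ _⁻
infixr 9 _^_

record _≈_ (x y : ℝ) : Set where
  constructor ≈-intro
  field
    close : ∀ ε → 0ℚ ℚ.< ε → Eventually λ n → ℚ.∣ seq x n ℚ.- seq y n ∣ ℚ.≤ ε

record _≤_ (x y : ℝ) : Set where
  constructor ≤-intro
  field
    below : ∀ ε → 0ℚ ℚ.< ε → Eventually λ n → seq x n ℚ.≤ seq y n ℚ.+ ε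

open _≈_ using (close)
open _≤_ using (below)

_<_ : ℝ → ℝ → Set
x < y = ∃[ ε ] 0ℚ ℚ.< ε × Eventually λ n → seq x n ℚ.+ ε ℚ.≤ seq y n

fromℚ : ℚ → ℝ
fromℚ q = mkℝ (λ _ → q) (cauchy-const q)

0ℝ 1ℝ : ℝ
0ℝ = fromℚ 0ℚ
1ℝ = fromℚ 1ℚ

_+_ : ℝ → ℝ → ℝ
x + y = mkℝ (λ n → seq x n ℚ.+ seq y n) (cauchy-+ (seq x) (cauchy x) (seq y) (cauchy y))

-_ : ℝ → ℝ
- x = mkℝ (λ n → ℚ.- seq x n) (cauchy-neg (seq x) (cauchy x))

_-_ : ℝ → ℝ → ℝ
x - y = x + - y

_*_ : ℝ → ℝ → ℝ
x * y = mkℝ (λ n → seq x n ℚ.* seq y n) (cauchy-* (seq x) (seq y) (cauchy x) (cauchy y))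

_^_ : ℝ → ℕ → ℝ
x ^ zero  = 1ℝ
x ^ suc n = x * x ^ n

∣_∣ : ℝ → ℝ
∣ x ∣ = mkℝ (λ n → ℚ.∣ seq x n ∣) (cauchy-∣∣ (seq x) (cauchy x))

_⁺ _⁻ : ℝ → ℝ
x ⁺ = mkℝ (λ n → 0ℚ ℚ.⊔ seq x n) (cauchy-⊔ (seq x) (cauchy x))
x ⁻ = (- x) ⁺

-- The rational ε in the proof of 0 < x is an eventual lower bound of x, so
-- truncating x below at ε changes only finitely many terms.
_⁻¹⟨_⟩ : (x : ℝ) → 0ℝ < x → ℝ
x ⁻¹⟨ ε , 0<ε , _ ⟩ = mkℝ (λ n → recip (ε ℚ.⊔ seq x n) (truncated>0 (seq x) 0<ε n)) (cauchy-recip (seq x) (cauchy x) 0<ε)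

-- The square root of the positive part of x.
√ : ℝ → ℝ
√ x = mkℝ (λ n → sqrtBelow (0ℚ ℚ.⊔ seq x n) n) (cauchy-√ (seq x) (cauchy x))

∑ : ℕ → (ℕ → ℝ) → ℝ
∑ zero    f = 0ℝ
∑ (suc n) f = ∑ n f + f n

private
  variable
    u v x y z x′ y′ : ℝ

pointwise-≈ : (∀ n → seq x n ≡ seq y n) → x ≈ y
pointwise-≈ {x} {y} eq .close ε 0<ε = 0 , λ n _ →
  ∣-∣≤ (weaken (eq n)) (weaken (sym (eq n)))
  where
  weaken : ∀ {p q} → p ≡ q → p ℚ.≤ q ℚ.+ ε
  weaken {p} {q} e = ℚ.≤-trans (ℚ.≤-reflexive (trans e (sym (ℚ.+-identityʳ q)))) (ℚ.+-monoʳ-≤ q (ℚ.<⇒≤ 0<ε))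

pointwise-≤ : (∀ n → seq x n ℚ.≤ seq y n) → x ≤ y
pointwise-≤ {x} {y} le .below ε 0<ε = 0 , λ n _ → ℚ.≤-trans (le n)
  (ℚ.≤-trans (ℚ.≤-reflexive (sym (ℚ.+-identityʳ (seq y n)))) (ℚ.+-monoʳ-≤ (seq y n) (ℚ.<⇒≤ 0<ε)))

≈-refl : x ≈ x
≈-refl {x} = pointwise-≈ {x} {x} λ _ → refl

≈-sym : x ≈ y → y ≈ x
≈-sym {x} {y} x≈y .close ε 0<ε =
  eventually₁ (λ n → subst (ℚ._≤ ε) (∣-∣-comm (seq x n) (seq y n))) (close x≈y ε 0<ε)

≈-trans : x ≈ y → y ≈ z → x ≈ z
≈-trans {x} {y} {z} x≈y y≈z .close ε 0<ε = eventually₂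
  (λ n p q → subst (ℚ.∣ seq x n ℚ.- seq z n ∣ ℚ.≤_) (half+half ε)
    (∣-∣-trans (seq x n) (seq y n) (seq z n) p q))
  (close x≈y _ (half>0 0<ε)) (close y≈z _ (half>0 0<ε))

≈⇒≤ : x ≈ y → x ≤ y
≈⇒≤ {x} {y} x≈y .below ε 0<ε = eventually₁ (λ n → ∣-∣≤⇒≤+) (close x≈y ε 0<ε)

≤-refl : x ≤ x
≤-refl = ≈⇒≤ ≈-refl

≤-trans : x ≤ y → y ≤ z → x ≤ z
≤-trans {x} {y} {z} x≤y y≤z .below ε 0<ε = eventually₂
  (λ n p q → ℚ.≤-trans p (ℚ.≤-trans (ℚ.+-monoˡ-≤ (½ ℚ.* ε) q)
    (ℚ.≤-reflexive (trans (ℚ.+-assoc (seq z n) (½ ℚ.* ε) (½ ℚ.* ε)) (cong (seq z n ℚ.+_) (half+half ε))))))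
  (below x≤y _ (half>0 0<ε)) (below y≤z _ (half>0 0<ε))

ℝ-preorder : Preorder 0ℓ 0ℓ 0ℓ
ℝ-preorder = record
  { Carrier = ℝ ; _≈_ = _≈_ ; _≲_ = _≤_
  ; isPreorder = record
    { isEquivalence = record { refl = ≈-refl ; sym = ≈-sym ; trans = ≈-trans }
    ; reflexive = ≈⇒≤ ; trans = ≤-trans } }

module ≤-Reasoning = Relation.Binary.Reasoning.Preorder ℝ-preorder

+-cong : x ≈ x′ → y ≈ y′ → x + y ≈ x′ + y′
+-cong {x} {x′} {y} {y′} p q .close ε 0<ε = eventually₂
  (λ n p q → subst (ℚ.∣ (seq x n ℚ.+ seq y n) ℚ.- (seq x′ n ℚ.+ seq y′ n) ∣ ℚ.≤_) (half+half ε)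
    (∣-∣-+ (seq x n) (seq x′ n) (seq y n) (seq y′ n) p q))
  (close p _ (half>0 0<ε)) (close q _ (half>0 0<ε))

*-cong : x ≈ x′ → y ≈ y′ → x * y ≈ x′ * y′
*-cong {x} {x′} {y} {y′} p q .close ε 0<ε = go (cauchy⇒bounded (seq x) (cauchy x)) (cauchy⇒bounded (seq y′) (cauchy y′))
  where
  Goal : Set
  Goal = Eventually λ n → ℚ.∣ seq x n ℚ.* seq y n ℚ.- seq x′ n ℚ.* seq y′ n ∣ ℚ.≤ ε
  go : Bounded (seq x) → Bounded (seq y′) → Goal
  go (b , 0<b , xb) (d , 0<d , yd) = fin (shrink 0<b (half>0 0<ε)) (shrink 0<d (half>0 0<ε))
    where
    fin : (∃[ δ ] 0ℚ ℚ.< δ × b ℚ.* δ ≡ ½ ℚ.* ε) → (∃[ η ] 0ℚ ℚ.< η × d ℚ.* η ≡ ½ ℚ.* ε) → Goal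
    fin (δ , 0<δ , bδ) (η , 0<η , dη) = eventually₂
      (λ n (bx , by) (p , q) →
        subst (ℚ.∣ seq x n ℚ.* seq y n ℚ.- seq x′ n ℚ.* seq y′ n ∣ ℚ.≤_) (trans (cong₂ ℚ._+_ bδ dη) (half+half ε))
          (∣-∣-* (seq x n) (seq x′ n) (seq y n) (seq y′ n) bx by p q))
      (eventually₂ (λ _ → _,_) xb yd)
      (eventually₂ (λ _ → _,_) (close p η 0<η) (close q δ 0<δ))

≤⇒0≤- : x ≤ y → 0ℝ ≤ y - x
≤⇒0≤- {x} {y} x≤y .below ε 0<ε = eventually₁
  (λ n h → subst (0ℚ ℚ.≤_)
    (solve 3 (λ y e x → (y :+ e) :+ (:- x) := (y :+ (:- x)) :+ e) refl (seq y n) ε (seq x n))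
    (subst (ℚ._≤ (seq y n ℚ.+ ε) ℚ.- seq x n) (ℚ.+-inverseʳ (seq x n)) (ℚ.+-monoˡ-≤ (ℚ.- seq x n) h)))
  (below x≤y ε 0<ε)
  where open +-*-Solver

0≤-⇒≤ : 0ℝ ≤ y - x → x ≤ y
0≤-⇒≤ {y} {x} h .below ε 0<ε = eventually₁
  (λ n h → subst (seq x n ℚ.≤_)
    (solve 3 (λ y e x → x :+ ((y :+ (:- x)) :+ e) := y :+ e) refl (seq y n) ε (seq x n))
    (subst (ℚ._≤ seq x n ℚ.+ ((seq y n ℚ.- seq x n) ℚ.+ ε)) (ℚ.+-identityʳ (seq x n)) (ℚ.+-monoʳ-≤ (seq x n) h)))
  (below h ε 0<ε)
  where open +-*-Solver

+-mono-≤ : x ≤ x′ → y ≤ y′ → x + y ≤ x′ + y′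
+-mono-≤ {x} {x′} {y} {y′} p q .below ε 0<ε = eventually₂
  (λ n h k → subst (seq x n ℚ.+ seq y n ℚ.≤_)
    (trans (solve 3 (λ a b e → (a :+ e) :+ (b :+ e) := (a :+ b) :+ (e :+ e)) refl (seq x′ n) (seq y′ n) (½ ℚ.* ε))
      (cong ((seq x′ n ℚ.+ seq y′ n) ℚ.+_) (half+half ε)))
    (ℚ.+-mono-≤ h k))
  (below p _ (half>0 0<ε)) (below q _ (half>0 0<ε))
  where open +-*-Solver

0≤∣-∣ : ∀ x → 0ℝ ≤ ∣ x ∣
0≤∣-∣ x = pointwise-≤ λ n → ℚ.0≤∣p∣ (seq x n)

0≤⇒∣-∣≈ : 0ℝ ≤ x → ∣ x ∣ ≈ x
0≤⇒∣-∣≈ {x} 0≤x .close ε 0<ε = eventually₁ (λ n → near (seq x n)) (below 0≤x (½ ℚ.* ε) (half>0 0<ε))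
  where
  open +-*-Solver
  near : ∀ p → 0ℚ ℚ.≤ p ℚ.+ ½ ℚ.* ε → ℚ.∣ ℚ.∣ p ∣ ℚ.- p ∣ ℚ.≤ ε
  near p h = ∣-∣≤ (∣p∣≤
      (subst (ℚ._≤ p ℚ.+ ε) (ℚ.+-identityʳ p) (ℚ.+-monoʳ-≤ p (ℚ.<⇒≤ 0<ε)))
      (subst (ℚ.- p ℚ.≤_)
        (trans (solve 2 (λ p e → (:- p) :+ ((p :+ e) :+ (p :+ e)) := p :+ (e :+ e)) refl p (½ ℚ.* ε))
          (cong (p ℚ.+_) (half+half ε)))
        (subst (ℚ._≤ ℚ.- p ℚ.+ ((p ℚ.+ ½ ℚ.* ε) ℚ.+ (p ℚ.+ ½ ℚ.* ε))) (ℚ.+-identityʳ (ℚ.- p))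
          (ℚ.+-monoʳ-≤ (ℚ.- p) (ℚ.+-mono-≤ {0ℚ} {p ℚ.+ ½ ℚ.* ε} {0ℚ} {p ℚ.+ ½ ℚ.* ε} h h)))))
    (ℚ.≤-trans (p≤∣p∣ p)
      (subst (ℚ._≤ ℚ.∣ p ∣ ℚ.+ ε) (ℚ.+-identityʳ ℚ.∣ p ∣) (ℚ.+-monoʳ-≤ ℚ.∣ p ∣ (ℚ.<⇒≤ 0<ε))))

∣-∣-homo-* : ∀ x y → ∣ x * y ∣ ≈ ∣ x ∣ * ∣ y ∣
∣-∣-homo-* x y = pointwise-≈ λ n → ℚ.∣p*q∣≡∣p∣*∣q∣ (seq x n) (seq y n)

∣-∣-triangle : ∀ x y → ∣ x + y ∣ ≤ ∣ x ∣ + ∣ y ∣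
∣-∣-triangle x y = pointwise-≤ λ n → ℚ.∣p+q∣≤∣p∣+∣q∣ (seq x n) (seq y n)

0≤*0≤ : 0ℝ ≤ x → 0ℝ ≤ y → 0ℝ ≤ x * y
0≤*0≤ {x} {y} 0≤x 0≤y = ≤-trans (0≤∣-∣ (x * y)) (≈⇒≤
  (≈-trans (∣-∣-homo-* x y) (*-cong (0≤⇒∣-∣≈ 0≤x) (0≤⇒∣-∣≈ 0≤y))))

*-mono-≤ : 0ℝ ≤ x → 0ℝ ≤ y′ → x ≤ x′ → y ≤ y′ → x * y ≤ x′ * y′
*-mono-≤ {x} {y′} {x′} {y} 0≤x 0≤y′ x≤x′ y≤y′ = 0≤-⇒≤ (begin
  0ℝ                               ≈⟨ pointwise-≈ (λ _ → refl) ⟩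
  0ℝ + 0ℝ                          ≲⟨ +-mono-≤ (0≤*0≤ (≤⇒0≤- x≤x′) 0≤y′) (0≤*0≤ 0≤x (≤⇒0≤- y≤y′)) ⟩
  (x′ - x) * y′ + x * (y′ - y)     ≈⟨ pointwise-≈ (λ n → solve 4 (λ x x′ y y′ →
                                        (x′ :+ (:- x)) :* y′ :+ x :* (y′ :+ (:- y)) :=
                                        x′ :* y′ :+ (:- (x :* y))) refl (seq x n) (seq x′ n) (seq y n) (seq y′ n)) ⟩
  x′ * y′ - x * y                  ∎)
  where
  open ≤-Reasoning
  open +-*-Solver

fromℚ-mono : ∀ {p q} → p ℚ.≤ q → fromℚ p ≤ fromℚ q
fromℚ-mono p≤q = pointwise-≤ λ _ → p≤q

upperBound : ∀ x → ∃[ b ] 0ℚ ℚ.< b × x ≤ fromℚ b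
upperBound x = go (cauchy⇒bounded (seq x) (cauchy x))
  where
  go : Bounded (seq x) → ∃[ b ] 0ℚ ℚ.< b × x ≤ fromℚ b
  go (b , 0<b , xb) = b , 0<b , ≤-intro λ ε 0<ε → eventually₁
    (λ n h → ℚ.≤-trans (ℚ.≤-trans (p≤∣p∣ (seq x n)) h)
      (subst (ℚ._≤ b ℚ.+ ε) (ℚ.+-identityʳ b) (ℚ.+-monoʳ-≤ b (ℚ.<⇒≤ 0<ε)))) xb

^-nonNeg : 0ℝ ≤ x → ∀ k → 0ℝ ≤ x ^ k
^-nonNeg 0≤x zero    = fromℚ-mono (ℚ.nonNegative⁻¹ 1ℚ)
^-nonNeg 0≤x (suc k) = 0≤*0≤ 0≤x (^-nonNeg 0≤x k)

^-monoˡ : 0ℝ ≤ x → x ≤ y → ∀ k → x ^ k ≤ y ^ k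
^-monoˡ 0≤x x≤y zero    = ≤-refl
^-monoˡ 0≤x x≤y (suc k) = *-mono-≤ 0≤x (^-nonNeg (≤-trans 0≤x x≤y) k) x≤y (^-monoˡ 0≤x x≤y k)

^-distrib-* : ∀ x y k → (x * y) ^ k ≈ x ^ k * y ^ k
^-distrib-* x y zero    = pointwise-≈ λ _ → sym (ℚ.*-identityʳ 1ℚ)
^-distrib-* x y (suc k) = ≈-trans (*-cong ≈-refl (^-distrib-* x y k))
  (pointwise-≈ λ n → solve 4 (λ x y u v → (x :* y) :* (u :* v) := (x :* u) :* (y :* v)) refl
    (seq x n) (seq y n) (seq (x ^ k) n) (seq (y ^ k) n))
  where open +-*-Solver

^-+ : ∀ x j k → x ^ (j ℕ.+ k) ≈ x ^ j * x ^ k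
^-+ x zero    k = pointwise-≈ λ n → sym (ℚ.*-identityˡ (seq (x ^ k) n))
^-+ x (suc j) k = ≈-trans (*-cong ≈-refl (^-+ x j k))
  (pointwise-≈ λ n → sym (ℚ.*-assoc (seq x n) (seq (x ^ j) n) (seq (x ^ k) n)))

1≤^ : 1ℝ ≤ x → ∀ k → 1ℝ ≤ x ^ k
1≤^ 1≤x k = ≤-trans (≈⇒≤ (1^ k)) (^-monoˡ (fromℚ-mono (ℚ.nonNegative⁻¹ 1ℚ)) 1≤x k)
  where
  1^ : ∀ k → 1ℝ ≈ 1ℝ ^ k
  1^ zero    = ≈-refl
  1^ (suc k) = ≈-trans (pointwise-≈ λ _ → sym (ℚ.*-identityʳ 1ℚ)) (*-cong ≈-refl (1^ k))

Continuous : (ℝ → ℝ) → Set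
Continuous f = ∀ (b ε : ℚ) → 0ℚ ℚ.< ε → ∃[ δ ] 0ℚ ℚ.< δ ×
  (∀ x y → ∣ x ∣ ≤ fromℚ b → ∣ y ∣ ≤ fromℚ b → ∣ x - y ∣ ≤ fromℚ δ → ∣ f x - f y ∣ ≤ fromℚ ε)

PolynomialGrowth : (ℝ → ℝ) → Set
PolynomialGrowth f = ∃[ C ] ∃[ k ] 0ℝ ≤ C × (∀ x → ∣ f x ∣ ≤ C * (1ℝ + ∣ x ∣) ^ k)

record TestFunction : Set where
  constructor mkTest
  field
    fun        : ℝ → ℝ
    continuous : Continuous fun
    growth     : PolynomialGrowth fun

open TestFunction using (fun; continuous; growth)

opaque

  0≤1+∣_∣ : ∀ x → 0ℝ ≤ 1ℝ + ∣ x ∣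
  0≤1+∣ x ∣ = pointwise-≤ λ n → ℚ.<⇒≤ (0<1+nonNeg (ℚ.0≤∣p∣ (seq x n)))

  1≤1+∣_∣ : ∀ x → 1ℝ ≤ 1ℝ + ∣ x ∣
  1≤1+∣ x ∣ = pointwise-≤ λ n →
    subst (ℚ._≤ 1ℚ ℚ.+ ℚ.∣ seq x n ∣) (ℚ.+-identityʳ 1ℚ) (ℚ.+-monoʳ-≤ 1ℚ (ℚ.0≤∣p∣ (seq x n)))

  locallyBounded : ∀ {f} → PolynomialGrowth f → ∀ b →
                   ∃[ B ] 0ℚ ℚ.< B × (∀ x → ∣ x ∣ ≤ fromℚ b → ∣ f x ∣ ≤ fromℚ B)
  locallyBounded {f} (C , k , 0≤C , grow) b = go (upperBound (C * (1ℝ + fromℚ b) ^ k))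
    where
    go : (∃[ B ] 0ℚ ℚ.< B × C * (1ℝ + fromℚ b) ^ k ≤ fromℚ B) →
         ∃[ B ] 0ℚ ℚ.< B × (∀ x → ∣ x ∣ ≤ fromℚ b → ∣ f x ∣ ≤ fromℚ B)
    go (B , 0<B , C≤B) = B , 0<B , λ x x≤b → begin
      ∣ f x ∣                  ≲⟨ grow x ⟩
      C * (1ℝ + ∣ x ∣) ^ k     ≲⟨ *-mono-≤ 0≤C
                                   (^-nonNeg (≤-trans 0≤1+∣ x ∣ (+-mono-≤ ≤-refl x≤b)) k) ≤-refl
                                   (^-monoˡ 0≤1+∣ x ∣ (+-mono-≤ ≤-refl x≤b) k) ⟩
      C * (1ℝ + fromℚ b) ^ k   ≲⟨ C≤B ⟩
      fromℚ B                  ∎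
      where open ≤-Reasoning

  const-continuous : ∀ a → Continuous (λ _ → a)
  const-continuous a b ε 0<ε = 1ℚ , ℚ.positive⁻¹ 1ℚ , λ _ _ _ _ _ → pointwise-≤ λ n →
    ℚ.≤-trans (ℚ.≤-reflexive (cong ℚ.∣_∣ (ℚ.+-inverseʳ (seq a n)))) (ℚ.<⇒≤ 0<ε)

  const-growth : ∀ a → PolynomialGrowth (λ _ → a)
  const-growth a = ∣ a ∣ , 0 , 0≤∣-∣ a , λ _ → ≈⇒≤ (pointwise-≈ λ n → sym (ℚ.*-identityʳ ℚ.∣ seq a n ∣))

  id-continuous : Continuous (λ x → x)
  id-continuous b ε 0<ε = ε , 0<ε , λ _ _ _ _ xy → xy

  id-growth : PolynomialGrowth (λ x → x)
  id-growth = 1ℝ , 1 , fromℚ-mono (ℚ.nonNegative⁻¹ 1ℚ) , λ x → begin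
    ∣ x ∣                     ≈⟨ pointwise-≈ (λ n → sym (ℚ.+-identityˡ ℚ.∣ seq x n ∣)) ⟩
    0ℝ + ∣ x ∣                ≲⟨ +-mono-≤ (fromℚ-mono (ℚ.nonNegative⁻¹ 1ℚ)) ≤-refl ⟩
    1ℝ + ∣ x ∣                ≈⟨ pointwise-≈ (λ n → sym (trans
                                   (ℚ.*-identityˡ ((1ℚ ℚ.+ ℚ.∣ seq x n ∣) ℚ.* 1ℚ))
                                   (ℚ.*-identityʳ (1ℚ ℚ.+ ℚ.∣ seq x n ∣)))) ⟩
    1ℝ * (1ℝ + ∣ x ∣) ^ 1     ∎
    where open ≤-Reasoning

  +-continuous : ∀ {f g} → Continuous f → Continuous g → Continuous (λ x → f x + g x)
  +-continuous {f} {g} cf cg b ε 0<ε = go (cf b (½ ℚ.* ε) (half>0 0<ε)) (cg b (½ ℚ.* ε) (half>0 0<ε))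
    where
    open ≤-Reasoning
    open +-*-Solver
    Near : (ℝ → ℝ) → ℚ → ℚ → Set
    Near h η δ = ∀ x y → ∣ x ∣ ≤ fromℚ b → ∣ y ∣ ≤ fromℚ b → ∣ x - y ∣ ≤ fromℚ δ → ∣ h x - h y ∣ ≤ fromℚ η
    go : (∃[ δ ] 0ℚ ℚ.< δ × Near f (½ ℚ.* ε) δ) → (∃[ δ ] 0ℚ ℚ.< δ × Near g (½ ℚ.* ε) δ) →
         ∃[ δ ] 0ℚ ℚ.< δ × Near (λ x → f x + g x) ε δ
    go (δ , 0<δ , nf) (η , 0<η , ng) = δ ℚ.⊓ η , min>0 0<δ 0<η , λ x y bx by xy → begin
      ∣ (f x + g x) - (f y + g y) ∣      ≲⟨ pointwise-≤ (λ n → ∣-∣-+ (seq (f x) n) (seq (f y) n)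
                                               (seq (g x) n) (seq (g y) n) ℚ.≤-refl ℚ.≤-refl) ⟩
      ∣ f x - f y ∣ + ∣ g x - g y ∣      ≲⟨ +-mono-≤
                                               (nf x y bx by (≤-trans xy (fromℚ-mono (ℚ.p⊓q≤p δ η))))
                                               (ng x y bx by (≤-trans xy (fromℚ-mono (ℚ.p⊓q≤q δ η)))) ⟩
      fromℚ (½ ℚ.* ε) + fromℚ (½ ℚ.* ε)  ≈⟨ pointwise-≈ (λ _ → half+half ε) ⟩
      fromℚ ε                            ∎

  +-growth : ∀ {f g} → PolynomialGrowth f → PolynomialGrowth g → PolynomialGrowth (λ x → f x + g x)
  +-growth {f} {g} (C , j , 0≤C , hf) (D , k , 0≤D , hg) = C + D , j ℕ.+ k
    , ≤-trans (≈⇒≤ (pointwise-≈ λ _ → refl)) (+-mono-≤ {0ℝ} {C} {0ℝ} {D} 0≤C 0≤D)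
    , λ x → begin
      ∣ f x + g x ∣                        ≲⟨ ∣-∣-triangle (f x) (g x) ⟩
      ∣ f x ∣ + ∣ g x ∣                    ≲⟨ +-mono-≤ (hf x) (hg x) ⟩
      C * X x ^ j + D * X x ^ k            ≈⟨ pointwise-≈ (λ n → solve 4 (λ C u D v →
                                                C :* u :+ D :* v := C :* (u :* con 1ℚ) :+ D :* (con 1ℚ :* v)) refl
                                                (seq C n) (seq (X x ^ j) n) (seq D n) (seq (X x ^ k) n)) ⟩
      C * (X x ^ j * 1ℝ) + D * (1ℝ * X x ^ k)
                                           ≲⟨ +-mono-≤
                                                (*-mono-≤ 0≤C (0≤*0≤ (0≤X^ x j) (0≤X^ x k)) ≤-refl
                                                  (*-mono-≤ (0≤X^ x j) (0≤X^ x k) ≤-refl (1≤^ 1≤1+∣ x ∣ k)))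
                                                (*-mono-≤ 0≤D (0≤*0≤ (0≤X^ x j) (0≤X^ x k)) ≤-refl
                                                  (*-mono-≤ (fromℚ-mono (ℚ.nonNegative⁻¹ 1ℚ)) (0≤X^ x k) (1≤^ 1≤1+∣ x ∣ j) ≤-refl)) ⟩
      C * (X x ^ j * X x ^ k) + D * (X x ^ j * X x ^ k)
                                           ≈⟨ pointwise-≈ (λ n → sym (ℚ.*-distribʳ-+
                                                (seq (X x ^ j * X x ^ k) n) (seq C n) (seq D n))) ⟩
      (C + D) * (X x ^ j * X x ^ k)        ≈⟨ *-cong {C + D} ≈-refl (≈-sym (^-+ (X x) j k)) ⟩
      (C + D) * X x ^ (j ℕ.+ k)            ∎
    where
    open ≤-Reasoning
    open +-*-Solver
    X : ℝ → ℝ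
    X x = 1ℝ + ∣ x ∣
    0≤X^ : ∀ x k → 0ℝ ≤ X x ^ k
    0≤X^ x = ^-nonNeg 0≤1+∣ x ∣

  *-continuous : ∀ {f g} → PolynomialGrowth f → PolynomialGrowth g →
                 Continuous f → Continuous g → Continuous (λ x → f x * g x)
  *-continuous {f} {g} gf gg cf cg b ε 0<ε = go (locallyBounded gf b) (locallyBounded gg b)
    where
    open ≤-Reasoning
    Near : (ℝ → ℝ) → ℚ → ℚ → Set
    Near h η δ = ∀ x y → ∣ x ∣ ≤ fromℚ b → ∣ y ∣ ≤ fromℚ b → ∣ x - y ∣ ≤ fromℚ δ → ∣ h x - h y ∣ ≤ fromℚ η
    BoundedBy : (ℝ → ℝ) → ℚ → Set
    BoundedBy h B = ∀ x → ∣ x ∣ ≤ fromℚ b → ∣ h x ∣ ≤ fromℚ B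
    Goal : Set
    Goal = ∃[ δ ] 0ℚ ℚ.< δ × Near (λ x → f x * g x) ε δ
    go : (∃[ B ] 0ℚ ℚ.< B × BoundedBy f B) → (∃[ B ] 0ℚ ℚ.< B × BoundedBy g B) → Goal
    go (F , 0<F , fF) (G , 0<G , gG) = go₂ (shrink 0<F (half>0 0<ε)) (shrink 0<G (half>0 0<ε))
      where
      go₂ : (∃[ η ] 0ℚ ℚ.< η × F ℚ.* η ≡ ½ ℚ.* ε) → (∃[ θ ] 0ℚ ℚ.< θ × G ℚ.* θ ≡ ½ ℚ.* ε) → Goal
      go₂ (η , 0<η , Fη) (θ , 0<θ , Gθ) = go₃ (cf b θ 0<θ) (cg b η 0<η)
        where
        go₃ : (∃[ δ ] 0ℚ ℚ.< δ × Near f θ δ) → (∃[ δ ] 0ℚ ℚ.< δ × Near g η δ) → Goal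
        go₃ (δ , 0<δ , nf) (δ′ , 0<δ′ , ng) = δ ℚ.⊓ δ′ , min>0 0<δ 0<δ′ , λ x y bx by xy → begin
          ∣ f x * g x - f y * g y ∣          ≲⟨ pointwise-≤ (λ n → ∣-∣-* (seq (f x) n) (seq (f y) n)
                                                   (seq (g x) n) (seq (g y) n) ℚ.≤-refl ℚ.≤-refl ℚ.≤-refl ℚ.≤-refl) ⟩
          ∣ f x ∣ * ∣ g x - g y ∣ + ∣ g y ∣ * ∣ f x - f y ∣
                                             ≲⟨ +-mono-≤
                                                  (*-mono-≤ (0≤∣-∣ (f x)) (fromℚ-mono (ℚ.<⇒≤ 0<η)) (fF x bx)
                                                    (ng x y bx by (≤-trans xy (fromℚ-mono (ℚ.p⊓q≤q δ δ′)))))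
                                                  (*-mono-≤ (0≤∣-∣ (g y)) (fromℚ-mono (ℚ.<⇒≤ 0<θ)) (gG y by)
                                                    (nf x y bx by (≤-trans xy (fromℚ-mono (ℚ.p⊓q≤p δ δ′))))) ⟩
          fromℚ F * fromℚ η + fromℚ G * fromℚ θ
                                             ≈⟨ pointwise-≈ (λ _ → trans (cong₂ ℚ._+_ Fη Gθ) (half+half ε)) ⟩
          fromℚ ε                            ∎

  *-growth : ∀ {f g} → PolynomialGrowth f → PolynomialGrowth g → PolynomialGrowth (λ x → f x * g x)
  *-growth {f} {g} (C , j , 0≤C , hf) (D , k , 0≤D , hg) = C * D , j ℕ.+ k , 0≤*0≤ 0≤C 0≤D , λ x → begin
    ∣ f x * g x ∣                      ≈⟨ ∣-∣-homo-* (f x) (g x) ⟩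
    ∣ f x ∣ * ∣ g x ∣                  ≲⟨ *-mono-≤ (0≤∣-∣ (f x)) (0≤*0≤ 0≤D (^-nonNeg 0≤1+∣ x ∣ k)) (hf x) (hg x) ⟩
    (C * X x ^ j) * (D * X x ^ k)      ≈⟨ pointwise-≈ (λ n → solve 4 (λ C u D v →
                                            (C :* u) :* (D :* v) := (C :* D) :* (u :* v)) refl
                                            (seq C n) (seq (X x ^ j) n) (seq D n) (seq (X x ^ k) n)) ⟩
    (C * D) * (X x ^ j * X x ^ k)      ≈⟨ *-cong {C * D} ≈-refl (≈-sym (^-+ (X x) j k)) ⟩
    (C * D) * X x ^ (j ℕ.+ k)          ∎
    where
    open ≤-Reasoning
    open +-*-Solver
    X : ℝ → ℝ
    X x = 1ℝ + ∣ x ∣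

  scaled-continuous : ∀ α {f} → Continuous f → Continuous (λ x → f (α * x))
  scaled-continuous α {f} cf b ε 0<ε = go (upperBound ∣ α ∣)
    where
    open ≤-Reasoning
    open +-*-Solver
    Near : (ℝ → ℝ) → ℚ → ℚ → Set
    Near h b′ δ = ∀ x y → ∣ x ∣ ≤ fromℚ b′ → ∣ y ∣ ≤ fromℚ b′ → ∣ x - y ∣ ≤ fromℚ δ → ∣ h x - h y ∣ ≤ fromℚ ε
    Goal : Set
    Goal = ∃[ δ ] 0ℚ ℚ.< δ × Near (λ x → f (α * x)) b δ
    go : (∃[ A ] 0ℚ ℚ.< A × ∣ α ∣ ≤ fromℚ A) → Goal
    go (A , 0<A , α≤A) = go₂ (cf (A ℚ.* b) ε 0<ε)
      where
      go₂ : (∃[ δ ] 0ℚ ℚ.< δ × Near f (A ℚ.* b) δ) → Goal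
      go₂ (δ , 0<δ , nf) = go₃ (shrink 0<A 0<δ)
        where
        scaled : ∀ z c → ∣ z ∣ ≤ fromℚ c → ∣ α * z ∣ ≤ fromℚ (A ℚ.* c)
        scaled z c z≤c = begin
          ∣ α * z ∣          ≈⟨ ∣-∣-homo-* α z ⟩
          ∣ α ∣ * ∣ z ∣      ≲⟨ *-mono-≤ (0≤∣-∣ α) (≤-trans (0≤∣-∣ z) z≤c) α≤A z≤c ⟩
          fromℚ A * fromℚ c  ≈⟨ pointwise-≈ (λ _ → refl) ⟩
          fromℚ (A ℚ.* c)    ∎
        go₃ : (∃[ η ] 0ℚ ℚ.< η × A ℚ.* η ≡ δ) → Goal
        go₃ (η , 0<η , Aη≡δ) = η , 0<η , λ x y bx by xy →
          nf (α * x) (α * y) (scaled x b bx) (scaled y b by) (begin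
            ∣ α * x - α * y ∣  ≈⟨ pointwise-≈ (λ n → cong ℚ.∣_∣ (solve 3 (λ a x y →
                                    a :* x :+ (:- (a :* y)) := a :* (x :+ (:- y))) refl
                                    (seq α n) (seq x n) (seq y n))) ⟩
            ∣ α * (x - y) ∣    ≲⟨ scaled (x - y) η xy ⟩
            fromℚ (A ℚ.* η)    ≈⟨ pointwise-≈ (λ _ → Aη≡δ) ⟩
            fromℚ δ            ∎)

  scaled-growth : ∀ α {f} → PolynomialGrowth f → PolynomialGrowth (λ x → f (α * x))
  scaled-growth α {f} (C , k , 0≤C , hf) = C * (1ℝ + ∣ α ∣) ^ k , k , 0≤*0≤ 0≤C (^-nonNeg 0≤1+∣ α ∣ k) , λ x → begin
    ∣ f (α * x) ∣                                  ≲⟨ hf (α * x) ⟩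
    C * (1ℝ + ∣ α * x ∣) ^ k                       ≲⟨ *-mono-≤ 0≤C
                                                        (^-nonNeg (0≤*0≤ 0≤1+∣ α ∣ 0≤1+∣ x ∣) k) ≤-refl
                                                        (^-monoˡ 0≤1+∣ α * x ∣ (expand x) k) ⟩
    C * ((1ℝ + ∣ α ∣) * (1ℝ + ∣ x ∣)) ^ k          ≈⟨ *-cong {C} ≈-refl (^-distrib-* (1ℝ + ∣ α ∣) (1ℝ + ∣ x ∣) k) ⟩
    C * ((1ℝ + ∣ α ∣) ^ k * (1ℝ + ∣ x ∣) ^ k)      ≈⟨ pointwise-≈ (λ n → sym (ℚ.*-assoc (seq C n)
                                                        (seq ((1ℝ + ∣ α ∣) ^ k) n) (seq ((1ℝ + ∣ x ∣) ^ k) n))) ⟩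
    C * (1ℝ + ∣ α ∣) ^ k * (1ℝ + ∣ x ∣) ^ k        ∎
    where
    open ≤-Reasoning
    open +-*-Solver
    expand : ∀ x → 1ℝ + ∣ α * x ∣ ≤ (1ℝ + ∣ α ∣) * (1ℝ + ∣ x ∣)
    expand x = begin
      1ℝ + ∣ α * x ∣                               ≈⟨ +-cong {1ℝ} ≈-refl (∣-∣-homo-* α x) ⟩
      1ℝ + ∣ α ∣ * ∣ x ∣                           ≈⟨ pointwise-≈ (λ n → sym (ℚ.+-identityʳ
                                                        (1ℚ ℚ.+ ℚ.∣ seq α n ∣ ℚ.* ℚ.∣ seq x n ∣))) ⟩
      (1ℝ + ∣ α ∣ * ∣ x ∣) + 0ℝ                    ≲⟨ +-mono-≤ ≤-refl (pointwise-≤ λ n →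
                                                        ℚ.+-mono-≤ {0ℚ} {ℚ.∣ seq α n ∣} {0ℚ} {ℚ.∣ seq x n ∣}
                                                          (ℚ.0≤∣p∣ (seq α n)) (ℚ.0≤∣p∣ (seq x n))) ⟩
      (1ℝ + ∣ α ∣ * ∣ x ∣) + (∣ α ∣ + ∣ x ∣)       ≈⟨ pointwise-≈ (λ n → solve 2 (λ a x →
                                                        (con 1ℚ :+ a :* x) :+ (a :+ x) :=
                                                        (con 1ℚ :+ a) :* (con 1ℚ :+ x)) refl ℚ.∣ seq α n ∣ ℚ.∣ seq x n ∣) ⟩
      (1ℝ + ∣ α ∣) * (1ℝ + ∣ x ∣)                  ∎

infixl 6 _+ᵗ_
infixl 7 _*ᵗ_

constᵗ : ℝ → TestFunction
constᵗ a = mkTest (λ _ → a) (const-continuous a) (const-growth a)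

idᵗ : TestFunction
idᵗ = mkTest (λ x → x) id-continuous id-growth

_+ᵗ_ _*ᵗ_ : TestFunction → TestFunction → TestFunction
φ +ᵗ ψ = mkTest (λ x → fun φ x + fun ψ x)
  (+-continuous (continuous φ) (continuous ψ)) (+-growth (growth φ) (growth ψ))
φ *ᵗ ψ = mkTest (λ x → fun φ x * fun ψ x)
  (*-continuous (growth φ) (growth ψ) (continuous φ) (continuous ψ)) (*-growth (growth φ) (growth ψ))

monomial : ℕ → TestFunction
monomial zero    = constᵗ 1ℝ
monomial (suc k) = idᵗ *ᵗ monomial k

scaled : ℝ → TestFunction → TestFunction
scaled α φ = mkTest (λ x → fun φ (α * x)) (scaled-continuous α (continuous φ)) (scaled-growth α (growth φ))

-- A measure is given by its integral, as a positive linear functional on the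
-- continuous functions of polynomial growth.  By the Daniell-Stone theorem
-- these functionals are exactly the integrals against positive Borel measures
-- on ℝ all of whose moments are finite (monotone convergence of φₙ ↓ 0 follows
-- from Dini's theorem on compact sets, the functional being finite on
-- 1 + x ^ (2 k)).
record Measure : Set where
  field
    ∫          : TestFunction → ℝ
    ∫-cong     : ∀ φ ψ → (∀ x → fun φ x ≈ fun ψ x) → ∫ φ ≈ ∫ ψ
    ∫-+        : ∀ φ ψ → ∫ (φ +ᵗ ψ) ≈ ∫ φ + ∫ ψ
    ∫-*        : ∀ a φ → ∫ (constᵗ a *ᵗ φ) ≈ a * ∫ φ
    ∫-positive : ∀ φ → (∀ x → 0ℝ ≤ fun φ x) → 0ℝ ≤ ∫ φ

open Measure

moment : Measure → ℕ → ℝ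
moment μ k = ∫ μ (monomial k)

IsProbability : Measure → Set
IsProbability μ = ∫ μ (constᵗ 1ℝ) ≈ 1ℝ

0ᵐ : Measure
0ᵐ = record
  { ∫          = λ _ → 0ℝ
  ; ∫-cong     = λ _ _ _ → ≈-refl
  ; ∫-+        = λ _ _ → pointwise-≈ λ _ → refl
  ; ∫-*        = λ a _ → pointwise-≈ λ n → sym (ℚ.*-zeroʳ (seq a n))
  ; ∫-positive = λ _ _ → ≤-refl
  }

_+ᵐ_ : Measure → Measure → Measure
μ +ᵐ ν = record
  { ∫          = λ φ → ∫ μ φ + ∫ ν φ
  ; ∫-cong     = λ φ ψ eq → +-cong (∫-cong μ φ ψ eq) (∫-cong ν φ ψ eq)
  ; ∫-+        = λ φ ψ → ≈-trans (+-cong (∫-+ μ φ ψ) (∫-+ ν φ ψ)) (pointwise-≈ λ n →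
      solve 4 (λ a b c d → (a :+ b) :+ (c :+ d) := (a :+ c) :+ (b :+ d)) refl
        (seq (∫ μ φ) n) (seq (∫ μ ψ) n) (seq (∫ ν φ) n) (seq (∫ ν ψ) n))
  ; ∫-*        = λ a φ → ≈-trans (+-cong (∫-* μ a φ) (∫-* ν a φ)) (pointwise-≈ λ n →
      sym (ℚ.*-distribˡ-+ (seq a n) (seq (∫ μ φ) n) (seq (∫ ν φ) n)))
  ; ∫-positive = λ φ 0≤φ → ≤-trans (≈⇒≤ (pointwise-≈ λ _ → refl))
      (+-mono-≤ {0ℝ} {∫ μ φ} {0ℝ} {∫ ν φ} (∫-positive μ φ 0≤φ) (∫-positive ν φ 0≤φ))
  }
  where open +-*-Solver

scaleᵐ : (r : ℝ) → 0ℝ ≤ r → Measure → Measure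
scaleᵐ r 0≤r μ = record
  { ∫          = λ φ → r * ∫ μ φ
  ; ∫-cong     = λ φ ψ eq → *-cong {r} ≈-refl (∫-cong μ φ ψ eq)
  ; ∫-+        = λ φ ψ → ≈-trans (*-cong {r} ≈-refl (∫-+ μ φ ψ)) (pointwise-≈ λ n →
      ℚ.*-distribˡ-+ (seq r n) (seq (∫ μ φ) n) (seq (∫ μ ψ) n))
  ; ∫-*        = λ a φ → ≈-trans (*-cong {r} ≈-refl (∫-* μ a φ)) (pointwise-≈ λ n →
      solve 3 (λ r a i → r :* (a :* i) := a :* (r :* i)) refl (seq r n) (seq a n) (seq (∫ μ φ) n))
  ; ∫-positive = λ φ 0≤φ → 0≤*0≤ 0≤r (∫-positive μ φ 0≤φ)
  }
  where open +-*-Solver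

dilateᵐ : ℝ → Measure → Measure
dilateᵐ α μ = record
  { ∫          = λ φ → ∫ μ (scaled α φ)
  ; ∫-cong     = λ φ ψ eq → ∫-cong μ (scaled α φ) (scaled α ψ) (λ x → eq (α * x))
  ; ∫-+        = λ φ ψ → ≈-trans
      (∫-cong μ (scaled α (φ +ᵗ ψ)) (scaled α φ +ᵗ scaled α ψ) (λ _ → ≈-refl))
      (∫-+ μ (scaled α φ) (scaled α ψ))
  ; ∫-*        = λ a φ → ≈-trans
      (∫-cong μ (scaled α (constᵗ a *ᵗ φ)) (constᵗ a *ᵗ scaled α φ) (λ _ → ≈-refl))
      (∫-* μ a (scaled α φ))
  ; ∫-positive = λ φ 0≤φ → ∫-positive μ (scaled α φ) (λ x → 0≤φ (α * x))
  }

-- A signed measure, as a difference of two positive ones, not necessarily its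
-- Jordan decomposition: signed measures are to be compared through ∫ˢ only.
record SignedMeasure : Set where
  constructor _⊖_
  field
    plus minus : Measure

open SignedMeasure

∫ˢ : SignedMeasure → TestFunction → ℝ
∫ˢ σ φ = ∫ (plus σ) φ - ∫ (minus σ) φ

momentˢ : SignedMeasure → ℕ → ℝ
momentˢ σ k = ∫ˢ σ (monomial k)

infixl 6 _+ˢ_
infixl 7 _•_

0ˢ : SignedMeasure
0ˢ = 0ᵐ ⊖ 0ᵐ

_+ˢ_ : SignedMeasure → SignedMeasure → SignedMeasure
(μ ⊖ ν) +ˢ (μ′ ⊖ ν′) = (μ +ᵐ μ′) ⊖ (ν +ᵐ ν′)

0≤⁺ : ∀ r → 0ℝ ≤ r ⁺
0≤⁺ r = pointwise-≤ λ n → ℚ.p≤p⊔q 0ℚ (seq r n)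

_•_ : ℝ → SignedMeasure → SignedMeasure
r • (μ ⊖ ν) = (scaleᵐ (r ⁺) (0≤⁺ r) μ +ᵐ scaleᵐ (r ⁻) (0≤⁺ (- r)) ν)
            ⊖ (scaleᵐ (r ⁺) (0≤⁺ r) ν +ᵐ scaleᵐ (r ⁻) (0≤⁺ (- r)) μ)

-- The indicator function of A composed with x ↦ α x is that of A / α, so this
-- is the measure A ↦ σ (A / α).
Λ : ℝ → SignedMeasure → SignedMeasure
Λ α (μ ⊖ ν) = dilateᵐ α μ ⊖ dilateᵐ α ν

∑ˢ : ∀ {n} → (Fin n → SignedMeasure) → SignedMeasure
∑ˢ {zero}  σ = 0ˢ
∑ˢ {suc n} σ = σ zero +ˢ ∑ˢ (λ i → σ (suc i))

record TaggedPartition (a b : ℝ) : Set where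
  field
    size      : ℕ
    point tag : ℕ → ℝ
    start     : point 0 ≈ a
    end       : point size ≈ b
    point≤tag : ∀ i → i ℕ.< size → point i ≤ tag i
    tag≤point : ∀ i → i ℕ.< size → tag i ≤ point (suc i)

open TaggedPartition

_HasMesh≤_ : ∀ {a b} → TaggedPartition a b → ℝ → Set
P HasMesh≤ δ = ∀ i → i ℕ.< size P → point P (suc i) - point P i ≤ δ

riemannSum : ∀ {a b} → (ℝ → ℝ) → TaggedPartition a b → ℝ
riemannSum f P = ∑ (size P) λ i → f (tag P i) * (point P (suc i) - point P i)

IsIntegral : (a b : ℝ) → (ℝ → ℝ) → ℝ → Set
IsIntegral a b f I = ∀ (ε : ℚ) → 0ℚ ℚ.< ε → ∃[ δ ] 0ℚ ℚ.< δ ×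
  (∀ (P : TaggedPartition a b) → P HasMesh≤ fromℚ δ → ∣ riemannSum f P - I ∣ ≤ fromℚ ε)

-- The density is understood to vanish outside [a , b]; an equality of
-- functionals on all test functions determines σ.
HasDensityOn : (a b : ℝ) → (ℝ → ℝ) → SignedMeasure → Set
HasDensityOn a b f σ = ∀ φ → IsIntegral a b (λ z → fun φ z * f z) (∫ˢ σ φ)

-- π is the area of the unit disc.
IsPi : ℝ → Set
IsPi π = 0ℝ < π × IsIntegral (- 1ℝ) 1ℝ (λ x → fromℚ (pos 2 ℚ./ 1) * √ (1ℝ - x * x)) π

module _ {m : ℕ} where

  -- The last entry is followed by the first.
  cyclicPairs : ∀ {n} → Vec (Fin m) n → Vec (Fin m × Fin m) n
  cyclicPairs []       = []
  cyclicPairs (v ∷ vs) = Vec.zip (v ∷ vs) (vs Vec.∷ʳ v)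

  module Graph (_~_ : Rel (Fin m) 0ℓ) (_~?_ : Binary.Decidable _~_) where

    -- Paths and cycles have distinct vertices, hence at most m of them, so the
    -- bounds on n below are no restriction.
    IsPath : ∀ {n} → Fin m → Fin m → Vec (Fin m) (suc n) → Set
    IsPath a b p = Vec.head p ≡ a × Vec.last p ≡ b × Unique p × Linked _~_ p

    Connected : Set
    Connected = ∀ (a b : Fin m) → Σ[ n ∈ Fin m ] ∃ λ (p : Vec (Fin m) (suc (toℕ n))) → IsPath a b p

    IsCycle : ∀ {n} → Vec (Fin m) n → Set
    IsCycle {n} p = 3 ℕ.≤ n × Unique p × All (λ e → proj₁ e ~ proj₂ e) (cyclicPairs p)

    HasCycle : Set
    HasCycle = Σ[ n ∈ Fin (suc m) ] ∃ λ (p : Vec (Fin m) (toℕ n)) → IsCycle p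

    HasLoop : Set
    HasLoop = ∃ λ (a : Fin m) → a ~ a

    IsTree : Set
    IsTree = Connected × ¬ HasCycle × ¬ HasLoop

    private

      anyVec? : ∀ {n} {P : Vec (Fin m) n → Set} → (∀ p → Dec (P p)) → Dec (∃ P)
      anyVec? {zero}  P? = map′ ([] ,_) (λ { ([] , h) → h }) (P? [])
      anyVec? {suc n} P? = map′ (λ { (v , p , h) → v ∷ p , h }) (λ { (v ∷ p , h) → v , p , h })
        (Fin.any? λ v → anyVec? λ p → P? (v ∷ p))

      unique? : ∀ {n} (p : Vec (Fin m) n) → Dec (Unique p)
      unique? = AllPairs.allPairs? (λ a b → ¬? (a Fin.≟ b))

    isTree? : Dec IsTree
    isTree? =
      (Fin.all? λ a → Fin.all? λ b → Fin.any? λ n → anyVec? λ p →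
        (Vec.head p Fin.≟ a) ×-dec (Vec.last p Fin.≟ b) ×-dec unique? p ×-dec Linked.linked? _~?_ p)
      ×-dec ¬? (Fin.any? λ n → anyVec? λ p →
        (3 ℕ.≤? toℕ n) ×-dec unique? p ×-dec All.all? (λ e → proj₁ e ~? proj₂ e) (cyclicPairs p))
      ×-dec ¬? (Fin.any? λ a → a ~? a)

  module _ {L : ℕ} (v : Vec (Fin m) L) where

    _~_ : Rel (Fin m) 0ℓ
    a ~ b = (a , b) ∈ cyclicPairs v ⊎ (b , a) ∈ cyclicPairs v

    _~?_ : Binary.Decidable _~_
    a ~? b = ((a , b) ∈? cyclicPairs v) ⊎-dec ((b , a) ∈? cyclicPairs v)
      where open import Data.Vec.Membership.DecPropositional (≡-dec Fin._≟_ Fin._≟_) using (_∈?_)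

    IsTreeWalk : Set
    IsTreeWalk = (∀ a → a ∈ v) × Graph.IsTree _~_ _~?_

    isTreeWalk? : Dec IsTreeWalk
    isTreeWalk? = (Fin.all? λ a → a ∈? v) ×-dec Graph.isTree? _~_ _~?_
      where open import Data.Vec.Membership.DecPropositional (Fin._≟_ {m}) using (_∈?_)

sequences : ∀ m L → List (Vec (Fin m) L)
sequences m zero    = [] ∷ []
sequences m (suc L) = List.cartesianProductWith _∷_ (List.allFin m) (sequences m L)

-- The values for m = 1 are conventions: only w 1 0 differs from the count.
w : (m L : ℕ) → ℕ
w 1 zero    = 1
w 1 (suc L) = 0
w m L       = List.length (List.filter isTreeWalk? (sequences m L))

treeWalkMoment : (c : ℝ) → 0ℝ < c → ℕ → ℝ
treeWalkMoment c c>0 ℓ = ∑ (suc ℓ) λ k → let m = suc k in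
  (c ⁻¹⟨ c>0 ⟩) ^ (suc ℓ ℕ.∸ m) * fromℚ ((pos (w m (2 ℕ.* ℓ)) ℚ./ (m !)) {{m !≢0}})

polynomial : List ℚ → ℝ → ℝ
polynomial []       x = 0ℝ
polynomial (a ∷ as) x = fromℚ a + x * polynomial as x

f : ℝ → ℝ
f = polynomial (1ℚ ∷ ½ ∷ pos 3 ℚ./ 8 ∷ pos 29 ℚ./ 16 ∷ pos 1987 ℚ./ 128 ∷ pos 47247 ℚ./ 256 ∷ [])

evenPolynomial : List ℤ → ℝ → ℝ
evenPolynomial as z = polynomial (List.map (λ a → a ℚ./ 1) as) (z * z)

private
  neg : ℕ → ℤ
  neg n = ℤ.- pos n

-- P i is the polynomial usually numbered i + 1, given by its coefficients in
-- powers of z ².  Two of them are corrections of the printed ones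
--   P₂ = 1 - 6 z² + 5 z⁴ - z⁶,
--   P₄ = 56 + 1602 z² - 8625 z⁴ + 16004 z⁶ - 13447 z⁸ + 5624 z¹⁰ - 1143 z¹² + 90 z¹⁴,
-- with which the expansion is false: the printed P₄ has mass 112 against the
-- semicircle law instead of 0 (all signs but the first are reversed), and the
-- printed P₂ makes the coefficient of c⁻² in the sixth moment 2 instead of
-- w 2 6 / 2! = 1 (a factor 2 is missing).
P : Fin 5 → ℝ → ℝ
P = λ i → evenPolynomial (Vec.lookup coefficients i)
  where
  coefficients : Vec (List ℤ) 5
  coefficients =
      (pos 1 ∷ neg 1 ∷ [])
    ∷ (pos 2 ∷ neg 12 ∷ pos 10 ∷ neg 2 ∷ [])
    ∷ (pos 9 ∷ neg 140 ∷ pos 358 ∷ neg 299 ∷ pos 98 ∷ neg 11 ∷ [])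
    ∷ (pos 56 ∷ neg 1602 ∷ pos 8625 ∷ neg 16004 ∷ pos 13447 ∷ neg 5624 ∷ pos 1143 ∷ neg 90 ∷ [])
    ∷ (pos 442 ∷ neg 17946 ∷ pos 171911 ∷ neg 574676 ∷ pos 904447 ∷ neg 768354
        ∷ pos 373181 ∷ neg 103622 ∷ pos 15298 ∷ neg 931 ∷ [])
    ∷ []

-- Since √ truncates its argument at 0, the indicator function of (-2 , 2) is
-- already accounted for.
semicircleDensity : (π : ℝ) → 0ℝ < π → (ℝ → ℝ) → ℝ → ℝ
semicircleDensity π π>0 p z = fromℚ ½ * π ⁻¹⟨ π>0 ⟩ * p z * √ (fromℚ (pos 4 ℚ./ 1) - z * z)

{-# OPTIONS --safe #-}
{-
Explore a tree walk step by step.  A step from a vertex returns to its parent,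
moves on to one of the subtrees found so far, or discovers a new vertex; which
continuations are possible depends on the explored tree and the current vertex
only.  Summing p ^ (new vertices) q ^ (repeated descents) over the continuations
at a new vertex that is left towards its parent j times (the end of the walk counting
as such for the root) gives a series S j in ℚ[[p, q]], with S 0 = 1 and
  S (j + 1) = S j + p Σₖ (j + k choose k) q ^ k S (k + 1) S (j + k + 1),
and w m (2 ℓ) / m ! is the coefficient of p ^ (m - 1) q ^ (ℓ - m + 1) in S 1.

With p = g (1 - g), the coefficients of q ^ e for e < 6 are rational functions of g
with poles at g = 1 and g = 1/2 only; for S 1 they are polynomials in 1 / (1 - 2 g)
and p, divided by a power of p.  As 1 / (1 - 2 g) = Σ (2 n choose n) p ^ n, its
powers have hypergeometric coefficients, so that the coefficient belonging to the
ℓ-th moment is a central binomial coefficient times a rational function of ℓ.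

The moments of the semicircle law satisfy (k + 4) m (k + 2) = 4 (k + 1) m k, by the
telescoping sum of z ^ (k + 1) (4 - z²) ^ (3/2) over uniform partitions, and the mass
is read off from the area of the disc; hence they are the Catalan numbers.  Both sides
of the expansion are therefore polynomials in 1 / c with rational coefficients, and
the claim is an identity between rational functions of ℓ for each of the first six.
-}
module Submission where

open import Algebra.Bundles using (CommutativeRing)
import Algebra.Properties.Ring
import Algebra.Solver.Ring
import Algebra.Solver.Ring.NaturalCoefficients.Default as NaturalCoefficients
open import Data.Bool.Base using (Bool; true; false; _∧_)
import Data.Bool.Properties as Bool
open import Data.Empty using (⊥; ⊥-elim)
open import Data.Fin.Base as Fin using (Fin; zero; suc; toℕ)
import Data.Fin.Properties as Fin
open import Data.Integer.Base as ℤ using (ℤ; -[1+_]) renaming (+_ to pos)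
import Data.Integer.Properties as ℤ
open import Data.List.Base as List using (List; []; _∷_; _++_; _ʳ++_)
import Data.List.Membership.DecPropositional as Membership
import Data.List.Properties as List
import Data.List.Relation.Binary.Permutation.Setoid.Properties as Permutationₛ
import Data.List.Relation.Unary.All as Allᴸ
import Data.List.Relation.Unary.AllPairs as AllPairsᴸ
open import Data.Nat.Base as ℕ using (ℕ; zero; suc; z≤n; s≤s; _!)
import Data.Nat.Properties as ℕ
open import Data.Product.Base using (Σ; ∃; ∃-syntax; _×_; _,_; proj₁; proj₂; map₂)
open import Data.Rational.Base as ℚ using (ℚ; 0ℚ; 1ℚ; ½)
import Data.Rational.Properties as ℚ
import Data.Rational.Unnormalised.Base as ℚᵘ
import Data.Rational.Unnormalised.Properties as ℚᵘ
open import Data.Sum.Base as Sum using (_⊎_; inj₁; inj₂)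
open import Data.Unit.Base using (⊤; tt)
import Data.Vec.Membership.Propositional as Vec
import Data.Vec.Membership.Propositional.Properties as Vec
import Data.Vec.Relation.Unary.Any as Anyⱽ
open import Level using (0ℓ)
open import Relation.Binary.Core using (Rel)
import Relation.Binary.Definitions as Binary
open import Relation.Binary.PropositionalEquality.Core as ≡ using (_≡_; _≢_)
open import Relation.Binary.PropositionalEquality.Properties using (module ≡-Reasoning)
open import Relation.Nullary.Decidable using (yes; no; does; ¬?; _×-dec_; toWitness)
open import Relation.Nullary.Negation using (¬_; contradiction)

-- The weight of a vertex is a sum over words: departures towards the parent are bars, re-entries
-- into a subtree are letters of their own kind. The kinds can be interleaved in any order, which is
-- why the continuations depend on the explored tree only and not on the history of the walk. The
-- tables of rational functions and polynomials are verified, not derived. The factor p makes the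
-- recursion contracting in powers of p, so whatever solves it for all j + e ≤ 6 must be S there.
-- Division by a power of p becomes a shift of the index: coefficient ℓ - i of S 1 i is coefficient
-- ℓ + D of p ^ (D + i) S 1 i. Read in this way the identity behind the coefficient of c ^ -i holds
-- for every ℓ. For ℓ < i the tree walk side is 0, and ℓ = 0 gives the total masses of the
-- correction measures. Each of the six identities is cleared of its denominators and decided as an
-- equality of integer polynomials in ℓ. For fixed ℓ both moments are polynomials in 1 / c, so the
-- error is an explicit polynomial divisible by c ^ -6.

module FormalSeries where

  -- Formal power series over a commutative ring, possibly truncated.

  module PowerSeries (R : CommutativeRing 0ℓ 0ℓ) where

    open CommutativeRing R
    open NaturalCoefficients commutativeSemiring using (solve; _:=_; _:+_)
    open import Relation.Binary.Reasoning.Setoid setoid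

    Series : Set
    Series = ℕ → Carrier

    tail : Series → Series
    tail a n = a (suc n)

    constant : Carrier → Series
    constant x zero    = x
    constant x (suc n) = 0#

    variable′ : Series
    variable′ zero    = 0#
    variable′ (suc n) = constant 1# n

    infixl 6 _⊕_
    infixl 7 _⊛_

    _⊕_ _⊛_ : Series → Series → Series
    (a ⊕ b) n = a n + b n
    (a ⊛ b) zero    = a 0 * b 0
    (a ⊛ b) (suc n) = a 0 * b (suc n) + (tail a ⊛ b) n

    ⊖_ : Series → Series
    (⊖ a) n = - a n

    -- Coefficient `n` of a product involves no coefficient beyond `n`; this makes multiplication
    -- compatible with equality up to a given degree.
    ⊛-cong≤ : ∀ {a a′ b b′} n → (∀ i → i ℕ.≤ n → a i ≈ a′ i) → (∀ i → i ℕ.≤ n → b i ≈ b′ i) →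
              (a ⊛ b) n ≈ (a′ ⊛ b′) n
    ⊛-cong≤ zero    p q = *-cong (p 0 z≤n) (q 0 z≤n)
    ⊛-cong≤ (suc n) p q = +-cong (*-cong (p 0 z≤n) (q (suc n) ℕ.≤-refl))
      (⊛-cong≤ n (λ i i≤n → p (suc i) (s≤s i≤n)) (λ i i≤n → q i (ℕ.m≤n⇒m≤1+n i≤n)))

    ⊛-cong : ∀ {a a′ b b′} → (∀ i → a i ≈ a′ i) → (∀ i → b i ≈ b′ i) → ∀ n → (a ⊛ b) n ≈ (a′ ⊛ b′) n
    ⊛-cong p q n = ⊛-cong≤ n (λ i _ → p i) (λ i _ → q i)

    ⊛-zeroˡ : ∀ {a} b → (∀ n → a n ≈ 0#) → ∀ n → (a ⊛ b) n ≈ 0#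
    ⊛-zeroˡ b a≈0 zero    = trans (*-cong (a≈0 0) refl) (zeroˡ _)
    ⊛-zeroˡ b a≈0 (suc n) = trans (+-cong (trans (*-cong (a≈0 0) refl) (zeroˡ _))
      (⊛-zeroˡ b (λ i → a≈0 (suc i)) n)) (+-identityˡ _)

    constant-⊛ : ∀ x a n → (constant x ⊛ a) n ≈ x * a n
    constant-⊛ x a zero    = refl
    constant-⊛ x a (suc n) = trans (+-cong refl (⊛-zeroˡ a (λ _ → refl) n)) (+-identityʳ _)

    variable-⊛-zero : ∀ a → (variable′ ⊛ a) 0 ≈ 0#
    variable-⊛-zero a = zeroˡ (a 0)

    variable-⊛-suc : ∀ a n → (variable′ ⊛ a) (suc n) ≈ a n
    variable-⊛-suc a n = begin
      0# * a (suc n) + (constant 1# ⊛ a) n  ≈⟨ +-cong (zeroˡ _) (constant-⊛ 1# a n) ⟩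
      0# + 1# * a n                          ≈⟨ trans (+-identityˡ _) (*-identityˡ _) ⟩
      a n                                    ∎

    ⊛-distribʳ : ∀ a b c n → ((a ⊕ b) ⊛ c) n ≈ (a ⊛ c) n + (b ⊛ c) n
    ⊛-distribʳ a b c zero    = distribʳ _ _ _
    ⊛-distribʳ a b c (suc n) = begin
      (a 0 + b 0) * c (suc n) + ((tail a ⊕ tail b) ⊛ c) n
        ≈⟨ +-cong (distribʳ _ _ _) (⊛-distribʳ (tail a) (tail b) c n) ⟩
      (a 0 * c (suc n) + b 0 * c (suc n)) + ((tail a ⊛ c) n + (tail b ⊛ c) n)
        ≈⟨ solve 4 (λ x y z w → (x :+ y) :+ (z :+ w) := (x :+ z) :+ (y :+ w)) refl _ _ _ _ ⟩
      (a ⊛ c) (suc n) + (b ⊛ c) (suc n) ∎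

    -- Mirror image of the defining recursion, with the other end of the sum split off;
    -- commutativity plays one against the other.
    ⊛-suc : ∀ a b n → (a ⊛ b) (suc n) ≈ (a ⊛ tail b) n + a (suc n) * b 0
    ⊛-suc a b zero    = refl
    ⊛-suc a b (suc n) = trans (+-cong refl (⊛-suc (tail a) b n)) (sym (+-assoc _ _ _))

    ⊛-comm : ∀ a b n → (a ⊛ b) n ≈ (b ⊛ a) n
    ⊛-comm a b zero    = *-comm _ _
    ⊛-comm a b (suc n) = begin
      a 0 * b (suc n) + (tail a ⊛ b) n ≈⟨ +-cong (*-comm _ _) (⊛-comm (tail a) b n) ⟩
      b (suc n) * a 0 + (b ⊛ tail a) n ≈⟨ +-comm _ _ ⟩
      (b ⊛ tail a) n + b (suc n) * a 0 ≈⟨ ⊛-suc b a n ⟨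
      (b ⊛ a) (suc n)                  ∎

    ⊛-distribˡ : ∀ a b c n → (a ⊛ (b ⊕ c)) n ≈ (a ⊛ b) n + (a ⊛ c) n
    ⊛-distribˡ a b c n = trans (⊛-comm a (b ⊕ c) n)
      (trans (⊛-distribʳ b c a n) (+-cong (⊛-comm b a n) (⊛-comm c a n)))

    ⊛-scaleˡ : ∀ x a b n → ((λ i → x * a i) ⊛ b) n ≈ x * (a ⊛ b) n
    ⊛-scaleˡ x a b zero    = *-assoc _ _ _
    ⊛-scaleˡ x a b (suc n) = trans (+-cong (*-assoc _ _ _) (⊛-scaleˡ x (tail a) b n)) (sym (distribˡ _ _ _))

    ⊛-assoc : ∀ a b c n → ((a ⊛ b) ⊛ c) n ≈ (a ⊛ (b ⊛ c)) n
    ⊛-assoc a b c zero    = *-assoc _ _ _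
    ⊛-assoc a b c (suc n) = begin
      (a 0 * b 0) * c (suc n) + (tail (a ⊛ b) ⊛ c) n
        ≈⟨ +-cong (*-assoc _ _ _) (⊛-distribʳ (λ i → a 0 * b (suc i)) (tail a ⊛ b) c n) ⟩
      a 0 * (b 0 * c (suc n)) + (((λ i → a 0 * b (suc i)) ⊛ c) n + ((tail a ⊛ b) ⊛ c) n)
        ≈⟨ +-cong refl (+-cong (⊛-scaleˡ (a 0) (tail b) c n) (⊛-assoc (tail a) b c n)) ⟩
      a 0 * (b 0 * c (suc n)) + (a 0 * (tail b ⊛ c) n + (tail a ⊛ (b ⊛ c)) n)
        ≈⟨ trans (sym (+-assoc _ _ _)) (+-cong (sym (distribˡ _ _ _)) refl) ⟩
      a 0 * (b ⊛ c) (suc n) + (tail a ⊛ (b ⊛ c)) n ∎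

    -- Two series are identified when they agree at the indices satisfying Ok, so
    -- that Ok n = n < N gives the series truncated at degree N.
    module _ (Ok : ℕ → Set) (down : ∀ {m n} → m ℕ.≤ n → Ok n → Ok m) where

      series : CommutativeRing 0ℓ 0ℓ
      series = record
        { Carrier = Series
        ; _≈_ = λ a b → ∀ n → Ok n → a n ≈ b n
        ; _+_ = _⊕_ ; _*_ = _⊛_ ; -_ = ⊖_ ; 0# = λ _ → 0# ; 1# = constant 1#
        ; isCommutativeRing = record
          { isRing = record
            { +-isAbelianGroup = record
              { isGroup = record
                { isMonoid = record
                  { isSemigroup = record
                    { isMagma = record
                      { isEquivalence = record
                        { refl = λ _ _ → refl ; sym = λ p n ok → sym (p n ok) ; trans = λ p q n ok → trans (p n ok) (q n ok) }
                      ; ∙-cong = λ p q n ok → +-cong (p n ok) (q n ok) }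
                    ; assoc = λ _ _ _ _ _ → +-assoc _ _ _ }
                  ; identity = (λ _ _ _ → +-identityˡ _) , (λ _ _ _ → +-identityʳ _) }
                ; inverse = (λ _ _ _ → -‿inverseˡ _) , (λ _ _ _ → -‿inverseʳ _)
                ; ⁻¹-cong = λ p n ok → -‿cong (p n ok) }
              ; comm = λ _ _ _ _ → +-comm _ _ }
            ; *-cong = λ p q n ok → ⊛-cong≤ n (λ i i≤n → p i (down i≤n ok)) (λ i i≤n → q i (down i≤n ok))
            ; *-assoc = λ a b c n _ → ⊛-assoc a b c n
            ; *-identity = (λ a n _ → trans (constant-⊛ 1# a n) (*-identityˡ _))
                         , (λ a n _ → trans (⊛-comm a (constant 1#) n) (trans (constant-⊛ 1# a n) (*-identityˡ _)))
            ; distrib = (λ a b c n _ → ⊛-distribˡ a b c n) , (λ a b c n _ → ⊛-distribʳ b c a n) }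
          ; *-comm = λ a b n _ → ⊛-comm a b n } }

-- Weights of the continuations of a walk at a vertex of an explored tree.

module WalkSums where

  data Tree (A : Set) : Set where
    node : A → List (Tree A) → Tree A

  module _ {A : Set} where

    label : Tree A → A
    label (node a ts) = a

    children : Tree A → List (Tree A)
    children (node a ts) = ts

    picks : List (Tree A) → List (Tree A × List (Tree A))
    picks []       = []
    picks (t ∷ ts) = (t , ts) ∷ List.map (map₂ (t ∷_)) (picks ts)

  module Sums (R : CommutativeRing 0ℓ 0ℓ) where

    open CommutativeRing R
    open NaturalCoefficients commutativeSemiring using (solve; _:=_; _:+_; _:*_)

    sumOver : ∀ {X : Set} → (X → Carrier) → List X → Carrier
    sumOver f []       = 0#
    sumOver f (x ∷ xs) = f x + sumOver f xs

    sumOver-cong : ∀ {X : Set} {f g : X → Carrier} → (∀ x → f x ≈ g x) → ∀ xs → sumOver f xs ≈ sumOver g xs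
    sumOver-cong eq []       = refl
    sumOver-cong eq (x ∷ xs) = +-cong (eq x) (sumOver-cong eq xs)

    sumOver-map : ∀ {X Y : Set} (f : Y → Carrier) (g : X → Y) xs →
                  sumOver f (List.map g xs) ≈ sumOver (λ x → f (g x)) xs
    sumOver-map f g []       = refl
    sumOver-map f g (x ∷ xs) = +-cong refl (sumOver-map f g xs)

    pow : Carrier → ℕ → Carrier
    pow x zero    = 1#
    pow x (suc n) = x * pow x n

    opaque

      Σ< : ℕ → (ℕ → Carrier) → Carrier
      Σ< zero    f = 0#
      Σ< (suc n) f = f 0 + Σ< n (λ k → f (suc k))

      Σ<-cong : ∀ n {f g} → (∀ k → f k ≈ g k) → Σ< n f ≈ Σ< n g
      Σ<-cong zero    eq = refl
      Σ<-cong (suc n) eq = +-cong (eq 0) (Σ<-cong n (λ k → eq (suc k)))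

      Σ<-+ : ∀ n f g → Σ< n (λ k → f k + g k) ≈ Σ< n f + Σ< n g
      Σ<-+ zero    f g = sym (+-identityˡ 0#)
      Σ<-+ (suc n) f g = trans (+-cong refl (Σ<-+ n _ _))
        (solve 4 (λ x y z w → (x :+ y) :+ (z :+ w) := (x :+ z) :+ (y :+ w)) refl _ _ _ _)

      Σ<-* : ∀ n c f → Σ< n (λ k → c * f k) ≈ c * Σ< n f
      Σ<-* zero    c f = sym (zeroʳ c)
      Σ<-* (suc n) c f = trans (+-cong refl (Σ<-* n c _)) (sym (distribˡ _ _ _))

      Σ<-zero : ∀ n → Σ< n (λ _ → 0#) ≈ 0#
      Σ<-zero zero    = refl
      Σ<-zero (suc n) = trans (+-identityˡ _) (Σ<-zero n)

      Σ<-swap : ∀ m n (f : ℕ → ℕ → Carrier) →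
                Σ< m (λ i → Σ< n (λ j → f i j)) ≈ Σ< n (λ j → Σ< m (λ i → f i j))
      Σ<-swap zero    n f = sym (Σ<-zero n)
      Σ<-swap (suc m) n f = trans (+-cong refl (Σ<-swap m n (λ i → f (suc i)))) (sym (Σ<-+ n _ _))

      Σ<-snoc : ∀ n f → Σ< (suc n) f ≈ Σ< n f + f n
      Σ<-snoc zero    f = +-comm _ _
      Σ<-snoc (suc n) f = trans (+-cong refl (Σ<-snoc n (λ k → f (suc k)))) (sym (+-assoc _ _ _))

      -- multichoose b k is the number of words with b bars and k letters that end
      -- with a bar (or are empty).
      multichoose : ℕ → ℕ → Carrier
      multichoose b       zero    = 1#
      multichoose zero    (suc k) = 0#
      multichoose (suc b) (suc k) = multichoose b (suc k) + multichoose (suc b) k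

      private
        mm : ℕ → ℕ → ℕ → Carrier
        mm b k l = multichoose b k * multichoose (b ℕ.+ k) l

        mm-step : ∀ b k l → mm (suc b) (suc k) (suc l) ≈
                  mm b (suc k) (suc l) + mm (suc b) k (suc l) + mm (suc b) (suc k) l
        mm-step b k l rewrite ℕ.+-suc b k =
          solve 4 (λ x y z w → (x :+ y) :* (z :+ w) := x :* z :+ y :* z :+ (x :+ y) :* w) refl _ _ _ _

      -- Both sides count the words with `b` bars and `k` and `l` letters of two kinds that end with
      -- a bar or are empty. The induction distinguishes the three possible first symbols, which is
      -- `mm-step`.
      multichoose-swap : ∀ b k l → multichoose b k * multichoose (b ℕ.+ k) l ≈
                                   multichoose b l * multichoose (b ℕ.+ l) k
      multichoose-swap b       zero    l       rewrite ℕ.+-identityʳ b = *-comm _ _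
      multichoose-swap b       (suc k) zero    rewrite ℕ.+-identityʳ b = *-comm _ _
      multichoose-swap zero    (suc k) (suc l) = trans (zeroˡ _) (sym (zeroˡ _))
      multichoose-swap (suc b) (suc k) (suc l) = trans (mm-step b k l)
        (trans (+-cong (+-cong (multichoose-swap b (suc k) (suc l)) (multichoose-swap (suc b) k (suc l)))
                       (multichoose-swap (suc b) (suc k) l))
          (trans (solve 3 (λ x y z → x :+ y :+ z := x :+ z :+ y) refl _ _ _) (sym (mm-step b l k))))

  module Value (R : CommutativeRing 0ℓ 0ℓ) (q p : CommutativeRing.Carrier R) (N : ℕ)
               (nilpotent : CommutativeRing._≈_ R (Sums.pow R q (suc N)) (CommutativeRing.0# R)) where

    open CommutativeRing R
    open Sums R
    open NaturalCoefficients commutativeSemiring using (solve; _:=_; _:+_; _:*_)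
    open import Relation.Binary.Reasoning.Setoid setoid

    Sequence : Set
    Sequence = ℕ → Carrier

    shift : Sequence → Sequence
    shift h k = h (suc k)

    opaque

      -- Words in which k new letters of weight q, whose further behaviour has
      -- weight h k, are interleaved with the b bars, the last bar staying last; the
      -- new letters are bars for everything that is counted by H.
      link : Sequence → Sequence → Sequence
      link h H b = Σ< (suc N) λ k → multichoose b k * pow q k * (h k * H (b ℕ.+ k))

      link-cong : ∀ {h h′ H H′} → (∀ k → h k ≈ h′ k) → (∀ k → H k ≈ H′ k) → ∀ b → link h H b ≈ link h′ H′ b
      link-cong eq eq′ b = Σ<-cong (suc N) λ k → *-cong refl (*-cong (eq k) (eq′ _))

      link-+ʳ : ∀ h H K b → link h (λ k → H k + K k) b ≈ link h H b + link h K b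
      link-+ʳ h H K b = trans (Σ<-cong (suc N) λ k →
          solve 4 (λ x y z w → x :* (y :* (z :+ w)) := x :* (y :* z) :+ x :* (y :* w)) refl _ _ _ _)
        (Σ<-+ (suc N) _ _)

      link-*ʳ : ∀ c h H b → link h (λ k → c * H k) b ≈ c * link h H b
      link-*ʳ c h H b = trans (Σ<-cong (suc N) λ k →
          solve 4 (λ c x y z → x :* (y :* (c :* z)) := c :* (x :* (y :* z))) refl _ _ _ _)
        (Σ<-* (suc N) _ _)

      link-+ˡ : ∀ h k H b → link (λ i → h i + k i) H b ≈ link h H b + link k H b
      link-+ˡ h k H b = trans (Σ<-cong (suc N) λ i →
          solve 4 (λ x y z w → x :* ((y :+ z) :* w) := x :* (y :* w) :+ x :* (z :* w)) refl _ _ _ _)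
        (Σ<-+ (suc N) _ _)

      link-*ˡ : ∀ c h H b → link (λ k → c * h k) H b ≈ c * link h H b
      link-*ˡ c h H b = trans (Σ<-cong (suc N) λ k →
          solve 4 (λ c x y z → x :* ((c :* y) :* z) := c :* (x :* (y :* z))) refl _ _ _ _)
        (Σ<-* (suc N) _ _)

      -- Two kinds of letters may be inserted in either order, the kind inserted second treating the
      -- first as bars. Hence any subtree of a vertex can be taken as the outermost one.
      link-swap : ∀ h h′ H b → link h (link h′ H) b ≈ link h′ (link h H) b
      link-swap h h′ H b = begin
        Σ< (suc N) (λ k → multichoose b k * pow q k * (h k * link h′ H (b ℕ.+ k)))
          ≈⟨ Σ<-cong (suc N) (λ k → trans (sym (*-assoc _ _ _)) (sym (Σ<-* (suc N) _ _))) ⟩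
        Σ< (suc N) (λ k → Σ< (suc N) (term h h′ k))
          ≈⟨ Σ<-swap (suc N) (suc N) (term h h′) ⟩
        Σ< (suc N) (λ l → Σ< (suc N) (λ k → term h h′ k l))
          ≈⟨ Σ<-cong (suc N) (λ l → Σ<-cong (suc N) (λ k → exchange k l)) ⟩
        Σ< (suc N) (λ l → Σ< (suc N) (term h′ h l))
          ≈⟨ Σ<-cong (suc N) (λ k → trans (sym (*-assoc _ _ _)) (sym (Σ<-* (suc N) _ _))) ⟨
        Σ< (suc N) (λ l → multichoose b l * pow q l * (h′ l * link h H (b ℕ.+ l))) ∎
        where
        term : Sequence → Sequence → ℕ → ℕ → Carrier
        term h h′ k l = multichoose b k * pow q k * h k * (multichoose (b ℕ.+ k) l * pow q l * (h′ l * H (b ℕ.+ k ℕ.+ l)))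
        exchange : ∀ k l → term h h′ k l ≈ term h′ h l k
        exchange k l = begin
          term h h′ k l
            ≈⟨ solve 7 (λ a x y c z u v → a :* x :* y :* (c :* z :* (u :* v)) := (a :* c) :* (x :* y :* z :* u :* v)) refl _ _ _ _ _ _ _ ⟩
          (multichoose b k * multichoose (b ℕ.+ k) l) * (pow q k * h k * pow q l * h′ l * H (b ℕ.+ k ℕ.+ l))
            ≈⟨ *-cong (multichoose-swap b k l) (*-cong refl (reflexive (≡.cong H index))) ⟩
          (multichoose b l * multichoose (b ℕ.+ l) k) * (pow q k * h k * pow q l * h′ l * H (b ℕ.+ l ℕ.+ k))
            ≈⟨ solve 7 (λ a x y c z u v → a :* x :* y :* (c :* z :* (u :* v)) := (a :* c) :* (z :* u :* x :* y :* v)) refl _ _ _ _ _ _ _ ⟨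
          term h′ h l k ∎
          where
          index : b ℕ.+ k ℕ.+ l ≡ b ℕ.+ l ℕ.+ k
          index = ≡.trans (ℕ.+-assoc b k l) (≡.trans (≡.cong (b ℕ.+_) (ℕ.+-comm k l)) (≡.sym (ℕ.+-assoc b l k)))

    opaque
      unfolding Σ< multichoose link

      -- Without bars only the empty word is left, because a nonempty word ends with a bar.
      link-zero : ∀ h H → link h H 0 ≈ h 0 * H 0
      link-zero h H = trans (+-cong (trans (*-cong (*-identityˡ 1#) refl) (*-identityˡ _)) (trans
        (Σ<-cong N λ k → trans (*-cong (zeroˡ _) refl) (zeroˡ _)) (Σ<-zero N))) (+-identityʳ _)

      -- The first symbol is a bar or one of the new letters.
      link-split : ∀ h H b → Σ< (suc N) (λ k → multichoose (suc b) k * pow q k * (h k * H (b ℕ.+ k))) ≈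
                             link h H b + q * link (shift h) H (suc b)
      link-split h H b = begin
        t 0 + Σ< N (λ k → t (suc k))
          ≈⟨ +-cong refl (Σ<-cong N step) ⟩
        u 0 + Σ< N (λ k → u (suc k) + q * v k)
          ≈⟨ trans (+-cong refl (Σ<-+ N _ _)) (sym (+-assoc _ _ _)) ⟩
        link h H b + Σ< N (λ k → q * v k)
          -- The missing summand at `N` carries the factor q ^ (N + 1) = 0; adding it completes the
          -- sum to a full `link`.
          ≈⟨ +-cong refl (trans (sym (+-identityʳ _)) (+-cong refl (sym last≈0))) ⟩
        link h H b + (Σ< N (λ k → q * v k) + q * v N)
          ≈⟨ +-cong refl (trans (sym (Σ<-snoc N _)) (Σ<-* (suc N) q v)) ⟩
        link h H b + q * link (shift h) H (suc b) ∎
        where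
        t u v : ℕ → Carrier
        t k = multichoose (suc b) k * pow q k * (h k * H (b ℕ.+ k))
        u k = multichoose b k * pow q k * (h k * H (b ℕ.+ k))
        v k = multichoose (suc b) k * pow q k * (h (suc k) * H (suc b ℕ.+ k))
        step : ∀ k → t (suc k) ≈ u (suc k) + q * v k
        step k rewrite ℕ.+-suc b k =
          solve 5 (λ x y q z w → (x :+ y) :* (q :* z) :* w := x :* (q :* z) :* w :+ q :* (y :* z :* w)) refl _ _ _ _ _
        last≈0 : q * v N ≈ 0#
        last≈0 = trans (solve 4 (λ q x y z → q :* (x :* y :* z) := (q :* y) :* (x :* z)) refl _ _ _ _)
          (trans (*-cong nilpotent refl) (zeroˡ _))

    opaque
      unfolding link

      -- A discrete product rule: with one more bar, the next event is a bar, a new letter, or one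
      -- of the events that `D` collects for `H`.
      link-step : ∀ h {H D} → (∀ b → H (suc b) ≈ H b + D (suc b)) → ∀ b →
                  link h H (suc b) ≈ link h H b + q * link (shift h) H (suc b) + link h D (suc b)
      link-step h {H} {D} eq b = begin
        link h H (suc b)
          ≈⟨ Σ<-cong (suc N) (λ k → trans (*-cong refl (*-cong refl (eq _)))
               (solve 4 (λ x y z w → x :* (y :* (z :+ w)) := x :* (y :* z) :+ x :* (y :* w)) refl _ _ _ _)) ⟩
        Σ< (suc N) (λ k → multichoose (suc b) k * pow q k * (h k * H (b ℕ.+ k)) +
                          multichoose (suc b) k * pow q k * (h k * D (suc b ℕ.+ k)))
          ≈⟨ Σ<-+ (suc N) _ _ ⟩
        Σ< (suc N) (λ k → multichoose (suc b) k * pow q k * (h k * H (b ℕ.+ k))) + link h D (suc b)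
          ≈⟨ +-cong (link-split h H b) refl ⟩
        link h H b + q * link (shift h) H (suc b) + link h D (suc b) ∎

      link-sumʳ : ∀ {X : Set} h (H : X → Sequence) xs b →
                  link h (λ k → sumOver (λ x → H x k) xs) b ≈ sumOver (λ x → link h (H x) b) xs
      link-sumʳ h H []       b = trans (Σ<-cong (suc N) λ k → trans (*-cong refl (zeroʳ _)) (zeroʳ _)) (Σ<-zero (suc N))
      link-sumʳ h H (x ∷ xs) b = trans (link-+ʳ h (H x) (λ k → sumOver (λ y → H y k) xs) b) (+-cong refl (link-sumʳ h H xs b))

      link-sumˡ : ∀ {X : Set} (h : X → Sequence) H xs b →
                  link (λ k → sumOver (λ x → h x k) xs) H b ≈ sumOver (λ x → link (h x) H b) xs
      link-sumˡ h H []       b = trans (Σ<-cong (suc N) λ k → trans (*-cong refl (zeroˡ _)) (zeroʳ _)) (Σ<-zero (suc N))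
      link-sumˡ h H (x ∷ xs) b = trans (link-+ˡ _ _ H b) (+-cong refl (link-sumˡ h H xs b))

    module _ (S : Sequence) (S-zero : S 0 ≈ 1#)
             (S-suc : ∀ b → S (suc b) ≈ S b + p * link (shift S) S (suc b)) {A : Set} where

      -- The weight of all continuations at a vertex with the given explored
      -- subtrees that leave it b times more.
      weight : List (Tree A) → Sequence
      weight []                 = S
      weight (node a ts ∷ us) b = link (weight ts) (weight us) b

      weight-zero : ∀ ts → weight ts 0 ≈ 1#
      weight-zero []               = S-zero
      weight-zero (node a ts ∷ us) = trans (link-zero (weight ts) (weight us))
        (trans (*-cong (weight-zero ts) (weight-zero us)) (*-identityˡ 1#))

      -- The shift stands for the entry made now. The subtree is left once for it, and once more for
      -- each later entry; only the later ones are letters of the word.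
      reenter : Tree A × List (Tree A) → Sequence
      reenter (t , us) = link (shift (weight (children t))) (weight us)

      forward : List (Tree A) → Sequence
      forward ts b = p * link (shift S) (weight ts) b + q * sumOver (λ x → reenter x b) (picks ts)

      -- The next step leaves the vertex, discovers a child or re-enters a known one. The re-entry
      -- of the first subtree comes from `link-step`; the steps into new or other subtrees are
      -- carried past it by `link-swap`.
      weight-suc : ∀ ts b → weight ts (suc b) ≈ weight ts b + forward ts (suc b)
      weight-suc []                  b = trans (S-suc b) (+-cong refl (sym (trans (+-cong refl (zeroʳ q)) (+-identityʳ _))))
      weight-suc (t@(node a ts) ∷ us) b = begin
        link h (weight us) (suc b)
          ≈⟨ link-step h (weight-suc us) b ⟩
        link h (weight us) b + q * r + link h (forward us) (suc b)
          ≈⟨ +-cong refl (trans (link-+ʳ h _ _ _) (+-cong (link-*ʳ p h _ _) (link-*ʳ q h _ _))) ⟩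
        link h (weight us) b + q * r + (p * link h (link (shift S) (weight us)) (suc b)
                                      + q * link h (λ k → sumOver (λ x → reenter x k) (picks us)) (suc b))
          ≈⟨ +-cong refl (+-cong (*-cong refl (link-swap h (shift S) (weight us) (suc b))) (*-cong refl others)) ⟩
        link h (weight us) b + q * r + (p * link (shift S) (weight (t ∷ us)) (suc b)
                                      + q * sumOver (λ x → reenter x (suc b)) (List.map (map₂ (t ∷_)) (picks us)))
          ≈⟨ solve 5 (λ a q r x y → a :+ q :* r :+ (x :+ q :* y) := a :+ (x :+ q :* (r :+ y))) refl _ _ _ _ _ ⟩
        weight (t ∷ us) b + forward (t ∷ us) (suc b) ∎
        where
        h = weight ts
        r = link (shift h) (weight us) (suc b)
        others : link h (λ k → sumOver (λ x → reenter x k) (picks us)) (suc b) ≈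
                 sumOver (λ x → reenter x (suc b)) (List.map (map₂ (t ∷_)) (picks us))
        others = trans (link-sumʳ h reenter (picks us) (suc b))
          (trans (sumOver-cong (λ x → link-swap h _ (weight (proj₂ x)) (suc b)) (picks us))
            (sym (sumOver-map (λ x → reenter x (suc b)) (map₂ (t ∷_)) (picks us))))

      ascend : List (Tree A) → Sequence → Sequence
      ascend ss h b = link h (weight ss) (suc b)

      -- Every vertex between the current one and the root still has to be left at least once, so
      -- all indices are one less than the number of departures. At the root the only departure is
      -- the end of the walk, hence `h 0`.
      context : List (A × List (Tree A)) → Sequence → Carrier
      context []              h = h 0
      context ((_ , ss) ∷ fs) h = context fs (ascend ss h)

      context-cong : ∀ fs {h h′} → (∀ k → h k ≈ h′ k) → context fs h ≈ context fs h′
      context-cong []              eq = eq 0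
      context-cong ((_ , ss) ∷ fs) eq = context-cong fs λ b → link-cong eq (λ _ → refl) (suc b)

      context-+ : ∀ fs h k → context fs (λ i → h i + k i) ≈ context fs h + context fs k
      context-+ []              h k = refl
      context-+ ((_ , ss) ∷ fs) h k =
        trans (context-cong fs λ b → link-+ˡ h k (weight ss) (suc b)) (context-+ fs _ _)

      context-* : ∀ fs c h → context fs (λ i → c * h i) ≈ c * context fs h
      context-* []              c h = refl
      context-* ((_ , ss) ∷ fs) c h =
        trans (context-cong fs λ b → link-*ˡ c h (weight ss) (suc b)) (context-* fs c _)

      context-sum : ∀ {X : Set} fs (h : X → Sequence) xs →
                    context fs (λ k → sumOver (λ x → h x k) xs) ≈ sumOver (λ x → context fs (h x)) xs
      context-sum []              h xs = refl
      context-sum ((_ , ss) ∷ fs) h xs =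
        trans (context-cong fs λ b → link-sumˡ h (weight ss) xs (suc b)) (context-sum fs (λ x → ascend ss (h x)) xs)

      value : List (Tree A) → List (A × List (Tree A)) → Carrier
      value ts fs = context fs (shift (weight ts))

      value-back : List (Tree A) → List (A × List (Tree A)) → Carrier
      value-back ts []              = 1#
      value-back ts ((a , ss) ∷ fs) = value (node a ts ∷ ss) fs

      -- This is `weight-suc` seen through the frames, in which `context` is linear.
      value-step : ∀ (a : A) ts fs → value ts fs ≈ value-back ts fs +
        (p * value [] ((a , ts) ∷ fs) + q * sumOver (λ x → value (children (proj₁ x)) ((a , proj₂ x) ∷ fs)) (picks ts))
      value-step a ts fs = begin
        context fs (shift (weight ts))
          ≈⟨ context-cong fs (weight-suc ts) ⟩
        context fs (λ b → weight ts b + forward ts (suc b))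
          ≈⟨ context-+ fs _ _ ⟩
        context fs (weight ts) + context fs (λ b → forward ts (suc b))
          ≈⟨ +-cong (back ts fs) (trans (context-+ fs _ _) (+-cong (context-* fs p _) (trans (context-* fs q _)
               (*-cong refl (context-sum fs (λ x → shift (reenter x)) (picks ts)))))) ⟩
        value-back ts fs +
        (p * value [] ((a , ts) ∷ fs) + q * sumOver (λ x → value (children (proj₁ x)) ((a , proj₂ x) ∷ fs)) (picks ts)) ∎
        where
        back : ∀ ts fs → context fs (weight ts) ≈ value-back ts fs
        back ts []              = weight-zero ts
        -- `ascend` has already inserted the vertex among its siblings in the way in which `weight`
        -- treats the list `node a ts ∷ ss`.
        back ts ((a , ss) ∷ fs) = refl

-- Trees that grow by attaching new vertices.

module GrowingTrees where

  open import Data.List.Membership.Propositional using (_∈_; _∉_)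
  open import Data.List.Membership.Propositional.Properties using (∈-++⁻)
  open import Data.List.Relation.Unary.Any using (here; there)
  open import Data.Vec.Base as Vec using (Vec; []; _∷_)
  open import Data.Vec.Relation.Unary.All as All using (All; []; _∷_)
  open import Data.Vec.Relation.Unary.AllPairs using ([]; _∷_)
  open import Data.Vec.Relation.Unary.Linked using (Linked; [-]; _∷_)
  open import Data.Vec.Relation.Unary.Unique.Propositional using (Unique)
  open import Data.Vec.Relation.Unary.Unique.Propositional.Properties using (lookup-injective)
  open ≡ using (refl; sym; trans; subst)
  open import Defs using (module Graph)

  module GrownTrees {m : ℕ} (root : Fin m) where

    Edges : Set
    Edges = List (Fin m × Fin m)

    vertices : Edges → List (Fin m)
    vertices []            = root ∷ []
    vertices ((c , p) ∷ E) = c ∷ vertices E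

    -- The pairs are (child , parent), the latest vertex coming first.
    data Grown : Edges → Set where
      start : Grown []
      grow  : ∀ {E c p} → Grown E → p ∈ vertices E → c ∉ vertices E → Grown ((c , p) ∷ E)

    Adjacent : Edges → Rel (Fin m) 0ℓ
    Adjacent E a b = (a , b) ∈ E ⊎ (b , a) ∈ E

    edge-vertices : ∀ {E c p} → Grown E → (c , p) ∈ E → c ∈ vertices E × p ∈ vertices E
    edge-vertices (grow G p∈ c∉) (here refl) = here refl , there p∈
    edge-vertices (grow G p∈ c∉) (there e)   =
      let c∈ , p∈ = edge-vertices G e in there c∈ , there p∈

    unique-parent : ∀ {E c p p′} → Grown E → (c , p) ∈ E → (c , p′) ∈ E → p ≡ p′
    unique-parent (grow G p∈ c∉) (here refl) (here refl) = refl
    unique-parent (grow G p∈ c∉) (here refl) (there e)   = contradiction (proj₁ (edge-vertices G e)) c∉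
    unique-parent (grow G p∈ c∉) (there e)   (here refl) = contradiction (proj₁ (edge-vertices G e)) c∉
    unique-parent (grow G p∈ c∉) (there e)   (there e′)  = unique-parent G e e′

    -- The time of attachment. It increases strictly from parent to child, which is what excludes
    -- loops and cycles.
    rank : Edges → Fin m → ℕ
    rank []            x = 0
    rank ((c , p) ∷ E) x with x Fin.≟ c
    ... | yes _ = suc (List.length E)
    ... | no  _ = rank E x

    rank≤length : ∀ E x → rank E x ℕ.≤ List.length E
    rank≤length []            x = z≤n
    rank≤length ((c , p) ∷ E) x with x Fin.≟ c
    ... | yes _ = ℕ.≤-refl
    ... | no  _ = ℕ.m≤n⇒m≤1+n (rank≤length E x)

    rank-old : ∀ {E c p x} → c ∉ vertices E → x ∈ vertices E → rank ((c , p) ∷ E) x ≡ rank E x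
    rank-old {E} {c} {p} {x} c∉ x∈ with x Fin.≟ c
    ... | yes refl = contradiction x∈ c∉
    ... | no  _    = refl

    rank-parent : ∀ {E c p} → Grown E → (c , p) ∈ E → rank E p ℕ.< rank E c
    rank-parent {(c , p) ∷ E} (grow G p∈ c∉) (here refl) with c Fin.≟ c
    ... | no c≢c = contradiction refl c≢c
    ... | yes _  = s≤s (subst (ℕ._≤ List.length E) (sym (rank-old {p = p} c∉ p∈)) (rank≤length E p))
    rank-parent {(c′ , p′) ∷ E} {c} {p} (grow G p∈ c∉) (there e) =
      let x , y = edge-vertices G e in
      subst (rank ((c′ , p′) ∷ E) p ℕ.<_) (sym (rank-old {p = p′} c∉ x))
        (subst (ℕ._< rank E c) (sym (rank-old {p = p′} c∉ y)) (rank-parent G e))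

    data Path (R : Rel (Fin m) 0ℓ) : Fin m → Fin m → List (Fin m) → Set where
      stop : ∀ {a} → Path R a a []
      step : ∀ {a b c xs} → R a b → a ∉ b ∷ xs → Path R b c xs → Path R a c (b ∷ xs)

    path-map : ∀ {R R′ : Rel (Fin m) 0ℓ} {a b xs} → (∀ {x y} → R x y → R′ x y) → Path R a b xs → Path R′ a b xs
    path-map f stop           = stop
    path-map f (step r a∉ π) = step (f r) a∉ (path-map f π)

    path-snoc : ∀ {R : Rel (Fin m) 0ℓ} {a b c xs} → Path R a b xs → R b c → c ∉ a ∷ xs → Path R a c (xs ++ c ∷ [])
    path-snoc stop r c∉ = step r (λ { (here a≡c) → c∉ (here (sym a≡c)) }) stop
    path-snoc {a = a} (step {b = b} {xs = xs} s a∉ π) r c∉ = step s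
      (λ a∈ → Sum.[ a∉ , (λ { (here a≡c) → c∉ (here (sym a≡c)) }) ] (∈-++⁻ (b ∷ xs) a∈))
      (path-snoc π r (λ c∈ → c∉ (there c∈)))

    -- The last component is needed by the induction: a path that stays among the older vertices
    -- cannot contain the newest one, so the latter may be added at an end.
    path : ∀ {E a b} → Grown E → a ∈ vertices E → b ∈ vertices E →
           Σ (List (Fin m)) λ xs → Path (Adjacent E) a b xs × (∀ {x} → x ∈ a ∷ xs → x ∈ vertices E)
    path start (here refl) (here refl) = [] , stop , λ x∈ → x∈
    path (grow G p∈ c∉) (here refl) (here refl) = [] , stop , λ { (here refl) → here refl }
    path (grow G p∈ c∉) (here refl) (there b∈) =
      let xs , π , inside = path G p∈ b∈ in
      _ ∷ xs , step (inj₁ (here refl)) (λ c∈ → c∉ (inside c∈)) (path-map (Sum.map there there) π) ,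
      λ { (here refl) → here refl ; (there x∈) → there (inside x∈) }
    path (grow {c = c} G p∈ c∉) (there a∈) (here refl) =
      let xs , π , inside = path G a∈ p∈ in
      xs ++ c ∷ [] , path-snoc (path-map (Sum.map there there) π) (inj₂ (here refl)) (λ c∈ → c∉ (inside c∈)) ,
      λ { (here refl) → there (inside (here refl))
        ; (there x∈) → Sum.[ (λ x∈ → there (inside (there x∈))) , (λ { (here refl) → here refl }) ] (∈-++⁻ xs x∈) }
    path (grow G p∈ c∉) (there a∈) (there b∈) =
      let xs , π , inside = path G a∈ b∈ in
      xs , path-map (Sum.map there there) π , λ x∈ → there (inside x∈)

    lastOf : ∀ {k} → Fin m → Vec (Fin m) k → Fin m
    lastOf x []       = x
    lastOf x (y ∷ ys) = lastOf y ys

    last≡lastOf : ∀ {k} x (ys : Vec (Fin m) k) → Vec.last (x ∷ ys) ≡ lastOf x ys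
    last≡lastOf x []       = refl
    last≡lastOf x (y ∷ ys) = last≡lastOf y ys

    module _ {R : Rel (Fin m) 0ℓ} where

      path-last : ∀ {a b xs} → Path R a b xs → lastOf a (Vec.fromList xs) ≡ b
      path-last stop          = refl
      path-last (step _ _ π) = path-last π

      ∉⇒All : ∀ {a : Fin m} xs → a ∉ xs → All (a ≢_) (Vec.fromList xs)
      ∉⇒All []       a∉ = []
      ∉⇒All (x ∷ xs) a∉ = (λ a≡x → a∉ (here a≡x)) ∷ ∉⇒All xs (λ a∈ → a∉ (there a∈))

      path-unique : ∀ {a b xs} → Path R a b xs → Unique (a ∷ Vec.fromList xs)
      path-unique stop                          = [] ∷ []
      path-unique (step {b = b} {xs = xs} _ a∉ π) = ∉⇒All (b ∷ xs) a∉ ∷ path-unique π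

      path-linked : ∀ {a b xs} → Path R a b xs → Linked R (a ∷ Vec.fromList xs)
      path-linked stop          = [-]
      path-linked (step r _ π) = r ∷ path-linked π

      path-closed : ∀ {a b xs z} → Path R a b xs → R b z →
                    All (λ e → R (proj₁ e) (proj₂ e)) (Vec.zip (a ∷ Vec.fromList xs) (Vec.fromList xs Vec.∷ʳ z))
      path-closed stop          s = s ∷ []
      path-closed (step r _ π) s = r ∷ path-closed π s

    unique⇒≤ : ∀ {n} {p : Vec (Fin m) n} → Unique p → n ℕ.≤ m
    unique⇒≤ u = Fin.injective⇒≤ (λ {i} {j} → lookup-injective u i j)

    module _ (_~_ : Rel (Fin m) 0ℓ) (_~?_ : Binary.Decidable _~_) where

      open Graph _~_ _~?_

      module _ {E : Edges} (grown : Grown E) (all : ∀ x → x ∈ vertices E)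
               (sound : ∀ {x y} → x ~ y → Adjacent E x y) (complete : ∀ {x y} → Adjacent E x y → x ~ y) where

        private

          connected : Connected
          connected a b = let xs , π , _ = path grown (all a) (all b) in
            witness (path-map complete π)
            where
            witness : ∀ {xs} → Path _~_ a b xs →
                      Σ (Fin m) λ n → ∃ λ (p : Vec (Fin m) (suc (toℕ n))) → IsPath a b p
            witness {xs} π = Fin.fromℕ< len , subst (λ n → ∃ λ (p : Vec (Fin m) (suc n)) → IsPath a b p)
              (sym (Fin.toℕ-fromℕ< len))
              (a ∷ Vec.fromList xs , refl , trans (last≡lastOf a (Vec.fromList xs)) (path-last π) , path-unique π , path-linked π)
              where
              len : List.length xs ℕ.< m
              len = unique⇒≤ (path-unique π)

          Closed : ∀ {k} → Fin m → Vec (Fin m) k → Fin m → Set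
          Closed y ys z = All (λ e → proj₁ e ~ proj₂ e) (Vec.zip (y ∷ ys) (ys Vec.∷ʳ z))

          -- A walk without backtracking that has once moved away from the root
          -- keeps moving away from it.
          away : ∀ {k} x y (ys : Vec (Fin m) k) z → (y , x) ∈ E → All (x ≢_) ys → Unique (y ∷ ys) →
                 All (z ≢_) (y ∷ ys) → (k ≡ 0 → x ≢ z) → Closed y ys z →
                 (z , lastOf y ys) ∈ E × rank E x ℕ.< rank E z
          away x y [] z e _ _ _ x≢z (r ∷ []) with sound r
          ... | inj₁ e′ = contradiction (unique-parent grown e e′) (x≢z refl)
          ... | inj₂ e′ = e′ , ℕ.<-trans (rank-parent grown e) (rank-parent grown e′)
          away x y (y′ ∷ ys) z e (x≢y′ ∷ _) ((_ ∷ y≢) ∷ u) (z≢y ∷ z≢) _ (r ∷ rs) with sound r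
          ... | inj₁ e′ = contradiction (unique-parent grown e e′) x≢y′
          ... | inj₂ e′ = let e″ , lt = away y y′ ys z e′ y≢ u z≢ (λ _ y≡z → z≢y (sym y≡z)) rs in
            e″ , ℕ.<-trans (rank-parent grown e) lt

          -- The counterpart of `away`: as the last step goes to a parent, no earlier step can go to
          -- a child, because `away` would then make the last step go to a child too.
          towards : ∀ {k} y (ys : Vec (Fin m) k) z → Unique (y ∷ ys) → All (z ≢_) (y ∷ ys) →
                    (lastOf y ys , z) ∈ E → Closed y ys z → rank E z ℕ.< rank E y
          towards y []        z u z≢ e rs = rank-parent grown e
          towards y (y′ ∷ ys) z ((_ ∷ y≢) ∷ u) (z≢y ∷ z≢) e (r ∷ rs) with sound r
          ... | inj₁ e′ = ℕ.<-trans (towards y′ ys z u z≢ e rs) (rank-parent grown e′)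
          ... | inj₂ e′ = ⊥-elim (ℕ.<-asym (rank-parent grown e)
            (rank-parent grown (proj₁ (away y y′ ys z e′ y≢ u z≢ (λ _ y≡z → z≢y (sym y≡z)) rs))))

          final : ∀ {k} y (ys : Vec (Fin m) k) z → Closed y ys z → lastOf y ys ~ z
          final y []        z (r ∷ [])  = r
          final y (y′ ∷ ys) z (_ ∷ rs) = final y′ ys z rs

          lastOf-≢ : ∀ {k x} y (ys : Vec (Fin m) k) → All (x ≢_) (y ∷ ys) → x ≢ lastOf y ys
          lastOf-≢ y []        (x≢y ∷ _) = x≢y
          lastOf-≢ y (y′ ∷ ys) (_ ∷ x≢) = lastOf-≢ y′ ys x≢

          -- A cycle that moves from `a` to a child comes back to `a` with a greater rank. If it
          -- moves to the parent of `a` instead, it returns either from a child, against the ranks,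
          -- or from the parent again, which then occurs twice.
          no-cycle : ∀ {n} (p : Vec (Fin m) n) → ¬ IsCycle p
          no-cycle (a ∷ b ∷ c ∷ ps) (_ , (a≢ ∷ (b≢ ∷ u)) , (r ∷ rs)) with sound r
          ... | inj₂ e = ℕ.<-irrefl refl (proj₂ (away a b (c ∷ ps) a e (All.tail a≢) (b≢ ∷ u) a≢ (λ ()) rs))
          ... | inj₁ e with sound (final b (c ∷ ps) a rs)
          ...   | inj₁ e′ = ℕ.<-asym (rank-parent grown e) (towards b (c ∷ ps) a (b≢ ∷ u) a≢ e′ rs)
          ...   | inj₂ e′ = lastOf-≢ c ps b≢ (unique-parent grown e e′)
          no-cycle []                (() , _)
          no-cycle (_ ∷ [])          (s≤s () , _)
          no-cycle (_ ∷ _ ∷ [])      (s≤s (s≤s ()) , _)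

        isTree : IsTree
        isTree = connected , (λ (_ , p , cycle) → no-cycle p cycle) ,
          λ (a , r) → Sum.[ irrefl , irrefl ] (sound r)
          where
          irrefl : ∀ {a} → (a , a) ∈ E → ⊥
          irrefl e = ℕ.<-irrefl refl (rank-parent grown e)

      -- The grown tree contains a simple path from `a` to `b`. If it has at least two edges, the
      -- edge from `b` back to `a` closes it to a cycle.
      tree-adjacent : ∀ {E a b} → Grown E → (∀ {x y} → x ~ y → y ~ x) → (∀ {x y} → Adjacent E x y → x ~ y) → IsTree →
                      a ∈ vertices E → b ∈ vertices E → a ~ b → Adjacent E a b
      tree-adjacent {E} {a} {b} grown symmetric complete (_ , acyclic , loopless) a∈ b∈ a~b
        with path grown a∈ b∈
      ... | _ , stop , _ = contradiction (a , a~b) loopless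
      ... | _ , step r _ stop , _ = r
      ... | x ∷ y ∷ xs , π@(step _ _ (step _ _ _)) , _ = contradiction cycle acyclic
        where
        p : Vec (Fin m) (suc (suc (suc (List.length xs))))
        p = a ∷ x ∷ y ∷ Vec.fromList xs
        len : suc (suc (suc (List.length xs))) ℕ.< suc m
        len = s≤s (unique⇒≤ (path-unique π))
        cycle : HasCycle
        cycle = Fin.fromℕ< len , subst (λ n → ∃ λ (p : Vec (Fin m) n) → IsCycle p) (sym (Fin.toℕ-fromℕ< len))
          (p , s≤s (s≤s (s≤s z≤n)) , path-unique π , path-closed (path-map complete π) (symmetric a~b))

-- Partial tree walks and the trees explored by them.

module TreeExploration where

  open import Data.List.Membership.Propositional using (_∈_; _∉_)
  open import Data.List.Membership.Propositional.Properties using (∈-++⁻; ∈-++⁺ˡ; ∈-++⁺ʳ; ∈-map⁻; ∈-map⁺)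
  open import Data.List.Relation.Unary.Any using (here; there)
  open import Data.List.Relation.Unary.All.Properties using (¬Any⇒All¬)
  open import Data.List.Relation.Unary.Unique.Propositional using () renaming (Unique to Uniqueᴸ)
  open import Data.List.Relation.Binary.Permutation.Propositional using
      (_↭_; ↭-refl; ↭-sym; ↭-trans; ↭-prep; ↭⇒↭ₛ; module PermutationReasoning)
  open import Data.List.Relation.Binary.Permutation.Propositional.Properties using (∈-resp-↭; ++⁺ˡ; ++⁺ʳ; shift; shifts)
  open import Data.Vec.Base as Vec using ([]; _∷_)
  open ≡ using (refl; sym; trans; cong; subst)
  open import Relation.Binary.PropositionalEquality.Properties using (setoid)
  open import Defs using (cyclicPairs; IsTreeWalk) renaming (_~_ to walkRelation; _~?_ to walkRelation?)
  open WalkSums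
  open GrowingTrees

  data Consecutive {A : Set} : List A → A → A → Set where
    now   : ∀ {x y zs} → Consecutive (x ∷ y ∷ zs) x y
    later : ∀ {x y z zs} → Consecutive zs x y → Consecutive (z ∷ zs) x y

  module _ {A : Set} where

    zip⇒consecutive : ∀ u (us : List A) z {x y} →
      (x , y) Vec.∈ Vec.zip (u ∷ Vec.fromList us) (Vec.fromList us Vec.∷ʳ z) → Consecutive (u ∷ us ++ z ∷ []) x y
    zip⇒consecutive u []        z (Anyⱽ.here refl) = now
    zip⇒consecutive u (u′ ∷ us) z (Anyⱽ.here refl) = now
    zip⇒consecutive u (u′ ∷ us) z (Anyⱽ.there e)   = later (zip⇒consecutive u′ us z e)

    consecutive⇒zip : ∀ u (us : List A) z {x y} → Consecutive (u ∷ us ++ z ∷ []) x y →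
      (x , y) Vec.∈ Vec.zip (u ∷ Vec.fromList us) (Vec.fromList us Vec.∷ʳ z)
    consecutive⇒zip u []        z now              = Anyⱽ.here refl
    consecutive⇒zip u []        z (later (later ()))
    consecutive⇒zip u (u′ ∷ us) z now              = Anyⱽ.here refl
    consecutive⇒zip u (u′ ∷ us) z (later c)        = Anyⱽ.there (consecutive⇒zip u′ us z c)

    consecutive-ʳ++ : ∀ (xs : List A) {ys x y} → Consecutive ys x y → Consecutive (xs ʳ++ ys) x y
    consecutive-ʳ++ []       c = c
    consecutive-ʳ++ (_ ∷ xs) c = consecutive-ʳ++ xs (later c)

    ʳ++-consecutive : ∀ a (xs : List A) {ys x y} → Consecutive ((a ∷ xs) ʳ++ ys) x y →
                      Consecutive (a ∷ xs) y x ⊎ Consecutive (a ∷ ys) x y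
    ʳ++-consecutive a []       c = inj₂ c
    ʳ++-consecutive a (b ∷ xs) c with ʳ++-consecutive b xs c
    ... | inj₁ d         = inj₁ (later d)
    ... | inj₂ now       = inj₁ now
    ... | inj₂ (later d) = inj₂ d

    Frames : Set
    Frames = List (A × List (Tree A))

    labels* : List (Tree A) → List A
    labels* []               = []
    labels* (node a ts ∷ us) = a ∷ labels* ts ++ labels* us

    -- The pairs are (child , parent).
    edges* : A → List (Tree A) → List (A × A)
    edges* a []               = []
    edges* a (node b ts ∷ us) = (b , a) ∷ edges* b ts ++ edges* a us

    labelsᶠ : Frames → List A
    labelsᶠ []              = []
    labelsᶠ ((p , ss) ∷ fs) = p ∷ labels* ss ++ labelsᶠ fs

    edgesᶠ : A → Frames → List (A × A)
    edgesᶠ a []              = []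
    edgesᶠ a ((p , ss) ∷ fs) = (a , p) ∷ edges* p ss ++ edgesᶠ p fs

    bottom : A → Frames → A
    bottom a []             = a
    bottom a ((p , _) ∷ fs) = bottom p fs

    -- The explored tree, seen from its vertex a with the subtrees ts below and
    -- the frames fs above.
    seen : A → List (Tree A) → Frames → List A
    seen a ts fs = a ∷ labels* ts ++ labelsᶠ fs

    explored : A → List (Tree A) → Frames → List (A × A)
    explored a ts fs = edges* a ts ++ edgesᶠ a fs

    open PermutationReasoning

    seen-up : ∀ a ts p ss fs → seen p (node a ts ∷ ss) fs ↭ seen a ts ((p , ss) ∷ fs)
    seen-up a ts p ss fs = begin
      p ∷ a ∷ (labels* ts ++ labels* ss) ++ labelsᶠ fs ≡⟨ cong (λ l → p ∷ a ∷ l) (List.++-assoc (labels* ts) _ _) ⟩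
      p ∷ a ∷ labels* ts ++ labels* ss ++ labelsᶠ fs   ↭⟨ shift p (a ∷ labels* ts) _ ⟨
      a ∷ labels* ts ++ p ∷ labels* ss ++ labelsᶠ fs   ∎

    explored-up : ∀ a ts p ss fs → explored p (node a ts ∷ ss) fs ↭ explored a ts ((p , ss) ∷ fs)
    explored-up a ts p ss fs = begin
      (a , p) ∷ (edges* a ts ++ edges* p ss) ++ edgesᶠ p fs ≡⟨ cong ((a , p) ∷_) (List.++-assoc (edges* a ts) _ _) ⟩
      (a , p) ∷ edges* a ts ++ edges* p ss ++ edgesᶠ p fs   ↭⟨ shift (a , p) (edges* a ts) _ ⟨
      edges* a ts ++ (a , p) ∷ edges* p ss ++ edgesᶠ p fs   ∎

    labels*-pick : ∀ ts {t us} → (t , us) ∈ picks ts → labels* ts ↭ labels* (t ∷ us)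
    labels*-pick (t ∷ ts)         (here refl) = ↭-refl
    labels*-pick (node a vs ∷ ts) (there x∈) with ∈-map⁻ _ x∈
    ... | (node c ws , us) , y∈ , refl = begin
      a ∷ labels* vs ++ labels* ts                     ↭⟨ ++⁺ˡ (a ∷ labels* vs) (labels*-pick ts y∈) ⟩
      a ∷ labels* vs ++ (c ∷ labels* ws) ++ labels* us ↭⟨ shifts (a ∷ labels* vs) (c ∷ labels* ws) ⟩
      c ∷ labels* ws ++ a ∷ labels* vs ++ labels* us   ∎

    edges*-pick : ∀ a ts {t us} → (t , us) ∈ picks ts → edges* a ts ↭ edges* a (t ∷ us)
    edges*-pick a (t ∷ ts)         (here refl) = ↭-refl
    edges*-pick a (node b vs ∷ ts) (there x∈) with ∈-map⁻ _ x∈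
    ... | (node c ws , us) , y∈ , refl = begin
      (b , a) ∷ edges* b vs ++ edges* a ts                          ↭⟨ ++⁺ˡ ((b , a) ∷ edges* b vs) (edges*-pick a ts y∈) ⟩
      (b , a) ∷ edges* b vs ++ ((c , a) ∷ edges* c ws) ++ edges* a us ↭⟨ shifts ((b , a) ∷ edges* b vs) ((c , a) ∷ edges* c ws) ⟩
      (c , a) ∷ edges* c ws ++ (b , a) ∷ edges* b vs ++ edges* a us ∎

    seen-down : ∀ a ts {c ws us} fs → (node c ws , us) ∈ picks ts → seen c ws ((a , us) ∷ fs) ↭ seen a ts fs
    seen-down a ts {c} {ws} {us} fs x∈ = begin
      seen c ws ((a , us) ∷ fs)          ↭⟨ seen-up c ws a us fs ⟨
      seen a (node c ws ∷ us) fs         ↭⟨ ↭-prep a (++⁺ʳ (labelsᶠ fs) (labels*-pick ts x∈)) ⟨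
      seen a ts fs                       ∎

    explored-down : ∀ a ts {c ws us} fs → (node c ws , us) ∈ picks ts → explored c ws ((a , us) ∷ fs) ↭ explored a ts fs
    explored-down a ts {c} {ws} {us} fs x∈ = begin
      explored c ws ((a , us) ∷ fs)      ↭⟨ explored-up c ws a us fs ⟨
      explored a (node c ws ∷ us) fs     ↭⟨ ++⁺ʳ (edgesᶠ a fs) (edges*-pick a ts x∈) ⟨
      explored a ts fs                   ∎

    edges*-vertex : ∀ b us {x y} → (x , y) ∈ edges* b us → y ∈ b ∷ labels* us
    edges*-vertex b (node c vs ∷ us) (here refl) = here refl
    edges*-vertex b (node c vs ∷ us) (there e) with ∈-++⁻ (edges* c vs) e
    ... | inj₁ e′ = there (∈-++⁺ˡ (edges*-vertex c vs e′))
    ... | inj₂ e′ with edges*-vertex b us e′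
    ...   | here refl = here refl
    ...   | there y∈  = there (there (∈-++⁺ʳ (labels* vs) y∈))

    edges*-parent : ∀ a ts {x y} → (x , y) ∈ edges* a ts → x ∈ List.map label ts ⊎ y ∈ labels* ts
    edges*-parent a (node b us ∷ ts) (here refl) = inj₁ (here refl)
    edges*-parent a (node b us ∷ ts) (there e) with ∈-++⁻ (edges* b us) e
    ... | inj₂ e′ = Sum.map there (λ y∈ → there (∈-++⁺ʳ (labels* us) y∈)) (edges*-parent a ts e′)
    ... | inj₁ e′ = inj₂ (∈-++⁺ˡ (edges*-vertex b us e′))

    edgesᶠ-parent : ∀ a fs {x y} → (x , y) ∈ edgesᶠ a fs → y ∈ labelsᶠ fs
    edgesᶠ-parent a ((p , ss) ∷ fs) (here refl) = here refl
    edgesᶠ-parent a ((p , ss) ∷ fs) (there e) with ∈-++⁻ (edges* p ss) e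
    ... | inj₂ e′ = there (∈-++⁺ʳ (labels* ss) (edgesᶠ-parent p fs e′))
    ... | inj₁ e′ = ∈-++⁺ˡ (edges*-vertex p ss e′)

    pick-label : ∀ (ts : List (Tree A)) {b} → b ∈ List.map label ts → ∃ λ x → x ∈ picks ts × label (proj₁ x) ≡ b
    pick-label (t ∷ ts) (here refl) = (t , ts) , here refl , refl
    pick-label (t ∷ ts) (there b∈)  = let x , x∈ , eq = pick-label ts b∈ in map₂ (t ∷_) x , there (∈-map⁺ _ x∈) , eq

  module _ {m : ℕ} where

    vertices-unique : ∀ {root : Fin m} {E} → GrownTrees.Grown root E → Uniqueᴸ (GrownTrees.vertices root E)
    vertices-unique GrownTrees.start             = Allᴸ.[] AllPairsᴸ.∷ AllPairsᴸ.[]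
    vertices-unique (GrownTrees.grow G p∈ c∉) = ¬Any⇒All¬ _ c∉ AllPairsᴸ.∷ vertices-unique G

    infix 4 _⊢_~_

    _⊢_~_ : List (Fin m) → Rel (Fin m) 0ℓ
    l ⊢ x ~ y = walkRelation (Vec.fromList l) x y

    TreeWalk : List (Fin m) → Set
    TreeWalk l = IsTreeWalk (Vec.fromList l)

    module Exploration (root : Fin m) where

      open GrownTrees root

      root-parentless : ∀ {E p} → Grown E → ¬ (root , p) ∈ E
      root-parentless (grow G p∈ c∉) (here refl) = c∉ (root∈ G)
        where
        root∈ : ∀ {E} → Grown E → root ∈ vertices E
        root∈ start         = here refl
        root∈ (grow G _ _) = there (root∈ G)
      root-parentless (grow G p∈ c∉) (there e)   = root-parentless G e

      -- The prefix of the walk is stored backwards, a being its last letter.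
      record Explored (prefix : List (Fin m)) (a : Fin m) (ts : List (Tree (Fin m))) (fs : Frames {Fin m}) : Set where
        field
          E        : Edges
          grown    : Grown E
          edges↭   : explored a ts fs ↭ E
          vertices↭ : seen a ts fs ↭ vertices E
          bottom≡  : bottom a fs ≡ root
          init     : List (Fin m)
          first    : prefix ≡ init ++ root ∷ []
          rest     : List (Fin m)
          last     : prefix ≡ a ∷ rest
          sound    : ∀ {x y} → Consecutive prefix x y → Adjacent E x y
          complete : ∀ {x y} → (x , y) ∈ E → ∀ w → prefix ʳ++ w ⊢ x ~ y
          visited  : ∀ {x} → x ∈ prefix → x ∈ vertices E
          visits   : ∀ {x} → x ∈ vertices E → x ∈ prefix

      ~-symmetric : ∀ l {x y} → l ⊢ x ~ y → l ⊢ y ~ x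
      ~-symmetric l = Sum.swap

      module _ {prefix a ts fs} (X : Explored prefix a ts fs) where

        open Explored X

        unrolled : ∀ w → prefix ʳ++ w ≡ root ∷ (init ʳ++ w)
        unrolled w rewrite first = List.++-ʳ++ init

        closed : ∀ w → root ∷ (init ʳ++ w) ++ root ∷ [] ≡ prefix ʳ++ (w ++ root ∷ [])
        closed w rewrite first = trans (cong (root ∷_) (sym (ʳ++-++ init))) (sym (List.++-ʳ++ init))
          where
          ʳ++-++ : ∀ xs {ys zs : List (Fin m)} → xs ʳ++ (ys ++ zs) ≡ (xs ʳ++ ys) ++ zs
          ʳ++-++ []       = refl
          ʳ++-++ (x ∷ xs) {ys} = ʳ++-++ xs {x ∷ ys}

        consecutive⇒~ : ∀ w {x y} → Consecutive (prefix ʳ++ (w ++ root ∷ [])) x y → prefix ʳ++ w ⊢ x ~ y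
        consecutive⇒~ w {x} {y} c = subst (_⊢ x ~ y) (sym (unrolled w))
          (inj₁ (consecutive⇒zip root (init ʳ++ w) root (subst (λ l → Consecutive l x y) (sym (closed w)) c)))

        ~⇒consecutive : ∀ w {x y} → prefix ʳ++ w ⊢ x ~ y →
          Consecutive (prefix ʳ++ (w ++ root ∷ [])) x y ⊎ Consecutive (prefix ʳ++ (w ++ root ∷ [])) y x
        ~⇒consecutive w {x} {y} r = Sum.map back back (subst (_⊢ x ~ y) (unrolled w) r)
          where
          back : ∀ {x y} → (x , y) Vec.∈ cyclicPairs (Vec.fromList (root ∷ (init ʳ++ w))) →
                 Consecutive (prefix ʳ++ (w ++ root ∷ [])) x y
          back {x} {y} e = subst (λ l → Consecutive l x y) (closed w) (zip⇒consecutive root (init ʳ++ w) root e)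

        next~ : ∀ b w → prefix ʳ++ (b ∷ w) ⊢ a ~ b
        next~ b w = consecutive⇒~ (b ∷ w)
          (subst (λ l → Consecutive (l ʳ++ (b ∷ w ++ root ∷ [])) a b) (sym last) (consecutive-ʳ++ rest now))

        adjacent⇒~ : ∀ w {x y} → Adjacent E x y → prefix ʳ++ w ⊢ x ~ y
        adjacent⇒~ w (inj₁ e) = complete e w
        adjacent⇒~ w (inj₂ e) = Sum.swap (complete e w)

        a∈ : a ∈ vertices E
        a∈ = visited (subst (a ∈_) (sym last) (here refl))

        -- A known vertex can only be entered along a known edge; all other known vertices therefore
        -- admit no completion.
        step-adjacent : ∀ {b w} → TreeWalk (prefix ʳ++ (b ∷ w)) → b ∈ vertices E → Adjacent E a b
        step-adjacent {b} {w} (_ , tree) b∈ = tree-adjacent _ (walkRelation? (Vec.fromList (prefix ʳ++ (b ∷ w)))) grown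
          (~-symmetric (prefix ʳ++ (b ∷ w))) (adjacent⇒~ (b ∷ w)) tree a∈ b∈ (next~ b w)

        seen-unique : Uniqueᴸ (seen a ts fs)
        seen-unique = Permutationₛ.Unique-resp-↭ (setoid _) (↭⇒↭ₛ (↭-sym vertices↭)) (vertices-unique grown)

        above : List (Fin m)
        above = List.map proj₁ (List.take 1 fs)

        parent-edge : ∀ {p ss fs′} → fs ≡ (p , ss) ∷ fs′ → (a , p) ∈ E
        parent-edge refl = ∈-resp-↭ edges↭ (∈-++⁺ʳ (edges* a ts) (here refl))

        -- The labels seen are distinct, so `a` is the parent in no edge except those to the roots
        -- of its explored subtrees; and its own parent is the label of the nearest frame.
        adjacent⇒neighbour : ∀ {b} → Adjacent E a b → b ∈ List.map label ts ++ above
        adjacent⇒neighbour {b} (inj₂ e) with ∈-++⁻ (edges* a ts) (∈-resp-↭ (↭-sym edges↭) e)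
        ... | inj₂ e′ = ⊥-elim (Allᴸ.lookup (AllPairsᴸ.head seen-unique) (∈-++⁺ʳ (labels* ts) (edgesᶠ-parent a fs e′)) refl)
        ... | inj₁ e′ with edges*-parent a ts e′
        ...   | inj₁ b∈ = ∈-++⁺ˡ b∈
        ...   | inj₂ a∈ = ⊥-elim (Allᴸ.lookup (AllPairsᴸ.head seen-unique) (∈-++⁺ˡ a∈) refl)
        adjacent⇒neighbour {b} (inj₁ e) = ∈-++⁺ʳ (List.map label ts) (go fs refl bottom≡)
          where
          go : ∀ gs → fs ≡ gs → bottom a gs ≡ root → b ∈ List.map proj₁ (List.take 1 gs)
          go []              eq refl = contradiction e (root-parentless grown)
          go ((p , ss) ∷ gs) eq _    = here (unique-parent grown e (parent-edge eq))

        ∈-ʳ++⁺ : ∀ (xs : List (Fin m)) {ys x} → x ∈ xs ⊎ x ∈ ys → x ∈ xs ʳ++ ys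
        ∈-ʳ++⁺ []       (inj₂ x∈)         = x∈
        ∈-ʳ++⁺ (_ ∷ xs) (inj₁ (here eq))  = ∈-ʳ++⁺ xs (inj₂ (here eq))
        ∈-ʳ++⁺ (_ ∷ xs) (inj₁ (there x∈)) = ∈-ʳ++⁺ xs (inj₁ x∈)
        ∈-ʳ++⁺ (_ ∷ xs) (inj₂ x∈)         = ∈-ʳ++⁺ xs (inj₂ (there x∈))

        ∈-ʳ++⁻ : ∀ (xs : List (Fin m)) {ys x} → x ∈ xs ʳ++ ys → x ∈ xs ⊎ x ∈ ys
        ∈-ʳ++⁻ []       x∈ = inj₂ x∈
        ∈-ʳ++⁻ (_ ∷ xs) x∈ with ∈-ʳ++⁻ xs x∈
        ... | inj₁ x∈′         = inj₁ (there x∈′)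
        ... | inj₂ (here eq)   = inj₁ (here eq)
        ... | inj₂ (there x∈′) = inj₂ x∈′

        -- The cyclic pair joins the last vertex to the root, so a complete walk stops at a child of
        -- the root. The return to the root is a step but not a letter, which is the source of the
        -- offset by one in the length conditions for completions.
        accept : List.length fs ≡ 1 → (∀ x → x ∈ vertices E) → TreeWalk (prefix ʳ++ [])
        accept one all = (λ x → Vec.∈-fromList⁺ (∈-ʳ++⁺ prefix (inj₁ (visits (all x))))) ,
          isTree _ (walkRelation? (Vec.fromList (prefix ʳ++ []))) grown all
            (λ r → Sum.[ adjacent , (λ c → Sum.swap (adjacent c)) ] (~⇒consecutive [] r)) (adjacent⇒~ [])
          where
          a-root : (a , root) ∈ E
          a-root = go fs refl bottom≡ one
            where
            go : ∀ gs → fs ≡ gs → bottom a gs ≡ root → List.length gs ≡ 1 → (a , root) ∈ E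
            go (_ ∷ []) eq refl refl = parent-edge eq
          adjacent : ∀ {x y} → Consecutive (prefix ʳ++ root ∷ []) x y → Adjacent E x y
          adjacent {x} {y} c
            with ʳ++-consecutive a rest (subst (λ l → Consecutive (l ʳ++ root ∷ []) x y) last c)
          ... | inj₁ d                 = Sum.swap (sound (subst (λ l → Consecutive l y x) (sym last) d))
          ... | inj₂ now               = inj₁ a-root
          ... | inj₂ (later (later ()))

        -- The closing pair has to be a known edge. The root has no parent, so the edge leads from
        -- `a` up to the root; with a second frame the root would acquire a parent.
        accepted : TreeWalk (prefix ʳ++ []) → List.length fs ≡ 1 × (∀ x → x ∈ vertices E)
        accepted (all , tree) = one (tree-adjacent _ (walkRelation? (Vec.fromList (prefix ʳ++ []))) grown
            (~-symmetric (prefix ʳ++ [])) (adjacent⇒~ []) tree a∈ (visited root∈) a~root) ,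
          λ x → visited (Sum.[ (λ x∈ → x∈) , (λ ()) ] (∈-ʳ++⁻ prefix (Vec.∈-fromList⁻ (all x))))
          where
          root∈ : root ∈ prefix
          root∈ = subst (root ∈_) (sym first) (∈-++⁺ʳ init (here refl))
          a~root : prefix ʳ++ [] ⊢ a ~ root
          a~root = consecutive⇒~ []
            (subst (λ l → Consecutive (l ʳ++ root ∷ []) a root) (sym last) (consecutive-ʳ++ rest now))
          one : Adjacent E a root → List.length fs ≡ 1
          one (inj₂ e) = contradiction e (root-parentless grown)
          one (inj₁ e) = go fs refl bottom≡
            where
            go : ∀ gs → fs ≡ gs → bottom a gs ≡ root → List.length gs ≡ 1
            go []                           eq refl = contradiction e (root-parentless grown)
            go (_ ∷ [])                     eq _    = refl
            go ((p , ss) ∷ (p′ , ss′) ∷ gs) eq _    =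
              contradiction (subst (λ x → (x , p′) ∈ E) (unique-parent grown (parent-edge eq) e) (grandparent eq)) (root-parentless grown)
              where
              grandparent : fs ≡ (p , ss) ∷ (p′ , ss′) ∷ gs → (p , p′) ∈ E
              grandparent refl = ∈-resp-↭ edges↭ (∈-++⁺ʳ (edges* a ts) (there (∈-++⁺ʳ (edges* p ss) (here refl))))

        first-step : ∀ {b l x y} → l ≡ a ∷ rest → Consecutive (b ∷ l) x y → (x ≡ b × y ≡ a) ⊎ Consecutive l x y
        first-step refl now       = inj₁ (refl , refl)
        first-step refl (later c) = inj₂ c

        adjacent-vertex : ∀ {b} → Adjacent E a b → b ∈ vertices E
        adjacent-vertex (inj₁ e) = proj₂ (edge-vertices grown e)
        adjacent-vertex (inj₂ e) = proj₁ (edge-vertices grown e)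

        -- Moving along a known edge changes only the vertex from which the explored tree is viewed,
        -- so `E` is kept and the two views agree up to a permutation.
        revisit : ∀ {b us gs} → Adjacent E a b → explored b us gs ↭ explored a ts fs → seen b us gs ↭ seen a ts fs →
                  bottom b gs ≡ root → Explored (b ∷ prefix) b us gs
        revisit {b} adj es↭ vs↭ bot = record
          { E = E ; grown = grown ; edges↭ = ↭-trans es↭ edges↭ ; vertices↭ = ↭-trans vs↭ vertices↭ ; bottom≡ = bot
          ; init = b ∷ init ; first = cong (b ∷_) first ; rest = prefix ; last = refl
          ; sound = λ c → Sum.[ (λ { (refl , refl) → Sum.swap adj }) , sound ] (first-step last c)
          ; complete = λ e w → complete e (b ∷ w)
          ; visited = λ { (here refl) → adjacent-vertex adj
                        ; (there x∈) → visited x∈ }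
          ; visits = λ x∈ → there (visits x∈) }

        discover : ∀ {b} → b ∉ vertices E → Explored (b ∷ prefix) b [] ((a , ts) ∷ fs)
        discover {b} b∉ = record
          { E = (b , a) ∷ E ; grown = grow grown a∈ b∉ ; edges↭ = ↭-prep _ edges↭ ; vertices↭ = ↭-prep _ vertices↭
          ; bottom≡ = bottom≡ ; init = b ∷ init ; first = cong (b ∷_) first ; rest = prefix ; last = refl
          ; sound = λ c → Sum.[ (λ { (refl , refl) → inj₁ (here refl) }) , (λ d → Sum.map there there (sound d)) ] (first-step last c)
          ; complete = λ { (here refl) w → Sum.swap (next~ b w) ; (there e) w → complete e (b ∷ w) }
          ; visited = λ { (here refl) → here refl ; (there x∈) → there (visited x∈) }
          ; visits = λ { (here refl) → here refl ; (there x∈) → there (visits x∈) } }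

        child-adjacent : ∀ {t us} → (t , us) ∈ picks ts → Adjacent E a (label t)
        child-adjacent {node c ws} x∈ = inj₂ (∈-resp-↭ edges↭ (∈-++⁺ˡ (∈-resp-↭ (↭-sym (edges*-pick a ts x∈)) (here refl))))

        descend : ∀ {t us} → (t , us) ∈ picks ts → Explored (label t ∷ prefix) (label t) (children t) ((a , us) ∷ fs)
        descend {node c ws} {us} x∈ = revisit (child-adjacent x∈)
          (explored-down a ts fs x∈) (seen-down a ts fs x∈) bottom≡

      retreat : ∀ {prefix a ts p ss fs} → Explored prefix a ts ((p , ss) ∷ fs) → Explored (p ∷ prefix) p (node a ts ∷ ss) fs
      retreat {a = a} {ts} {p} {ss} {fs} X = revisit X (inj₁ (parent-edge X refl))
        (explored-up a ts p ss fs) (seen-up a ts p ss fs) (Explored.bottom≡ X)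

      begin-walk : Explored (root ∷ []) root [] []
      begin-walk = record
        { E = [] ; grown = start ; edges↭ = ↭-refl ; vertices↭ = ↭-refl ; bottom≡ = refl
        ; init = [] ; first = refl ; rest = [] ; last = refl
        ; sound = λ { (later ()) } ; complete = λ () ; visited = λ x∈ → x∈ ; visits = λ x∈ → x∈ }

-- Counting the completions of a partial walk.

module WalkCounting where

  open import Data.Nat.ListAction using (sum)
  open import Data.List.Membership.Propositional using (_∈_; _∉_)
  open import Data.List.Membership.Propositional.Properties using (∈-++⁻; ∈-++⁺ˡ; ∈-++⁺ʳ; ∈-filter⁺; ∈-filter⁻; ∈-allFin)
  open import Data.List.Membership.Propositional.Properties.WithK using (unique∧set⇒bag)
  open import Data.List.Relation.Unary.Any using (here; there)
  open import Data.List.Relation.Unary.All as Allᴸ using ([]; _∷_)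
  open import Data.List.Relation.Unary.AllPairs as AllPairsᴸ using ([]; _∷_)
  open import Data.List.Relation.Unary.Unique.Propositional using () renaming (Unique to Uniqueᴸ)
  open import Data.List.Relation.Unary.Unique.Propositional.Properties using (allFin⁺) renaming (filter⁺ to unique-filter; ++⁺ to unique-++)
  open import Data.List.Relation.Binary.BagAndSetEquality using (∼bag⇒↭)
  open import Data.List.Relation.Binary.Permutation.Propositional using (_↭_; prep; swap) renaming (refl to ↭-refl′; trans to ↭-trans′)
  open import Data.List.Relation.Binary.Permutation.Propositional.Properties using (↭-length)
  open import Data.List.Relation.Binary.Sublist.Propositional as Sublist using (_⊆_; []; _∷_; _∷ʳ_)
  open import Data.List.Relation.Binary.Sublist.Propositional.Properties using (All-resp-⊆) renaming (++⁺ to ⊆-++⁺; ++⁺ˡ to ⊆-++⁺ˡ)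
  open import Function.Bundles using (mk⇔)
  open import Relation.Unary using (Pred; Decidable)
  open ≡ using (cong; cong₂; subst)
  open import Data.Vec.Base as Vec using (Vec; []; _∷_)
  open import Defs using (isTreeWalk?; sequences; w)
  open WalkSums
  open GrowingTrees
  open TreeExploration

  module _ {A : Set} where

    unique-⊆ : ∀ {xs ys : List A} → xs ⊆ ys → Uniqueᴸ ys → Uniqueᴸ xs
    unique-⊆ []             []       = []
    unique-⊆ (y ∷ʳ τ)       (_ ∷ u)  = unique-⊆ τ u
    unique-⊆ (≡.refl ∷ τ)   (x≢ ∷ u) = All-resp-⊆ τ x≢ ∷ unique-⊆ τ u

    roots⊆labels : ∀ (ts : List (Tree A)) → List.map label ts ⊆ labels* ts
    roots⊆labels []               = []
    roots⊆labels (node a us ∷ ts) = ≡.refl ∷ ⊆-++⁺ˡ (labels* us) (roots⊆labels ts)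

    map-picks : ∀ {B : Set} (f : Tree A → B) ts → List.map (λ x → f (proj₁ x)) (picks ts) ≡ List.map f ts
    map-picks f []       = ≡.refl
    map-picks f (t ∷ ts) = cong (f t ∷_) (≡.trans (≡.sym (List.map-∘ (picks ts))) (map-picks f ts))

  module _ {m : ℕ} where

    words : ℕ → List (List (Fin m))
    words zero    = [] ∷ []
    words (suc r) = List.cartesianProductWith _∷_ (List.allFin m) (words r)

    opaque

      count : ∀ {P : Pred (List (Fin m)) 0ℓ} → Decidable P → ℕ → ℕ
      count P? r = List.length (List.filter P? (words r))

      length-filter-map : ∀ {P : Pred (List (Fin m)) 0ℓ} (P? : Decidable P) b ws →
                          List.length (List.filter P? (List.map (b ∷_) ws)) ≡
                          List.length (List.filter (λ w → P? (b ∷ w)) ws)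
      length-filter-map P? b []       = ≡.refl
      length-filter-map P? b (w ∷ ws) with P? (b ∷ w)
      ... | yes _ = cong suc (length-filter-map P? b ws)
      ... | no  _ = length-filter-map P? b ws

      count-suc : ∀ {P : Pred (List (Fin m)) 0ℓ} (P? : Decidable P) r →
                  count P? (suc r) ≡ sum (List.map (λ b → count (λ w → P? (b ∷ w)) r) (List.allFin m))
      count-suc P? r = go (List.allFin m)
        where
        go : ∀ bs → List.length (List.filter P? (List.cartesianProductWith _∷_ bs (words r))) ≡
                    sum (List.map (λ b → count (λ w → P? (b ∷ w)) r) bs)
        go []       = ≡.refl
        go (b ∷ bs) = ≡.trans (cong List.length (List.filter-++ P? (List.map (b ∷_) (words r)) _))
          (≡.trans (List.length-++ (List.filter P? (List.map (b ∷_) (words r))))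
            (cong₂ ℕ._+_ (length-filter-map P? b (words r)) (go bs)))

      count-none : ∀ {P : Pred (List (Fin m)) 0ℓ} (P? : Decidable P) → (∀ w → ¬ P w) → ∀ r → count P? r ≡ 0
      count-none P? none r = cong List.length (List.filter-none P? (Allᴸ.universal none (words r)))

      count-one : ∀ {P : Pred (List (Fin m)) 0ℓ} (P? : Decidable P) → P [] → count P? 0 ≡ 1
      count-one P? p = cong List.length (List.filter-all P? (p ∷ []))

      count-zero : ∀ {P : Pred (List (Fin m)) 0ℓ} (P? : Decidable P) → ¬ P [] → count P? 0 ≡ 0
      count-zero P? ¬p = cong List.length (List.filter-none P? (¬p ∷ []))

    opaque

      treeWalk? : Decidable (TreeWalk {m})
      treeWalk? l = isTreeWalk? (Vec.fromList l)

  module Embedding (R : CommutativeRing 0ℓ 0ℓ) where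

    open CommutativeRing R
    open Sums R

    ι : ℕ → Carrier
    ι zero    = 0#
    ι (suc n) = 1# + ι n

    ι-+ : ∀ m n → ι (m ℕ.+ n) ≈ ι m + ι n
    ι-+ zero    n = sym (+-identityˡ _)
    ι-+ (suc m) n = trans (+-cong refl (ι-+ m n)) (sym (+-assoc _ _ _))

    ι-* : ∀ m n → ι (m ℕ.* n) ≈ ι m * ι n
    ι-* zero    n = sym (zeroˡ _)
    ι-* (suc m) n = trans (ι-+ n (m ℕ.* n)) (trans (+-cong (sym (*-identityˡ _)) (ι-* m n)) (sym (distribʳ _ _ _)))

    ι-sum : ∀ {X : Set} (h : X → ℕ) xs → ι (sum (List.map h xs)) ≈ sumOver (λ x → ι (h x)) xs
    ι-sum h []       = refl
    ι-sum h (x ∷ xs) = trans (ι-+ (h x) _) (+-cong refl (ι-sum h xs))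

    sumOver-cong∈ : ∀ {X : Set} {f g : X → Carrier} xs → (∀ x → x ∈ xs → f x ≈ g x) → sumOver f xs ≈ sumOver g xs
    sumOver-cong∈ []       eq = refl
    sumOver-cong∈ (x ∷ xs) eq = +-cong (eq x (here ≡.refl)) (sumOver-cong∈ xs (λ y y∈ → eq y (there y∈)))

    sumOver-zero : ∀ {X : Set} {f : X → Carrier} xs → (∀ x → x ∈ xs → f x ≈ 0#) → sumOver f xs ≈ 0#
    sumOver-zero []       eq = refl
    sumOver-zero (x ∷ xs) eq = trans (+-cong (eq x (here ≡.refl)) (sumOver-zero xs (λ y y∈ → eq y (there y∈)))) (+-identityˡ _)

    sumOver-const : ∀ {X : Set} c (xs : List X) → sumOver (λ _ → c) xs ≈ ι (List.length xs) * c
    sumOver-const c []       = sym (zeroˡ c)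
    sumOver-const c (x ∷ xs) = trans (+-cong (sym (*-identityˡ c)) (sumOver-const c xs)) (sym (distribʳ _ _ _))

    sumOver-*ˡ : ∀ {X : Set} c (f : X → Carrier) xs → sumOver (λ x → c * f x) xs ≈ c * sumOver f xs
    sumOver-*ˡ c f []       = sym (zeroʳ c)
    sumOver-*ˡ c f (x ∷ xs) = trans (+-cong refl (sumOver-*ˡ c f xs)) (sym (distribˡ _ _ _))

    sumOver-++ : ∀ {X : Set} (f : X → Carrier) xs ys → sumOver f (xs ++ ys) ≈ sumOver f xs + sumOver f ys
    sumOver-++ f []       ys = sym (+-identityˡ _)
    sumOver-++ f (x ∷ xs) ys = trans (+-cong refl (sumOver-++ f xs ys)) (sym (+-assoc _ _ _))

    sumOver-↭ : ∀ {X : Set} (f : X → Carrier) {xs ys} → xs ↭ ys → sumOver f xs ≈ sumOver f ys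
    sumOver-↭ f ↭-refl′        = refl
    sumOver-↭ f (prep x p)     = +-cong refl (sumOver-↭ f p)
    sumOver-↭ f (swap x y p)   = trans (+-cong refl (+-cong refl (sumOver-↭ f p)))
      (trans (sym (+-assoc _ _ _)) (trans (+-cong (+-comm _ _) refl) (+-assoc _ _ _)))
    sumOver-↭ f (↭-trans′ p q) = trans (sumOver-↭ f p) (sumOver-↭ f q)

  module _ {m : ℕ} where

    open Membership (Fin._≟_ {m}) using (_∈?_)

    outside : List (Fin m) → List (Fin m)
    outside xs = List.filter (λ x → ¬? (x ∈? xs)) (List.allFin m)

    outside-unique : ∀ xs → Uniqueᴸ (outside xs)
    outside-unique xs = unique-filter (λ x → ¬? (x ∈? xs)) (allFin⁺ m)

    ∈-outside⁺ : ∀ {xs x} → x ∉ xs → x ∈ outside xs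
    ∈-outside⁺ {xs} {x} x∉ = ∈-filter⁺ (λ x → ¬? (x ∈? xs)) (∈-allFin x) x∉

    ∈-outside⁻ : ∀ {xs x} → x ∈ outside xs → x ∉ xs
    ∈-outside⁻ {xs} x∈ = proj₂ (∈-filter⁻ (λ x → ¬? (x ∈? xs)) {xs = List.allFin m} x∈)

    allFin-split : ∀ {xs} → Uniqueᴸ xs → List.allFin m ↭ xs ++ outside xs
    allFin-split {xs} u = ∼bag⇒↭ (unique∧set⇒bag (allFin⁺ m)
      (unique-++ u (outside-unique xs) (λ (x∈ , x∈′) → ∈-outside⁻ x∈′ x∈))
      (λ {x} → mk⇔ (λ _ → split x) (λ _ → ∈-allFin x)))
      where
      split : ∀ x → x ∈ xs ++ outside xs
      split x with x ∈? xs
      ... | yes x∈ = ∈-++⁺ˡ x∈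
      ... | no x∉  = ∈-++⁺ʳ xs (∈-outside⁺ x∉)

    length-outside : ∀ {xs} → Uniqueᴸ xs → List.length xs ℕ.+ List.length (outside xs) ≡ m
    length-outside {xs} u = ≡.trans (≡.sym (List.length-++ xs))
      (≡.trans (≡.sym (↭-length (allFin-split u))) (List.length-tabulate {n = m} (λ x → x)))

  -- The count is compared with any `V` obeying the step equation. In `V ts fs n e` there are `n`
  -- vertices left to discover and `e` descents into known subtrees left to make.
  module Tally (R : CommutativeRing 0ℓ 0ℓ) {m : ℕ} (N : ℕ)
               (V : List (Tree (Fin m)) → Frames {Fin m} → ℕ → ℕ → CommutativeRing.Carrier R) where

    open CommutativeRing R
    open Sums R
    open Embedding R
    open import Relation.Binary.Reasoning.Setoid setoid

    backward : Fin m → List (Tree (Fin m)) → Frames {Fin m} → ℕ → ℕ → Carrier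
    backward a ts []              zero    zero    = 1#
    backward a ts []              zero    (suc e) = 0#
    backward a ts []              (suc n) e       = 0#
    backward a ts ((p , ss) ∷ fs) n       e       = V (node a ts ∷ ss) fs n e

    discovery : Fin m → List (Tree (Fin m)) → Frames {Fin m} → ℕ → ℕ → Carrier
    discovery a ts fs zero    e = 0#
    discovery a ts fs (suc n) e = V [] ((a , ts) ∷ fs) n e

    revisiting : Fin m → Frames {Fin m} → ℕ → ℕ → Tree (Fin m) × List (Tree (Fin m)) → Carrier
    revisiting a fs n zero    x        = 0#
    revisiting a fs n (suc e) (t , us) = V (children t) ((a , us) ∷ fs) n e

    module _ (V-step : ∀ a ts fs n e → e ℕ.< N → V ts fs n e ≈
                backward a ts fs n e + (discovery a ts fs n e + sumOver (revisiting a fs n e) (picks ts)))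
             (root : Fin m) where

      open GrownTrees root
      open Exploration root

      completions : List (Fin m) → ℕ → ℕ
      completions prefix = count (λ w → treeWalk? (prefix ʳ++ w))

      module _ {prefix a ts fs} (X : Explored prefix a ts fs) where

        open Explored X

        neighbours : List (Fin m)
        neighbours = List.map label ts ++ above X

        neighbours-unique : Uniqueᴸ neighbours
        neighbours-unique = unique-⊆ (⊆-++⁺ (roots⊆labels ts) (parent fs)) (AllPairsᴸ.tail (seen-unique X))
          where
          parent : ∀ gs → List.map proj₁ (List.take 1 gs) ⊆ labelsᶠ gs
          parent []             = []
          parent ((p , ss) ∷ gs) = ≡.refl ∷ Sublist.minimum _

        neighbour∈ : ∀ {b} → b ∈ neighbours → b ∈ vertices E
        neighbour∈ b∈ with ∈-++⁻ (List.map label ts) b∈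
        ... | inj₂ b∈fs = go fs ≡.refl b∈fs
          where
          go : ∀ gs → fs ≡ gs → _ ∈ List.map proj₁ (List.take 1 gs) → _ ∈ vertices E
          go (_ ∷ _) eq (here ≡.refl) = proj₂ (edge-vertices grown (parent-edge X eq))
        ... | inj₁ b∈ts with pick-label ts b∈ts
        ...   | (node c us , vs) , x∈ , ≡.refl = adjacent-vertex X (child-adjacent X x∈)

        -- The next letter is an explored child, the parent, or an unseen vertex. Any other known
        -- vertex would be entered along an edge outside the explored tree and contributes 0.
        total : ∀ r → ι (completions prefix (suc r)) ≈
          (sumOver (λ x → ι (completions (label (proj₁ x) ∷ prefix) r)) (picks ts) +
           sumOver (λ b → ι (completions (b ∷ prefix) r)) (above X)) +
          sumOver (λ b → ι (completions (b ∷ prefix) r)) (outside (vertices E))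
        total r = begin
          ι (completions prefix (suc r))
            ≈⟨ reflexive (cong ι (count-suc (λ w → treeWalk? (prefix ʳ++ w)) r)) ⟩
          ι (sum (List.map (λ b → completions (b ∷ prefix) r) (List.allFin m)))
            ≈⟨ ι-sum _ (List.allFin m) ⟩
          sumOver h (List.allFin m)
            ≈⟨ sumOver-↭ h (allFin-split support-unique) ⟩
          sumOver h (support ++ outside support)
            ≈⟨ trans (sumOver-++ h support _) (trans (+-cong refl (sumOver-zero (outside support) vanish)) (+-identityʳ _)) ⟩
          sumOver h support
            ≈⟨ trans (sumOver-++ h neighbours _) (+-cong (trans (sumOver-++ h (List.map label ts) _) (+-cong roots refl)) refl) ⟩
          (sumOver (λ x → h (label (proj₁ x))) (picks ts) + sumOver h (above X)) + sumOver h (outside (vertices E)) ∎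
          where
          h : Fin m → Carrier
          h b = ι (completions (b ∷ prefix) r)
          support : List (Fin m)
          support = neighbours ++ outside (vertices E)
          support-unique : Uniqueᴸ support
          support-unique = unique-++ neighbours-unique (outside-unique (vertices E))
            (λ (b∈ , b∈′) → ∈-outside⁻ b∈′ (neighbour∈ b∈))
          open Membership (Fin._≟_ {m}) using (_∈?_)
          vanish : ∀ b → b ∈ outside support → h b ≈ 0#
          vanish b b∈ with b ∈? vertices E
          ... | no b∉   = contradiction (∈-++⁺ʳ neighbours (∈-outside⁺ b∉)) (∈-outside⁻ b∈)
          ... | yes b∈E = reflexive (cong ι (count-none (λ w → treeWalk? (prefix ʳ++ (b ∷ w)))
            (λ w tw → ∈-outside⁻ b∈ (∈-++⁺ˡ (adjacent⇒neighbour X (step-adjacent X tw b∈E)))) r))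
          roots : sumOver h (List.map label ts) ≈ sumOver (λ x → h (label (proj₁ x))) (picks ts)
          roots = trans (reflexive (cong (sumOver h) (≡.sym (map-picks label ts))))
            (sumOver-map h (λ x → label (proj₁ x)) (picks ts))

        unseen : ∀ {n} → List.length (vertices E) ℕ.+ n ≡ m → List.length (outside (vertices E)) ≡ n
        unseen {n} eq = ℕ.+-cancelˡ-≡ (List.length (vertices E)) _ n
          (≡.trans (length-outside (vertices-unique grown)) (≡.sym eq))

        all-seen : List.length (vertices E) ℕ.+ 0 ≡ m → ∀ x → x ∈ vertices E
        all-seen eq x with unseen eq | x ∈? vertices E
          where open Membership (Fin._≟_ {m}) using (_∈?_)
        ... | _     | yes x∈ = x∈
        ... | empty | no x∉  with outside (vertices E) | ∈-outside⁺ x∉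
        ...   | [] | ()

        nothing-unseen : (∀ x → x ∈ vertices E) → ∀ {n} → List.length (vertices E) ℕ.+ n ≡ m → n ≡ 0
        nothing-unseen all {n} eq = go (outside (vertices E)) ≡.refl (unseen eq)
          where
          go : ∀ xs → outside (vertices E) ≡ xs → List.length xs ≡ n → n ≡ 0
          go []      _    len = ≡.sym len
          go (x ∷ _) out≡ _   = contradiction (all x) (∈-outside⁻ {xs = vertices E} (subst (x ∈_) (≡.sym out≡) (here ≡.refl)))

      grow-length : ∀ {l n} → l ℕ.+ suc n ≡ m → suc l ℕ.+ n ≡ m
      grow-length {l} {n} eq = ≡.trans (≡.sym (ℕ.+-suc l n)) eq

      -- Each undiscovered vertex costs a step down and a step up, and each frame one step up. The
      -- final return to the root is not a letter, whence the successor of `r`.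
      too-short : ∀ r {prefix a ts fs n} (X : Explored prefix a ts fs) → List.length (vertices (Explored.E X)) ℕ.+ n ≡ m →
                  suc r ℕ.< 2 ℕ.* n ℕ.+ List.length fs → ι (completions prefix r) ≈ 0#
      too-short zero {prefix} {fs = fs} {n} X eq lt =
        reflexive (cong ι (count-zero (λ w → treeWalk? (prefix ʳ++ w)) none))
        where
        none : ¬ TreeWalk (prefix ʳ++ [])
        none tw with accepted X tw
        ... | one , all with nothing-unseen X all eq
        ...   | ≡.refl = ℕ.<-irrefl (≡.sym one) lt
      too-short (suc r) {prefix} {a} {ts} {fs} {n} X eq lt = trans (total X r)
        (trans (+-cong (trans (+-cong old (back fs ≡.refl)) (+-identityˡ _)) (new n ≡.refl)) (+-identityˡ _))
        where
        old : sumOver (λ x → ι (completions (label (proj₁ x) ∷ prefix) r)) (picks ts) ≈ 0#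
        old = sumOver-zero (picks ts) λ { (node _ _ , _) x∈ → too-short r {n = n} (descend X x∈) eq
          (ℕ.<-trans (ℕ.n<1+n _) (ℕ.<-trans lt (ℕ.≤-reflexive (≡.sym (ℕ.+-suc (2 ℕ.* n) _))))) }
        back : ∀ gs → fs ≡ gs → sumOver (λ b → ι (completions (b ∷ prefix) r)) (List.map proj₁ (List.take 1 gs)) ≈ 0#
        back []              _      = refl
        back ((p , ss) ∷ gs) ≡.refl = trans (+-identityʳ _) (too-short r {n = n} (retreat X) eq
          (ℕ.s<s⁻¹ (subst (suc (suc r) ℕ.<_) (ℕ.+-suc (2 ℕ.* n) _) lt)))
        new : ∀ k → n ≡ k → sumOver (λ b → ι (completions (b ∷ prefix) r)) (outside (vertices (Explored.E X))) ≈ 0#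
        new zero    ≡.refl with outside (vertices (Explored.E X)) | unseen X eq
        ... | [] | _ = refl
        new (suc k) ≡.refl = sumOver-zero (outside _) λ b b∈ → too-short r {n = k}
            (discover X (∈-outside⁻ {xs = vertices (Explored.E X)} b∈)) (grow-length eq)
          (ℕ.s<s⁻¹ (subst (suc (suc r) ℕ.<_) (≡.trans (cong (ℕ._+ List.length fs) (ℕ.*-suc 2 k))
            (cong suc (≡.sym (ℕ.+-suc (2 ℕ.* k) _)))) lt))

      even+ : ∀ i j l → 1 ≢ suc j ℕ.+ suc i ℕ.+ l
      even+ i j l eq rewrite ℕ.+-suc j i with eq
      ... | ()

      -- New vertices and repeated descents cost two steps each, frames one. The factor `n !` counts
      -- the orders in which the unseen labels can be discovered, since `V` does not distinguish
      -- them.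
      tally : ∀ r {prefix a ts fs} n e (X : Explored prefix a ts fs) → List.length (vertices (Explored.E X)) ℕ.+ n ≡ m →
              e ℕ.< N → suc r ≡ 2 ℕ.* (n ℕ.+ e) ℕ.+ List.length fs → ι (completions prefix r) ≈ ι (n !) * V ts fs n e
      tally zero {prefix} {a} {ts} {(p , ss) ∷ []} zero zero X eq e<N len = begin
        ι (completions prefix 0)
          ≈⟨ reflexive (cong ι (count-one (λ w → treeWalk? (prefix ʳ++ w)) (accept X ≡.refl (all-seen X eq)))) ⟩
        ι 1
          ≈⟨ trans (sym (*-identityʳ _)) (*-cong refl (sym one)) ⟩
        ι 1 * V ts ((p , ss) ∷ []) 0 0 ∎
        where
        done : ∀ a ts fs → discovery a ts fs 0 0 + sumOver (revisiting a fs 0 0) (picks ts) ≈ 0#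
        done a ts fs = trans (+-identityˡ _) (sumOver-zero (picks ts) (λ _ _ → refl))
        one : V ts ((p , ss) ∷ []) 0 0 ≈ 1#
        one = trans (V-step a ts ((p , ss) ∷ []) 0 0 e<N) (trans (+-cong
          (trans (V-step p (node a ts ∷ ss) [] 0 0 e<N) (trans (+-cong refl (done p (node a ts ∷ ss) [])) (+-identityʳ 1#)))
          (done a ts ((p , ss) ∷ []))) (+-identityʳ 1#))
      tally zero {fs = []}        zero zero X eq e<N ()
      tally zero {fs = _ ∷ _ ∷ _} zero zero X eq e<N ()
      tally zero {fs = fs} zero    (suc e) X eq e<N len = contradiction len (even+ (e ℕ.+ 0) e (List.length fs))
      tally zero {fs = fs} (suc n) e       X eq e<N len = contradiction len (even+ (n ℕ.+ e ℕ.+ 0) (n ℕ.+ e) (List.length fs))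
      tally (suc r) {prefix} {a} {ts} {fs} n e X eq e<N len = begin
        ι (completions prefix (suc r))
          ≈⟨ total X r ⟩
        (sumOver (λ x → ι (completions (label (proj₁ x) ∷ prefix) r)) (picks ts) +
         sumOver (λ b → ι (completions (b ∷ prefix) r)) (above X)) +
        sumOver (λ b → ι (completions (b ∷ prefix) r)) (outside (vertices (Explored.E X)))
          ≈⟨ +-cong (+-cong (old e ≡.refl) (back fs ≡.refl)) (new n ≡.refl) ⟩
        (ι (n !) * sumOver (revisiting a fs n e) (picks ts) + ι (n !) * backward a ts fs n e) + ι (n !) * discovery a ts fs n e
          ≈⟨ trans (+-cong (trans (+-comm _ _) (sym (distribˡ _ _ _))) refl) (sym (distribˡ _ _ _)) ⟩
        ι (n !) * ((backward a ts fs n e + sumOver (revisiting a fs n e) (picks ts)) + discovery a ts fs n e)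
          ≈⟨ *-cong refl (trans (+-assoc _ _ _) (+-cong refl (+-comm _ _))) ⟩
        ι (n !) * (backward a ts fs n e + (discovery a ts fs n e + sumOver (revisiting a fs n e) (picks ts)))
          ≈⟨ *-cong refl (V-step a ts fs n e e<N) ⟨
        ι (n !) * V ts fs n e ∎
        where
        old : ∀ k → e ≡ k → sumOver (λ x → ι (completions (label (proj₁ x) ∷ prefix) r)) (picks ts) ≈
              ι (n !) * sumOver (revisiting a fs n k) (picks ts)
        -- With no repeated descent left to spend, another one would leave too few letters for the
        -- `n` discoveries and the way back.
        old zero    ≡.refl = trans (sumOver-zero (picks ts) λ { (node _ _ , _) x∈ → too-short r {n = n} (descend X x∈) eq
            (subst (λ k → suc r ℕ.< k) (≡.sym (ℕ.+-suc (2 ℕ.* n) _))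
              (subst (λ k → suc r ℕ.< suc (2 ℕ.* k ℕ.+ List.length fs)) (ℕ.+-identityʳ n) (ℕ.m<n⇒m<1+n (ℕ.≤-reflexive len)))) })
          (sym (trans (*-cong refl (sumOver-zero (picks ts) (λ _ _ → refl))) (zeroʳ _)))
        old (suc k) ≡.refl = trans (sumOver-cong∈ (picks ts) λ
            { (node _ _ , _) x∈ → tally r n k (descend X x∈) eq (ℕ.<-trans (ℕ.n<1+n k) e<N)
            (shorten (n ℕ.+ k) (≡.trans len (cong (λ k → 2 ℕ.* k ℕ.+ List.length fs) (ℕ.+-suc n k)))) })
          (sumOver-*ˡ (ι (n !)) _ (picks ts))
          where
          shorten : ∀ k → suc (suc r) ≡ 2 ℕ.* suc k ℕ.+ List.length fs → suc r ≡ 2 ℕ.* k ℕ.+ suc (List.length fs)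
          shorten k eq = ≡.trans (ℕ.suc-injective (≡.trans eq (cong (ℕ._+ List.length fs) (ℕ.*-suc 2 k)))) (≡.sym (ℕ.+-suc (2 ℕ.* k) _))
        back : ∀ gs → fs ≡ gs → sumOver (λ b → ι (completions (b ∷ prefix) r)) (List.map proj₁ (List.take 1 gs)) ≈
               ι (n !) * backward a ts gs n e
        back []              ≡.refl = sym (trans (*-cong refl (nowhere n e len)) (zeroʳ _))
          where
          nowhere : ∀ n e → suc (suc r) ≡ 2 ℕ.* (n ℕ.+ e) ℕ.+ 0 → backward a ts [] n e ≈ 0#
          nowhere zero    (suc e) _ = refl
          nowhere (suc n) e       _ = refl
        back ((p , ss) ∷ gs) ≡.refl = trans (+-identityʳ _) (tally r n e (retreat X) eq e<N
          (ℕ.suc-injective (≡.trans len (ℕ.+-suc (2 ℕ.* (n ℕ.+ e)) _))))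
        new : ∀ k → n ≡ k → sumOver (λ b → ι (completions (b ∷ prefix) r)) (outside (vertices (Explored.E X))) ≈
              ι (k !) * discovery a ts fs k e
        new zero    ≡.refl with outside (vertices (Explored.E X)) | unseen X eq
        ... | [] | _ = sym (zeroʳ _)
        new (suc k) ≡.refl = begin
          sumOver (λ b → ι (completions (b ∷ prefix) r)) (outside (vertices (Explored.E X)))
            ≈⟨ sumOver-cong∈ (outside _) (λ b b∈ → tally r k e (discover X (∈-outside⁻ {xs = vertices (Explored.E X)} b∈))
                (grow-length eq) e<N
                 (≡.trans (ℕ.suc-injective (≡.trans len (cong (ℕ._+ List.length fs) (ℕ.*-suc 2 (k ℕ.+ e)))))
                     (≡.sym (ℕ.+-suc (2 ℕ.* (k ℕ.+ e)) _)))) ⟩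
          sumOver (λ b → ι (k !) * V [] ((a , ts) ∷ fs) k e) (outside (vertices (Explored.E X)))
            ≈⟨ sumOver-const _ (outside (vertices (Explored.E X))) ⟩
          ι (List.length (outside (vertices (Explored.E X)))) * (ι (k !) * V [] ((a , ts) ∷ fs) k e)
            ≈⟨ *-cong (reflexive (cong ι (unseen X eq))) refl ⟩
          ι (suc k) * (ι (k !) * V [] ((a , ts) ∷ fs) k e)
            ≈⟨ trans (sym (*-assoc _ _ _)) (*-cong (sym (ι-* (suc k) (k !))) refl) ⟩
          ι (suc k !) * V [] ((a , ts) ∷ fs) k e ∎

  module _ {m : ℕ} where

    private
      treeWalkᵇ : (∃ λ L → Vec (Fin m) L) → Bool
      treeWalkᵇ (L , v) = does (isTreeWalk? v)

      vec≡fromList : ∀ {L} (v : Vec (Fin m) L) → _≡_ {A = ∃ (Vec (Fin m))} (L , v) (_ , Vec.fromList (Vec.toList v))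
      vec≡fromList []      = ≡.refl
      vec≡fromList (x ∷ v) = cong (λ (n , u) → suc n , x ∷ u) (vec≡fromList v)

      toList-sequences : ∀ L → List.map Vec.toList (sequences m L) ≡ words {m} L
      toList-sequences zero    = ≡.refl
      toList-sequences (suc L) = ≡.trans (go (List.allFin m)) (cong (List.cartesianProductWith _∷_ (List.allFin m)) (toList-sequences L))
        where
        go : ∀ bs → List.map Vec.toList (List.cartesianProductWith _∷_ bs (sequences m L)) ≡
                    List.cartesianProductWith _∷_ bs (List.map Vec.toList (sequences m L))
        go []       = ≡.refl
        go (b ∷ bs) = ≡.trans (List.map-++ Vec.toList (List.map (b ∷_) (sequences m L)) _)
          (cong₂ _++_ (≡.trans (≡.sym (List.map-∘ (sequences m L))) (List.map-∘ (sequences m L))) (go bs))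

    opaque
      unfolding count treeWalk?

      length-filter-toList : ∀ {L} (vs : List (Vec (Fin m) L)) → List.length (List.filter isTreeWalk? vs) ≡
        List.length (List.filter (treeWalk? {m}) (List.map Vec.toList vs))
      length-filter-toList []       = ≡.refl
      length-filter-toList (v ∷ vs)
        with does (isTreeWalk? v) | does (isTreeWalk? (Vec.fromList (Vec.toList v))) | cong treeWalkᵇ (vec≡fromList v)
      ... | true  | .true  | ≡.refl = cong suc (length-filter-toList vs)
      ... | false | .false | ≡.refl = length-filter-toList vs

      treeWalks≡count : ∀ L → List.length (List.filter isTreeWalk? (sequences m L)) ≡ count (treeWalk? {m}) L
      treeWalks≡count L = ≡.trans (length-filter-toList (sequences m L))
        (cong (λ ls → List.length (List.filter (treeWalk? {m}) ls)) (toList-sequences L))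

  w≡count : ∀ k L → w (suc (suc k)) L ≡ count (treeWalk? {suc (suc k)}) L
  w≡count k L = treeWalks≡count L

-- Decidable identities between rational functions with poles at 1 and 1/2.

module RationalFunctions where

  open import Data.Maybe.Base using (Maybe; just; nothing)
  open import Algebra.Solver.Ring.AlmostCommutativeRing using (fromCommutativeRing; _-Raw-AlmostCommutative⟶_)
  open ≡ using (cong)
  open WalkSums
  open WalkCounting

  module Integers (R : CommutativeRing 0ℓ 0ℓ) where

    open CommutativeRing R
    open Embedding R
    open Algebra.Properties.Ring ring using (-‿involutive; -‿distribˡ-*; -‿distribʳ-*; -0#≈0#; -‿+-comm)
    open import Relation.Binary.Reasoning.Setoid setoid

    ιℤ : ℤ → Carrier
    ιℤ (pos n)  = ι n
    ιℤ -[1+ n ] = - ι (suc n)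

    ιℤ-neg : ∀ i → ιℤ (ℤ.- i) ≈ - ιℤ i
    ιℤ-neg (pos zero)    = sym -0#≈0#
    ιℤ-neg (pos (suc n)) = refl
    ιℤ-neg -[1+ n ]      = sym (-‿involutive _)

    ιℤ-⊖ : ∀ m n → ιℤ (m ℤ.⊖ n) ≈ ι m - ι n
    ιℤ-⊖ zero    zero    = trans (sym (+-identityˡ _)) (+-cong refl (sym -0#≈0#))
    ιℤ-⊖ zero    (suc n) = sym (+-identityˡ _)
    ιℤ-⊖ (suc m) zero    = trans (sym (+-identityʳ _)) (+-cong refl (sym -0#≈0#))
    ιℤ-⊖ (suc m) (suc n) = begin
      ιℤ (suc m ℤ.⊖ suc n)            ≈⟨ reflexive (cong ιℤ (ℤ.[1+m]⊖[1+n]≡m⊖n m n)) ⟩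
      ιℤ (m ℤ.⊖ n)                    ≈⟨ ιℤ-⊖ m n ⟩
      ι m - ι n                       ≈⟨ +-identityˡ _ ⟨
      0# + (ι m - ι n)                ≈⟨ +-cong (-‿inverseʳ 1#) refl ⟨
      (1# - 1#) + (ι m - ι n)         ≈⟨ +-assoc _ _ _ ⟩
      1# + (- 1# + (ι m - ι n))       ≈⟨ +-cong refl (trans (sym (+-assoc _ _ _)) (trans (+-cong (+-comm _ _) refl) (+-assoc _ _ _))) ⟩
      1# + (ι m + (- 1# - ι n))       ≈⟨ +-assoc _ _ _ ⟨
      ι (suc m) + (- 1# - ι n)        ≈⟨ +-cong refl (-‿+-comm 1# (ι n)) ⟩
      ι (suc m) - ι (suc n)           ∎

    ιℤ-+ : ∀ i j → ιℤ (i ℤ.+ j) ≈ ιℤ i + ιℤ j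
    ιℤ-+ (pos m)  (pos n)  = ι-+ m n
    ιℤ-+ (pos m)  -[1+ n ] = ιℤ-⊖ m (suc n)
    ιℤ-+ -[1+ m ] (pos n)  = trans (ιℤ-⊖ n (suc m)) (+-comm _ _)
    ιℤ-+ -[1+ m ] -[1+ n ] = trans (-‿cong (trans (reflexive (cong (λ k → ι (suc k)) (≡.sym (ℕ.+-suc m n)))) (ι-+ (suc m) (suc n))))
      (sym (-‿+-comm _ _))

    ιℤ-* : ∀ i j → ιℤ (i ℤ.* j) ≈ ιℤ i * ιℤ j
    ιℤ-* (pos m)  (pos n)  = trans (reflexive (cong ιℤ (≡.sym (ℤ.pos-* m n)))) (ι-* m n)
    ιℤ-* (pos m)  -[1+ n ] = begin
      ιℤ (pos m ℤ.* -[1+ n ])          ≈⟨ reflexive (cong ιℤ (≡.sym (ℤ.neg-distribʳ-* (pos m) (pos (suc n))))) ⟩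
      ιℤ (ℤ.- (pos m ℤ.* pos (suc n))) ≈⟨ trans (ιℤ-neg (pos m ℤ.* pos (suc n))) (-‿cong (ιℤ-* (pos m) (pos (suc n)))) ⟩
      - (ι m * ι (suc n))              ≈⟨ -‿distribʳ-* _ _ ⟩
      ι m * - ι (suc n)                ∎
    ιℤ-* -[1+ m ] (pos n)  = begin
      ιℤ (-[1+ m ] ℤ.* pos n)          ≈⟨ reflexive (cong ιℤ (≡.sym (ℤ.neg-distribˡ-* (pos (suc m)) (pos n)))) ⟩
      ιℤ (ℤ.- (pos (suc m) ℤ.* pos n)) ≈⟨ trans (ιℤ-neg (pos (suc m) ℤ.* pos n)) (-‿cong (ιℤ-* (pos (suc m)) (pos n))) ⟩
      - (ι (suc m) * ι n)              ≈⟨ -‿distribˡ-* _ _ ⟩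
      - ι (suc m) * ι n                ∎
    ιℤ-* -[1+ m ] -[1+ n ] = begin
      ι (suc m ℕ.* suc n)              ≈⟨ ι-* (suc m) (suc n) ⟩
      ι (suc m) * ι (suc n)            ≈⟨ -‿involutive _ ⟨
      - - (ι (suc m) * ι (suc n))      ≈⟨ -‿cong (-‿distribˡ-* _ _) ⟩
      - (- ι (suc m) * ι (suc n))      ≈⟨ -‿distribʳ-* _ _ ⟩
      - ι (suc m) * - ι (suc n)        ∎

    private
      homomorphism : CommutativeRing.rawRing ℤ.+-*-commutativeRing -Raw-AlmostCommutative⟶ fromCommutativeRing R
      homomorphism = record
        { ⟦_⟧ = ιℤ ; +-homo = ιℤ-+ ; *-homo = ιℤ-* ; -‿homo = ιℤ-neg ; 0-homo = refl ; 1-homo = +-identityʳ 1# }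

      weaklyDecidable : ∀ i j → Maybe (ιℤ i ≈ ιℤ j)
      weaklyDecidable i j with i ℤ.≟ j
      ... | yes eq = just (reflexive (cong ιℤ eq))
      ... | no  _  = nothing

    module Solver = Algebra.Solver.Ring (CommutativeRing.rawRing ℤ.+-*-commutativeRing)
      (fromCommutativeRing R) homomorphism weaklyDecidable

  Polynomial : Set
  Polynomial = List ℤ

  infixl 6 _+ᴾ_
  infixl 7 _*ᴾ_ _·ᴾ_

  _+ᴾ_ _*ᴾ_ : Polynomial → Polynomial → Polynomial
  []      +ᴾ q       = q
  (a ∷ p) +ᴾ []      = a ∷ p
  (a ∷ p) +ᴾ (b ∷ q) = a ℤ.+ b ∷ p +ᴾ q

  _·ᴾ_ : ℤ → Polynomial → Polynomial
  a ·ᴾ p = List.map (a ℤ.*_) p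

  []      *ᴾ q = []
  (a ∷ p) *ᴾ q = a ·ᴾ q +ᴾ (pos 0 ∷ p *ᴾ q)

  _^ᴾ_ : Polynomial → ℕ → Polynomial
  p ^ᴾ zero  = pos 1 ∷ []
  p ^ᴾ suc n = p *ᴾ p ^ᴾ n

  isZero : Polynomial → Bool
  isZero []      = true
  isZero (a ∷ p) = does (a ℤ.≟ pos 0) ∧ isZero p

  module Evaluation (R : CommutativeRing 0ℓ 0ℓ) (x : CommutativeRing.Carrier R) where

    open CommutativeRing R
    open Integers R
    open Sums R using (pow)
    open Solver using (solve; _:=_; _:+_; _:*_; con)

    ⟦_⟧ : Polynomial → Carrier
    ⟦ [] ⟧    = 0#
    ⟦ a ∷ p ⟧ = ιℤ a + x * ⟦ p ⟧

    ⟦+⟧ : ∀ p q → ⟦ p +ᴾ q ⟧ ≈ ⟦ p ⟧ + ⟦ q ⟧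
    ⟦+⟧ []      q       = sym (+-identityˡ _)
    ⟦+⟧ (a ∷ p) []      = sym (+-identityʳ _)
    ⟦+⟧ (a ∷ p) (b ∷ q) = trans (+-cong (ιℤ-+ a b) (*-cong refl (⟦+⟧ p q)))
      (solve 5 (λ a b x u v → a :+ b :+ x :* (u :+ v) := a :+ x :* u :+ (b :+ x :* v)) refl _ _ _ _ _)

    ⟦·⟧ : ∀ a p → ⟦ a ·ᴾ p ⟧ ≈ ιℤ a * ⟦ p ⟧
    ⟦·⟧ a []      = sym (zeroʳ _)
    ⟦·⟧ a (b ∷ p) = trans (+-cong (ιℤ-* a b) (*-cong refl (⟦·⟧ a p)))
      (solve 4 (λ a b x u → a :* b :+ x :* (a :* u) := a :* (b :+ x :* u)) refl _ _ _ _)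

    ⟦*⟧ : ∀ p q → ⟦ p *ᴾ q ⟧ ≈ ⟦ p ⟧ * ⟦ q ⟧
    ⟦*⟧ []      q = sym (zeroˡ _)
    ⟦*⟧ (a ∷ p) q = trans (⟦+⟧ (a ·ᴾ q) (pos 0 ∷ p *ᴾ q))
      (trans (+-cong (⟦·⟧ a q) (+-cong refl (*-cong refl (⟦*⟧ p q))))
        (solve 4 (λ a x u v → a :* v :+ (con (pos 0) :+ x :* (u :* v)) := (a :+ x :* u) :* v) refl _ _ _ _))

    ⟦^⟧ : ∀ p n → ⟦ p ^ᴾ n ⟧ ≈ pow ⟦ p ⟧ n
    ⟦^⟧ p zero    = solve 1 (λ x → con (pos 1) :+ x :* con (pos 0) := con (pos 1)) refl x ⟨trans⟩ +-identityʳ 1#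
      where _⟨trans⟩_ = trans
    ⟦^⟧ p (suc n) = trans (⟦*⟧ p (p ^ᴾ n)) (*-cong refl (⟦^⟧ p n))

    isZero⇒≈ : ∀ p → isZero p ≡ true → ⟦ p ⟧ ≈ 0#
    isZero⇒≈ []      _ = refl
    isZero⇒≈ (a ∷ p) h with a ℤ.≟ pos 0
    ... | yes ≡.refl = trans (+-cong refl (trans (*-cong refl (isZero⇒≈ p h)) (zeroʳ x))) (+-identityˡ _)
    isZero⇒≈ (a ∷ p) () | no _

    -- Reflection: one computation with lists of integers proves the identity at every point of
    -- every commutative ring.
    equal⇒≈ : ∀ p q → isZero (p +ᴾ ℤ.- pos 1 ·ᴾ q) ≡ true → ⟦ p ⟧ ≈ ⟦ q ⟧
    equal⇒≈ p q h = begin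
      ⟦ p ⟧                                    ≈⟨ solve 2 (λ u v → u := u :+ con (ℤ.- pos 1) :* v :+ v) refl _ _ ⟩
      ⟦ p ⟧ + ιℤ (ℤ.- pos 1) * ⟦ q ⟧ + ⟦ q ⟧   ≈⟨ +-cong (trans (+-cong refl (sym (⟦·⟧ (ℤ.- pos 1) q))) (sym (⟦+⟧ p _))) refl ⟩
      ⟦ p +ᴾ ℤ.- pos 1 ·ᴾ q ⟧ + ⟦ q ⟧          ≈⟨ +-cong (isZero⇒≈ (p +ᴾ ℤ.- pos 1 ·ᴾ q) h) refl ⟩
      0# + ⟦ q ⟧                               ≈⟨ +-identityˡ _ ⟩
      ⟦ q ⟧                                    ∎
      where open import Relation.Binary.Reasoning.Setoid setoid

  record Fraction : Set where
    constructor fraction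
    field
      numerator : Polynomial
      ord₁ ord₂ : ℕ

  open Fraction

  1−x 1−2x : Polynomial
  1−x  = pos 1 ∷ ℤ.- pos 1 ∷ []
  1−2x = pos 1 ∷ ℤ.- pos 2 ∷ []

  raise : ℕ → ℕ → Polynomial → Polynomial
  raise k l p = p *ᴾ (1−x ^ᴾ k *ᴾ 1−2x ^ᴾ l)

  infixl 6 _+ᶠ_
  infixl 7 _*ᶠ_

  -- The sum `a + (a′ ∸ a)` is the maximum of the two pole orders, so adding does not multiply the
  -- denominators.
  _+ᶠ_ _*ᶠ_ : Fraction → Fraction → Fraction
  fraction p a b +ᶠ fraction q a′ b′ =
    fraction (raise (a′ ℕ.∸ a) (b′ ℕ.∸ b) p +ᴾ raise (a ℕ.∸ a′) (b ℕ.∸ b′) q) (a ℕ.+ (a′ ℕ.∸ a)) (b ℕ.+ (b′ ℕ.∸ b))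
  fraction p a b *ᶠ fraction q a′ b′ = fraction (p *ᴾ q) (a ℕ.+ a′) (b ℕ.+ b′)

  polynomialᶠ : Polynomial → Fraction
  polynomialᶠ p = fraction p 0 0

  infix 4 _==ᶠ_

  _==ᶠ_ : Fraction → Fraction → Bool
  fraction p a b ==ᶠ fraction q a′ b′ =
    isZero (raise (a′ ℕ.∸ a) (b′ ℕ.∸ b) p +ᴾ ℤ.- pos 1 ·ᴾ raise (a ℕ.∸ a′) (b ℕ.∸ b′) q)

  +-∸-comm : ∀ m n → n ℕ.+ (m ℕ.∸ n) ≡ m ℕ.+ (n ℕ.∸ m)
  +-∸-comm zero    n       = ≡.trans (cong (n ℕ.+_) (ℕ.0∸n≡0 n)) (ℕ.+-identityʳ n)
  +-∸-comm (suc m) zero    = cong suc (≡.sym (ℕ.+-identityʳ m))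
  +-∸-comm (suc m) (suc n) = cong suc (+-∸-comm m n)

  -- The fraction p / ((1 - x)ᵃ (1 - 2 x)ᵇ), given the inverses c of 1 - x and σ of 1 - 2 x.
  module FractionEvaluation (R : CommutativeRing 0ℓ 0ℓ) (x c σ : CommutativeRing.Carrier R)
    (c-inverse : CommutativeRing._≈_ R (CommutativeRing._*_ R c (Evaluation.⟦_⟧ R x 1−x)) (CommutativeRing.1# R))
    (σ-inverse : CommutativeRing._≈_ R (CommutativeRing._*_ R σ (Evaluation.⟦_⟧ R x 1−2x)) (CommutativeRing.1# R)) where

    open CommutativeRing R
    open Integers R
    open Sums R using (pow)
    open Evaluation R x
    open Solver using (solve; _:=_; _:+_; _:*_; con)
    open import Relation.Binary.Reasoning.Setoid setoid

    pow-+ : ∀ y m n → pow y (m ℕ.+ n) ≈ pow y m * pow y n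
    pow-+ y zero    n = sym (*-identityˡ _)
    pow-+ y (suc m) n = trans (*-cong refl (pow-+ y m n)) (sym (*-assoc _ _ _))

    pow-inverse : ∀ {y z} → y * z ≈ 1# → ∀ n → pow y n * pow z n ≈ 1#
    pow-inverse yz≈1 zero    = *-identityˡ 1#
    pow-inverse yz≈1 (suc n) = trans (solve 4 (λ y u z v → y :* u :* (z :* v) := y :* z :* (u :* v)) refl _ _ _ _)
      (trans (*-cong yz≈1 (pow-inverse yz≈1 n)) (*-identityˡ 1#))

    ⟦_⟧ᶠ : Fraction → Carrier
    ⟦ fraction p a b ⟧ᶠ = ⟦ p ⟧ * (pow c a * pow σ b)

    raise≈ : ∀ p a b k l → ⟦ raise k l p ⟧ * (pow c (a ℕ.+ k) * pow σ (b ℕ.+ l)) ≈ ⟦ p ⟧ * (pow c a * pow σ b)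
    raise≈ p a b k l = begin
      ⟦ raise k l p ⟧ * (pow c (a ℕ.+ k) * pow σ (b ℕ.+ l))
        ≈⟨ *-cong (trans (⟦*⟧ p _) (*-cong refl (trans (⟦*⟧ (1−x ^ᴾ k) _) (*-cong (⟦^⟧ 1−x k) (⟦^⟧ 1−2x l)))))
             (*-cong (pow-+ c a k) (pow-+ σ b l)) ⟩
      ⟦ p ⟧ * (pow ⟦ 1−x ⟧ k * pow ⟦ 1−2x ⟧ l) * ((pow c a * pow c k) * (pow σ b * pow σ l))
        ≈⟨ solve 7 (λ p u v c c′ s s′ → p :* (u :* v) :* ((c :* c′) :* (s :* s′)) := p :* (c :* s) :* ((c′ :* u) :* (s′ :* v)))
             refl _ _ _ _ _ _ _ ⟩
      ⟦ p ⟧ * (pow c a * pow σ b) * ((pow c k * pow ⟦ 1−x ⟧ k) * (pow σ l * pow ⟦ 1−2x ⟧ l))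
        ≈⟨ *-cong refl (trans (*-cong (pow-inverse c-inverse k) (pow-inverse σ-inverse l)) (*-identityˡ 1#)) ⟩
      ⟦ p ⟧ * (pow c a * pow σ b) * 1#
        ≈⟨ *-identityʳ _ ⟩
      ⟦ p ⟧ * (pow c a * pow σ b) ∎

    raise≈′ : ∀ q a b a′ b′ → ⟦ raise (a ℕ.∸ a′) (b ℕ.∸ b′) q ⟧ * (pow c (a ℕ.+ (a′ ℕ.∸ a)) * pow σ (b ℕ.+ (b′ ℕ.∸ b))) ≈
              ⟦ fraction q a′ b′ ⟧ᶠ
    raise≈′ q a b a′ b′ = trans (*-cong refl (*-cong (reflexive (cong (pow c) (≡.sym (+-∸-comm a a′))))
      (reflexive (cong (pow σ) (≡.sym (+-∸-comm b b′)))))) (raise≈ q a′ b′ (a ℕ.∸ a′) (b ℕ.∸ b′))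

    ⟦+ᶠ⟧ : ∀ x y → ⟦ x +ᶠ y ⟧ᶠ ≈ ⟦ x ⟧ᶠ + ⟦ y ⟧ᶠ
    ⟦+ᶠ⟧ (fraction p a b) (fraction q a′ b′) = trans (*-cong (⟦+⟧ (raise (a′ ℕ.∸ a) (b′ ℕ.∸ b) p) _) refl)
      (trans (distribʳ _ _ _) (+-cong (raise≈ p a b (a′ ℕ.∸ a) (b′ ℕ.∸ b)) (raise≈′ q a b a′ b′)))

    ⟦*ᶠ⟧ : ∀ x y → ⟦ x *ᶠ y ⟧ᶠ ≈ ⟦ x ⟧ᶠ * ⟦ y ⟧ᶠ
    ⟦*ᶠ⟧ (fraction p a b) (fraction q a′ b′) = trans (*-cong (⟦*⟧ p q) (*-cong (pow-+ c a a′) (pow-+ σ b b′)))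
      (solve 6 (λ p q c c′ s s′ → p :* q :* ((c :* c′) :* (s :* s′)) := p :* (c :* s) :* (q :* (c′ :* s′))) refl _ _ _ _ _ _)

    ⟦polynomialᶠ⟧ : ∀ p → ⟦ polynomialᶠ p ⟧ᶠ ≈ ⟦ p ⟧
    ⟦polynomialᶠ⟧ p = trans (*-cong refl (*-identityˡ 1#)) (*-identityʳ _)

    ==ᶠ⇒≈ : ∀ x y → (x ==ᶠ y) ≡ true → ⟦ x ⟧ᶠ ≈ ⟦ y ⟧ᶠ
    ==ᶠ⇒≈ (fraction p a b) (fraction q a′ b′) h = trans (sym (raise≈ p a b (a′ ℕ.∸ a) (b′ ℕ.∸ b)))
      (trans (*-cong (equal⇒≈ (raise (a′ ℕ.∸ a) (b′ ℕ.∸ b) p) (raise (a ℕ.∸ a′) (b ℕ.∸ b′) q) h) refl) (raise≈′ q a b a′ b′))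

-- Closed forms for the coefficients of powers of q in S.

module ClosedForms where

  open ≡ using (refl)
  open RationalFunctions

  multichooseℕ : ℕ → ℕ → ℕ
  multichooseℕ b       zero    = 1
  multichooseℕ zero    (suc k) = 0
  multichooseℕ (suc b) (suc k) = multichooseℕ b (suc k) ℕ.+ multichooseℕ (suc b) k

  module Recursion {C : Set} (_+_ _*_ : C → C → C) (nat : ℕ → C) where

    conv : (ℕ → C) → (ℕ → C) → ℕ → C
    conv X Y zero    = X 0 * Y 0
    conv X Y (suc n) = (X 0 * Y (suc n)) + conv (λ i → X (suc i)) Y n

    -- The coefficient of q ^ (k + e) in the sum of multichoose b i q ^ i X (i + 1) X (b + i) over i ≥ k.
    splits : ℕ → (ℕ → ℕ → C) → ℕ → ℕ → C
    splits b X k zero    = nat (multichooseℕ b k) * conv (X (suc k)) (X (b ℕ.+ k)) 0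
    splits b X k (suc e) = (nat (multichooseℕ b k) * conv (X (suc k)) (X (b ℕ.+ k)) (suc e)) + splits b X (suc k) e

  private
    neg : ℕ → ℤ
    neg n = ℤ.- pos n

  -- closedForm j e is the coefficient of q ^ e in S j, as a function of the series g with p = g (1 - g).
  closedForm : ℕ → ℕ → Fraction
  closedForm j 0 = fraction (pos 1 ∷ []) j 0
  closedForm 0 (suc _) = fraction [] 0 0
  closedForm 1 1 = fraction (pos 0 ∷ pos 1 ∷ []) 3 1
  closedForm 2 1 = fraction (pos 0 ∷ pos 3 ∷ neg 4 ∷ []) 5 1
  closedForm 3 1 = fraction (pos 0 ∷ pos 6 ∷ neg 9 ∷ []) 6 1
  closedForm 4 1 = fraction (pos 0 ∷ pos 10 ∷ neg 16 ∷ []) 7 1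
  closedForm 5 1 = fraction (pos 0 ∷ pos 15 ∷ neg 25 ∷ []) 8 1
  closedForm 1 2 = fraction (pos 0 ∷ pos 1 ∷ pos 1 ∷ neg 11 ∷ pos 11 ∷ []) 6 3
  closedForm 2 2 = fraction (pos 0 ∷ pos 4 ∷ neg 2 ∷ neg 52 ∷ pos 117 ∷ neg 72 ∷ []) 8 3
  closedForm 3 2 = fraction (pos 0 ∷ pos 10 ∷ neg 4 ∷ neg 153 ∷ pos 361 ∷ neg 235 ∷ []) 9 3
  closedForm 4 2 = fraction (pos 0 ∷ pos 20 ∷ neg 1 ∷ neg 366 ∷ pos 866 ∷ neg 576 ∷ []) 10 3
  closedForm 1 3 = fraction (pos 0 ∷ pos 1 ∷ pos 10 ∷ neg 70 ∷ pos 98 ∷ pos 106 ∷ neg 336 ∷ pos 202 ∷ []) 9 5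
  closedForm 2 3 = fraction (pos 0 ∷ pos 5 ∷ pos 38 ∷ neg 414 ∷ pos 1044 ∷ neg 281 ∷ neg 2570 ∷ pos 3866 ∷ neg 1728 ∷ []) 11 5
  closedForm 3 3 = fraction (pos 0 ∷ pos 15 ∷ pos 117 ∷ neg 1323 ∷ pos 3369 ∷ neg 396 ∷ neg 10526 ∷ pos 15764 ∷ neg 7226 ∷ []) 12 5
  closedForm 1 4 = fraction (pos 0 ∷ pos 1 ∷ pos 35 ∷ neg 202 ∷ neg 196 ∷ pos 3622 ∷ neg 9580 ∷ pos 8949 ∷ pos 2195 ∷ neg 9329 ∷
      pos 4595 ∷ []) 12 7
  closedForm 2 4 = fraction (pos 0 ∷ pos 6 ∷ pos 180 ∷ neg 1496 ∷ pos 1285 ∷ pos 20646 ∷ neg 86521 ∷ pos 141804 ∷ neg 73030 ∷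
      neg 79004 ∷ pos 123205 ∷ neg 47488 ∷ []) 14 7
  closedForm 1 5 = fraction (pos 0 ∷ pos 1 ∷ pos 92 ∷ neg 230 ∷ neg 4952 ∷ pos 33991 ∷ neg 76434 ∷ neg 14502 ∷ pos 410704 ∷ neg
      846455 ∷ pos 716096 ∷ neg 94334 ∷ neg 239204 ∷ pos 116158 ∷ []) 15 9
  closedForm _ _ = fraction [] 0 0

  x−x² : Polynomial
  x−x² = pos 0 ∷ pos 1 ∷ neg 1 ∷ []

  open Recursion _+ᶠ_ _*ᶠ_ (λ n → polynomialᶠ (pos n ∷ []))

  -- The `k`-th summand of the recursion raises the lower index by `k` but also uses up `k` powers
  -- of q. Hence only entries with index sum at most `suc j + e` occur, and a triangular table
  -- suffices.
  closedForm-recursion : ∀ j e → suc j ℕ.+ e ℕ.≤ 6 →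
    (closedForm (suc j) e ==ᶠ closedForm j e +ᶠ polynomialᶠ x−x² *ᶠ splits (suc j) closedForm 0 e) ≡ true
  closedForm-recursion 0 0 _ = refl
  closedForm-recursion 0 1 _ = refl
  closedForm-recursion 0 2 _ = refl
  closedForm-recursion 0 3 _ = refl
  closedForm-recursion 0 4 _ = refl
  closedForm-recursion 0 5 _ = refl
  closedForm-recursion 1 0 _ = refl
  closedForm-recursion 1 1 _ = refl
  closedForm-recursion 1 2 _ = refl
  closedForm-recursion 1 3 _ = refl
  closedForm-recursion 1 4 _ = refl
  closedForm-recursion 2 0 _ = refl
  closedForm-recursion 2 1 _ = refl
  closedForm-recursion 2 2 _ = refl
  closedForm-recursion 2 3 _ = refl
  closedForm-recursion 3 0 _ = refl
  closedForm-recursion 3 1 _ = refl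
  closedForm-recursion 3 2 _ = refl
  closedForm-recursion 4 0 _ = refl
  closedForm-recursion 4 1 _ = refl
  closedForm-recursion 5 0 _ = refl
  closedForm-recursion 0 (suc (suc (suc (suc (suc (suc _)))))) (s≤s (s≤s (s≤s (s≤s (s≤s (s≤s ()))))))
  closedForm-recursion 1 (suc (suc (suc (suc (suc _))))) (s≤s (s≤s (s≤s (s≤s (s≤s (s≤s ()))))))
  closedForm-recursion 2 (suc (suc (suc (suc _)))) (s≤s (s≤s (s≤s (s≤s (s≤s (s≤s ()))))))
  closedForm-recursion 3 (suc (suc (suc _))) (s≤s (s≤s (s≤s (s≤s (s≤s (s≤s ()))))))
  closedForm-recursion 4 (suc (suc _)) (s≤s (s≤s (s≤s (s≤s (s≤s (s≤s ()))))))
  closedForm-recursion 5 (suc _) (s≤s (s≤s (s≤s (s≤s (s≤s (s≤s ()))))))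
  closedForm-recursion (suc (suc (suc (suc (suc (suc _)))))) zero (s≤s (s≤s (s≤s (s≤s (s≤s (s≤s ()))))))
  closedForm-recursion (suc (suc (suc (suc (suc (suc _)))))) (suc _) (s≤s (s≤s (s≤s (s≤s (s≤s (s≤s ()))))))

-- Existence and uniqueness of the solution of the recursion.

module RecursionSolution where

  open ≡ using (refl; cong; sym; trans)
  open FormalSeries
  open WalkCounting
  open RationalFunctions
  open ClosedForms

  module ℚ⟦p⟧ = PowerSeries ℚ.+-*-commutativeRing
  open ℚ⟦p⟧ using (Series; _⊕_; _⊛_)

  module ιℚ = Embedding ℚ.+-*-commutativeRing

  ι : ℕ → ℚ
  ι = ιℚ.ι

  𝔸 : CommutativeRing 0ℓ 0ℓ
  𝔸 = ℚ⟦p⟧.series (λ _ → ⊤) (λ _ _ → tt)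

  𝔸< : ℕ → CommutativeRing 0ℓ 0ℓ
  𝔸< t = ℚ⟦p⟧.series (ℕ._< t) ℕ.≤-<-trans

  module A = CommutativeRing 𝔸
  module A< t = CommutativeRing (𝔸< t)

  p : Series
  p = ℚ⟦p⟧.variable′

  open Recursion _⊕_ _⊛_ (Embedding.ι 𝔸)

  -- Only the part with the factor `p` refers to the previous iterate; the other part refers to the
  -- new one at a smaller index `j`.
  next : (ℕ → ℕ → Series) → ℕ → ℕ → Series
  next X zero    zero    = A.1#
  next X zero    (suc e) = A.0#
  next X (suc j) e       = next X j e ⊕ (p ⊛ splits (suc j) X 0 e)

  iterate : ℕ → ℕ → ℕ → Series
  iterate zero    j e = A.0#
  iterate (suc t) = next (iterate t)

  module _ (t : ℕ) where

    conv-cong : ∀ {X X′ Y Y′ : ℕ → Series} e → (∀ a → a ℕ.≤ e → A<._≈_ t (X a) (X′ a)) →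
                (∀ a → a ℕ.≤ e → A<._≈_ t (Y a) (Y′ a)) → A<._≈_ t (conv X Y e) (conv X′ Y′ e)
    conv-cong zero    f g = A<.*-cong t (f 0 z≤n) (g 0 z≤n)
    conv-cong (suc e) f g = A<.+-cong t (A<.*-cong t (f 0 z≤n) (g (suc e) ℕ.≤-refl))
      (conv-cong e (λ a a≤ → f (suc a) (s≤s a≤)) (λ a a≤ → g a (ℕ.m≤n⇒m≤1+n a≤)))

    Agree : ℕ → (ℕ → ℕ → Series) → (ℕ → ℕ → Series) → Set
    Agree D X Y = ∀ j e → j ℕ.+ e ℕ.≤ D → A<._≈_ t (X j e) (Y j e)

    splits-cong : ∀ {D X Y} → Agree D X Y → ∀ b k e → suc k ℕ.+ e ℕ.≤ D → b ℕ.+ k ℕ.+ e ℕ.≤ D →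
                  A<._≈_ t (splits b X k e) (splits b Y k e)
    splits-cong {D} {X} {Y} agree b k zero    h h′ = A<.*-cong t (A<.refl t {x = Embedding.ι 𝔸 (multichooseℕ b k)})
      (conv-cong {X = X (suc k)} {X′ = Y (suc k)} 0 (λ a a≤ → agree _ a (ℕ.≤-trans (ℕ.+-monoʳ-≤ (suc k) a≤) h))
        (λ a a≤ → agree _ a (ℕ.≤-trans (ℕ.+-monoʳ-≤ (b ℕ.+ k) a≤) h′)))
    splits-cong {D} {X} {Y} agree b k (suc e) h h′ = A<.+-cong t
      (A<.*-cong t (A<.refl t {x = Embedding.ι 𝔸 (multichooseℕ b k)})
        (conv-cong {X = X (suc k)} {X′ = Y (suc k)} (suc e) (λ a a≤ → agree _ a (ℕ.≤-trans (ℕ.+-monoʳ-≤ (suc k) a≤) h))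
          (λ a a≤ → agree _ a (ℕ.≤-trans (ℕ.+-monoʳ-≤ (b ℕ.+ k) a≤) h′))))
      (splits-cong agree b (suc k) e (≡.subst (ℕ._≤ D) (ℕ.+-suc (suc k) e) h)
        (≡.subst (ℕ._≤ D) (trans (ℕ.+-suc (b ℕ.+ k) e) (cong (ℕ._+ e) (sym (ℕ.+-suc b k)))) h′))

    -- The factor `p` gains one degree of accuracy, which makes `next` a contraction.
    p-cong : ∀ {X Y} → A<._≈_ t X Y → A<._≈_ (suc t) (p ⊛ X) (p ⊛ Y)
    p-cong {X} {Y} eq zero    _       = trans (ℚ⟦p⟧.variable-⊛-zero X) (sym (ℚ⟦p⟧.variable-⊛-zero Y))
    p-cong {X} {Y} eq (suc n) (s≤s h) = trans (ℚ⟦p⟧.variable-⊛-suc X n) (trans (eq n h) (sym (ℚ⟦p⟧.variable-⊛-suc Y n)))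

  next-cong : ∀ t {D X Y} → Agree t D X Y → Agree (suc t) D (next X) (next Y)
  next-cong t agree zero    zero    h n n<t = refl
  next-cong t agree zero    (suc e) h n n<t = refl
  next-cong t {D} {X} {Y} agree (suc j) e h = A<.+-cong (suc t) {next X j e} {next Y j e}
    (next-cong t agree j e (ℕ.≤-trans (ℕ.n≤1+n _) h))
    (p-cong t (splits-cong t agree (suc j) 0 e (ℕ.≤-trans (s≤s (ℕ.m≤n+m e j)) h)
      (≡.subst (λ i → i ℕ.+ e ℕ.≤ D) (sym (ℕ.+-identityʳ (suc j))) h)))

  iterate-agree : ∀ t k D → Agree t D (iterate t) (iterate (t ℕ.+ k))
  iterate-agree zero    k D j e h n ()
  iterate-agree (suc t) k D = next-cong t (iterate-agree t k D)

  opaque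

    -- The fixed point of next: each iteration fixes one more power of p.
    S : ℕ → ℕ → Series
    S j e n = iterate (suc n) j e n

    iterate-S : ∀ t D → Agree t D (iterate t) S
    iterate-S t D j e h n n<t with ℕ.m≤n⇒∃[o]m+o≡n n<t
    ... | k , refl = sym (iterate-agree (suc n) k D j e h n ℕ.≤-refl)

    S-recursion : ∀ j e → A._≈_ (S (suc j) e) (S j e ⊕ (p ⊛ splits (suc j) S 0 e))
    S-recursion j e n _ = cong (next (iterate n) j e n ℚ.+_)
      (p-cong n (splits-cong n (iterate-S n _) (suc j) 0 e (ℕ.m≤m+n (1 ℕ.+ e) (suc j ℕ.+ 0 ℕ.+ e)) (ℕ.m≤n+m _ (1 ℕ.+ e))) n ℕ.≤-refl)

    S-zero : ∀ n → S 0 0 n ≡ A.1# n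
    S-zero n = refl

    S-zero-suc : ∀ e n → S 0 (suc e) n ≡ 0ℚ
    S-zero-suc e n = refl

  module _ (g c σ : Series)
    (c-inverse : A._≈_ (A._*_ c (Evaluation.⟦_⟧ 𝔸 g 1−x)) A.1#) (σ-inverse : A._≈_ (A._*_ σ (Evaluation.⟦_⟧ 𝔸 g 1−2x)) A.1#)
    (g−g² : A._≈_ (Evaluation.⟦_⟧ 𝔸 g x−x²) p) where

    open FractionEvaluation 𝔸 g c σ c-inverse σ-inverse
    open Evaluation 𝔸 g
    module F = Recursion _+ᶠ_ _*ᶠ_ (λ n → polynomialᶠ (pos n ∷ []))

    ⟦conv⟧ : ∀ X Y e → A._≈_ ⟦ F.conv X Y e ⟧ᶠ (conv (λ a → ⟦ X a ⟧ᶠ) (λ a → ⟦ Y a ⟧ᶠ) e)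
    ⟦conv⟧ X Y zero    = ⟦*ᶠ⟧ (X 0) (Y 0)
    ⟦conv⟧ X Y (suc e) = A.trans (⟦+ᶠ⟧ (X 0 *ᶠ Y (suc e)) (F.conv (λ i → X (suc i)) Y e))
      (A.+-cong (⟦*ᶠ⟧ (X 0) (Y (suc e))) (⟦conv⟧ (λ i → X (suc i)) Y e))

    ⟦nat⟧ : ∀ n → A._≈_ ⟦ polynomialᶠ (pos n ∷ []) ⟧ᶠ (Embedding.ι 𝔸 n)
    ⟦nat⟧ n = A.trans (⟦polynomialᶠ⟧ (pos n ∷ [])) (A.trans (A.+-cong (A.refl {Embedding.ι 𝔸 n}) (A.zeroʳ g))
        (A.+-identityʳ (Embedding.ι 𝔸 n)))

    ⟦splits⟧ : ∀ b X k e → A._≈_ ⟦ F.splits b X k e ⟧ᶠ (splits b (λ i a → ⟦ X i a ⟧ᶠ) k e)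
    ⟦splits⟧ b X k zero    = A.trans (⟦*ᶠ⟧ (polynomialᶠ (pos (multichooseℕ b k) ∷ [])) (F.conv (X (suc k)) (X (b ℕ.+ k)) 0))
      (A.*-cong (⟦nat⟧ (multichooseℕ b k)) (⟦conv⟧ (X (suc k)) (X (b ℕ.+ k)) 0))
    ⟦splits⟧ b X k (suc e) = A.trans (⟦+ᶠ⟧ (polynomialᶠ (pos (multichooseℕ b k) ∷ []) *ᶠ F.conv (X (suc k)) (X (b ℕ.+ k))
        (suc e)) (F.splits b X (suc k) e))
      (A.+-cong (A.trans (⟦*ᶠ⟧ (polynomialᶠ (pos (multichooseℕ b k) ∷ [])) (F.conv (X (suc k)) (X (b ℕ.+ k)) (suc e)))
        (A.*-cong (⟦nat⟧ (multichooseℕ b k)) (⟦conv⟧ (X (suc k)) (X (b ℕ.+ k)) (suc e)))) (⟦splits⟧ b X (suc k) e))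

    C : ℕ → ℕ → Series
    C j e = ⟦ closedForm j e ⟧ᶠ

    C-recursion : ∀ j e → suc j ℕ.+ e ℕ.≤ 6 → A._≈_ (C (suc j) e) (C j e ⊕ (p ⊛ splits (suc j) C 0 e))
    C-recursion j e h = A.trans (==ᶠ⇒≈ (closedForm (suc j) e) (closedForm j e +ᶠ product) (closedForm-recursion j e h))
      (A.trans (⟦+ᶠ⟧ (closedForm j e) product)
        (A.+-cong (A.refl {C j e}) (A.trans (⟦*ᶠ⟧ (polynomialᶠ x−x²) (F.splits (suc j) closedForm 0 e))
          (A.*-cong (A.trans (⟦polynomialᶠ⟧ x−x²) g−g²) (⟦splits⟧ (suc j) closedForm 0 e)))))
      where
      product : Fraction
      product = polynomialᶠ x−x² *ᶠ F.splits (suc j) closedForm 0 e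

    -- Both are built by the recursion, so each application of `next` makes them agree in one more
    -- power of `p`. The comparison stays inside the triangle where the table is known to satisfy
    -- the recursion.
    iterate-closed : ∀ t → Agree t 6 (iterate t) C
    iterate-closed zero    j e h n ()
    iterate-closed (suc t) j e h = A<.trans (suc t) {iterate (suc t) j e} {next C j e} {C j e} (next-cong t (iterate-closed t) j e h)
      (λ n _ → next-C j e h n tt)
      where
      next-C : ∀ j e → j ℕ.+ e ℕ.≤ 6 → A._≈_ (next C j e) (C j e)
      next-C zero    zero    h = A.sym (A.trans (⟦nat⟧ 1) (A.+-identityʳ A.1#))
      next-C zero    (suc e) h = A.sym (A.zeroˡ _)
      next-C (suc j) e       h = A.trans (A.+-cong (next-C j e (ℕ.≤-trans (ℕ.n≤1+n _) h)) (A.refl {p ⊛ splits (suc j) C 0 e}))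
          (A.sym (C-recursion j e h))

    opaque
      unfolding S

      S-closed : ∀ j e → j ℕ.+ e ℕ.≤ 6 → A._≈_ (S j e) (C j e)
      S-closed j e h n _ = iterate-closed (suc n) j e h n ℕ.≤-refl

-- The series in p and q, and the number of tree walks as its coefficients.

module BivariateSeries where

  open import Defs using (w)
  open ≡ using (refl; cong; cong₂; sym; trans)
  open FormalSeries
  open WalkSums
  open TreeExploration using (Frames; module Exploration)
  open WalkCounting
  open ClosedForms
  open RecursionSolution hiding (ι; module ιℚ)

  module _ (R : CommutativeRing 0ℓ 0ℓ) where

    open CommutativeRing R hiding (zero) renaming (refl to ≈-refl; sym to ≈-sym; trans to ≈-trans)
    open PowerSeries R
    open Embedding R
    private module SR = Sums R

    delay : ℕ → Series → Series
    delay zero    X e       = X e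
    delay (suc k) X zero    = 0#
    delay (suc k) X (suc e) = delay k X e

    module _ (Ok : ℕ → Set) (down : ∀ {m n} → m ℕ.≤ n → Ok n → Ok m) where

      private
        module B = CommutativeRing (series Ok down)
        module SB = Sums (series Ok down)

      pow-delay : ∀ k X e → (SB.pow variable′ k ⊛ X) e ≈ delay k X e
      pow-delay zero    X e       = ≈-trans (constant-⊛ 1# X e) (*-identityˡ _)
      pow-delay (suc k) X e       = ≈-trans (⊛-assoc variable′ (SB.pow variable′ k) X e) (go e)
        where
        go : ∀ e → (variable′ ⊛ (SB.pow variable′ k ⊛ X)) e ≈ delay (suc k) X e
        go zero    = variable-⊛-zero (SB.pow variable′ k ⊛ X)
        go (suc e) = ≈-trans (variable-⊛-suc (SB.pow variable′ k ⊛ X) e) (pow-delay k X e)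

      opaque
        unfolding Sums.Σ<

        Σ<-coefficient : ∀ n f e → SB.Σ< n f e ≈ SR.Σ< n (λ k → f k e)
        Σ<-coefficient zero    f e = ≈-refl
        Σ<-coefficient (suc n) f e = +-cong ≈-refl (Σ<-coefficient n (λ k → f (suc k)) e)

        multichoose-constant : ∀ b k e → SB.multichoose b k e ≈ constant (ι (multichooseℕ b k)) e
        multichoose-constant b       zero    zero    = ≈-sym (+-identityʳ 1#)
        multichoose-constant b       zero    (suc e) = ≈-refl
        multichoose-constant zero    (suc k) zero    = ≈-refl
        multichoose-constant zero    (suc k) (suc e) = ≈-refl
        multichoose-constant (suc b) (suc k) zero    = ≈-trans
          (+-cong (multichoose-constant b (suc k) zero) (multichoose-constant (suc b) k zero))
          (≈-sym (ι-+ (multichooseℕ b (suc k)) (multichooseℕ (suc b) k)))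
        multichoose-constant (suc b) (suc k) (suc e) = ≈-trans
          (+-cong (multichoose-constant b (suc k) (suc e)) (multichoose-constant (suc b) k (suc e))) (+-identityˡ 0#)

      summand : ∀ b k Z e → ((SB.multichoose b k ⊛ SB.pow variable′ k) ⊛ Z) e ≈ ι (multichooseℕ b k) * delay k Z e
      summand b k Z e = ≈-trans (⊛-assoc (SB.multichoose b k) (SB.pow variable′ k) Z e)
        (≈-trans (⊛-cong (multichoose-constant b k) (λ _ → ≈-refl) e)
          (≈-trans (constant-⊛ _ (SB.pow variable′ k ⊛ Z) e) (*-cong ≈-refl (pow-delay k Z e))))

      open Recursion _+_ _*_ ι

      conv≈⊛ : ∀ X Y e → conv X Y e ≈ (X ⊛ Y) e
      conv≈⊛ X Y zero    = ≈-refl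
      conv≈⊛ X Y (suc e) = +-cong ≈-refl (conv≈⊛ (tail X) Y e)

      opaque
        unfolding Sums.Σ<

        -- The factor q ^ i delays a series by `i` places, so at index `e` the summands beyond the
        -- `e`-th vanish and any upper limit above `e` gives the same sum.
        sum-splits : ∀ b (X : ℕ → Series) n k e → e ℕ.< n →
          SR.Σ< n (λ i → ι (multichooseℕ b (k ℕ.+ i)) * delay i (X (suc k ℕ.+ i) ⊛ X (b ℕ.+ (k ℕ.+ i))) e) ≈ splits b X k e
        sum-splits b X (suc n) k zero _ rewrite ℕ.+-identityʳ k = ≈-trans
          (+-cong ≈-refl (≈-trans (SR.Σ<-cong n (λ i → zeroʳ (ι (multichooseℕ b (k ℕ.+ suc i))))) (SR.Σ<-zero n))) (+-identityʳ _)
        sum-splits b X (suc n) k (suc e) (s≤s e<n) = +-cong head rest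
          where
          head : ι (multichooseℕ b (k ℕ.+ 0)) * (X (suc k ℕ.+ 0) ⊛ X (b ℕ.+ (k ℕ.+ 0))) (suc e) ≈
                 ι (multichooseℕ b k) * conv (X (suc k)) (X (b ℕ.+ k)) (suc e)
          head rewrite ℕ.+-identityʳ k = *-cong ≈-refl (≈-sym (conv≈⊛ (X (suc k)) (X (b ℕ.+ k)) (suc e)))
          rest : SR.Σ< n (λ i → ι (multichooseℕ b (k ℕ.+ suc i)) * delay i (X (suc k ℕ.+ suc i) ⊛ X (b ℕ.+ (k ℕ.+ suc i))) e) ≈
                 splits b X (suc k) e
          rest = ≈-trans (SR.Σ<-cong n (λ i → reflexive (cong (λ j →
            ι (multichooseℕ b j) * delay i (X (suc j) ⊛ X (b ℕ.+ j)) e) (ℕ.+-suc k i)))) (sum-splits b X n (suc k) e e<n)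

  module ℚ⟦p,q⟧ = PowerSeries 𝔸

  Ok : ℕ → Set
  Ok = ℕ._< 6

  𝔹 : CommutativeRing 0ℓ 0ℓ
  𝔹 = ℚ⟦p,q⟧.series Ok ℕ.≤-<-trans

  module B = CommutativeRing 𝔹

  q pᴮ : B.Carrier
  q  = ℚ⟦p,q⟧.variable′
  pᴮ = ℚ⟦p,q⟧.constant p

  q-nilpotent : B._≈_ (Sums.pow 𝔹 q 6) B.0#
  q-nilpotent e e<6 = A.trans (A.sym (B.*-identityʳ (Sums.pow 𝔹 q 6) e e<6))
    (A.trans (pow-delay 𝔸 Ok ℕ.≤-<-trans 6 B.1# e) (vanish 6 e e<6))
    where
    vanish : ∀ k e → e ℕ.< k → A._≈_ (delay 𝔸 k B.1# e) A.0#
    vanish (suc k) zero    _       = A.refl {A.0#}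
    vanish (suc k) (suc e) (s≤s h) = vanish k e h

  open Value 𝔹 q pᴮ 5 q-nilpotent

  opaque
    unfolding link

    link-coefficient : ∀ b e → e ℕ.< 6 → A._≈_ (link (shift S) S b e) (Recursion.splits A._+_ A._*_ (Embedding.ι 𝔸) b S 0 e)
    link-coefficient b e e<6 = A.trans (Σ<-coefficient 𝔸 Ok ℕ.≤-<-trans 6 (λ k → term k) e)
      (A.trans (Sums.Σ<-cong 𝔸 6 (λ k → summand 𝔸 Ok ℕ.≤-<-trans b k (B._*_ (S (suc k)) (S (b ℕ.+ k))) e))
        (sum-splits 𝔸 Ok ℕ.≤-<-trans b S 6 0 e e<6))
      where
      term : ℕ → B.Carrier
      term k = B._*_ (B._*_ (Sums.multichoose 𝔹 b k) (Sums.pow 𝔹 q k)) (B._*_ (S (suc k)) (S (b ℕ.+ k)))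

  S-one : B._≈_ (S 0) B.1#
  S-one zero    _ n _ = S-zero n
  S-one (suc e) _ n _ = S-zero-suc e n

  S-suc : ∀ b → B._≈_ (S (suc b)) (B._+_ (S b) (B._*_ pᴮ (link (shift S) S (suc b))))
  S-suc b e e<6 = A.trans (S-recursion b e) (A.+-cong (A.refl {S b e})
    (A.trans (A.*-cong (A.refl {p}) (A.sym (link-coefficient (suc b) e e<6)))
      (A.sym (ℚ⟦p,q⟧.constant-⊛ p (link (shift S) S (suc b)) e))))

  module _ {m : ℕ} where

    V : List (Tree (Fin m)) → Frames {Fin m} → ℕ → ℕ → ℚ
    V ts fs n e = value S S-one S-suc ts fs e n

    private
      backᴮ : List (Tree (Fin m)) → Frames {Fin m} → B.Carrier
      backᴮ = value-back S S-one S-suc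

      module T = Tally ℚ.+-*-commutativeRing 6 V
      module Q = Sums ℚ.+-*-commutativeRing
      module SB = Sums 𝔹

      sumOver-coefficient : ∀ {X : Set} (f : X → B.Carrier) xs n e → SB.sumOver f xs e n ≡ Q.sumOver (λ x → f x e n) xs
      sumOver-coefficient f []       n e = refl
      sumOver-coefficient f (x ∷ xs) n e = cong (f x e n ℚ.+_) (sumOver-coefficient f xs n e)

      back : ∀ a ts fs n e → backᴮ ts fs e n ≡ T.backward a ts fs n e
      back a ts []              zero    zero    = refl
      back a ts []              zero    (suc e) = refl
      back a ts []              (suc n) zero    = refl
      back a ts []              (suc n) (suc e) = refl
      back a ts ((c , ss) ∷ fs) n       e       = refl

      discover : ∀ a ts fs n e → B._*_ pᴮ (value S S-one S-suc [] ((a , ts) ∷ fs)) e n ≡ T.discovery a ts fs n e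
      discover a ts fs zero    e = trans (ℚ⟦p,q⟧.constant-⊛ p X e zero tt) (ℚ⟦p⟧.variable-⊛-zero (X e))
        where
        X : B.Carrier
        X = value S S-one S-suc [] ((a , ts) ∷ fs)
      discover a ts fs (suc n) e = trans (ℚ⟦p,q⟧.constant-⊛ p X e (suc n) tt) (ℚ⟦p⟧.variable-⊛-suc (X e) n)
        where
        X : B.Carrier
        X = value S S-one S-suc [] ((a , ts) ∷ fs)

      revisit : ∀ a ts fs n e →
        B._*_ q (SB.sumOver (λ x → value S S-one S-suc (children (proj₁ x)) ((a , proj₂ x) ∷ fs)) (picks ts)) e n ≡
        Q.sumOver (T.revisiting a fs n e) (picks ts)
      revisit a ts fs n zero    = trans (ℚ⟦p,q⟧.variable-⊛-zero (SB.sumOver _ (picks ts)) n tt) (zeros (picks ts))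
        where
        zeros : ∀ {X : Set} (xs : List X) → 0ℚ ≡ Q.sumOver (λ _ → 0ℚ) xs
        zeros []       = refl
        zeros (x ∷ xs) = trans (zeros xs) (sym (ℚ.+-identityˡ _))
      revisit a ts fs n (suc e) = trans (ℚ⟦p,q⟧.variable-⊛-suc (SB.sumOver _ (picks ts)) e n tt)
        (sumOver-coefficient _ (picks ts) n e)

    V-step : ∀ a ts fs n e → e ℕ.< 6 → V ts fs n e ≡
             T.backward a ts fs n e ℚ.+ (T.discovery a ts fs n e ℚ.+ Q.sumOver (T.revisiting a fs n e) (picks ts))
    V-step a ts fs n e e<6 = trans (value-step S S-one S-suc a ts fs e e<6 n tt)
      (cong₂ ℚ._+_ (back a ts fs n e) (cong₂ ℚ._+_ (discover a ts fs n e) (revisit a ts fs n e)))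

  open RecursionSolution using (ι; module ιℚ)

  module _ (k e r : ℕ) (e<6 : e ℕ.< 6) (len : suc r ≡ 2 ℕ.* (suc k ℕ.+ e)) where

    private
      m : ℕ
      m = suc (suc k)
      module T = Tally ℚ.+-*-commutativeRing {suc (suc k)} 6 V
      module Q = Sums ℚ.+-*-commutativeRing

    -- For the empty exploration the value is `S 1`, because the root is left exactly once, at the
    -- end. The first letter is fixed, which leaves `r` letters of `suc r`.
    from-root : ∀ (b : Fin m) → ι (T.completions V-step b (b ∷ []) r) ≡ ι (suc k !) ℚ.* S 1 e (suc k)
    from-root b = T.tally V-step b r (suc k) e (Exploration.begin-walk b) refl e<6 (trans len (sym (ℕ.+-identityʳ _)))

    total-count : ι (count (treeWalk? {m}) (suc r)) ≡ Q.sumOver (λ b → ι (count (λ l → treeWalk? {m} (b ∷ l)) r)) (List.allFin m)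
    total-count = trans (cong ι (count-suc (treeWalk? {m}) r)) (ιℚ.ι-sum (λ b → count (λ l → treeWalk? {m} (b ∷ l)) r) (List.allFin m))

    by-root : Q.sumOver (λ b → ι (count (λ l → treeWalk? {m} (b ∷ l)) r)) (List.allFin m) ≡
              Q.sumOver (λ (b : Fin m) → ι (suc k !) ℚ.* S 1 e (suc k)) (List.allFin m)
    by-root = ιℚ.sumOver-cong∈ (List.allFin m) (λ b _ → from-root b)

    constant-sum : Q.sumOver (λ (b : Fin m) → ι (suc k !) ℚ.* S 1 e (suc k)) (List.allFin m) ≡ ι m ℚ.* (ι (suc k !) ℚ.* S 1 e (suc k))
    constant-sum = trans (ιℚ.sumOver-const (ι (suc k !) ℚ.* S 1 e (suc k)) (List.allFin m))
      (cong (λ n → ι n ℚ.* (ι (suc k !) ℚ.* S 1 e (suc k))) (List.length-tabulate {n = m} (λ b → b)))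

    factorial : ι m ℚ.* (ι (suc k !) ℚ.* S 1 e (suc k)) ≡ ι (m ℕ.* suc k !) ℚ.* S 1 e (suc k)
    factorial = trans (sym (ℚ.*-assoc (ι m) (ι (suc k !)) (S 1 e (suc k))))
      (cong (ℚ._* S 1 e (suc k)) (sym (ιℚ.ι-* m (suc k !))))

    -- The factorial is made up of the choices of the first vertex and the orders in which the other
    -- labels are discovered.
    treeWalks-series : ι (w (suc (suc k)) (suc r)) ≡ ι (suc (suc k) !) ℚ.* S 1 e (suc k)
    treeWalks-series = trans (cong ι (w≡count k (suc r))) (trans total-count (trans by-root (trans constant-sum factorial)))

-- The series of central binomial coefficients and the Catalan series.

module CentralBinomial where

  open ≡ using (refl; cong; cong₂; sym; trans)
  open import Defs using (module Estimates)
  open FormalSeries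
  open WalkSums
  open WalkCounting
  open RationalFunctions
  open ClosedForms
  open RecursionSolution

  open ℚ⟦p⟧ using (Series; _⊕_; _⊛_; tail)

  module ℤℚ = Integers ℚ.+-*-commutativeRing

  0≤ι : ∀ n → 0ℚ ℚ.≤ ι n
  0≤ι zero    = ℚ.≤-refl
  0≤ι (suc n) = ℚ.<⇒≤ (Estimates.0<1+nonNeg (0≤ι n))

  0<ι-suc : ∀ n → 0ℚ ℚ.< ι (suc n)
  0<ι-suc n = Estimates.0<1+nonNeg (0≤ι n)

  ι-cancel : ∀ n {x y} → ι (suc n) ℚ.* x ≡ ι (suc n) ℚ.* y → x ≡ y
  ι-cancel n {x} {y} eq = trans (expand x) (trans (cong (r ℚ.*_) eq) (sym (expand y)))
    where
    r : ℚ
    r = Estimates.recip (ι (suc n)) (0<ι-suc n)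
    expand : ∀ x → x ≡ r ℚ.* (ι (suc n) ℚ.* x)
    expand x = trans (sym (ℚ.*-identityˡ x)) (trans
      (cong (ℚ._* x) (trans (sym (Estimates.p*recip (0<ι-suc n))) (ℚ.*-comm (ι (suc n)) r))) (ℚ.*-assoc r (ι (suc n)) x))

  opaque

    -- The central binomial coefficients.
    β : ℕ → ℚ
    β zero    = 1ℚ
    β (suc n) = Estimates.recip (ι (suc n)) (0<ι-suc n) ℚ.* ((ι 4 ℚ.* ι n ℚ.+ ι 2) ℚ.* β n)

    β-zero : β 0 ≡ 1ℚ
    β-zero = refl

    β-suc : ∀ n → ι (suc n) ℚ.* β (suc n) ≡ (ι 4 ℚ.* ι n ℚ.+ ι 2) ℚ.* β n
    β-suc n = trans (sym (ℚ.*-assoc (ι (suc n)) _ _))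
      (trans (cong (ℚ._* ((ι 4 ℚ.* ι n ℚ.+ ι 2) ℚ.* β n)) (Estimates.p*recip (0<ι-suc n))) (ℚ.*-identityˡ _))

  -- The derivation p d/dp.
  θ : Series → Series
  θ a n = ι n ℚ.* a n

  module SQ = ℤℚ.Solver

  θ-⊛ : ∀ a b → A._≈_ (θ (a ⊛ b)) (θ a ⊛ b ⊕ a ⊛ θ b)
  θ-⊛ a b n _ = go a b n
    where
    open SQ using (solve; _:=_; _:+_; _:*_; con)
    go : ∀ a b n → ι n ℚ.* (a ⊛ b) n ≡ (θ a ⊛ b) n ℚ.+ (a ⊛ θ b) n
    go a b zero    = solve 2 (λ x y → con (pos 0) :* (x :* y) := con (pos 0) :* x :* y :+ x :* (con (pos 0) :* y)) refl (a 0) (b 0)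
    go a b (suc n) = begin
      ι (suc n) ℚ.* (a 0 ℚ.* b (suc n) ℚ.+ (tail a ⊛ b) n)
        ≡⟨ solve 4 (λ i a b t → (con (pos 1) :+ i) :* (a :* b :+ t) := a :* ((con (pos 1) :+ i) :* b) :+ (t :+ i :* t)) refl
            (ι n) (a 0) (b (suc n)) ((tail a ⊛ b) n) ⟩
      a 0 ℚ.* θ b (suc n) ℚ.+ ((tail a ⊛ b) n ℚ.+ ι n ℚ.* (tail a ⊛ b) n)
        ≡⟨ cong (λ t → a 0 ℚ.* θ b (suc n) ℚ.+ ((tail a ⊛ b) n ℚ.+ t)) (go (tail a) b n) ⟩
      a 0 ℚ.* θ b (suc n) ℚ.+ ((tail a ⊛ b) n ℚ.+ ((θ (tail a) ⊛ b) n ℚ.+ (tail a ⊛ θ b) n))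
        ≡⟨ solve 6 (λ x y a b c d → x :+ (a :+ (b :+ c)) := con (pos 0) :* d :* y :+ (a :+ b) :+ (x :+ c)) refl
             (a 0 ℚ.* θ b (suc n)) (b (suc n)) ((tail a ⊛ b) n) ((θ (tail a) ⊛ b) n) ((tail a ⊛ θ b) n) (a 0) ⟩
      θ a 0 ℚ.* b (suc n) ℚ.+ ((tail a ⊛ b) n ℚ.+ (θ (tail a) ⊛ b) n) ℚ.+ (a ⊛ θ b) (suc n)
        ≡⟨ cong (λ t → θ a 0 ℚ.* b (suc n) ℚ.+ t ℚ.+ (a ⊛ θ b) (suc n)) (sym (trans
             (ℚ⟦p⟧.⊛-cong {b = b} (λ i → solve 2 (λ i a → (con (pos 1) :+ i) :* a := a :+ i :* a) refl (ι i) (a (suc i))) (λ _ → refl) n)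
             (ℚ⟦p⟧.⊛-distribʳ (tail a) (θ (tail a)) b n))) ⟩
      (θ a ⊛ b) (suc n) ℚ.+ (a ⊛ θ b) (suc n) ∎
      where open ≡-Reasoning

  θ-zero⇒constant : ∀ a → A._≈_ (θ a) A.0# → ∀ n → a (suc n) ≡ 0ℚ
  θ-zero⇒constant a eq n = ι-cancel n (trans (eq (suc n) tt) (sym (ℚ.*-zeroʳ (ι (suc n)))))

  module SA = Integers.Solver 𝔸
  open Integers 𝔸 using () renaming (ιℤ to ιᴬ)

  σ : Series
  σ = β

  open import Relation.Binary.Reasoning.Setoid A.setoid
  open SA using (solve; _:=_; _:+_; _:*_; _:-_; :-_; con)

  scalar : ∀ k X n → (ιᴬ (pos k) ⊛ X) n ≡ ι k ℚ.* X n
  scalar zero    X n = trans (ℚ⟦p⟧.⊛-zeroˡ X (λ _ → refl) n) (sym (ℚ.*-zeroˡ (X n)))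
  scalar (suc k) X n = trans (ℚ⟦p⟧.⊛-distribʳ A.1# (ιᴬ (pos k)) X n) (trans
    (cong₂ ℚ._+_ (trans (ℚ⟦p⟧.constant-⊛ 1ℚ X n) (ℚ.*-identityˡ (X n))) (scalar k X n))
    (SQ.solve 2 (λ i x → x SQ.:+ i SQ.:* x SQ.:= (SQ.con (pos 1) SQ.:+ i) SQ.:* x) refl (ι k) (X n)))

  -- The coefficient form of (1 - 4p) θσ = 2pσ.
  θσ : A._≈_ (θ σ) (p ⊛ (ιᴬ (pos 4) ⊛ θ σ ⊕ ιᴬ (pos 2) ⊛ σ))
  θσ zero    _ = trans (ℚ.*-zeroˡ (β 0)) (sym (ℚ⟦p⟧.variable-⊛-zero (ιᴬ (pos 4) ⊛ θ σ ⊕ ιᴬ (pos 2) ⊛ σ)))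
  θσ (suc n) _ = trans (β-suc n) (trans (SQ.solve 2 (λ i b → ((four SQ.:* i) SQ.:+ two) SQ.:* b SQ.:= four SQ.:*
      (i SQ.:* b) SQ.:+ two SQ.:* b) refl (ι n) (β n))
    (sym (trans (ℚ⟦p⟧.variable-⊛-suc (ιᴬ (pos 4) ⊛ θ σ ⊕ ιᴬ (pos 2) ⊛ σ) n)
      (cong₂ ℚ._+_ (scalar 4 (θ σ) n) (scalar 2 σ n)))))
    where
    four two : SQ.Polynomial 2
    four = SQ.con (pos 4)
    two  = SQ.con (pos 2)

  θ-+ : ∀ a b → A._≈_ (θ (a ⊕ b)) (θ a ⊕ θ b)
  θ-+ a b n _ = ℚ.*-distribˡ-+ (ι n) (a n) (b n)

  θ-neg : ∀ a → A._≈_ (θ (A.- a)) (A.- θ a)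
  θ-neg a n _ = sym (ℚ.neg-distribʳ-* (ι n) (a n))

  θ-cong : ∀ {a b} → A._≈_ a b → A._≈_ (θ a) (θ b)
  θ-cong eq n _ = cong (ι n ℚ.*_) (eq n tt)

  θ-ι : ∀ k → A._≈_ (θ (ιᴬ (pos k))) A.0#
  θ-ι k zero    _ = ℚ.*-zeroˡ (ιᴬ (pos k) 0)
  θ-ι k (suc n) _ = trans (cong (ι (suc n) ℚ.*_) (go k)) (ℚ.*-zeroʳ (ι (suc n)))
    where
    go : ∀ k → ιᴬ (pos k) (suc n) ≡ 0ℚ
    go zero    = refl
    go (suc k) = trans (ℚ.+-identityˡ _) (go k)

  θp : A._≈_ (θ p) p
  θp zero          _ = refl
  θp (suc zero)    _ = refl
  θp (suc (suc n)) _ = ℚ.*-zeroʳ (ι (suc (suc n)))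

  d : Series
  d = ιᴬ (pos 1) A.- ιᴬ (pos 4) ⊛ p

  θd : A._≈_ (θ d) (A.- (ιᴬ (pos 4) ⊛ p))
  θd = begin
    θ d                                                              ≈⟨ θ-+ (ιᴬ (pos 1)) (A.- (ιᴬ (pos 4) ⊛ p)) ⟩
    θ (ιᴬ (pos 1)) ⊕ θ (A.- (ιᴬ (pos 4) ⊛ p))                        ≈⟨ A.+-cong (θ-ι 1)
        (A.trans (θ-neg (ιᴬ (pos 4) ⊛ p)) (A.-‿cong (θ-⊛ (ιᴬ (pos 4)) p))) ⟩
    A.0# ⊕ A.- (θ (ιᴬ (pos 4)) ⊛ p ⊕ ιᴬ (pos 4) ⊛ θ p)               ≈⟨ A.+-cong {A.0#} A.refl
        (A.-‿cong (A.+-cong (A.*-cong (θ-ι 4) (A.refl {p})) (A.*-cong (A.refl {ιᴬ (pos 4)}) θp))) ⟩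
    A.0# ⊕ A.- (A.0# ⊛ p ⊕ ιᴬ (pos 4) ⊛ p)                           ≈⟨ solve 1
        (λ p → con (pos 0) :+ (:- (con (pos 0) :* p :+ con (pos 4) :* p)) := :- (con (pos 4) :* p)) A.refl p ⟩
    A.- (ιᴬ (pos 4) ⊛ p)                                             ∎

  dθσ : A._≈_ (d ⊛ θ σ) (ιᴬ (pos 2) ⊛ (p ⊛ σ))
  dθσ = begin
    d ⊛ θ σ
      ≈⟨ solve 2 (λ p t → (con (pos 1) :- con (pos 4) :* p) :* t := t :- con (pos 4) :* (p :* t)) A.refl p (θ σ) ⟩
    θ σ A.- ιᴬ (pos 4) ⊛ (p ⊛ θ σ)
      ≈⟨ A.+-cong θσ (A.refl {A.- (ιᴬ (pos 4) ⊛ (p ⊛ θ σ))}) ⟩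
    p ⊛ (ιᴬ (pos 4) ⊛ θ σ ⊕ ιᴬ (pos 2) ⊛ σ) A.- ιᴬ (pos 4) ⊛ (p ⊛ θ σ)
      ≈⟨ solve 3 (λ p t s → p :* (con (pos 4) :* t :+ con (pos 2) :* s) :- con (pos 4) :* (p :* t) := con (pos 2) :* (p :* s))
          A.refl p (θ σ) σ ⟩
    ιᴬ (pos 2) ⊛ (p ⊛ σ) ∎

  -- The derivative vanishes by `dθσ` and the constant term is 1. So `σ` is (1 - 4 p) ^ (-1/2).
  dσσ≈1 : A._≈_ (d ⊛ (σ ⊛ σ)) A.1#
  dσσ≈1 zero    _ = trans (cong₂ (λ x y → d 0 ℚ.* (x ℚ.* y)) β-zero β-zero) refl
  dσσ≈1 (suc n) _ = θ-zero⇒constant (d ⊛ (σ ⊛ σ)) zero′ n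
    where
    zero′ : A._≈_ (θ (d ⊛ (σ ⊛ σ))) A.0#
    zero′ = begin
      θ (d ⊛ (σ ⊛ σ))                                       ≈⟨ A.trans (θ-⊛ d (σ ⊛ σ))
          (A.+-cong (A.*-cong θd (A.refl {σ ⊛ σ})) (A.*-cong (A.refl {d}) (θ-⊛ σ σ))) ⟩
      A.- (ιᴬ (pos 4) ⊛ p) ⊛ (σ ⊛ σ) ⊕ d ⊛ (θ σ ⊛ σ ⊕ σ ⊛ θ σ) ≈⟨ solve 4
          (λ d t s x → x :+ d :* (t :* s :+ s :* t) := x :+ con (pos 2) :* ((d :* t) :* s)) A.refl d (θ σ) σ
          (A.- (ιᴬ (pos 4) ⊛ p) ⊛ (σ ⊛ σ)) ⟩
      A.- (ιᴬ (pos 4) ⊛ p) ⊛ (σ ⊛ σ) ⊕ ιᴬ (pos 2) ⊛ ((d ⊛ θ σ) ⊛ σ) ≈⟨ A.+-cong (A.refl {A.- (ιᴬ (pos 4) ⊛ p) ⊛ (σ ⊛ σ)})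
          (A.*-cong (A.refl {ιᴬ (pos 2)}) (A.*-cong dθσ (A.refl {σ}))) ⟩
      A.- (ιᴬ (pos 4) ⊛ p) ⊛ (σ ⊛ σ) ⊕ ιᴬ (pos 2) ⊛ (ιᴬ (pos 2) ⊛ (p ⊛ σ) ⊛ σ) ≈⟨ solve 2
          (λ p s → :- (con (pos 4) :* p) :* (s :* s) :+ con (pos 2) :* (con (pos 2) :* (p :* s) :* s) := con (pos 0)) A.refl p σ ⟩
      A.0#                                                  ∎

  open Sums 𝔸 using (pow)

  dθσ^ : ∀ k → A._≈_ (d ⊛ θ (pow σ k)) (ιᴬ (pos 2) ⊛ (ιᴬ (pos k) ⊛ (p ⊛ pow σ k)))
  dθσ^ zero    = begin
    d ⊛ θ (pow σ 0)                                  ≈⟨ A.*-cong (A.refl {d}) (A.trans (θ-cong (A.sym (A.+-identityʳ A.1#))) (θ-ι 1)) ⟩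
    d ⊛ A.0#                                         ≈⟨ solve 3
        (λ d p s → d :* con (pos 0) := con (pos 2) :* (con (pos 0) :* (p :* s))) A.refl d p (pow σ 0) ⟩
    ιᴬ (pos 2) ⊛ (ιᴬ (pos 0) ⊛ (p ⊛ pow σ 0))        ∎
  dθσ^ (suc k) = begin
    d ⊛ θ (σ ⊛ pow σ k)                              ≈⟨ A.*-cong (A.refl {d}) (θ-⊛ σ (pow σ k)) ⟩
    d ⊛ (θ σ ⊛ pow σ k ⊕ σ ⊛ θ (pow σ k))            ≈⟨ solve 5
        (λ d t x s u → d :* (t :* x :+ s :* u) := (d :* t) :* x :+ s :* (d :* u)) A.refl d (θ σ) (pow σ k) σ (θ (pow σ k)) ⟩
    (d ⊛ θ σ) ⊛ pow σ k ⊕ σ ⊛ (d ⊛ θ (pow σ k))      ≈⟨ A.+-cong (A.*-cong dθσ (A.refl {pow σ k})) (A.*-cong (A.refl {σ}) (dθσ^ k)) ⟩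
    ιᴬ (pos 2) ⊛ (p ⊛ σ) ⊛ pow σ k ⊕ σ ⊛ (ιᴬ (pos 2) ⊛ (ιᴬ (pos k) ⊛ (p ⊛ pow σ k))) ≈⟨ solve 4
        (λ p s x i → con (pos 2) :* (p :* s) :* x :+ s :* (con (pos 2) :* (i :* (p :* x))) := con (pos 2) :*
        ((con (pos 1) :+ i) :* (p :* (s :* x)))) A.refl p σ (pow σ k) (ιᴬ (pos k)) ⟩
    ιᴬ (pos 2) ⊛ ((ιᴬ (pos 1) ⊕ ιᴬ (pos k)) ⊛ (p ⊛ pow σ (suc k))) ≈⟨ A.*-cong (A.refl {ιᴬ (pos 2)})
        (A.*-cong (A.+-cong (A.+-identityʳ A.1#) (A.refl {ιᴬ (pos k)})) (A.refl {p ⊛ pow σ (suc k)})) ⟩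
    ιᴬ (pos 2) ⊛ (ιᴬ (pos (suc k)) ⊛ (p ⊛ pow σ (suc k))) ∎

  -- As σ² = 1 / (1 - 4 p), the derivative of σᵏ is 2 k p σᵏ⁺², which is also (k / 2) (σᵏ⁺² - σᵏ).
  -- Comparing coefficients gives the next odd power from the previous one.
  σ^-raise : ∀ k n → ι k ℚ.* pow σ (suc (suc k)) n ≡ (ι k ℚ.+ ι 2 ℚ.* ι n) ℚ.* pow σ k n
  σ^-raise k n = trans (sym (scalar k (pow σ (suc (suc k))) n)) (trans (series n tt) (trans
    (cong₂ ℚ._+_ (scalar k (pow σ k) n) (scalar 2 (θ (pow σ k)) n))
    (SQ.solve 3 (λ i n x → i SQ.:* x SQ.:+ SQ.con (pos 2) SQ.:* (n SQ.:* x) SQ.:= (i SQ.:+ SQ.con (pos 2) SQ.:* n) SQ.:* x) refl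
        (ι k) (ι n) (pow σ k n))))
    where
    x : Series
    x = pow σ k
    i : Series
    i = ιᴬ (pos k)
    series : A._≈_ (i ⊛ pow σ (suc (suc k))) (i ⊛ x ⊕ ιᴬ (pos 2) ⊛ θ x)
    series = begin
      i ⊛ (σ ⊛ (σ ⊛ x))
        ≈⟨ solve 4 (λ i s x p → i :* (s :* (s :* x)) := (s :* s) :*
            (i :* ((con (pos 1) :- con (pos 4) :* p) :* x) :+ con (pos 2) :* (con (pos 2) :* (i :* (p :* x))))) A.refl i σ x p ⟩
      (σ ⊛ σ) ⊛ (i ⊛ (d ⊛ x) ⊕ ιᴬ (pos 2) ⊛ (ιᴬ (pos 2) ⊛ (i ⊛ (p ⊛ x))))
        ≈⟨ A.*-cong (A.refl {σ ⊛ σ}) (A.+-cong (A.refl {i ⊛ (d ⊛ x)}) (A.*-cong (A.refl {ιᴬ (pos 2)}) (A.sym (dθσ^ k)))) ⟩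
      (σ ⊛ σ) ⊛ (i ⊛ (d ⊛ x) ⊕ ιᴬ (pos 2) ⊛ (d ⊛ θ x))
        ≈⟨ solve 5 (λ s i d x t → (s :* s) :* (i :* (d :* x) :+ con (pos 2) :* (d :* t)) := (d :* (s :* s)) :*
            (i :* x :+ con (pos 2) :* t)) A.refl σ i d x (θ x) ⟩
      (d ⊛ (σ ⊛ σ)) ⊛ (i ⊛ x ⊕ ιᴬ (pos 2) ⊛ θ x)
        ≈⟨ A.trans (A.*-cong dσσ≈1 (A.refl {i ⊛ x ⊕ ιᴬ (pos 2) ⊛ θ x})) (A.*-identityˡ _) ⟩
      i ⊛ x ⊕ ιᴬ (pos 2) ⊛ θ x ∎

  p-cancel : ∀ {X Y} → A._≈_ (p ⊛ X) (p ⊛ Y) → A._≈_ X Y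
  p-cancel {X} {Y} eq n _ = trans (sym (ℚ⟦p⟧.variable-⊛-suc X n)) (trans (eq (suc n) tt) (ℚ⟦p⟧.variable-⊛-suc Y n))

  -- s is the square root of 1 - 4 p, and g = (1 - s) / 2.
  half s g c : Series
  half = ℚ⟦p⟧.constant ½
  s = d ⊛ σ
  g = half ⊛ (ιᴬ (pos 1) A.- s)
  c = tail g

  half+half≈1 : A._≈_ (half ⊕ half) A.1#
  half+half≈1 zero    _ = refl
  half+half≈1 (suc n) _ = refl

  private
    one : A._≈_ (ιᴬ (pos 1)) A.1#
    one = A.+-identityʳ A.1#

  σs≈1 : A._≈_ (σ ⊛ s) A.1#
  σs≈1 = A.trans (solve 2 (λ s d → s :* (d :* s) := d :* (s :* s)) A.refl σ d) dσσ≈1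

  ss≈d : A._≈_ (s ⊛ s) d
  ss≈d = A.trans (solve 2 (λ s d → d :* s :* (d :* s) := d :* (d :* (s :* s))) A.refl σ d)
    (A.trans (A.*-cong (A.refl {d}) dσσ≈1) (A.*-identityʳ d))

  open Evaluation 𝔸 g using (⟦_⟧)

  1−2g : A._≈_ ⟦ 1−2x ⟧ s
  1−2g = begin
    ⟦ 1−2x ⟧                                                            ≈⟨ solve 2 (λ h s → let g = h :* (con (pos 1) :- s) in
                                                                              con (pos 1) :+ g :* (con (ℤ.- pos 2) :+ g :* con
                                                                                  (pos 0)) := con (pos 1) :- (h :+ h) :*
                                                                                  (con (pos 1) :- s)) A.refl half s ⟩
    ιᴬ (pos 1) A.- (half ⊕ half) ⊛ (ιᴬ (pos 1) A.- s)                   ≈⟨ A.+-cong (A.refl {ιᴬ (pos 1)})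
        (A.-‿cong (A.*-cong (A.trans half+half≈1 (A.sym one)) (A.refl {ιᴬ (pos 1) A.- s}))) ⟩
    ιᴬ (pos 1) A.- ιᴬ (pos 1) ⊛ (ιᴬ (pos 1) A.- s)                      ≈⟨ solve 1
        (λ s → con (pos 1) :- con (pos 1) :* (con (pos 1) :- s) := s) A.refl s ⟩
    s                                                                   ∎

  σ-inverse : A._≈_ (σ ⊛ ⟦ 1−2x ⟧) A.1#
  σ-inverse = A.trans (A.*-cong (A.refl {σ}) 1−2g) σs≈1

  g−g² : A._≈_ ⟦ x−x² ⟧ p
  g−g² = begin
    ⟦ x−x² ⟧
      ≈⟨ solve 2 (λ h s → let g = h :* (con (pos 1) :- s) in
           con (pos 0) :+ g :* (con (pos 1) :+ g :* (con (ℤ.- pos 1) :+ g :* con (pos 0))) :=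
           h :* (con (pos 1) :- s) :* (con (pos 1) :- (h :+ h) :* con (pos 1)) :+ (h :* h) :* (con (pos 1) :- s :* s)) A.refl half s ⟩
    half ⊛ (ιᴬ (pos 1) A.- s) ⊛ (ιᴬ (pos 1) A.- (half ⊕ half) ⊛ ιᴬ (pos 1)) ⊕ (half ⊛ half) ⊛ (ιᴬ (pos 1) A.- s ⊛ s)
      ≈⟨ A.+-cong (A.*-cong (A.refl {half ⊛ (ιᴬ (pos 1) A.- s)})
          (A.+-cong (A.refl {ιᴬ (pos 1)}) (A.-‿cong (A.*-cong (A.trans half+half≈1 (A.sym one)) (A.refl {ιᴬ (pos 1)})))))
           (A.*-cong (A.refl {half ⊛ half}) (A.+-cong (A.refl {ιᴬ (pos 1)}) (A.-‿cong ss≈d))) ⟩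
    half ⊛ (ιᴬ (pos 1) A.- s) ⊛ (ιᴬ (pos 1) A.- ιᴬ (pos 1) ⊛ ιᴬ (pos 1)) ⊕ (half ⊛ half) ⊛ (ιᴬ (pos 1) A.- d)
      ≈⟨ solve 3 (λ h s p → h :* (con (pos 1) :- s) :* (con (pos 1) :- con (pos 1) :* con (pos 1)) :+ (h :* h) :*
          (con (pos 1) :- (con (pos 1) :- con (pos 4) :* p)) :=
           (h :+ h) :* (h :+ h) :* p) A.refl half s p ⟩
    (half ⊕ half) ⊛ (half ⊕ half) ⊛ p
      ≈⟨ A.trans (A.*-cong (A.trans (A.*-cong half+half≈1 half+half≈1) (A.*-identityˡ A.1#)) (A.refl {p})) (A.*-identityˡ p) ⟩
    p ∎

  pc≈g : A._≈_ (p ⊛ c) g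
  pc≈g zero    _ = trans (ℚ⟦p⟧.variable-⊛-zero c) (sym (trans (cong (λ b → ½ ℚ.* (1ℚ ℚ.+ ℚ.- (d 0 ℚ.* b))) β-zero) refl))
  pc≈g (suc n) _ = ℚ⟦p⟧.variable-⊛-suc c n

  -- `c` is g / p, and p = g (1 - g), so the claim holds after multiplication by `p`, which can be
  -- cancelled.
  c-inverse : A._≈_ (c ⊛ ⟦ 1−x ⟧) A.1#
  c-inverse = p-cancel (begin
    p ⊛ (c ⊛ ⟦ 1−x ⟧) ≈⟨ A.trans (A.sym (A.*-assoc p c ⟦ 1−x ⟧)) (A.*-cong pc≈g (A.refl {⟦ 1−x ⟧})) ⟩
    g ⊛ ⟦ 1−x ⟧       ≈⟨ solve 1 (λ g → g :* (con (pos 1) :+ g :* (con (ℤ.- pos 1) :+ g :* con (pos 0))) :=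
                            con (pos 0) :+ g :* (con (pos 1) :+ g :* (con (ℤ.- pos 1) :+ g :* con (pos 0)))) A.refl g ⟩
    ⟦ x−x² ⟧          ≈⟨ A.trans g−g² (A.sym (A.*-identityʳ p)) ⟩
    p ⊛ A.1#          ∎)

-- Splitting the closed forms by parity in σ.

module PoleExpansion where

  open ≡ using (refl; trans)
  open WalkSums
  open RationalFunctions
  open ClosedForms
  open RecursionSolution
  open CentralBinomial

  open ℚ⟦p⟧ using (_⊕_; _⊛_)
  open Sums 𝔸 using (pow)

  infixr 9 _∘ᴾ_

  _∘ᴾ_ : Polynomial → Polynomial → Polynomial
  []      ∘ᴾ q = []
  (a ∷ p) ∘ᴾ q = (a ∷ []) +ᴾ q *ᴾ (p ∘ᴾ q)

  module _ (R : CommutativeRing 0ℓ 0ℓ) where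

    open CommutativeRing R using (_≈_; +-cong; *-cong; +-identityʳ; zeroʳ) renaming (refl to ≈-refl; trans to ≈-trans)
    open Integers R
    open Evaluation R

    ⟦⟧-cong : ∀ P {x y} → x ≈ y → ⟦_⟧ x P ≈ ⟦_⟧ y P
    ⟦⟧-cong []      eq = ≈-refl
    ⟦⟧-cong (a ∷ P) eq = +-cong ≈-refl (*-cong eq (⟦⟧-cong P eq))

    ⟦∘⟧ : ∀ x P Q → ⟦_⟧ x (P ∘ᴾ Q) ≈ ⟦_⟧ (⟦_⟧ x Q) P
    ⟦∘⟧ x []      Q = ≈-refl
    ⟦∘⟧ x (a ∷ P) Q = ≈-trans (⟦+⟧ x (a ∷ []) (Q *ᴾ P ∘ᴾ Q)) (+-cong (≈-trans (+-cong ≈-refl (zeroʳ x)) (+-identityʳ _))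
      (≈-trans (⟦*⟧ x Q (P ∘ᴾ Q)) (*-cong ≈-refl (⟦∘⟧ x P Q))))

  private
    neg : ℕ → ℤ
    neg n = ℤ.- pos n

  odd : ℕ → ℕ
  odd zero    = 1
  odd (suc j) = suc (suc (odd j))

  -- The numbers a and b and the polynomials A and E with 2 pᵃ S 1 i = A(p) σᵇ + E(p).
  record Decomposition : Set where
    constructor decomposition
    field
      shift halfOrder degree : ℕ
      principal remainder    : Polynomial

    order : ℕ
    order = odd halfOrder

  open Decomposition

  -- The substitution of 1 - g for g fixes p and changes the sign of σ. The odd and the even part of
  -- a function of g under it give A(p) σᵇ with b odd and E(p); they add up to twice the function,
  -- whence the factor 2. The field `shift` is the order of the pole of `closedForm 1 i` at g = 1,
  -- where p has a simple zero.
  decompose : ℕ → Decomposition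
  decompose 0 = decomposition 1 0 1
    (neg 1 ∷ pos 4 ∷ [])
    (pos 1 ∷ [])
  decompose 1 = decomposition 3 0 2
    (pos 1 ∷ neg 4 ∷ pos 2 ∷ [])
    (neg 1 ∷ pos 2 ∷ [])
  decompose 2 = decomposition 6 1 4
    (pos 2 ∷ neg 26 ∷ pos 122 ∷ neg 243 ∷ pos 178 ∷ neg 22 ∷ [])
    (neg 2 ∷ pos 14 ∷ neg 26 ∷ pos 11 ∷ [])
  decompose 3 = decomposition 9 2 6
    (pos 11 ∷ neg 230 ∷ pos 1995 ∷ neg 9232 ∷ pos 24345 ∷ neg 36022 ∷ pos 27160 ∷ neg 8100 ∷ pos 404 ∷ [])
    (neg 11 ∷ pos 120 ∷ neg 465 ∷ pos 762 ∷ neg 485 ∷ pos 80 ∷ [])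
  decompose 4 = decomposition 12 3 8
    (pos 90 ∷ neg 2583 ∷ pos 32486 ∷ neg 234675 ∷ pos 1071808 ∷ neg 3208023 ∷ pos 6303704 ∷ neg 7908948 ∷ pos 5935356 ∷ neg
        2338656 ∷ pos 364476 ∷ neg 9190 ∷ [])
    (neg 90 ∷ pos 1323 ∷ neg 7664 ∷ pos 22169 ∷ neg 33442 ∷ pos 24955 ∷ neg 7778 ∷ pos 644 ∷ [])
  decompose 5 = decomposition 15 4 10
    (pos 931 ∷ neg 33918 ∷ pos 557822 ∷ neg 5466920 ∷ pos 35490261 ∷ neg 160419550 ∷ pos 516405006 ∷ neg 1189712300 ∷ pos
        1942280496 ∷ neg 2189739506 ∷ pos 1626609300 ∷ neg 734387812 ∷ pos 174322198 ∷ neg 16119792 ∷ pos 232316 ∷ [])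
    (neg 931 ∷ pos 17160 ∷ neg 131636 ∷ pos 544292 ∷ neg 1313139 ∷ pos 1869724 ∷ neg 1515024 ∷ pos 636440 ∷ neg 114012 ∷ pos 5418 ∷ [])
  decompose (suc (suc (suc (suc (suc (suc _)))))) = decomposition 0 0 0 [] []

  decompose-check : ∀ i → i ℕ.< 6 → let δ = decompose i in
    (polynomialᶠ ((pos 2 ∷ []) *ᴾ x−x² ^ᴾ shift δ) *ᶠ closedForm 1 i ==ᶠ
     fraction (principal δ ∘ᴾ x−x²) 0 (order δ) +ᶠ polynomialᶠ (remainder δ ∘ᴾ x−x²)) ≡ true
  decompose-check 0 _ = refl
  decompose-check 1 _ = refl
  decompose-check 2 _ = refl
  decompose-check 3 _ = refl
  decompose-check 4 _ = refl
  decompose-check 5 _ = refl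
  decompose-check (suc (suc (suc (suc (suc (suc _)))))) (s≤s (s≤s (s≤s (s≤s (s≤s (s≤s ()))))))

  module _ where

    open FractionEvaluation 𝔸 g c σ c-inverse σ-inverse
    open Evaluation 𝔸 g using (⟦_⟧; ⟦*⟧; ⟦^⟧)
    open Evaluation 𝔸 p using () renaming (⟦_⟧ to ⟦_⟧ₚ)

    pow-cong : ∀ {x y} → A._≈_ x y → ∀ n → A._≈_ (pow x n) (pow y n)
    pow-cong eq zero    = A.refl {A.1#}
    pow-cong eq (suc n) = A.*-cong eq (pow-cong eq n)

    at-p : ∀ P → A._≈_ ⟦ P ∘ᴾ x−x² ⟧ ⟦ P ⟧ₚ
    at-p P = A.trans (⟦∘⟧ 𝔸 g P x−x²) (⟦⟧-cong 𝔸 P g−g²)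

    two : A._≈_ ⟦ pos 2 ∷ [] ⟧ (Integers.ιℤ 𝔸 (pos 2))
    two = A.trans (A.+-cong (A.refl {Integers.ιℤ 𝔸 (pos 2)}) (A.zeroʳ g)) (A.+-identityʳ (Integers.ιℤ 𝔸 (pos 2)))

    S-decomposition : ∀ i → i ℕ.< 6 → let δ = decompose i in
      A._≈_ (Integers.ιℤ 𝔸 (pos 2) ⊛ pow p (shift δ) ⊛ S 1 i) (⟦ principal δ ⟧ₚ ⊛ pow σ (order δ) ⊕ ⟦ remainder δ ⟧ₚ)
    S-decomposition i i<6 = begin
      Integers.ιℤ 𝔸 (pos 2) ⊛ pow p (shift δ) ⊛ S 1 i
        ≈⟨ A.*-cong (A.sym (A.trans (⟦*⟧ (pos 2 ∷ []) (x−x² ^ᴾ shift δ))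
             (A.*-cong two (A.trans (⟦^⟧ x−x² (shift δ)) (pow-cong g−g² (shift δ)))))) (S-closed g c σ c-inverse σ-inverse g−g² 1 i i<6) ⟩
      ⟦ (pos 2 ∷ []) *ᴾ x−x² ^ᴾ shift δ ⟧ ⊛ ⟦ closedForm 1 i ⟧ᶠ
        ≈⟨ A.trans (⟦*ᶠ⟧ (polynomialᶠ factor) (closedForm 1 i)) (A.*-cong (⟦polynomialᶠ⟧ factor) (A.refl {⟦ closedForm 1 i ⟧ᶠ})) ⟨
      ⟦ polynomialᶠ factor *ᶠ closedForm 1 i ⟧ᶠ
        ≈⟨ ==ᶠ⇒≈ (polynomialᶠ factor *ᶠ closedForm 1 i) (fraction (principal δ ∘ᴾ x−x²) 0 (order δ) +ᶠ polynomialᶠ (remainder δ ∘ᴾ x−x²))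
             (decompose-check i i<6) ⟩
      ⟦ fraction (principal δ ∘ᴾ x−x²) 0 (order δ) +ᶠ polynomialᶠ (remainder δ ∘ᴾ x−x²) ⟧ᶠ
        ≈⟨ ⟦+ᶠ⟧ (fraction (principal δ ∘ᴾ x−x²) 0 (order δ)) (polynomialᶠ (remainder δ ∘ᴾ x−x²)) ⟩
      ⟦ principal δ ∘ᴾ x−x² ⟧ ⊛ (A.1# ⊛ pow σ (order δ)) ⊕ ⟦ polynomialᶠ (remainder δ ∘ᴾ x−x²) ⟧ᶠ
        ≈⟨ A.+-cong (A.*-cong (at-p (principal δ)) (A.*-identityˡ (pow σ (order δ))))
             (A.trans (⟦polynomialᶠ⟧ (remainder δ ∘ᴾ x−x²)) (at-p (remainder δ))) ⟩
      ⟦ principal δ ⟧ₚ ⊛ pow σ (order δ) ⊕ ⟦ remainder δ ⟧ₚ ∎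
      where
      δ : Decomposition
      δ = decompose i
      factor : Polynomial
      factor = (pos 2 ∷ []) *ᴾ x−x² ^ᴾ shift δ
      open import Relation.Binary.Reasoning.Setoid A.setoid

-- Coefficients of A(p) σᵇ as multiples of central binomial coefficients.

module CoefficientRatios where

  open ≡ using (refl; cong; cong₂; sym; trans)
  open WalkSums
  open RationalFunctions
  open RecursionSolution
  open CentralBinomial
  open BivariateSeries using (delay; pow-delay)
  open PoleExpansion

  open ℚ⟦p⟧ using (Series; _⊛_)
  open Sums 𝔸 using (pow)

  ℚ-ring : CommutativeRing 0ℓ 0ℓ
  ℚ-ring = ℚ.+-*-commutativeRing

  _at_ : Polynomial → ℚ → ℚ
  P at x = Evaluation.⟦_⟧ ℚ-ring x P

  _atₚ : Polynomial → Series
  P atₚ = Evaluation.⟦_⟧ 𝔸 p P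

  pow-p-⊛ : ∀ a X n → (pow p a ⊛ X) (a ℕ.+ n) ≡ X n
  pow-p-⊛ a X n = trans (pow-delay ℚ-ring (λ _ → ⊤) (λ _ _ → tt) a X (a ℕ.+ n)) (go a)
    where
    go : ∀ a → delay ℚ-ring a X (a ℕ.+ n) ≡ X n
    go zero    = refl
    go (suc a) = go a

  pow-p-⊛-low : ∀ a X n → n ℕ.< a → (pow p a ⊛ X) n ≡ 0ℚ
  pow-p-⊛-low a X n n<a = trans (pow-delay ℚ-ring (λ _ → ⊤) (λ _ _ → tt) a X n) (go a n n<a)
    where
    go : ∀ a n → n ℕ.< a → delay ℚ-ring a X n ≡ 0ℚ
    go (suc a) zero    _       = refl
    go (suc a) (suc n) (s≤s h) = go a n h

  integer-⊛ : ∀ a X n → (Integers.ιℤ 𝔸 a ⊛ X) n ≡ ℤℚ.ιℤ a ℚ.* X n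
  integer-⊛ (pos k)  X n = scalar k X n
  integer-⊛ -[1+ k ] X n = trans (trans (ℚ⟦p⟧.⊛-cong {a = A.- κ} {a′ = λ i → (ℚ.- 1ℚ) ℚ.* κ i} {b = X}
      (λ i → ℚ.neg-distribˡ-* 1ℚ (κ i) ⟨flip⟩ cong ℚ.-_ (sym (ℚ.*-identityˡ (κ i)))) (λ _ → refl) n)
      (trans (ℚ⟦p⟧.⊛-scaleˡ (ℚ.- 1ℚ) κ X n) (cong ((ℚ.- 1ℚ) ℚ.*_) (scalar (suc k) X n))))
    (SQ.solve 2 (λ i x → SQ.con (ℤ.- pos 1) SQ.:* (i SQ.:* x) SQ.:= (SQ.:- i) SQ.:* x) refl (ι (suc k)) (X n))
    where
    κ : Series
    κ = Integers.ιℤ 𝔸 (pos (suc k))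
    _⟨flip⟩_ : ∀ {x y z : ℚ} → y ≡ z → x ≡ y → x ≡ z
    p ⟨flip⟩ q = trans q p

  polynomial-⊛-zero : ∀ a P X → ((a ∷ P) atₚ ⊛ X) 0 ≡ ℤℚ.ιℤ a ℚ.* X 0
  polynomial-⊛-zero a P X = trans (ℚ⟦p⟧.⊛-distribʳ (Integers.ιℤ 𝔸 a) (p ⊛ P atₚ) X 0) (trans (cong₂ ℚ._+_ (integer-⊛ a X 0)
    (trans (cong (ℚ._* X 0) (ℚ⟦p⟧.variable-⊛-zero (P atₚ))) (ℚ.*-zeroˡ (X 0)))) (ℚ.+-identityʳ _))

  polynomial-⊛-suc : ∀ a P X n → ((a ∷ P) atₚ ⊛ X) (suc n) ≡ ℤℚ.ιℤ a ℚ.* X (suc n) ℚ.+ (P atₚ ⊛ X) n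
  polynomial-⊛-suc a P X n = trans (ℚ⟦p⟧.⊛-distribʳ (Integers.ιℤ 𝔸 a) (p ⊛ P atₚ) X (suc n)) (cong₂ ℚ._+_ (integer-⊛ a X (suc n))
    (trans (ℚ⟦p⟧.⊛-assoc p (P atₚ) X (suc n)) (ℚ⟦p⟧.variable-⊛-suc (P atₚ ⊛ X) n)))

  polynomial-high : ∀ P n → List.length P ℕ.≤ n → (P atₚ) n ≡ 0ℚ
  polynomial-high []      n       _       = refl
  polynomial-high (a ∷ P) (suc n) (s≤s h) = trans (sym (A.*-identityʳ ((a ∷ P) atₚ) (suc n) tt)) (trans (polynomial-⊛-suc a P A.1# n)
    (trans (cong₂ ℚ._+_ (ℚ.*-zeroʳ (ℤℚ.ιℤ a)) (trans (A.*-identityʳ (P atₚ) n tt) (polynomial-high P n h))) refl))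

  x−1 : Polynomial
  x−1 = ℤ.- pos 1 ∷ pos 1 ∷ []

  -- The coefficients of a series X with (n + 1) X (n + 1) = (4 n + 2 b) X n can be
  -- expressed by one of them: denominator b (length A) times [A(p) X] n is
  -- numerator b A times X n, both polynomials being evaluated at n.
  denominator : ℕ → ℕ → Polynomial
  denominator b zero          = pos 1 ∷ []
  denominator b (suc zero)    = pos 1 ∷ []
  denominator b (suc (suc l)) = denominator b (suc l) ∘ᴾ x−1 *ᴾ (pos (2 ℕ.* b) ℤ.- pos 4 ∷ pos 4 ∷ [])

  numerator : ℕ → Polynomial → Polynomial
  numerator b []              = []
  numerator b (a ∷ [])        = a ∷ []
  numerator b (a ∷ A@(_ ∷ _)) = a ·ᴾ denominator b (List.length (a ∷ A)) +ᴾ (pos 0 ∷ numerator b A ∘ᴾ x−1)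

  module _ {x : ℚ} where

    open Evaluation ℚ-ring x public using (⟦+⟧; ⟦*⟧; ⟦·⟧)

  at-x−1 : ∀ P n → (P ∘ᴾ x−1) at ι (suc n) ≡ P at ι n
  at-x−1 P n = trans (⟦∘⟧ ℚ-ring (ι (suc n)) P x−1) (⟦⟧-cong ℚ-ring P
    (SQ.solve 1 (λ n → (SQ.con (ℤ.- pos 1)) SQ.:+ (SQ.con (pos 1) SQ.:+ n) SQ.:*
        (SQ.con (pos 1) SQ.:+ (SQ.con (pos 1) SQ.:+ n) SQ.:* SQ.con (pos 0)) SQ.:= n) refl (ι n)))

  module _ (b : ℕ) (X : Series) (ratio : ∀ n → ι (suc n) ℚ.* X (suc n) ≡ (ι 4 ℚ.* ι n ℚ.+ ι (2 ℕ.* b)) ℚ.* X n) where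

    linear : ∀ n → (pos (2 ℕ.* b) ℤ.- pos 4 ∷ pos 4 ∷ []) at ι (suc n) ≡ ι 4 ℚ.* ι n ℚ.+ ι (2 ℕ.* b)
    linear n = trans (cong (ℚ._+ ι (suc n) ℚ.* (ι 4 ℚ.+ ι (suc n) ℚ.* 0ℚ)) (trans (ℤℚ.ιℤ-+ (pos (2 ℕ.* b)) (ℤ.- pos 4)) refl))
      (SQ.solve 2 (λ b n → (b SQ.:+ SQ.con (ℤ.- pos 4)) SQ.:+ (SQ.con (pos 1) SQ.:+ n) SQ.:*
          (SQ.con (pos 4) SQ.:+ (SQ.con (pos 1) SQ.:+ n) SQ.:* SQ.con (pos 0)) SQ.:=
        SQ.con (pos 4) SQ.:* n SQ.:+ b) refl (ι (2 ℕ.* b)) (ι n))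

    -- The coefficients are traced back to the last one, by n X n = (4 n - 4 + 2 b) X (n - 1). The
    -- linear factors on the right collect in the denominator, the factors n in the numerator.
    ratio-sum : ∀ P n → denominator b (List.length P) at ι n ℚ.* (P atₚ ⊛ X) n ≡ numerator b P at ι n ℚ.* X n
    ratio-sum []       n = trans (cong (denominator b 0 at ι n ℚ.*_) (ℚ⟦p⟧.⊛-zeroˡ X (λ _ → refl) n))
        (trans (ℚ.*-zeroʳ (denominator b 0 at ι n)) (sym (ℚ.*-zeroˡ (X n))))
    ratio-sum (a ∷ []) n = trans (cong (denominator b 1 at ι n ℚ.*_) (trans
        (ℚ⟦p⟧.⊛-cong {b = X} (λ i → A.trans (A.+-cong (A.refl {Integers.ιℤ 𝔸 a}) (A.zeroʳ p))
            (A.+-identityʳ (Integers.ιℤ 𝔸 a)) i tt) (λ _ → refl) n) (integer-⊛ a X n)))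
      (SQ.solve 3 (λ a n x → (SQ.con (pos 1) SQ.:+ n SQ.:* SQ.con (pos 0)) SQ.:* (a SQ.:* x) SQ.:=
          (a SQ.:+ n SQ.:* SQ.con (pos 0)) SQ.:* x) refl (ℤℚ.ιℤ a) (ι n) (X n))
    -- There is no coefficient before index 0; correspondingly the tail of the numerator carries the
    -- factor n, which is 0 here.
    ratio-sum (a ∷ P@(_ ∷ _)) zero = begin
      D ℚ.* ((a ∷ P) atₚ ⊛ X) 0                          ≡⟨ cong (D ℚ.*_) (polynomial-⊛-zero a P X) ⟩
      D ℚ.* (ℤℚ.ιℤ a ℚ.* X 0)                            ≡⟨ SQ.solve 4
          (λ d a x m → d SQ.:* (a SQ.:* x) SQ.:= (a SQ.:* d SQ.:+ (SQ.con (pos 0) SQ.:+ SQ.con (pos 0) SQ.:* m)) SQ.:* x) refl D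
          (ℤℚ.ιℤ a) (X 0) M ⟩
      (ℤℚ.ιℤ a ℚ.* D ℚ.+ (0ℚ ℚ.+ 0ℚ ℚ.* M)) ℚ.* X 0      ≡⟨ cong (ℚ._* X 0) (unfold 0) ⟨
      numerator b (a ∷ P) at ι 0 ℚ.* X 0                 ∎
      where
      open ≡-Reasoning
      D M : ℚ
      D = denominator b (List.length (a ∷ P)) at ι 0
      M = (numerator b P ∘ᴾ x−1) at ι 0
      unfold : ∀ n → numerator b (a ∷ P) at ι n ≡ ℤℚ.ιℤ a ℚ.* denominator b (List.length (a ∷ P)) at ι n ℚ.+
          (0ℚ ℚ.+ ι n ℚ.* (numerator b P ∘ᴾ x−1) at ι n)
      unfold n = trans (⟦+⟧ (a ·ᴾ denominator b (List.length (a ∷ P))) (pos 0 ∷ numerator b P ∘ᴾ x−1))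
          (cong₂ ℚ._+_ (⟦·⟧ a (denominator b (List.length (a ∷ P)))) refl)
    ratio-sum (a ∷ P@(_ ∷ _)) (suc n) = begin
      D ℚ.* ((a ∷ P) atₚ ⊛ X) (suc n)                                              ≡⟨ cong (D ℚ.*_) (polynomial-⊛-suc a P X n) ⟩
      D ℚ.* (ℤℚ.ιℤ a ℚ.* X (suc n) ℚ.+ (P atₚ ⊛ X) n)                              ≡⟨ SQ.solve 4
          (λ d a x y → d SQ.:* (a SQ.:* x SQ.:+ y) SQ.:= a SQ.:* d SQ.:* x SQ.:+ d SQ.:* y) refl D (ℤℚ.ιℤ a) (X (suc n)) ((P atₚ ⊛ X) n) ⟩
      ℤℚ.ιℤ a ℚ.* D ℚ.* X (suc n) ℚ.+ D ℚ.* (P atₚ ⊛ X) n                          ≡⟨ cong (ℤℚ.ιℤ a ℚ.* D ℚ.* X (suc n) ℚ.+_) tail-sum ⟩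
      ℤℚ.ιℤ a ℚ.* D ℚ.* X (suc n) ℚ.+ M ℚ.* (ι (suc n) ℚ.* X (suc n))              ≡⟨ SQ.solve 5
          (λ a d x m n → a SQ.:* d SQ.:* x SQ.:+ m SQ.:* (n SQ.:* x) SQ.:=
          (a SQ.:* d SQ.:+ (SQ.con (pos 0) SQ.:+ n SQ.:* m)) SQ.:* x) refl (ℤℚ.ιℤ a) D (X (suc n)) M (ι (suc n)) ⟩
      (ℤℚ.ιℤ a ℚ.* D ℚ.+ (0ℚ ℚ.+ ι (suc n) ℚ.* M)) ℚ.* X (suc n)                   ≡⟨ cong (ℚ._* X (suc n))
          (trans (⟦+⟧ (a ·ᴾ denominator b (List.length (a ∷ P))) (pos 0 ∷ numerator b P ∘ᴾ x−1))
          (cong₂ ℚ._+_ (⟦·⟧ a (denominator b (List.length (a ∷ P)))) refl)) ⟨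
      numerator b (a ∷ P) at ι (suc n) ℚ.* X (suc n)                               ∎
      where
      open ≡-Reasoning
      D M L : ℚ
      D = denominator b (List.length (a ∷ P)) at ι (suc n)
      M = (numerator b P ∘ᴾ x−1) at ι (suc n)
      L = ι 4 ℚ.* ι n ℚ.+ ι (2 ℕ.* b)
      tail-sum : D ℚ.* (P atₚ ⊛ X) n ≡ M ℚ.* (ι (suc n) ℚ.* X (suc n))
      tail-sum = begin
        D ℚ.* (P atₚ ⊛ X) n
          ≡⟨ cong (ℚ._* (P atₚ ⊛ X) n) (trans (⟦*⟧ (denominator b (List.length P) ∘ᴾ x−1) _)
              (cong₂ ℚ._*_ (at-x−1 (denominator b (List.length P)) n) (linear n))) ⟩
        denominator b (List.length P) at ι n ℚ.* L ℚ.* (P atₚ ⊛ X) n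
          ≡⟨ SQ.solve 3 (λ d l y → d SQ.:* l SQ.:* y SQ.:= l SQ.:* (d SQ.:* y)) refl (denominator b (List.length P) at ι n) L
              ((P atₚ ⊛ X) n) ⟩
        L ℚ.* (denominator b (List.length P) at ι n ℚ.* (P atₚ ⊛ X) n)
          ≡⟨ cong (L ℚ.*_) (ratio-sum P n) ⟩
        L ℚ.* (numerator b P at ι n ℚ.* X n)
          ≡⟨ SQ.solve 3 (λ d l y → l SQ.:* (d SQ.:* y) SQ.:= d SQ.:* (l SQ.:* y)) refl (numerator b P at ι n) L (X n) ⟩
        numerator b P at ι n ℚ.* (L ℚ.* X n)
          ≡⟨ cong₂ ℚ._*_ (sym (at-x−1 (numerator b P) n)) (sym (ratio n)) ⟩
        M ℚ.* (ι (suc n) ℚ.* X (suc n)) ∎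

  -- The coefficient form of (1 - 4 p) θ(σᵇ) = 2 b p σᵇ.
  σ^-ratio : ∀ b n → ι (suc n) ℚ.* pow σ b (suc n) ≡ (ι 4 ℚ.* ι n ℚ.+ ι (2 ℕ.* b)) ℚ.* pow σ b n
  σ^-ratio b n = begin
    Y (suc n)
      ≡⟨ SQ.solve 2 (λ y z → y SQ.:= y SQ.:+ (SQ.:- (SQ.con (pos 4) SQ.:* z)) SQ.:+ SQ.con (pos 4) SQ.:* z) refl (Y (suc n)) (Y n) ⟩
    Y (suc n) ℚ.+ ℚ.- (ι 4 ℚ.* Y n) ℚ.+ ι 4 ℚ.* Y n
      ≡⟨ cong (ℚ._+ ι 4 ℚ.* Y n) (trans (sym left) (trans (dθσ^ b (suc n) tt) right)) ⟩
    ι 2 ℚ.* (ι b ℚ.* X n) ℚ.+ ι 4 ℚ.* (ι n ℚ.* X n)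
      ≡⟨ trans (SQ.solve 4 (λ b n x t → t SQ.:* (b SQ.:* x) SQ.:+ SQ.con (pos 4) SQ.:* (n SQ.:* x) SQ.:=
          (SQ.con (pos 4) SQ.:* n SQ.:+ t SQ.:* b) SQ.:* x) refl (ι b) (ι n) (X n) (ι 2))
           (cong (λ t → (ι 4 ℚ.* ι n ℚ.+ t) ℚ.* X n) (sym (ιℚ.ι-* 2 b))) ⟩
    (ι 4 ℚ.* ι n ℚ.+ ι (2 ℕ.* b)) ℚ.* X n ∎
    where
    open ≡-Reasoning
    X Y : Series
    X = pow σ b
    Y = θ X
    left : (d ⊛ Y) (suc n) ≡ Y (suc n) ℚ.+ ℚ.- (ι 4 ℚ.* Y n)
    left = trans (SA.solve 2 (λ p y → (SA.con (pos 1) SA.:- SA.con (pos 4) SA.:* p) SA.:* y SA.:= y SA.:- SA.con (pos 4) SA.:*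
        (p SA.:* y)) A.refl p Y (suc n) tt)
      (cong (λ t → Y (suc n) ℚ.+ ℚ.- t) (trans (scalar 4 (p ⊛ Y) (suc n)) (cong (ι 4 ℚ.*_) (ℚ⟦p⟧.variable-⊛-suc Y n))))
    right : (Integers.ιℤ 𝔸 (pos 2) ⊛ (Integers.ιℤ 𝔸 (pos b) ⊛ (p ⊛ X))) (suc n) ≡ ι 2 ℚ.* (ι b ℚ.* X n)
    right = trans (scalar 2 (Integers.ιℤ 𝔸 (pos b) ⊛ (p ⊛ X)) (suc n)) (cong (ι 2 ℚ.*_)
      (trans (scalar b (p ⊛ X) (suc n)) (cong (ι b ℚ.*_) (ℚ⟦p⟧.variable-⊛-suc X n))))

  doubleFactorial : ℕ → ℕ
  doubleFactorial zero    = 1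
  doubleFactorial (suc j) = odd j ℕ.* doubleFactorial j

  rising : ℕ → Polynomial
  rising zero    = pos 1 ∷ []
  rising (suc j) = rising j *ᴾ (pos (odd j) ∷ pos 2 ∷ [])

  -- By `σ^-raise`, passing from exponent 2 i + 1 to 2 i + 3 multiplies coefficient `n` by (2 i + 1
  -- + 2 n) / (2 i + 1).
  σ^-odd : ∀ j n → ι (doubleFactorial j) ℚ.* pow σ (odd j) n ≡ rising j at ι n ℚ.* β n
  σ^-odd zero    n = trans (cong (ι 1 ℚ.*_) (A.*-identityʳ σ n tt))
    (SQ.solve 2 (λ n x → SQ.con (pos 1) SQ.:* x SQ.:= (SQ.con (pos 1) SQ.:+ n SQ.:* SQ.con (pos 0)) SQ.:* x) refl (ι n) (β n))
  σ^-odd (suc j) n = begin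
    ι (odd j ℕ.* doubleFactorial j) ℚ.* pow σ (suc (suc (odd j))) n
      ≡⟨ cong (ℚ._* pow σ (suc (suc (odd j))) n) (trans (ιℚ.ι-* (odd j) (doubleFactorial j))
          (ℚ.*-comm (ι (odd j)) (ι (doubleFactorial j)))) ⟩
    ι (doubleFactorial j) ℚ.* ι (odd j) ℚ.* pow σ (suc (suc (odd j))) n
      ≡⟨ trans (ℚ.*-assoc (ι (doubleFactorial j)) (ι (odd j)) _) (cong (ι (doubleFactorial j) ℚ.*_) (σ^-raise (odd j) n)) ⟩
    ι (doubleFactorial j) ℚ.* ((ι (odd j) ℚ.+ ι 2 ℚ.* ι n) ℚ.* pow σ (odd j) n)
      ≡⟨ SQ.solve 3 (λ f o x → f SQ.:* (o SQ.:* x) SQ.:= o SQ.:* (f SQ.:* x)) refl (ι (doubleFactorial j))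
          (ι (odd j) ℚ.+ ι 2 ℚ.* ι n) (pow σ (odd j) n) ⟩
    (ι (odd j) ℚ.+ ι 2 ℚ.* ι n) ℚ.* (ι (doubleFactorial j) ℚ.* pow σ (odd j) n)
      ≡⟨ cong ((ι (odd j) ℚ.+ ι 2 ℚ.* ι n) ℚ.*_) (σ^-odd j n) ⟩
    (ι (odd j) ℚ.+ ι 2 ℚ.* ι n) ℚ.* (rising j at ι n ℚ.* β n)
      ≡⟨ SQ.solve 4 (λ o n r b → (o SQ.:+ SQ.con (pos 2) SQ.:* n) SQ.:* (r SQ.:* b) SQ.:= r SQ.:*
          (o SQ.:+ n SQ.:* (SQ.con (pos 2) SQ.:+ n SQ.:* SQ.con (pos 0))) SQ.:* b) refl (ι (odd j)) (ι n) (rising j at ι n) (β n) ⟩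
    rising j at ι n ℚ.* ((pos (odd j) ∷ pos 2 ∷ []) at ι n) ℚ.* β n
      ≡⟨ cong (ℚ._* β n) (⟦*⟧ {ι n} (rising j) (pos (odd j) ∷ pos 2 ∷ [])) ⟨
    rising (suc j) at ι n ℚ.* β n ∎
    where open ≡-Reasoning

  -- Coefficient n + 1 of g = (1 - (1 - 4 p) σ) / 2. In this form, in place of `β n` divided by n +
  -- 1, combinations of Catalan numbers are again coefficients of a polynomial in p times σ.
  catalan : ℕ → ℚ
  catalan n = ½ ℚ.* (ι 4 ℚ.* β n ℚ.- β (suc n))

  catalanSum : List ℤ → ℕ → ℚ
  catalanSum []       ℓ = 0ℚ
  catalanSum (a ∷ as) ℓ = ℤℚ.ιℤ a ℚ.* catalan ℓ ℚ.+ catalanSum as (suc ℓ)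

  xᴾ : Polynomial
  xᴾ = pos 0 ∷ pos 1 ∷ []

  -- The polynomial A for which catalanSum as ℓ is half the coefficient of p ^ (ℓ + D) in A(p) σ.
  catalanPolynomial : List ℤ → ℕ → Polynomial
  catalanPolynomial []       D       = []
  catalanPolynomial (a ∷ as) zero    = []
  catalanPolynomial (a ∷ as) (suc D) = catalanPolynomial as D +ᴾ xᴾ ^ᴾ D *ᴾ (ℤ.- a ∷ pos 4 ℤ.* a ∷ [])

  -- Each Catalan number is half of a coefficient of (4 p - 1) σ, one index further on. Suitable
  -- powers of p bring the indices ℓ + 1, ℓ + 2 and so on to the common index ℓ + D.
  catalanPolynomial-sum : ∀ as D ℓ → List.length as ℕ.≤ D → (catalanPolynomial as D atₚ ⊛ σ) (ℓ ℕ.+ D) ≡ ι 2 ℚ.* catalanSum as ℓ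
  catalanPolynomial-sum []       D       ℓ _       = trans (ℚ⟦p⟧.⊛-zeroˡ σ (λ _ → refl) (ℓ ℕ.+ D)) refl
  catalanPolynomial-sum (a ∷ as) (suc D) ℓ (s≤s h) = begin
    (catalanPolynomial (a ∷ as) (suc D) atₚ ⊛ σ) (ℓ ℕ.+ suc D)
      ≡⟨ cong (catalanPolynomial (a ∷ as) (suc D) atₚ ⊛ σ) (trans (ℕ.+-suc ℓ D) (cong suc refl)) ⟩
    (catalanPolynomial (a ∷ as) (suc D) atₚ ⊛ σ) (suc ℓ ℕ.+ D)
      ≡⟨ A.trans (A.*-cong (E.⟦+⟧ (catalanPolynomial as D) _) (A.refl {σ})) (A.distribʳ σ (catalanPolynomial as D atₚ) _) (suc ℓ ℕ.+ D) tt ⟩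
    (catalanPolynomial as D atₚ ⊛ σ) (suc ℓ ℕ.+ D) ℚ.+ ((xᴾ ^ᴾ D *ᴾ Q) atₚ ⊛ σ) (suc ℓ ℕ.+ D)
      ≡⟨ cong₂ ℚ._+_ (catalanPolynomial-sum as D (suc ℓ) h) (trans first (solution a)) ⟩
    ι 2 ℚ.* catalanSum as (suc ℓ) ℚ.+ ι 2 ℚ.* (ℤℚ.ιℤ a ℚ.* catalan ℓ)
      ≡⟨ SQ.solve 3 (λ t x y → t SQ.:* x SQ.:+ t SQ.:* y SQ.:= t SQ.:* (y SQ.:+ x)) refl (ι 2) (catalanSum as (suc ℓ))
          (ℤℚ.ιℤ a ℚ.* catalan ℓ) ⟩
    ι 2 ℚ.* catalanSum (a ∷ as) ℓ ∎
    where
    open ≡-Reasoning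
    module E = Evaluation 𝔸 p
    Q : Polynomial
    Q = ℤ.- a ∷ pos 4 ℤ.* a ∷ []
    first : ((xᴾ ^ᴾ D *ᴾ Q) atₚ ⊛ σ) (suc ℓ ℕ.+ D) ≡ (Q atₚ ⊛ σ) (suc ℓ)
    first = trans (A.trans (A.*-cong (A.trans (E.⟦*⟧ (xᴾ ^ᴾ D) Q)
        (A.*-cong (A.trans (E.⟦^⟧ xᴾ D) (pow-cong x≈p D)) (A.refl {Q atₚ}))) (A.refl {σ}))
        (A.*-assoc (pow p D) (Q atₚ) σ) (suc ℓ ℕ.+ D) tt)
      (trans (cong (pow p D ⊛ (Q atₚ ⊛ σ)) (ℕ.+-comm (suc ℓ) D)) (pow-p-⊛ D (Q atₚ ⊛ σ) (suc ℓ)))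
      where
      x≈p : A._≈_ (xᴾ atₚ) p
      x≈p = SA.solve 1 (λ p → SA.con (pos 0) SA.:+ p SA.:* (SA.con (pos 1) SA.:+ p SA.:* SA.con (pos 0)) SA.:= p) A.refl p
    solution : ∀ a → ((ℤ.- a ∷ pos 4 ℤ.* a ∷ []) atₚ ⊛ σ) (suc ℓ) ≡ ι 2 ℚ.* (ℤℚ.ιℤ a ℚ.* catalan ℓ)
    solution a = begin
      ((ℤ.- a ∷ pos 4 ℤ.* a ∷ []) atₚ ⊛ σ) (suc ℓ)
        ≡⟨ trans (polynomial-⊛-suc (ℤ.- a) (pos 4 ℤ.* a ∷ []) σ ℓ) (cong₂ ℚ._+_ (cong (ℚ._* β (suc ℓ)) (ℤℚ.ιℤ-neg a)) constant) ⟩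
      ℚ.- ℤℚ.ιℤ a ℚ.* β (suc ℓ) ℚ.+ ι 4 ℚ.* ℤℚ.ιℤ a ℚ.* β ℓ
        ≡⟨ SQ.solve 3 (λ a b c → (SQ.:- a) SQ.:* b SQ.:+ SQ.con (pos 4) SQ.:* a SQ.:* c SQ.:= SQ.con (pos 1) SQ.:*
            (a SQ.:* (SQ.con (pos 4) SQ.:* c SQ.:- b))) refl (ℤℚ.ιℤ a) (β (suc ℓ)) (β ℓ) ⟩
      ι 2 ℚ.* ½ ℚ.* (ℤℚ.ιℤ a ℚ.* (ι 4 ℚ.* β ℓ ℚ.- β (suc ℓ)))
        ≡⟨ SQ.solve 4 (λ t h a x → t SQ.:* h SQ.:* (a SQ.:* x) SQ.:= t SQ.:* (a SQ.:* (h SQ.:* x))) refl (ι 2) ½ (ℤℚ.ιℤ a)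
            (ι 4 ℚ.* β ℓ ℚ.- β (suc ℓ)) ⟩
      ι 2 ℚ.* (ℤℚ.ιℤ a ℚ.* catalan ℓ) ∎
      where
      constant : ((pos 4 ℤ.* a ∷ []) atₚ ⊛ σ) ℓ ≡ ι 4 ℚ.* ℤℚ.ιℤ a ℚ.* β ℓ
      constant = trans (A.*-cong {u = σ} (A.trans (A.+-cong (A.refl {Integers.ιℤ 𝔸 (pos 4 ℤ.* a)}) (A.zeroʳ p))
          (A.+-identityʳ (Integers.ιℤ 𝔸 (pos 4 ℤ.* a)))) (A.refl {σ}) ℓ tt)
        (trans (integer-⊛ (pos 4 ℤ.* a) σ ℓ) (cong (ℚ._* β ℓ) (ℤℚ.ιℤ-* (pos 4) a)))

-- Catalan numbers, and the even powers of f as polynomials in ℓ.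

module DilationPowers where

  open ≡ using (refl; cong; cong₂; sym; trans)
  open WalkSums
  open RationalFunctions
  open ClosedForms
  open RecursionSolution
  open CentralBinomial
  open PoleExpansion
  open CoefficientRatios

  open ℚ⟦p⟧ using (Series; _⊛_)
  open Sums 𝔸 using (pow)

  catalan-β : ∀ n → ι (suc n) ℚ.* catalan n ≡ β n
  catalan-β n = begin
    ι (suc n) ℚ.* (½ ℚ.* (ι 4 ℚ.* β n ℚ.- β (suc n)))
      ≡⟨ solve 4 (λ i h b b′ → (con (pos 1) :+ i) :* (h :* (con (pos 4) :* b :- b′)) := h :*
          (con (pos 4) :* (con (pos 1) :+ i) :* b :- (con (pos 1) :+ i) :* b′)) refl (ι n) ½ (β n) (β (suc n)) ⟩
    ½ ℚ.* (ι 4 ℚ.* ι (suc n) ℚ.* β n ℚ.- ι (suc n) ℚ.* β (suc n))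
      ≡⟨ cong (λ t → ½ ℚ.* (ι 4 ℚ.* ι (suc n) ℚ.* β n ℚ.- t)) (β-suc n) ⟩
    ½ ℚ.* (ι 4 ℚ.* ι (suc n) ℚ.* β n ℚ.- (ι 4 ℚ.* ι n ℚ.+ ι 2) ℚ.* β n)
      ≡⟨ solve 3 (λ i h b → h :* (con (pos 4) :* (con (pos 1) :+ i) :* b :- (con (pos 4) :* i :+ con (pos 2)) :* b) :=
          (con (pos 2) :* h) :* b) refl (ι n) ½ (β n) ⟩
    ι 2 ℚ.* ½ ℚ.* β n
      ≡⟨ ℚ.*-identityˡ (β n) ⟩
    β n ∎
    where
    open ≡-Reasoning
    open SQ using (solve; _:=_; _:+_; _:*_; _:-_; con)

  catalan-suc : ∀ n → ι (suc (suc n)) ℚ.* catalan (suc n) ≡ (ι 4 ℚ.* ι n ℚ.+ ι 2) ℚ.* catalan n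
  catalan-suc n = trans (catalan-β (suc n)) (ι-cancel n (trans (β-suc n) (trans
    (cong ((ι 4 ℚ.* ι n ℚ.+ ι 2) ℚ.*_) (sym (catalan-β n)))
    (solve 3 (λ l i c → l :* (i :* c) := i :* (l :* c)) refl (ι 4 ℚ.* ι n ℚ.+ ι 2) (ι (suc n)) (catalan n)))))
    where open SQ using (solve; _:=_; _:*_)

  catalan-zero : catalan 0 ≡ 1ℚ
  catalan-zero = ι-cancel 0 (trans (catalan-β 0) β-zero)

  -- The coefficients of f, of 1024 f² and of 122880 f ^ (2 ℓ), the last ones as polynomials in ℓ.
  fSeries : Series
  fSeries 0 = 1ℚ
  fSeries 1 = ½
  fSeries 2 = pos 3 ℚ./ 8
  fSeries 3 = pos 29 ℚ./ 16
  fSeries 4 = pos 1987 ℚ./ 128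
  fSeries 5 = pos 47247 ℚ./ 256
  fSeries _ = 0ℚ

  fSquare : ℕ → ℕ
  fSquare 0 = 1024
  fSquare 1 = 1024
  fSquare 2 = 1024
  fSquare 3 = 4096
  fSquare 4 = 33792
  fSquare 5 = 395264
  fSquare _ = 0

  fPower : ℕ → Polynomial
  fPower 0 = pos 122880 ∷ []
  fPower 1 = pos 0 ∷ pos 122880 ∷ []
  fPower 2 = pos 0 ∷ pos 61440 ∷ pos 61440 ∷ []
  fPower 3 = pos 0 ∷ pos 409600 ∷ pos 61440 ∷ pos 20480 ∷ []
  fPower 4 = pos 0 ∷ pos 3594240 ∷ pos 424960 ∷ pos 30720 ∷ pos 5120 ∷ []
  fPower 5 = pos 0 ∷ pos 43401216 ∷ pos 3799040 ∷ pos 220160 ∷ pos 10240 ∷ pos 1024 ∷ []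
  fPower _ = []

  module Rᴾ = Recursion _+ᴾ_ _*ᴾ_ (λ n → pos n ∷ [])
  module Rℚ = Recursion ℚ._+_ ℚ._*_ ι

  at-conv : ∀ x X Y n → Rᴾ.conv X Y n at x ≡ Rℚ.conv (λ i → X i at x) (λ i → Y i at x) n
  at-conv x X Y zero    = ⟦*⟧ {x} (X 0) (Y 0)
  at-conv x X Y (suc n) = trans (⟦+⟧ {x} (X 0 *ᴾ Y (suc n)) _) (cong₂ ℚ._+_ (⟦*⟧ {x} (X 0) (Y (suc n))) (at-conv x (λ i → X (suc i)) Y n))

  conv-⊛ : ∀ X Y n → Rℚ.conv X Y n ≡ (X ⊛ Y) n
  conv-⊛ X Y zero    = refl
  conv-⊛ X Y (suc n) = cong (X 0 ℚ.* Y (suc n) ℚ.+_) (conv-⊛ (λ i → X (suc i)) Y n)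

  conv-scale : ∀ x y n {X X′ Y Y′} → (∀ i → i ℕ.≤ n → X′ i ≡ x ℚ.* X i) → (∀ i → i ℕ.≤ n → Y′ i ≡ y ℚ.* Y i) →
               Rℚ.conv X′ Y′ n ≡ x ℚ.* y ℚ.* Rℚ.conv X Y n
  conv-scale x y zero    {X} {X′} {Y} {Y′} p q = trans (cong₂ ℚ._*_ (p 0 z≤n) (q 0 z≤n))
    (solve 4 (λ x y a b → x :* a :* (y :* b) := x :* y :* (a :* b)) refl x y (X 0) (Y 0))
    where open SQ using (solve; _:=_; _:*_)
  conv-scale x y (suc n) {X} {X′} {Y} {Y′} p q = trans (cong₂ ℚ._+_ (cong₂ ℚ._*_ (p 0 z≤n) (q (suc n) ℕ.≤-refl))
      (conv-scale x y n (λ i h → p (suc i) (s≤s h)) (λ i h → q i (ℕ.m≤n⇒m≤1+n h))))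
    (solve 5 (λ x y a b c → x :* a :* (y :* b) :+ x :* y :* c := x :* y :* (a :* b :+ c)) refl x y (X 0) (Y (suc n))
        (Rℚ.conv (λ i → X (suc i)) Y n))
    where open SQ using (solve; _:=_; _:*_; _:+_)

  x+ : ℕ → Polynomial
  x+ k = pos k ∷ pos 1 ∷ []

  at-x+ : ∀ P k n → (P ∘ᴾ x+ k) at ι n ≡ P at ι (n ℕ.+ k)
  at-x+ P k n = trans (⟦∘⟧ ℚ-ring (ι n) P (x+ k)) (⟦⟧-cong ℚ-ring P (trans
    (SQ.solve 2 (λ k n → k SQ.:+ n SQ.:* (SQ.con (pos 1) SQ.:+ n SQ.:* SQ.con (pos 0)) SQ.:= n SQ.:+ k) refl (ι k) (ι n))
        (sym (ιℚ.ι-+ n k))))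

  equalᴾ : Polynomial → Polynomial → Bool
  equalᴾ P Q = isZero (P +ᴾ ℤ.- pos 1 ·ᴾ Q)

  equal-at : ∀ P Q → equalᴾ P Q ≡ true → ∀ x → P at x ≡ Q at x
  equal-at P Q h x = Evaluation.equal⇒≈ ℚ-ring x P Q h

  toℚᵘ-ι : ∀ n → ℚ.toℚᵘ (ι n) ℚᵘ.≃ ℚᵘ.mkℚᵘ (pos n) 0
  toℚᵘ-ι zero    = ℚᵘ.≃-refl
  toℚᵘ-ι (suc n) = ℚᵘ.≃-trans (ℚ.toℚᵘ-homo-+ 1ℚ (ι n)) (ℚᵘ.≃-trans (ℚᵘ.+-congʳ ℚᵘ.1ℚᵘ (toℚᵘ-ι n))
    (ℚᵘ.*≡* (cong (λ k → (pos 1 ℤ.+ k) ℤ.* pos 1) (ℤ.*-identityʳ (pos n)))))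

  ι≡/1 : ∀ n → ι n ≡ pos n ℚ./ 1
  ι≡/1 n = ℚ.toℚᵘ-injective (ℚᵘ.≃-trans (toℚᵘ-ι n) (ℚᵘ.≃-sym (ℚ.toℚᵘ-fromℚᵘ (ℚᵘ.mkℚᵘ (pos n) 0))))

  ιℤ≡/1 : ∀ a → ℤℚ.ιℤ a ≡ a ℚ./ 1
  ιℤ≡/1 (pos n)    = ι≡/1 n
  ιℤ≡/1 -[1+ n ]   = cong ℚ.-_ (ι≡/1 (suc n))

  fSquare-value : ∀ i → i ℕ.< 6 → pos (fSquare i) ℚ./ 1 ≡ (pos 1024 ℚ./ 1) ℚ.* Rℚ.conv fSeries fSeries i
  fSquare-value 0 _ = refl
  fSquare-value 1 _ = refl
  fSquare-value 2 _ = refl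
  fSquare-value 3 _ = refl
  fSquare-value 4 _ = refl
  fSquare-value 5 _ = refl
  fSquare-value (suc (suc (suc (suc (suc (suc _)))))) (s≤s (s≤s (s≤s (s≤s (s≤s (s≤s ()))))))

  at-constant : ∀ a x → (a ∷ []) at x ≡ ℤℚ.ιℤ a
  at-constant a x = trans (cong (ℤℚ.ιℤ a ℚ.+_) (ℚ.*-zeroʳ x)) (ℚ.+-identityʳ (ℤℚ.ιℤ a))

  at-literal : ∀ n x → (pos n ∷ []) at x ≡ pos n ℚ./ 1
  at-literal n x = trans (at-constant (pos n) x) (ι≡/1 n)

  opaque

    1024ᴾ 122880ᴾ : Polynomial
    1024ᴾ   = pos 1024 ∷ []
    122880ᴾ = pos 122880 ∷ []

    1024ℚ 122880ℚ : ℚ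
    1024ℚ   = pos 1024 ℚ./ 1
    122880ℚ = pos 122880 ℚ./ 1

    at-1024 : ∀ x → 1024ᴾ at x ≡ 1024ℚ
    at-1024 x = at-literal 1024 x

    at-122880 : ∀ x → 122880ᴾ at x ≡ 122880ℚ
    at-122880 x = at-literal 122880 x

    1024-cancel : ∀ {x y} → 1024ℚ ℚ.* x ≡ 1024ℚ ℚ.* y → x ≡ y
    1024-cancel {x} {y} eq = ℚ.≤-antisym (ℚ.*-cancelˡ-≤-pos 1024ℚ (ℚ.≤-reflexive eq)) (ℚ.*-cancelˡ-≤-pos 1024ℚ (ℚ.≤-reflexive (sym eq)))

    fSquare-coefficient : ∀ i → i ℕ.< 6 → ι (fSquare i) ≡ 1024ℚ ℚ.* Rℚ.conv fSeries fSeries i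
    fSquare-coefficient i i<6 = trans (ι≡/1 (fSquare i)) (fSquare-value i i<6)

    fPower-zero : ∀ i → i ℕ.< 6 → fPower i at 0ℚ ≡ 122880ℚ ℚ.* A.1# i
    fPower-zero i i<6 = trans (at-zero (fPower i)) (trans (ιℤ≡/1 (head (fPower i))) (value i i<6))
      where
      head : Polynomial → ℤ
      head []      = pos 0
      head (a ∷ _) = a
      at-zero : ∀ P → P at 0ℚ ≡ ℤℚ.ιℤ (head P)
      at-zero []      = refl
      at-zero (a ∷ P) = trans (cong (ℤℚ.ιℤ a ℚ.+_) (ℚ.*-zeroˡ (P at 0ℚ))) (ℚ.+-identityʳ (ℤℚ.ιℤ a))
      value : ∀ i → i ℕ.< 6 → head (fPower i) ℚ./ 1 ≡ (pos 122880 ℚ./ 1) ℚ.* A.1# i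
      value 0 _ = refl
      value 1 _ = refl
      value 2 _ = refl
      value 3 _ = refl
      value 4 _ = refl
      value 5 _ = refl
      value (suc (suc (suc (suc (suc (suc _)))))) (s≤s (s≤s (s≤s (s≤s (s≤s (s≤s ()))))))

    fPower-suc : ∀ i → i ℕ.< 6 → equalᴾ (1024ᴾ *ᴾ (fPower i ∘ᴾ x+ 1)) (Rᴾ.conv (λ k → pos (fSquare k) ∷ []) fPower i) ≡ true
    fPower-suc 0 _ = refl
    fPower-suc 1 _ = refl
    fPower-suc 2 _ = refl
    fPower-suc 3 _ = refl
    fPower-suc 4 _ = refl
    fPower-suc 5 _ = refl
    fPower-suc (suc (suc (suc (suc (suc (suc _)))))) (s≤s (s≤s (s≤s (s≤s (s≤s (s≤s ()))))))

  -- The induction multiplies by f². The polynomials arise from the binomial expansion of (1 + (f² -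
  -- 1)) ^ ℓ up to the fifth power of f² - 1; 122880 is 1024 times 5!, and 5! clears the
  -- denominators of the binomial coefficients.
  fPower-coefficient : ∀ ℓ i → i ℕ.< 6 → fPower i at ι ℓ ≡ 122880ℚ ℚ.* pow (fSeries ⊛ fSeries) ℓ i
  fPower-coefficient zero    i i<6 = fPower-zero i i<6
  fPower-coefficient (suc ℓ) i i<6 = 1024-cancel (begin
    1024ℚ ℚ.* fPower i at ι (suc ℓ)
      ≡⟨ cong₂ ℚ._*_ (sym (at-1024 (ι ℓ))) (sym (trans (at-x+ (fPower i) 1 ℓ) (cong (λ n → fPower i at ι n) (ℕ.+-comm ℓ 1)))) ⟩
    1024ᴾ at ι ℓ ℚ.* (fPower i ∘ᴾ x+ 1) at ι ℓ
      ≡⟨ trans (sym (⟦*⟧ {ι ℓ} 1024ᴾ (fPower i ∘ᴾ x+ 1))) (equal-at (1024ᴾ *ᴾ (fPower i ∘ᴾ x+ 1))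
          (Rᴾ.conv (λ k → pos (fSquare k) ∷ []) fPower i) (fPower-suc i i<6) (ι ℓ)) ⟩
    Rᴾ.conv (λ k → pos (fSquare k) ∷ []) fPower i at ι ℓ
      ≡⟨ at-conv (ι ℓ) (λ k → pos (fSquare k) ∷ []) fPower i ⟩
    Rℚ.conv (λ k → (pos (fSquare k) ∷ []) at ι ℓ) (λ k → fPower k at ι ℓ) i
      ≡⟨ conv-scale 1024ℚ 122880ℚ i {X = Rℚ.conv fSeries fSeries} {Y = pow (fSeries ⊛ fSeries) ℓ}
           (λ k h → trans (at-constant (pos (fSquare k)) (ι ℓ)) (fSquare-coefficient k (ℕ.≤-<-trans h i<6)))
           (λ k h → fPower-coefficient ℓ k (ℕ.≤-<-trans h i<6)) ⟩
    1024ℚ ℚ.* 122880ℚ ℚ.* Rℚ.conv (Rℚ.conv fSeries fSeries) (pow (fSeries ⊛ fSeries) ℓ) i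
      ≡⟨ trans (ℚ.*-assoc 1024ℚ 122880ℚ (Rℚ.conv (Rℚ.conv fSeries fSeries) (pow (fSeries ⊛ fSeries) ℓ) i))
          (cong (λ t → 1024ℚ ℚ.* (122880ℚ ℚ.* t))
           (trans (conv-⊛ (Rℚ.conv fSeries fSeries) (pow (fSeries ⊛ fSeries) ℓ) i)
               (ℚ⟦p⟧.⊛-cong {b = pow (fSeries ⊛ fSeries) ℓ} (conv-⊛ fSeries fSeries) (λ _ → refl) i))) ⟩
    1024ℚ ℚ.* (122880ℚ ℚ.* pow (fSeries ⊛ fSeries) (suc ℓ) i) ∎)
    where open ≡-Reasoning

-- The six identities between rational functions of ℓ.

module CoefficientIdentity where

  open ≡ using (refl; cong; cong₂; sym; trans)
  open import Defs using (module Estimates)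
  open WalkSums
  open RationalFunctions
  open RecursionSolution
  open CentralBinomial
  open PoleExpansion
  open CoefficientRatios
  open DilationPowers

  open ℚ⟦p⟧ using (_⊛_)
  open Sums 𝔸 using (pow)

  private
    neg : ℕ → ℤ
    neg n = ℤ.- pos n

  -- The density of σᵢ, with the semicircle law as σ₀, in powers of z².
  density : ℕ → List ℤ
  density 0 = pos 1 ∷ []
  density 1 = pos 1 ∷ neg 1 ∷ []
  density 2 = pos 2 ∷ neg 12 ∷ pos 10 ∷ neg 2 ∷ []
  density 3 = pos 9 ∷ neg 140 ∷ pos 358 ∷ neg 299 ∷ pos 98 ∷ neg 11 ∷ []
  density 4 = pos 56 ∷ neg 1602 ∷ pos 8625 ∷ neg 16004 ∷ pos 13447 ∷ neg 5624 ∷ pos 1143 ∷ neg 90 ∷ []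
  density 5 = pos 442 ∷ neg 17946 ∷ pos 171911 ∷ neg 574676 ∷ pos 904447 ∷ neg 768354
            ∷ pos 373181 ∷ neg 103622 ∷ pos 15298 ∷ neg 931 ∷ []
  density _ = []

  open Decomposition

  module _ (i : ℕ) where

    private
      D : ℕ
      D = degree (decompose i)

    catalanNumerator : ℕ → Polynomial
    catalanNumerator j = numerator 1 (catalanPolynomial (density j) D) ∘ᴾ x+ D

    catalanDenominator principalNumerator principalDenominator : Polynomial
    catalanDenominator   = denominator 1 (suc D) ∘ᴾ x+ D
    principalNumerator   = numerator (order (decompose i)) (principal (decompose i)) ∘ᴾ x+ D
    principalDenominator = denominator (order (decompose i)) (List.length (principal (decompose i))) ∘ᴾ x+ D

    -- The product of the denominators of both sides. The shift by `D` makes positivity at all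
    -- natural ℓ visible: the polynomial has a positive constant term and no negative coefficient.
    clearing : Polynomial
    clearing = (pos (doubleFactorial (halfOrder (decompose i))) ∷ []) *ᴾ (principalDenominator *ᴾ (catalanDenominator *ᴾ 122880ᴾ))

    -- The coefficient identity for the index `i`, divided by the common factor `β (ℓ + D)` and
    -- cross-multiplied. The convolution is the product of the expansions of f ^ (2 ℓ) and of the
    -- moments of the measures.
    identity : Bool
    identity = equalᴾ (122880ᴾ *ᴾ (catalanDenominator *ᴾ (principalNumerator *ᴾ (rising (halfOrder (decompose i)) ∘ᴾ x+ D))))
      ((pos (doubleFactorial (halfOrder (decompose i))) ∷ []) *ᴾ (principalDenominator *ᴾ Rᴾ.conv fPower catalanNumerator i))

  opaque
    unfolding 122880ᴾ

    identity-holds : ∀ {i} → i ℕ.< 6 → identity i ≡ true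
    identity-holds = toWitness {a? = ℕ.allUpTo? (λ i → identity i Bool.≟ true) 6} tt

  isNonNegative isPositive : Polynomial → Bool
  isNonNegative []               = true
  isNonNegative (pos _    ∷ P)   = isNonNegative P
  isNonNegative (-[1+ _ ] ∷ P)   = false
  isPositive []                  = false
  isPositive (pos zero    ∷ P)   = false
  isPositive (pos (suc _) ∷ P)   = isNonNegative P
  isPositive (-[1+ _ ]    ∷ P)   = false

  opaque
    unfolding 122880ᴾ

    clearing-positive : ∀ {i} → i ℕ.< 6 → isPositive (clearing i) ≡ true
    clearing-positive = toWitness {a? = ℕ.allUpTo? (λ i → isPositive (clearing i) Bool.≟ true) 6} tt

  density-fits : ∀ {i} → i ℕ.< 6 → ∀ {j} → j ℕ.< suc i → let D = degree (decompose i) in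
    List.length (catalanPolynomial (density j) D) ≡ suc D × List.length (density j) ℕ.≤ D
  density-fits = toWitness {a? = ℕ.allUpTo? (λ i → ℕ.allUpTo? (λ j →
    (List.length (catalanPolynomial (density j) (degree (decompose i))) ℕ.≟ suc (degree (decompose i))) ×-dec
    (List.length (density j) ℕ.≤? degree (decompose i))) (suc i)) 6} tt

  remainder-fits : ∀ {i} → i ℕ.< 6 → List.length (remainder (decompose i)) ℕ.≤ degree (decompose i)
  remainder-fits = toWitness {a? = ℕ.allUpTo? (λ i → List.length (remainder (decompose i)) ℕ.≤? degree (decompose i)) 6} tt

  nonNegative-at : ∀ P → isNonNegative P ≡ true → ∀ n → 0ℚ ℚ.≤ P at ι n
  nonNegative-at []          _ n = ℚ.≤-refl
  nonNegative-at (pos a ∷ P) h n = ℚ.+-mono-≤ (0≤ι a) (Estimates.*-nonNeg (0≤ι n) (nonNegative-at P h n))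

  positive-at : ∀ P → isPositive P ≡ true → ∀ n → 0ℚ ℚ.< P at ι n
  positive-at (pos (suc a) ∷ P) h n = ℚ.+-mono-<-≤ (0<ι-suc a) (Estimates.*-nonNeg (0≤ι n) (nonNegative-at P h n))

  positive-cancel : ∀ {x y z} → 0ℚ ℚ.< x → x ℚ.* y ≡ x ℚ.* z → y ≡ z
  positive-cancel {x} {y} {z} 0<x eq = ℚ.≤-antisym
    (ℚ.*-cancelˡ-≤-pos x {{ℚ.positive 0<x}} (ℚ.≤-reflexive eq)) (ℚ.*-cancelˡ-≤-pos x {{ℚ.positive 0<x}} (ℚ.≤-reflexive (sym eq)))

  module _ (i : ℕ) (i<6 : i ℕ.< 6) (ℓ : ℕ) where

    private
      δ : Decomposition
      δ = decompose i

      D n : ℕ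
      D = degree δ
      n = ℓ ℕ.+ D

      b : ℕ
      b = order δ

      F M : ℕ → ℚ
      F = pow (fSeries ⊛ fSeries) ℓ
      M j = catalanSum (density j) ℓ

      R : Polynomial
      R = rising (halfOrder δ) ∘ᴾ x+ D

      df dA dC nA r u v : ℚ
      df = ι (doubleFactorial (halfOrder δ))
      dA = principalDenominator i at ι ℓ
      dC = catalanDenominator i at ι ℓ
      nA = principalNumerator i at ι ℓ
      r  = R at ι ℓ
      u  = (principal δ atₚ ⊛ pow σ b) n
      v  = (pow p (shift δ) ⊛ S 1 i) n

      N : ℕ → ℚ
      N j = catalanNumerator i j at ι ℓ

      -- The remainder of the decomposition has degree below `D`, so coefficient ℓ + D does not see
      -- it.
      principal-part : ι 2 ℚ.* v ≡ u
      principal-part = begin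
        ι 2 ℚ.* v                                                   ≡⟨ integer-⊛ (pos 2) (pow p (shift δ) ⊛ S 1 i) n ⟨
        (Integers.ιℤ 𝔸 (pos 2) ⊛ (pow p (shift δ) ⊛ S 1 i)) n       ≡⟨ A.*-assoc (Integers.ιℤ 𝔸 (pos 2)) (pow p (shift δ)) (S 1 i) n tt ⟨
        (Integers.ιℤ 𝔸 (pos 2) ⊛ pow p (shift δ) ⊛ S 1 i) n         ≡⟨ S-decomposition i i<6 n tt ⟩
        u ℚ.+ (remainder δ atₚ) n                                   ≡⟨ cong (u ℚ.+_)
            (polynomial-high (remainder δ) n (ℕ.≤-trans (remainder-fits i<6) (ℕ.m≤n+m D ℓ))) ⟩
        u ℚ.+ 0ℚ                                                    ≡⟨ ℚ.+-identityʳ u ⟩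
        u                                                           ∎
        where open ≡-Reasoning

      principal-ratio : df ℚ.* (dA ℚ.* u) ≡ nA ℚ.* r ℚ.* β n
      principal-ratio = begin
        df ℚ.* (dA ℚ.* u)                 ≡⟨ cong (df ℚ.*_) (trans
            (cong (ℚ._* u) (at-x+ (denominator b (List.length (principal δ))) D ℓ)) (ratio-sum b (pow σ b) (σ^-ratio b) (principal δ) n)) ⟩
        df ℚ.* (numerator b (principal δ) at ι n ℚ.* pow σ b n)
          ≡⟨ solve 3 (λ x y z → x :* (y :* z) := y :* (x :* z)) refl df (numerator b (principal δ) at ι n) (pow σ b n) ⟩
        numerator b (principal δ) at ι n ℚ.* (df ℚ.* pow σ b n)
          ≡⟨ cong₂ ℚ._*_ (sym (at-x+ (numerator b (principal δ)) D ℓ))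
              (trans (σ^-odd (halfOrder δ) n) (cong (ℚ._* β n) (sym (at-x+ (rising (halfOrder δ)) D ℓ)))) ⟩
        nA ℚ.* (r ℚ.* β n)                ≡⟨ ℚ.*-assoc nA r (β n) ⟨
        nA ℚ.* r ℚ.* β n                  ∎
        where
        open ≡-Reasoning
        open SQ using (solve; _:=_; _:*_)

      catalan-ratio : ∀ j → j ℕ.≤ i → β n ℚ.* N j ≡ dC ℚ.* ι 2 ℚ.* M j
      catalan-ratio j j≤i = begin
        β n ℚ.* N j                         ≡⟨ trans (ℚ.*-comm (β n) (N j)) (cong (ℚ._* β n) (at-x+ (numerator 1 Q) D ℓ)) ⟩
        numerator 1 Q at ι n ℚ.* β n        ≡⟨ ratio-sum 1 σ β-suc Q n ⟨
        denominator 1 (List.length Q) at ι n ℚ.* (Q atₚ ⊛ σ) n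
          ≡⟨ cong₂ ℚ._*_ (trans (cong (λ l → denominator 1 l at ι n) (proj₁ fits)) (sym (at-x+ (denominator 1 (suc D)) D ℓ)))
               (catalanPolynomial-sum (density j) D ℓ (proj₂ fits)) ⟩
        dC ℚ.* (ι 2 ℚ.* M j)                ≡⟨ ℚ.*-assoc dC (ι 2) (M j) ⟨
        dC ℚ.* ι 2 ℚ.* M j                  ∎
        where
        open ≡-Reasoning
        Q : Polynomial
        Q = catalanPolynomial (density j) D
        fits : List.length Q ≡ suc D × List.length (density j) ℕ.≤ D
        fits = density-fits i<6 (s≤s j≤i)

      Z : ℚ
      Z = 122880ℚ

      evaluated : Z ℚ.* (dC ℚ.* (nA ℚ.* r)) ≡ df ℚ.* (dA ℚ.* Rℚ.conv (λ a → fPower a at ι ℓ) N i)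
      evaluated = begin
        Z ℚ.* (dC ℚ.* (nA ℚ.* r))
          ≡⟨ cong₂ ℚ._*_ (at-122880 (ι ℓ)) (trans (⟦*⟧ {ι ℓ} (catalanDenominator i) (principalNumerator i *ᴾ R))
              (cong (dC ℚ.*_) (⟦*⟧ {ι ℓ} (principalNumerator i) R))) ⟨
        122880ᴾ at ι ℓ ℚ.* (catalanDenominator i *ᴾ (principalNumerator i *ᴾ R)) at ι ℓ
          ≡⟨ ⟦*⟧ {ι ℓ} 122880ᴾ (catalanDenominator i *ᴾ (principalNumerator i *ᴾ R)) ⟨
        (122880ᴾ *ᴾ (catalanDenominator i *ᴾ (principalNumerator i *ᴾ R))) at ι ℓ
          ≡⟨ equal-at (122880ᴾ *ᴾ (catalanDenominator i *ᴾ (principalNumerator i *ᴾ R)))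
              ((pos (doubleFactorial (halfOrder δ)) ∷ []) *ᴾ (principalDenominator i *ᴾ Rᴾ.conv fPower (catalanNumerator i) i))
              (identity-holds i<6) (ι ℓ) ⟩
        ((pos (doubleFactorial (halfOrder δ)) ∷ []) *ᴾ (principalDenominator i *ᴾ Rᴾ.conv fPower (catalanNumerator i) i)) at ι ℓ
          ≡⟨ trans (⟦*⟧ {ι ℓ} (pos (doubleFactorial (halfOrder δ)) ∷ [])
              (principalDenominator i *ᴾ Rᴾ.conv fPower (catalanNumerator i) i))
              (cong₂ ℚ._*_ (at-constant (pos (doubleFactorial (halfOrder δ))) (ι ℓ))
               (trans (⟦*⟧ {ι ℓ} (principalDenominator i) (Rᴾ.conv fPower (catalanNumerator i) i))
                   (cong (dA ℚ.*_) (at-conv (ι ℓ) fPower (catalanNumerator i) i)))) ⟩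
        df ℚ.* (dA ℚ.* Rℚ.conv (λ a → fPower a at ι ℓ) N i) ∎
        where open ≡-Reasoning

      K : ℚ
      K = clearing i at ι ℓ

      K≡ : K ≡ df ℚ.* (dA ℚ.* (dC ℚ.* Z))
      K≡ = trans (⟦*⟧ {ι ℓ} (pos (doubleFactorial (halfOrder δ)) ∷ [])
          (principalDenominator i *ᴾ (catalanDenominator i *ᴾ 122880ᴾ)))
          (cong₂ ℚ._*_ (at-constant (pos (doubleFactorial (halfOrder δ))) (ι ℓ))
        (trans (⟦*⟧ {ι ℓ} (principalDenominator i) (catalanDenominator i *ᴾ 122880ᴾ))
            (cong (dA ℚ.*_) (trans (⟦*⟧ {ι ℓ} (catalanDenominator i) 122880ᴾ) (cong (dC ℚ.*_) (at-122880 (ι ℓ)))))))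

    -- Both sides are `β n` times a rational function of ℓ. Multiplication by `K` removes the
    -- denominators, `evaluated` compares the numerators, and positivity of `K` allows it to be
    -- cancelled again.
    S-coefficient : (pow p (shift δ) ⊛ S 1 i) n ≡ Rℚ.conv (pow (fSeries ⊛ fSeries) ℓ) (λ j → catalanSum (density j) ℓ) i
    S-coefficient = ι-cancel 1 (positive-cancel (positive-at (clearing i) (clearing-positive i<6) ℓ) (begin
      K ℚ.* (ι 2 ℚ.* v)
        ≡⟨ cong₂ ℚ._*_ K≡ principal-part ⟩
      df ℚ.* (dA ℚ.* (dC ℚ.* Z)) ℚ.* u
        ≡⟨ solve 5 (λ f a c z u → f :* (a :* (c :* z)) :* u := z :* c :* (f :* (a :* u))) refl df dA dC Z u ⟩
      Z ℚ.* dC ℚ.* (df ℚ.* (dA ℚ.* u))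
        ≡⟨ cong (Z ℚ.* dC ℚ.*_) principal-ratio ⟩
      Z ℚ.* dC ℚ.* (nA ℚ.* r ℚ.* β n)
        ≡⟨ solve 4 (λ z c x b → z :* c :* (x :* b) := z :* (c :* x) :* b) refl Z dC (nA ℚ.* r) (β n) ⟩
      Z ℚ.* (dC ℚ.* (nA ℚ.* r)) ℚ.* β n
        ≡⟨ cong (ℚ._* β n) evaluated ⟩
      df ℚ.* (dA ℚ.* Rℚ.conv φ N i) ℚ.* β n
        ≡⟨ solve 4 (λ f a x b → f :* (a :* x) :* b := f :* (a :* (con (pos 1) :* b :* x))) refl df dA (Rℚ.conv φ N i) (β n) ⟩
      df ℚ.* (dA ℚ.* (ι 1 ℚ.* β n ℚ.* Rℚ.conv φ N i))
        ≡⟨ cong (λ t → df ℚ.* (dA ℚ.* t)) (trans (sym (conv-scale (ι 1) (β n) i {X = φ} {X′ = φ} {Y = N}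
            (λ a _ → sym (ℚ.*-identityˡ (φ a))) (λ _ _ → refl)))
             (conv-scale Z (dC ℚ.* ι 2) i {X = F} {X′ = φ} {Y = M} (λ a h → fPower-coefficient ℓ a (ℕ.≤-<-trans h i<6)) catalan-ratio)) ⟩
      df ℚ.* (dA ℚ.* (Z ℚ.* (dC ℚ.* ι 2) ℚ.* Rℚ.conv F M i))
        ≡⟨ solve 6 (λ f a c z t x → f :* (a :* (z :* (c :* t) :* x)) := f :* (a :* (c :* z)) :* (t :* x)) refl df dA dC Z (ι 2)
            (Rℚ.conv F M i) ⟩
      df ℚ.* (dA ℚ.* (dC ℚ.* Z)) ℚ.* (ι 2 ℚ.* Rℚ.conv F M i)
        ≡⟨ cong (ℚ._* (ι 2 ℚ.* Rℚ.conv F M i)) K≡ ⟨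
      K ℚ.* (ι 2 ℚ.* Rℚ.conv F M i) ∎))
      where
      open ≡-Reasoning
      open SQ using (solve; _:=_; _:*_; con)
      φ : ℕ → ℚ
      φ a = fPower a at ι ℓ

-- Real arithmetic, bounds, and square roots of rational numbers.

module RealArithmetic where

  open ≡ using (refl; cong; cong₂; sym; trans; subst)
  open import Defs
  open RationalFunctions using (module Integers)

  open Estimates

  open _≈_ using (close)
  open _≤_ using (below)
  open ℝ using (seq; cauchy)

  neg-cong : ∀ {x y} → x ≈ y → - x ≈ - y
  neg-cong {x} {y} x≈y .close ε 0<ε = eventually₁
    (λ n → subst (ℚ._≤ ε) (sym (∣-∣-neg (seq x n) (seq y n)))) (close x≈y ε 0<ε)

  ℝ-ring : CommutativeRing 0ℓ 0ℓ
  ℝ-ring = record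
    { Carrier = ℝ ; _≈_ = _≈_ ; _+_ = _+_ ; _*_ = _*_ ; -_ = -_ ; 0# = 0ℝ ; 1# = 1ℝ
    ; isCommutativeRing = record
      { isRing = record
        { +-isAbelianGroup = record
          { isGroup = record
            { isMonoid = record
              { isSemigroup = record
                { isMagma = record
                  { isEquivalence = record { refl = ≈-refl ; sym = ≈-sym ; trans = ≈-trans }
                  ; ∙-cong = +-cong }
                ; assoc = λ x y z → pointwise-≈ λ n → ℚ.+-assoc (seq x n) (seq y n) (seq z n) }
              ; identity = (λ x → pointwise-≈ λ n → ℚ.+-identityˡ (seq x n)) , (λ x → pointwise-≈ λ n → ℚ.+-identityʳ (seq x n)) }
            ; inverse = (λ x → pointwise-≈ λ n → ℚ.+-inverseˡ (seq x n)) , (λ x → pointwise-≈ λ n → ℚ.+-inverseʳ (seq x n))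
            ; ⁻¹-cong = neg-cong }
          ; comm = λ x y → pointwise-≈ λ n → ℚ.+-comm (seq x n) (seq y n) }
        ; *-cong = *-cong
        ; *-assoc = λ x y z → pointwise-≈ λ n → ℚ.*-assoc (seq x n) (seq y n) (seq z n)
        ; *-identity = (λ x → pointwise-≈ λ n → ℚ.*-identityˡ (seq x n)) , (λ x → pointwise-≈ λ n → ℚ.*-identityʳ (seq x n))
        ; distrib = (λ x y z → pointwise-≈ λ n → ℚ.*-distribˡ-+ (seq x n) (seq y n) (seq z n))
                  , (λ x y z → pointwise-≈ λ n → ℚ.*-distribʳ-+ (seq x n) (seq y n) (seq z n)) }
      ; *-comm = λ x y → pointwise-≈ λ n → ℚ.*-comm (seq x n) (seq y n) } }

  module ℝ-ring = CommutativeRing ℝ-ring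
  module SR = Integers.Solver ℝ-ring

  fromℚ-cong : ∀ {p q} → p ≡ q → fromℚ p ≈ fromℚ q
  fromℚ-cong refl = ≈-refl

  fromℚ-+ : ∀ p q → fromℚ (p ℚ.+ q) ≈ fromℚ p + fromℚ q
  fromℚ-+ p q = pointwise-≈ λ _ → refl

  fromℚ-* : ∀ p q → fromℚ (p ℚ.* q) ≈ fromℚ p * fromℚ q
  fromℚ-* p q = pointwise-≈ λ _ → refl

  ∣∣-cong : ∀ {x y} → x ≈ y → ∣ x ∣ ≈ ∣ y ∣
  ∣∣-cong {x} {y} x≈y .close ε 0<ε = eventually₁ (λ n → ℚ.≤-trans (∣-∣-∣∣ (seq x n) (seq y n))) (close x≈y ε 0<ε)

  infix 4 _BoundedBy_

  _BoundedBy_ : ℝ → ℚ → Set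
  x BoundedBy b = ∣ x ∣ ≤ fromℚ b

  bounded-cong : ∀ {x y b} → x ≈ y → x BoundedBy b → y BoundedBy b
  bounded-cong x≈y h = ≤-trans (≈⇒≤ (∣∣-cong (≈-sym x≈y))) h

  bounded-weaken : ∀ {x b c} → b ℚ.≤ c → x BoundedBy b → x BoundedBy c
  bounded-weaken b≤c h = ≤-trans h (fromℚ-mono b≤c)

  bounded-fromℚ : ∀ {q b} → ℚ.∣ q ∣ ℚ.≤ b → fromℚ q BoundedBy b
  bounded-fromℚ h = pointwise-≤ λ _ → h

  bounded-+ : ∀ {x y b c} → x BoundedBy b → y BoundedBy c → x + y BoundedBy b ℚ.+ c
  bounded-+ {x} {y} {b} {c} h k = ≤-trans (∣-∣-triangle x y) (≤-trans (+-mono-≤ h k) (≈⇒≤ (≈-sym (fromℚ-+ b c))))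

  bounded-neg : ∀ {x b} → x BoundedBy b → - x BoundedBy b
  bounded-neg {x} h = ≤-trans (≈⇒≤ (pointwise-≈ λ n → ℚ.∣-p∣≡∣p∣ (seq x n))) h

  bounded-* : ∀ {x y b c} → x BoundedBy b → y BoundedBy c → x * y BoundedBy b ℚ.* c
  bounded-* {x} {y} {b} {c} h k = ≤-trans (≈⇒≤ (∣-∣-homo-* x y))
    (≤-trans (*-mono-≤ (0≤∣-∣ x) (≤-trans (0≤∣-∣ y) k) h k) (≈⇒≤ (≈-sym (fromℚ-* b c))))

  nonNeg-bounded : ∀ {x b} → 0ℝ ≤ x → x ≤ fromℚ b → x BoundedBy b
  nonNeg-bounded 0≤x h = ≤-trans (≈⇒≤ (0≤⇒∣-∣≈ 0≤x)) h

  bound : ∀ x → ∃[ b ] 0ℚ ℚ.< b × x BoundedBy b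
  bound x = upperBound ∣ x ∣

  small⇒≈0 : ∀ {x} → (∀ ε → 0ℚ ℚ.< ε → x BoundedBy ε) → x ≈ 0ℝ
  small⇒≈0 {x} h .close ε 0<ε = eventually₁
    (λ n k → subst (λ t → ℚ.∣ t ∣ ℚ.≤ ε) (sym (ℚ.+-identityʳ (seq x n))) (subst (ℚ.∣ seq x n ∣ ℚ.≤_) (half+half ε) k))
    (below (h (½ ℚ.* ε) (half>0 0<ε)) (½ ℚ.* ε) (half>0 0<ε))

  ≈⇒-≈0 : ∀ {x y} → x ≈ y → x - y ≈ 0ℝ
  ≈⇒-≈0 {x} {y} eq = ≈-trans (+-cong eq (≈-refl {x = - y})) (ℝ-ring.-‿inverseʳ y)

  -≈0⇒≈ : ∀ {x y} → x - y ≈ 0ℝ → x ≈ y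
  -≈0⇒≈ {x} {y} eq = ≈-trans (SR.solve 2 (λ x y → x SR.:= (x SR.:- y) SR.:+ y) ≈-refl x y)
    (≈-trans (+-cong eq (≈-refl {x = y})) (ℝ-ring.+-identityˡ y))

  small⇒≈ : ∀ {x y} → (∀ ε → 0ℚ ℚ.< ε → x - y BoundedBy ε) → x ≈ y
  small⇒≈ h = -≈0⇒≈ (small⇒≈0 h)

  ∣∣-square : ∀ q → ℚ.∣ q ∣ ℚ.* ℚ.∣ q ∣ ≡ ℚ.∣ q ℚ.* q ∣
  ∣∣-square q = sym (ℚ.∣p*q∣≡∣p∣*∣q∣ q q)

  square-≤⇒≤ : ∀ {p ε} → 0ℚ ℚ.< ε → p ℚ.* p ℚ.≤ ε ℚ.* ε → p ℚ.≤ ε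
  square-≤⇒≤ {p} {ε} 0<ε h with p ℚ.≤? ε
  ... | yes p≤ε = p≤ε
  ... | no p≰ε  = contradiction (ℚ.<-≤-trans lt h) (ℚ.<-irrefl refl)
    where
    ε<p : ε ℚ.< p
    ε<p = ℚ.≰⇒> p≰ε
    lt : ε ℚ.* ε ℚ.< p ℚ.* p
    lt = ℚ.<-trans (ℚ.*-monoʳ-<-pos ε {{ℚ.positive 0<ε}} ε<p) (ℚ.*-monoˡ-<-pos p {{ℚ.positive (ℚ.<-trans 0<ε ε<p)}} ε<p)

  square≈0⇒≈0 : ∀ {x} → x * x ≈ 0ℝ → x ≈ 0ℝ
  square≈0⇒≈0 {x} h .close ε 0<ε = eventually₁
    (λ n k → square-≤⇒≤ 0<ε (ℚ.≤-trans (ℚ.≤-reflexive (trans (∣∣-square (seq x n ℚ.- 0ℚ)) (cong ℚ.∣_∣ (lemma (seq x n))))) k))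
    (close h (ε ℚ.* ε) (*-pos 0<ε 0<ε))
    where
    lemma : ∀ q → (q ℚ.- 0ℚ) ℚ.* (q ℚ.- 0ℚ) ≡ q ℚ.* q ℚ.- 0ℚ
    lemma q = trans (cong₂ ℚ._*_ (ℚ.+-identityʳ q) (ℚ.+-identityʳ q)) (sym (ℚ.+-identityʳ (q ℚ.* q)))

  ≤-antisym : ∀ {x y} → x ≤ y → y ≤ x → x ≈ y
  ≤-antisym {x} {y} x≤y y≤x .close ε 0<ε = eventually₂ (λ n → ∣-∣≤) (below x≤y ε 0<ε) (below y≤x ε 0<ε)

  -- For nonnegative x and y, (x - y)² ≤ |x² - y²|.
  square-injective : ∀ {x y} → 0ℝ ≤ x → 0ℝ ≤ y → x * x ≈ y * y → x ≈ y
  square-injective {x} {y} 0≤x 0≤y eq = -≈0⇒≈ (square≈0⇒≈0 (≤-antisym upper (square≥0 (x - y))))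
    where
    square≥0 : ∀ z → 0ℝ ≤ z * z
    square≥0 z = pointwise-≤ λ n → ℚ.≤-trans (ℚ.0≤∣p∣ (seq z n ℚ.* seq z n)) (ℚ.≤-reflexive (ℚ.0≤p⇒∣p∣≡p (sq (seq z n))))
      where
      sq : ∀ q → 0ℚ ℚ.≤ q ℚ.* q
      sq q with ℚ.≤-total 0ℚ q
      ... | inj₁ 0≤q = *-nonNeg 0≤q 0≤q
      ... | inj₂ q≤0 = subst (0ℚ ℚ.≤_) (trans (sym (ℚ.neg-distribˡ-* q (ℚ.- q)))
          (trans (cong ℚ.-_ (sym (ℚ.neg-distribʳ-* q q))) (neg-involutive (q ℚ.* q))))
                         (*-nonNeg (ℚ.neg-antimono-≤ q≤0) (ℚ.neg-antimono-≤ q≤0))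
        where
        neg-involutive : ∀ q → ℚ.- (ℚ.- q) ≡ q
        neg-involutive = solve 1 (λ q → :- (:- q) := q) refl
          where
          open import Data.Rational.Solver using (module +-*-Solver)
          open +-*-Solver
    upper : (x - y) * (x - y) ≤ 0ℝ
    upper = begin
      (x - y) * (x - y)                                 ≲⟨ ≤-trans (≈⇒≤ (≈-sym (0≤⇒∣-∣≈ (square≥0 (x - y)))))
          (≈⇒≤ (∣-∣-homo-* (x - y) (x - y))) ⟩
      ∣ x - y ∣ * ∣ x - y ∣                             ≲⟨ *-mono-≤ (0≤∣-∣ (x - y)) (≤-trans (0≤∣-∣ (x - y)) minus≤plus) ≤-refl minus≤plus ⟩
      ∣ x - y ∣ * ∣ x + y ∣                             ≈⟨ ≈-sym (∣-∣-homo-* (x - y) (x + y)) ⟩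
      ∣ (x - y) * (x + y) ∣                             ≈⟨ ∣∣-cong
          (≈-trans (SR.solve 2 (λ x y → (x SR.:- y) SR.:* (x SR.:+ y) SR.:= x SR.:* x SR.:- y SR.:* y) ≈-refl x y) (≈⇒-≈0 eq)) ⟩
      ∣ 0ℝ ∣                                            ≈⟨ pointwise-≈ (λ _ → refl) ⟩
      0ℝ                                                ∎
      where
      open ≤-Reasoning
      minus≤plus : ∣ x - y ∣ ≤ ∣ x + y ∣
      minus≤plus = begin
        ∣ x - y ∣         ≲⟨ ∣-∣-triangle x (- y) ⟩
        ∣ x ∣ + ∣ - y ∣   ≈⟨ +-cong (0≤⇒∣-∣≈ 0≤x) (≈-trans (pointwise-≈ λ n → ℚ.∣-p∣≡∣p∣ (seq y n)) (0≤⇒∣-∣≈ 0≤y)) ⟩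
        x + y             ≈⟨ ≈-sym (0≤⇒∣-∣≈ (≤-trans (≈⇒≤ (pointwise-≈ λ _ → refl)) (+-mono-≤ {0ℝ} {x} {0ℝ} {y} 0≤x 0≤y))) ⟩
        ∣ x + y ∣         ∎

  -- Square roots of rational numbers suffice, as the Riemann sums are taken at rational points
  -- only.
  root : ℚ → ℝ
  root q = √ (fromℚ q)

  root≥0 : ∀ q → 0ℝ ≤ root q
  root≥0 q = pointwise-≤ λ n → Brackets.lo≥0 (bisect-brackets {0ℚ ℚ.⊔ q} (ℚ.p≤p⊔q 0ℚ q) n)

  module _ {q : ℚ} (0≤q : 0ℚ ℚ.≤ q) where

    private
      max≡ : 0ℚ ℚ.⊔ q ≡ q
      max≡ = ℚ.p≤q⇒p⊔q≡q 0≤q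

    root-square : root q * root q ≈ fromℚ q
    root-square = small⇒≈ λ ε 0<ε → ≤-intro λ ε′ 0<ε′ → go ε 0<ε ε′ 0<ε′ (cauchy⇒bounded (seq (root q)) (cauchy (root q)))
      where
      go : ∀ ε → 0ℚ ℚ.< ε → ∀ ε′ → 0ℚ ℚ.< ε′ → Bounded (seq (root q)) →
           Eventually λ n → seq ∣ root q * root q - fromℚ q ∣ n ℚ.≤ ε ℚ.+ ε′
      -- If `lo` is at most `b` and hi = lo + (1 + q) h with h ≤ 1, then hi² - lo² is at most this
      -- factor times h.
      go ε 0<ε ε′ 0<ε′ (b , 0<b , lo≤b) = go₂ (shrink {p = (1ℚ ℚ.+ q) ℚ.* (b ℚ.+ b ℚ.+ (1ℚ ℚ.+ q))} positive 0<ε)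
        where
        positive : 0ℚ ℚ.< (1ℚ ℚ.+ q) ℚ.* (b ℚ.+ b ℚ.+ (1ℚ ℚ.+ q))
        positive = *-pos (0<1+nonNeg 0≤q) (ℚ.+-mono-< {0ℚ} {b ℚ.+ b} {0ℚ} (ℚ.+-mono-< {0ℚ} {b} {0ℚ} {b} 0<b 0<b) (0<1+nonNeg 0≤q))
        go₂ : (∃[ δ ] 0ℚ ℚ.< δ × (1ℚ ℚ.+ q) ℚ.* (b ℚ.+ b ℚ.+ (1ℚ ℚ.+ q)) ℚ.* δ ≡ ε) →
              Eventually λ n → seq ∣ root q * root q - fromℚ q ∣ n ℚ.≤ ε ℚ.+ ε′
        go₂ (δ , 0<δ , eq) = eventually₂ (λ n lo≤b small → estimate n lo≤b small) lo≤b (halfPow→0 0<δ)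
          where
          open import Data.Rational.Solver using (module +-*-Solver)
          open +-*-Solver
          estimate : ∀ n → ℚ.∣ seq (root q) n ∣ ℚ.≤ b → halfPow n ℚ.≤ δ → ℚ.∣ seq (root q) n ℚ.* seq (root q) n ℚ.- q ∣ ℚ.≤ ε ℚ.+ ε′
          estimate n lo≤b small = ℚ.≤-trans (∣-∣≤ {q = q} (ℚ.≤-trans lo²
              (ℚ.≤-trans (ℚ.≤-reflexive (sym (ℚ.+-identityʳ q))) (ℚ.+-monoʳ-≤ q (ℚ.<⇒≤ 0<ε)))) upper)
              (ℚ.≤-trans (ℚ.≤-reflexive (sym (ℚ.+-identityʳ ε))) (ℚ.+-monoʳ-≤ ε (ℚ.<⇒≤ 0<ε′)))
            where
            module B = Brackets (bisect-brackets {0ℚ ℚ.⊔ q} (ℚ.p≤p⊔q 0ℚ q) n)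
            lo hi h : ℚ
            lo = seq (root q) n
            hi = proj₂ (bisect (0ℚ ℚ.⊔ q) n)
            h  = halfPow n
            lo² : lo ℚ.* lo ℚ.≤ q
            lo² = subst (lo ℚ.* lo ℚ.≤_) max≡ B.lo²≤
            hi≡ : hi ≡ lo ℚ.+ (1ℚ ℚ.+ q) ℚ.* h
            hi≡ = trans B.gap≡ (cong (λ t → lo ℚ.+ (1ℚ ℚ.+ t) ℚ.* h) max≡)
            h≤1 : h ℚ.≤ 1ℚ
            h≤1 = halfPow-antitone {0} {n} z≤n
            upper : q ℚ.≤ lo ℚ.* lo ℚ.+ ε
            upper = begin
              q                                       ≤⟨ subst (ℚ._≤ hi ℚ.* hi) max≡ B.≤hi² ⟩
              hi ℚ.* hi                               ≡⟨ cong (λ t → t ℚ.* t) hi≡ ⟩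
              (lo ℚ.+ (1ℚ ℚ.+ q) ℚ.* h) ℚ.* (lo ℚ.+ (1ℚ ℚ.+ q) ℚ.* h)
                ≡⟨ solve 3 (λ l g h → (l :+ g :* h) :* (l :+ g :* h) := l :* l :+ (g :* (l :+ l :+ g :* h)) :* h) refl lo (1ℚ ℚ.+ q) h ⟩
              lo ℚ.* lo ℚ.+ ((1ℚ ℚ.+ q) ℚ.* (lo ℚ.+ lo ℚ.+ (1ℚ ℚ.+ q) ℚ.* h)) ℚ.* h
                ≤⟨ ℚ.+-monoʳ-≤ (lo ℚ.* lo) (*-mono (*-nonNeg 0≤g
                    (ℚ.+-mono-≤ {0ℚ} {lo ℚ.+ lo} {0ℚ} (ℚ.+-mono-≤ {0ℚ} {lo} {0ℚ} {lo} B.lo≥0 B.lo≥0) (*-nonNeg 0≤g (ℚ.<⇒≤ (0<halfPow n)))))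
                     (ℚ.<⇒≤ 0<δ) (ℚ.*-monoˡ-≤-nonNeg (1ℚ ℚ.+ q) {{ℚ.nonNegative 0≤g}}
                       (ℚ.+-mono-≤ (ℚ.+-mono-≤ lo≤ lo≤) (ℚ.≤-trans (ℚ.*-monoˡ-≤-nonNeg (1ℚ ℚ.+ q) {{ℚ.nonNegative 0≤g}} h≤1)
                           (ℚ.≤-reflexive (ℚ.*-identityʳ (1ℚ ℚ.+ q)))))) small) ⟩
              lo ℚ.* lo ℚ.+ (1ℚ ℚ.+ q) ℚ.* (b ℚ.+ b ℚ.+ (1ℚ ℚ.+ q)) ℚ.* δ
                ≡⟨ cong (lo ℚ.* lo ℚ.+_) eq ⟩
              lo ℚ.* lo ℚ.+ ε ∎
              where
              open ℚ.≤-Reasoning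
              0≤g : 0ℚ ℚ.≤ 1ℚ ℚ.+ q
              0≤g = ℚ.<⇒≤ (0<1+nonNeg 0≤q)
              lo≤ : lo ℚ.≤ b
              lo≤ = ℚ.≤-trans (p≤∣p∣ lo) lo≤b

    root-bounded : ∀ {b} → 0ℚ ℚ.< b → q ℚ.≤ b ℚ.* b → root q BoundedBy b
    root-bounded 0<b q≤b² = nonNeg-bounded (root≥0 q) (pointwise-≤ λ n → square-≤⇒≤ 0<b
      (ℚ.≤-trans (subst (seq (root q) n ℚ.* seq (root q) n ℚ.≤_) max≡ (Brackets.lo²≤ (bisect-brackets {0ℚ ℚ.⊔ q} (ℚ.p≤p⊔q 0ℚ q) n))) q≤b²))

    root-close : ∀ {r η} → 0ℚ ℚ.≤ r → 0ℚ ℚ.< η → r ℚ.≤ q ℚ.+ η ℚ.* η → root r ≤ root q + fromℚ η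
    root-close {r} {η} 0≤r 0<η h .below ε 0<ε = go (shrink (0<1+nonNeg 0≤q) 0<ε)
      where
      go : (∃[ δ ] 0ℚ ℚ.< δ × (1ℚ ℚ.+ q) ℚ.* δ ≡ ε) → Eventually λ n → seq (root r) n ℚ.≤ seq (root q) n ℚ.+ η ℚ.+ ε
      go (δ , 0<δ , eq) = eventually₁ (λ n small → ℚ.≤-trans
          (subst₂′ (ℚ.p≤q⇒p⊔q≡q 0≤r) max≡ (λ s t → sqrtBelow s n ℚ.≤ sqrtBelow t n ℚ.+ ((1ℚ ℚ.+ q) ℚ.* halfPow n ℚ.+ η))
              (sqrtBelow-close n n 0≤r 0≤q 0<η h))
          (ℚ.≤-trans (ℚ.+-monoʳ-≤ (seq (root q) n) (ℚ.+-monoˡ-≤ η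
              (ℚ.≤-trans (ℚ.*-monoˡ-≤-nonNeg (1ℚ ℚ.+ q) {{ℚ.nonNegative (ℚ.<⇒≤ (0<1+nonNeg 0≤q))}} small) (ℚ.≤-reflexive eq))))
            (ℚ.≤-reflexive (trans (cong (seq (root q) n ℚ.+_) (ℚ.+-comm ε η)) (sym (ℚ.+-assoc (seq (root q) n) η ε))))))
        (halfPow→0 0<δ)
        where
        subst₂′ : ∀ {a a′ b b′ : ℚ} → a ≡ a′ → b ≡ b′ → (R : ℚ → ℚ → Set) → R a′ b′ → R a b
        subst₂′ refl refl R x = x

-- Left Riemann sums over uniform partitions and their limits.

module RiemannSums where

  open ≡ using (refl; cong; sym; trans)
  open import Defs
  open RecursionSolution using (ι; module ιℚ)
  open CentralBinomial using (0≤ι; module SQ)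
  open RealArithmetic

  open Estimates

  ∑-cong : ∀ n {f g : ℕ → ℝ} → (∀ i → i ℕ.< n → f i ≈ g i) → ∑ n f ≈ ∑ n g
  ∑-cong zero    eq = ≈-refl
  ∑-cong (suc n) eq = +-cong (∑-cong n (λ i i<n → eq i (ℕ.m<n⇒m<1+n i<n))) (eq n ℕ.≤-refl)

  ∑-+ : ∀ n (f g : ℕ → ℝ) → ∑ n (λ i → f i + g i) ≈ ∑ n f + ∑ n g
  ∑-+ zero    f g = pointwise-≈ λ _ → refl
  ∑-+ (suc n) f g = ≈-trans (+-cong (∑-+ n f g) (≈-refl {x = f n + g n}))
    (SR.solve 4 (λ a b c d → (a SR.:+ b) SR.:+ (c SR.:+ d) SR.:= (a SR.:+ c) SR.:+ (b SR.:+ d)) ≈-refl (∑ n f) (∑ n g) (f n) (g n))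

  ∑-* : ∀ n c (f : ℕ → ℝ) → ∑ n (λ i → c * f i) ≈ c * ∑ n f
  ∑-* zero    c f = ≈-sym (ℝ-ring.zeroʳ c)
  ∑-* (suc n) c f = ≈-trans (+-cong (∑-* n c f) (≈-refl {x = c * f n})) (≈-sym (ℝ-ring.distribˡ c (∑ n f) (f n)))

  ∑-bounded : ∀ n {f : ℕ → ℝ} {b} → (∀ i → i ℕ.< n → f i BoundedBy b) → ∑ n f BoundedBy ι n ℚ.* b
  ∑-bounded zero    {b = b} h = bounded-fromℚ (ℚ.≤-reflexive (sym (ℚ.*-zeroˡ b)))
  ∑-bounded (suc n) {b = b} h = bounded-weaken (ℚ.≤-reflexive
      (SQ.solve 2 (λ n b → n SQ.:* b SQ.:+ b SQ.:= (SQ.con (pos 1) SQ.:+ n) SQ.:* b) refl (ι n) b))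
    (bounded-+ (∑-bounded n (λ i i<n → h i (ℕ.m<n⇒m<1+n i<n))) (h n ℕ.≤-refl))

  ∑-telescope : ∀ n (H : ℕ → ℝ) → ∑ n (λ i → H (suc i) - H i) ≈ H n - H 0
  ∑-telescope zero    H = ≈-sym (ℝ-ring.-‿inverseʳ (H 0))
  ∑-telescope (suc n) H = ≈-trans (+-cong (∑-telescope n H) (≈-refl {x = H (suc n) - H n}))
    (SR.solve 3 (λ a b c → (b SR.:- a) SR.:+ (c SR.:- b) SR.:= c SR.:- a) ≈-refl (H 0) (H n) (H (suc n)))

  -- With 2 ^ K cells the points are rational and the mesh is `L` times `halfPow K`, so that it
  -- tends to 0 by `halfPow→0`.
  module Uniform (a L : ℚ) (0<L : 0ℚ ℚ.< L) (K : ℕ) where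

    N : ℕ
    N = 2 ℕ.^ K

    Δ : ℚ
    Δ = L ℚ.* halfPow K

    0≤Δ : 0ℚ ℚ.≤ Δ
    0≤Δ = *-nonNeg (ℚ.<⇒≤ 0<L) (ℚ.<⇒≤ (0<halfPow K))

    x : ℕ → ℚ
    x i = a ℚ.+ ι i ℚ.* Δ

    x-suc : ∀ i → x (suc i) ≡ x i ℚ.+ Δ
    x-suc i = SQ.solve 3 (λ a i d → a SQ.:+ (SQ.con (pos 1) SQ.:+ i) SQ.:* d SQ.:= a SQ.:+ i SQ.:* d SQ.:+ d) refl a (ι i) Δ

    x-zero : x 0 ≡ a
    x-zero = trans (cong (a ℚ.+_) (ℚ.*-zeroˡ Δ)) (ℚ.+-identityʳ a)

    NΔ : ι N ℚ.* Δ ≡ L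
    NΔ = trans (SQ.solve 3 (λ n l h → n SQ.:* (l SQ.:* h) SQ.:= l SQ.:* (n SQ.:* h)) refl (ι N) L (halfPow K))
        (trans (cong (L ℚ.*_) (go K)) (ℚ.*-identityʳ L))
      where
      go : ∀ K → ι (2 ℕ.^ K) ℚ.* halfPow K ≡ 1ℚ
      go zero    = refl
      go (suc K) = trans (cong (ℚ._* (½ ℚ.* halfPow K)) (ιℚ.ι-* 2 (2 ℕ.^ K)))
        (trans (SQ.solve 4 (λ t n h k → t SQ.:* n SQ.:* (h SQ.:* k) SQ.:= (t SQ.:* h) SQ.:* (n SQ.:* k)) refl (ι 2)
            (ι (2 ℕ.^ K)) ½ (halfPow K))
          (trans (cong (ι 2 ℚ.* ½ ℚ.*_) (go K)) refl))

    x-N : x N ≡ a ℚ.+ L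
    x-N = cong (a ℚ.+_) NΔ

    a≤x : ∀ i → a ℚ.≤ x i
    a≤x i = ℚ.≤-trans (ℚ.≤-reflexive (sym (ℚ.+-identityʳ a))) (ℚ.+-monoʳ-≤ a (*-nonNeg (0≤ι i) 0≤Δ))

    ι-mono : ∀ {i j} → i ℕ.≤ j → ι i ℚ.≤ ι j
    ι-mono {j = j} z≤n       = 0≤ι j
    ι-mono         (s≤s i≤j) = ℚ.+-monoʳ-≤ 1ℚ (ι-mono i≤j)

    x≤ : ∀ i → i ℕ.≤ N → x i ℚ.≤ a ℚ.+ L
    x≤ i i≤N = ℚ.≤-trans (ℚ.+-monoʳ-≤ a (ℚ.*-monoʳ-≤-nonNeg Δ {{ℚ.nonNegative 0≤Δ}} (ι-mono i≤N))) (ℚ.≤-reflexive x-N)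

    partition : ∀ {A B} → fromℚ a ≈ A → fromℚ (a ℚ.+ L) ≈ B → TaggedPartition A B
    partition start≈ end≈ = record
      { size = N ; point = λ i → fromℚ (x i) ; tag = λ i → fromℚ (x i)
      ; start = ≈-trans (fromℚ-cong x-zero) start≈ ; end = ≈-trans (fromℚ-cong x-N) end≈
      ; point≤tag = λ _ _ → ≤-refl
      ; tag≤point = λ i _ → fromℚ-mono (ℚ.≤-trans (ℚ.≤-reflexive (sym (ℚ.+-identityʳ (x i))))
          (ℚ.≤-trans (ℚ.+-monoʳ-≤ (x i) 0≤Δ) (ℚ.≤-reflexive (sym (x-suc i))))) }

    step : ∀ i → x (suc i) ℚ.- x i ≡ Δ
    step i = trans (cong (ℚ._- x i) (x-suc i)) (SQ.solve 2 (λ x d → x SQ.:+ d SQ.:- x SQ.:= d) refl (x i) Δ)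

    mesh : ∀ {A B δ} (start≈ : fromℚ a ≈ A) (end≈ : fromℚ (a ℚ.+ L) ≈ B) → Δ ℚ.≤ δ → partition start≈ end≈ HasMesh≤ fromℚ δ
    mesh start≈ end≈ Δ≤δ i _ = pointwise-≤ λ _ → ℚ.≤-trans (ℚ.≤-reflexive (step i)) Δ≤δ

    leftSum : (ℝ → ℝ) → ℝ
    leftSum f = ∑ N λ i → f (fromℚ (x i)) * fromℚ Δ

    leftSum-cong : ∀ {f g} → (∀ i → i ℕ.< N → f (fromℚ (x i)) ≈ g (fromℚ (x i))) → leftSum f ≈ leftSum g
    leftSum-cong eq = ∑-cong N λ i i<N → *-cong (eq i i<N) ≈-refl

    riemannSum≈leftSum : ∀ f {A B} (start≈ : fromℚ a ≈ A) (end≈ : fromℚ (a ℚ.+ L) ≈ B) → riemannSum f (partition start≈ end≈) ≈ leftSum f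
    riemannSum≈leftSum f start≈ end≈ = ∑-cong N λ i _ → *-cong (≈-refl {x = f (fromℚ (x i))}) (pointwise-≈ λ _ → step i)

  module _ (a L : ℚ) (0<L : 0ℚ ℚ.< L) where

    open Uniform a L 0<L

    mesh→0 : ∀ {δ} → 0ℚ ℚ.< δ → Eventually λ K → Δ K ℚ.≤ δ
    mesh→0 {δ} 0<δ = go (shrink 0<L 0<δ)
      where
      go : (∃[ δ′ ] 0ℚ ℚ.< δ′ × L ℚ.* δ′ ≡ δ) → Eventually λ K → Δ K ℚ.≤ δ
      go (δ′ , 0<δ′ , eq) = eventually₁ (λ K h → ℚ.≤-trans (ℚ.*-monoˡ-≤-nonNeg L {{ℚ.nonNegative (ℚ.<⇒≤ 0<L)}} h)
          (ℚ.≤-reflexive eq)) (halfPow→0 0<δ′)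

    converges : ∀ {A B f I} → fromℚ a ≈ A → fromℚ (a ℚ.+ L) ≈ B → IsIntegral A B f I →
                ∀ ε → 0ℚ ℚ.< ε → Eventually λ K → leftSum K f - I BoundedBy ε
    converges {f = f} {I} start≈ end≈ integral ε 0<ε = go (integral ε 0<ε)
      where
      go : (∃[ δ ] 0ℚ ℚ.< δ × (∀ P → P HasMesh≤ fromℚ δ → ∣ riemannSum f P - I ∣ ≤ fromℚ ε)) →
           Eventually λ K → leftSum K f - I BoundedBy ε
      go (δ , 0<δ , h) = eventually₁ (λ K Δ≤δ → bounded-cong (+-cong (riemannSum≈leftSum K f start≈ end≈) (≈-refl {x = - I}))
        (h (partition K start≈ end≈) (mesh K start≈ end≈ Δ≤δ))) (mesh→0 0<δ)

  -- A limit is determined by the sums, and inherits linear relations between them.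
  Limit : (ℕ → ℝ) → ℝ → Set
  Limit X I = ∀ ε → 0ℚ ℚ.< ε → Eventually λ K → X K - I BoundedBy ε

  limit-cong : ∀ {X Y I} → (∀ K → X K ≈ Y K) → Limit X I → Limit Y I
  limit-cong {I = I} eq lim ε 0<ε = eventually₁ (λ K → bounded-cong (+-cong (eq K) (≈-refl {x = - I}))) (lim ε 0<ε)

  limit-unique : ∀ {X I J} → Limit X I → Limit X J → I ≈ J
  limit-unique {X} {I} {J} lim lim′ = small⇒≈ λ ε 0<ε → go ε
      (eventually₂ (λ K → _,_) (lim (½ ℚ.* ε) (half>0 0<ε)) (lim′ (½ ℚ.* ε) (half>0 0<ε)))
    where
    go : ∀ ε → (Eventually λ K → (X K - I BoundedBy ½ ℚ.* ε) × (X K - J BoundedBy ½ ℚ.* ε)) → I - J BoundedBy ε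
    go ε (N , h) = let u , v = h N ℕ.≤-refl in bounded-weaken (ℚ.≤-reflexive (half+half ε))
      (bounded-cong (SR.solve 3 (λ x i j → (SR.:- (x SR.:- i)) SR.:+ (x SR.:- j) SR.:= i SR.:- j) ≈-refl (X N) I J)
          (bounded-+ (bounded-neg {X N - I} u) v))

  limit-+ : ∀ {X Y I J} → Limit X I → Limit Y J → Limit (λ K → X K + Y K) (I + J)
  limit-+ {X} {Y} {I} {J} lim lim′ ε 0<ε = eventually₂ (λ K u v → bounded-weaken (ℚ.≤-reflexive (half+half ε))
    (bounded-cong (SR.solve 4 (λ x y i j → (x SR.:- i) SR.:+ (y SR.:- j) SR.:= (x SR.:+ y) SR.:- (i SR.:+ j)) ≈-refl (X K)
        (Y K) I J) (bounded-+ u v)))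
    (lim (½ ℚ.* ε) (half>0 0<ε)) (lim′ (½ ℚ.* ε) (half>0 0<ε))

  limit-* : ∀ c {X I} → Limit X I → Limit (λ K → c * X K) (c * I)
  limit-* c {X} {I} lim ε 0<ε = go (bound c)
    where
    go : (∃[ b ] 0ℚ ℚ.< b × c BoundedBy b) → Eventually λ K → c * X K - c * I BoundedBy ε
    go (b , 0<b , h) = go₂ (shrink 0<b 0<ε)
      where
      go₂ : (∃[ δ ] 0ℚ ℚ.< δ × b ℚ.* δ ≡ ε) → Eventually λ K → c * X K - c * I BoundedBy ε
      go₂ (δ , 0<δ , eq) = eventually₁ (λ K u → bounded-weaken (ℚ.≤-reflexive eq)
        (bounded-cong (SR.solve 3 (λ c x i → c SR.:* (x SR.:- i) SR.:= c SR.:* x SR.:- c SR.:* i) ≈-refl c (X K) I)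
            (bounded-* h u))) (lim δ 0<δ)

  limit-zero : Limit (λ _ → 0ℝ) 0ℝ
  limit-zero ε 0<ε = 0 , λ _ _ → bounded-cong {0ℝ} (pointwise-≈ λ _ → refl) (bounded-fromℚ (ℚ.<⇒≤ 0<ε))

-- Increments of z ^ (k + 1) (4 - z²) ^ (3/2).

module SemicircleIncrements where

  open ≡ using (refl; cong; cong₂; sym; trans; subst)
  open import Defs
  open WalkSums using (module Sums)
  open RationalFunctions using (module Integers)
  open RecursionSolution using (ι)
  open CentralBinomial using (0≤ι; module SQ)
  open RealArithmetic
  open RiemannSums

  open Estimates
  open ℝ using (seq)
  open Sums ℚ.+-*-commutativeRing using (pow)

  -2ℚ 2ℚ 4ℚ : ℚ
  -2ℚ = ℚ.- (pos 2 ℚ./ 1)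
  2ℚ  = pos 2 ℚ./ 1
  4ℚ  = pos 4 ℚ./ 1

  pow-nonNeg : ∀ {x} → 0ℚ ℚ.≤ x → ∀ k → 0ℚ ℚ.≤ pow x k
  pow-nonNeg 0≤x zero    = ℚ.nonNegative⁻¹ 1ℚ
  pow-nonNeg 0≤x (suc k) = *-nonNeg 0≤x (pow-nonNeg 0≤x k)

  pow-bounded : ∀ {x b} → ℚ.∣ x ∣ ℚ.≤ b → ∀ k → ℚ.∣ pow x k ∣ ℚ.≤ pow b k
  pow-bounded {x} h zero    = ℚ.≤-refl
  pow-bounded {x} {b} h (suc k) = ℚ.≤-trans (ℚ.≤-reflexive (ℚ.∣p*q∣≡∣p∣*∣q∣ x (pow x k)))
    (*-mono (ℚ.0≤∣p∣ x) (pow-nonNeg (ℚ.≤-trans (ℚ.0≤∣p∣ x) h) k) h (pow-bounded h k))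

  module _ (x Δ : ℚ) where

    -- The remainder of (x + Δ) ^ k beyond its terms of degree at most 1 in Δ.
    remainder : ℕ → ℚ
    remainder zero    = 0ℚ
    remainder (suc k) = ι (suc k) ℚ.* pow x k ℚ.* (Δ ℚ.* Δ) ℚ.+ (x ℚ.+ Δ) ℚ.* remainder k

    pow-taylor : ∀ k → pow (x ℚ.+ Δ) (suc k) ≡ pow x (suc k) ℚ.+ ι (suc k) ℚ.* pow x k ℚ.* Δ ℚ.+ remainder k
    pow-taylor zero    = SQ.solve 2 (λ x d → (x SQ.:+ d) SQ.:* SQ.con (pos 1) SQ.:= x SQ.:* SQ.con (pos 1) SQ.:+ SQ.con
        (pos 1) SQ.:* SQ.con (pos 1) SQ.:* d SQ.:+ SQ.con (pos 0)) refl x Δ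
    pow-taylor (suc k) = trans (cong ((x ℚ.+ Δ) ℚ.*_) (pow-taylor k))
      (SQ.solve 5 (λ x d y i r → (x SQ.:+ d) SQ.:* (x SQ.:* y SQ.:+ i SQ.:* y SQ.:* d SQ.:+ r) SQ.:=
        x SQ.:* (x SQ.:* y) SQ.:+ (SQ.con (pos 1) SQ.:+ i) SQ.:* (x SQ.:* y) SQ.:* d SQ.:+
            (i SQ.:* y SQ.:* (d SQ.:* d) SQ.:+ (x SQ.:+ d) SQ.:* r)) refl x Δ (pow x k) (ι (suc k)) (remainder k))

  taylorBound : ℕ → ℚ
  taylorBound zero    = 0ℚ
  taylorBound (suc k) = ι (suc k) ℚ.* pow 2ℚ k ℚ.+ 2ℚ ℚ.* taylorBound k

  taylorBound-nonNeg : ∀ k → 0ℚ ℚ.≤ taylorBound k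
  taylorBound-nonNeg zero    = ℚ.≤-refl
  taylorBound-nonNeg (suc k) = ℚ.+-mono-≤ {0ℚ} {ι (suc k) ℚ.* pow 2ℚ k} {0ℚ}
      (*-nonNeg (0≤ι (suc k)) (pow-nonNeg (ℚ.nonNegative⁻¹ 2ℚ) k)) (*-nonNeg (ℚ.nonNegative⁻¹ 2ℚ) (taylorBound-nonNeg k))

  remainder-bounded : ∀ {x Δ} → ℚ.∣ x ∣ ℚ.≤ 2ℚ → ℚ.∣ x ℚ.+ Δ ∣ ℚ.≤ 2ℚ → 0ℚ ℚ.≤ Δ → ∀ k →
      ℚ.∣ remainder x Δ k ∣ ℚ.≤ taylorBound k ℚ.* (Δ ℚ.* Δ)
  remainder-bounded {x} {Δ} h h′ 0≤Δ zero    = ℚ.≤-reflexive (sym (ℚ.*-zeroˡ (Δ ℚ.* Δ)))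
  remainder-bounded {x} {Δ} h h′ 0≤Δ (suc k) = begin
    ℚ.∣ ι (suc k) ℚ.* pow x k ℚ.* (Δ ℚ.* Δ) ℚ.+ (x ℚ.+ Δ) ℚ.* remainder x Δ k ∣
      ≤⟨ ℚ.∣p+q∣≤∣p∣+∣q∣ (ι (suc k) ℚ.* pow x k ℚ.* (Δ ℚ.* Δ)) ((x ℚ.+ Δ) ℚ.* remainder x Δ k) ⟩
    ℚ.∣ ι (suc k) ℚ.* pow x k ℚ.* (Δ ℚ.* Δ) ∣ ℚ.+ ℚ.∣ (x ℚ.+ Δ) ℚ.* remainder x Δ k ∣
      ≡⟨ cong₂ ℚ._+_ (trans (ℚ.∣p*q∣≡∣p∣*∣q∣ (ι (suc k) ℚ.* pow x k) (Δ ℚ.* Δ))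
          (cong₂ ℚ._*_ (trans (ℚ.∣p*q∣≡∣p∣*∣q∣ (ι (suc k)) (pow x k)) (cong (ℚ._* ℚ.∣ pow x k ∣) (ℚ.0≤p⇒∣p∣≡p (0≤ι (suc k)))))
          (ℚ.0≤p⇒∣p∣≡p 0≤Δ²)))
           (ℚ.∣p*q∣≡∣p∣*∣q∣ (x ℚ.+ Δ) (remainder x Δ k)) ⟩
    ι (suc k) ℚ.* ℚ.∣ pow x k ∣ ℚ.* (Δ ℚ.* Δ) ℚ.+ ℚ.∣ x ℚ.+ Δ ∣ ℚ.* ℚ.∣ remainder x Δ k ∣
      ≤⟨ ℚ.+-mono-≤ (ℚ.*-monoʳ-≤-nonNeg (Δ ℚ.* Δ) {{ℚ.nonNegative 0≤Δ²}}
          (ℚ.*-monoˡ-≤-nonNeg (ι (suc k)) {{ℚ.nonNegative (0≤ι (suc k))}} (pow-bounded h k)))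
           (*-mono (ℚ.0≤∣p∣ (x ℚ.+ Δ)) (*-nonNeg (taylorBound-nonNeg k) 0≤Δ²) h′ (remainder-bounded h h′ 0≤Δ k)) ⟩
    ι (suc k) ℚ.* pow 2ℚ k ℚ.* (Δ ℚ.* Δ) ℚ.+ 2ℚ ℚ.* (taylorBound k ℚ.* (Δ ℚ.* Δ))
      ≡⟨ SQ.solve 4 (λ a t c d → a SQ.:* d SQ.:+ t SQ.:* (c SQ.:* d) SQ.:= (a SQ.:+ t SQ.:* c) SQ.:* d) refl
          (ι (suc k) ℚ.* pow 2ℚ k) 2ℚ (taylorBound k) (Δ ℚ.* Δ) ⟩
    taylorBound (suc k) ℚ.* (Δ ℚ.* Δ) ∎
    where
    open ℚ.≤-Reasoning
    0≤Δ² : 0ℚ ℚ.≤ Δ ℚ.* Δ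
    0≤Δ² = *-nonNeg 0≤Δ 0≤Δ

  arc : ℚ → ℝ
  arc x = root (4ℚ ℚ.- x ℚ.* x)

  cube : ℝ → ℝ
  cube y = y * (y * y)

  radicand≥0 : ∀ {x} → ℚ.∣ x ∣ ℚ.≤ 2ℚ → 0ℚ ℚ.≤ 4ℚ ℚ.- x ℚ.* x
  radicand≥0 {x} h = ℚ.≤-trans (ℚ.≤-reflexive (sym (ℚ.+-inverseʳ (x ℚ.* x)))) (ℚ.+-monoˡ-≤ (ℚ.- (x ℚ.* x)) (ℚ.≤-trans (p≤∣p∣ (x ℚ.* x))
    (ℚ.≤-trans (ℚ.≤-reflexive (sym (∣∣-square x))) (*-mono (ℚ.0≤∣p∣ x) (ℚ.nonNegative⁻¹ 2ℚ) h h))))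

  radicand≤4 : ∀ x → 4ℚ ℚ.- x ℚ.* x ℚ.≤ 2ℚ ℚ.* 2ℚ
  radicand≤4 x = ℚ.≤-trans (ℚ.+-monoʳ-≤ 4ℚ (ℚ.neg-antimono-≤ (ℚ.≤-trans (ℚ.0≤∣p∣ (x ℚ.* x)) (ℚ.≤-reflexive (ℚ.0≤p⇒∣p∣≡p sq)))))
      (ℚ.≤-reflexive (ℚ.+-identityʳ 4ℚ))
    where
    sq : 0ℚ ℚ.≤ x ℚ.* x
    sq = subst (0ℚ ℚ.≤_) (trans (∣∣-square x) (square-abs x)) (*-nonNeg (ℚ.0≤∣p∣ x) (ℚ.0≤∣p∣ x))
      where
      square-abs : ∀ x → ℚ.∣ x ℚ.* x ∣ ≡ x ℚ.* x
      square-abs x with ℚ.∣p∣≡p∨∣p∣≡-p x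
      ... | inj₁ e = trans (sym (∣∣-square x)) (cong (λ t → t ℚ.* t) e)
      ... | inj₂ e = trans (sym (∣∣-square x)) (trans (cong (λ t → t ℚ.* t) e)
          (SQ.solve 1 (λ x → (SQ.:- x) SQ.:* (SQ.:- x) SQ.:= x SQ.:* x) refl x))

  private
    _·_ : ℚ → ℚ → ℚ
    _·_ = ℚ._*_
    infixl 7 _·_

  -- The bounds for `t₁` to `t₄` in `Increment`, divided by η Δ and added: `t₁` and `t₂` contribute
  -- (20 + 12) 2 ^ k, which is 16 times 2 ^ (k + 1), then 24 comes from `t₃` and 16 from `t₄`.
  errorBound : ℕ → ℚ
  errorBound k = pow 2ℚ (suc k) · ι 16 ℚ.+ ι 24 · (ι (suc k) · pow 2ℚ k) ℚ.+ ι 16 · taylorBound k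

  errorBound-nonNeg : ∀ k → 0ℚ ℚ.≤ errorBound k
  errorBound-nonNeg k = ℚ.+-mono-≤ {0ℚ} {pow 2ℚ (suc k) · ι 16 ℚ.+ ι 24 · (ι (suc k) · pow 2ℚ k)} {0ℚ} {ι 16 · taylorBound k}
    (ℚ.+-mono-≤ {0ℚ} {pow 2ℚ (suc k) · ι 16} {0ℚ} {ι 24 · (ι (suc k) · pow 2ℚ k)}
        (*-nonNeg (pow-nonNeg (ℚ.nonNegative⁻¹ 2ℚ) (suc k)) (0≤ι 16))
        (*-nonNeg (0≤ι 24) (*-nonNeg (0≤ι (suc k)) (pow-nonNeg (ℚ.nonNegative⁻¹ 2ℚ) k))))
    (*-nonNeg (0≤ι 16) (taylorBound-nonNeg k))

  -- The increment of z ^ (k + 1) (4 - z²) ^ (3/2), compared with the derivative at the left end point.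
  module Increment (k : ℕ) {x Δ η : ℚ} (x≤2 : ℚ.∣ x ∣ ℚ.≤ 2ℚ) (x′≤2 : ℚ.∣ x ℚ.+ Δ ∣ ℚ.≤ 2ℚ) (0≤Δ : 0ℚ ℚ.≤ Δ) (Δ≤1 : Δ ℚ.≤ 1ℚ)
                   (0<η : 0ℚ ℚ.< η) (Δ≤η : Δ ℚ.≤ η) (5Δ≤η² : ι 5 ℚ.* Δ ℚ.≤ η ℚ.* η) where

    p q D X B R i : ℝ
    p = arc x
    q = arc (x ℚ.+ Δ)
    D = fromℚ Δ
    X = fromℚ x
    B = fromℚ (pow x k)
    R = fromℚ (remainder x Δ k)
    i = fromℚ (ι (suc k))

    -- The derivative of z ^ (k + 1) (4 - z²) ^ (3/2) at `x` is this number times `arc x`; the two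
    -- powers in it give the two moments of the recurrence.
    slope : ℚ
    slope = ι 4 · ι (suc k) · pow x k ℚ.- (ι (suc k) ℚ.+ ι 3) · pow x (suc (suc k))

    p² : p * p ≈ fromℚ 4ℚ - X * X
    p² = ≈-trans (root-square (radicand≥0 x≤2)) (pointwise-≈ λ _ → refl)

    q² : q * q ≈ fromℚ 4ℚ - (X + D) * (X + D)
    q² = ≈-trans (root-square (radicand≥0 x′≤2)) (pointwise-≈ λ _ → refl)

    p≤2 : p BoundedBy 2ℚ
    p≤2 = root-bounded (radicand≥0 x≤2) (ℚ.positive⁻¹ 2ℚ) (radicand≤4 x)

    q≤2 : q BoundedBy 2ℚ
    q≤2 = root-bounded (radicand≥0 x′≤2) (ℚ.positive⁻¹ 2ℚ) (radicand≤4 (x ℚ.+ Δ))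

    width : ℚ
    width = ι 2 · x · Δ ℚ.+ Δ · Δ

    width-bounded : ℚ.∣ width ∣ ℚ.≤ ι 5 ℚ.* Δ
    width-bounded = begin
      ℚ.∣ width ∣                              ≡⟨ cong ℚ.∣_∣
          (SQ.solve 2 (λ x d → SQ.con (pos 2) SQ.:* x SQ.:* d SQ.:+ d SQ.:* d SQ.:= (SQ.con (pos 2) SQ.:* x SQ.:+ d) SQ.:* d) refl x Δ) ⟩
      ℚ.∣ (ι 2 · x ℚ.+ Δ) · Δ ∣                ≡⟨ trans (ℚ.∣p*q∣≡∣p∣*∣q∣ (ι 2 · x ℚ.+ Δ) Δ)
          (cong (ℚ.∣ ι 2 · x ℚ.+ Δ ∣ ℚ.*_) (ℚ.0≤p⇒∣p∣≡p 0≤Δ)) ⟩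
      ℚ.∣ ι 2 · x ℚ.+ Δ ∣ · Δ                  ≤⟨ ℚ.*-monoʳ-≤-nonNeg Δ {{ℚ.nonNegative 0≤Δ}} (ℚ.≤-trans (ℚ.∣p+q∣≤∣p∣+∣q∣ (ι 2 · x) Δ)
                                                    (ℚ.+-mono-≤ (ℚ.≤-trans (ℚ.≤-reflexive (ℚ.∣p*q∣≡∣p∣*∣q∣ (ι 2) x))
                                                        (ℚ.*-monoˡ-≤-nonNeg (ι 2) x≤2))
                                                        (ℚ.≤-trans (ℚ.≤-reflexive (ℚ.0≤p⇒∣p∣≡p 0≤Δ)) Δ≤1))) ⟩
      ι 5 ℚ.* Δ                                ∎
      where open ℚ.≤-Reasoning

    -- At the end points ±2 the root has no Lipschitz bound. Instead p² - q² = 2 x Δ + Δ² is at most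
    -- 5 Δ ≤ η² in absolute value, and roots of numbers at distance at most η² differ by at most η.
    difference-bounded : q - p BoundedBy η
    difference-bounded = abs≤ (minus (root-close (radicand≥0 x≤2) (radicand≥0 x′≤2) 0<η
        (near x (x ℚ.+ Δ) ((SQ.solve 2 (λ x d → SQ.con (pos 4) SQ.:- (x SQ.:+ d) SQ.:* (x SQ.:+ d) SQ.:-
        (SQ.con (pos 4) SQ.:- x SQ.:* x) SQ.:= SQ.:- (SQ.con (pos 2) SQ.:* x SQ.:* d SQ.:+ d SQ.:* d)) refl x Δ))
        (ℚ.≤-trans (-p≤∣p∣ width) (ℚ.≤-trans width-bounded 5Δ≤η²)))))
        (minus (root-close (radicand≥0 x′≤2) (radicand≥0 x≤2) 0<η
            (near (x ℚ.+ Δ) x ((SQ.solve 2 (λ x d → SQ.con (pos 4) SQ.:- x SQ.:* x SQ.:-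
            (SQ.con (pos 4) SQ.:- (x SQ.:+ d) SQ.:* (x SQ.:+ d)) SQ.:= SQ.con (pos 2) SQ.:* x SQ.:* d SQ.:+ d SQ.:* d) refl
            x Δ)) (ℚ.≤-trans (p≤∣p∣ width) (ℚ.≤-trans width-bounded 5Δ≤η²)))))
      where

      near : ∀ x y {w} → 4ℚ ℚ.- y ℚ.* y ℚ.- (4ℚ ℚ.- x ℚ.* x) ≡ w → w ℚ.≤ η ℚ.* η → 4ℚ ℚ.- y ℚ.* y ℚ.≤ 4ℚ ℚ.- x ℚ.* x ℚ.+ η ℚ.* η
      near x y eq h = -≤⇒≤+ (ℚ.≤-trans (ℚ.≤-reflexive eq) h)
      minus : ∀ {a b} → a ≤ b + fromℚ η → a - b ≤ fromℚ η
      minus {a} {b} h = 0≤-⇒≤ (≤-trans (≤⇒0≤- h) (≈⇒≤ (SR.solve 3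
          (λ a b e → (b SR.:+ e) SR.:- a SR.:= e SR.:- (a SR.:- b)) ≈-refl a b (fromℚ η))))
      abs≤ : ∀ {a b} → a - b ≤ fromℚ η → b - a ≤ fromℚ η → a - b BoundedBy η
      abs≤ {a} {b} h h′ ._≤_.below ε 0<ε = eventually₂ (λ n u v → ∣p∣≤ u
          (subst (ℚ._≤ η ℚ.+ ε) (SQ.solve 2 (λ a b → b SQ.:- a SQ.:= SQ.:- (a SQ.:- b)) refl (seq a n) (seq b n)) v))
          (_≤_.below h ε 0<ε) (_≤_.below h′ ε 0<ε)

    increment : ℝ
    increment = fromℚ (pow (x ℚ.+ Δ) (suc k)) * cube q - fromℚ (pow x (suc k)) * cube p

    private
      δ E₁ E₂ t₁ t₂ t₃ t₄ two : ℝ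
      two = fromℚ 2ℚ
      δ  = q - p
      E₁ = p * p - (fromℚ 4ℚ - X * X)
      E₂ = q * q - (fromℚ 4ℚ - (X + D) * (X + D))
      t₁ = X * B * (δ * (δ * (q + q + p)))
      t₂ = X * B * (fromℚ (ι 3) * (D * D) * p)
      t₃ = two * (i * B) * D * (δ * (q * q + q * p + p * p))
      t₄ = two * (R * cube q)

      -- The factor 2 is due to 2 (q³ - p³) - 3 p (q² - p²) = (q - p)² (2 q + p), where q² - p² is a
      -- polynomial in x and Δ. What remains after removal of the derivative is of order η Δ in
      -- every term.
      expand : two * (increment - fromℚ (slope ℚ.* Δ) * p) ≈ t₁ - t₂ + t₃ + t₄
      expand = begin
        two * (increment - fromℚ (slope ℚ.* Δ) * p)
          ≈⟨ *-cong (≈-refl {x = two}) (+-cong (+-cong (*-cong taylor (≈-refl {x = cube q}))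
              (neg-cong (*-cong {y = cube p} first (≈-refl {x = cube p})))) (neg-cong (*-cong {y = p} slope≈ (≈-refl {x = p})))) ⟩
        two * ((X * B + i * B * D + R) * cube q - X * B * cube p - (four * i * B - (i + three) * (X * (X * B))) * D * p)
          ≈⟨ *-cong {y = expression} (pointwise-≈ {two} {Integers.ιℤ ℝ-ring (pos 2)} λ _ → refl)
              (+-cong (≈-refl {x = (X * B + i * B * D + R) * cube q - X * B * cube p})
              (neg-cong (*-cong {y = p} (*-cong {y = D} (+-cong
              (*-cong {y = B} (*-cong {y = i} (pointwise-≈ {four} {Integers.ιℤ ℝ-ring (pos 4)} λ _ → refl) ≈-refl)
              ≈-refl) (neg-cong (*-cong {y = X * (X * B)}
              (+-cong (≈-refl {x = i}) (pointwise-≈ {three} {Integers.ιℤ ℝ-ring (pos 3)} λ _ → refl)) ≈-refl)))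
              ≈-refl) ≈-refl))) ⟩
        _ ≈⟨ SR.solve 7 (λ p q X B D R i → con (pos 2) :* ((X :* B :+ i :* B :* D :+ R) :* (q :* (q :* q)) :- X :* B :*
            (p :* (p :* p)) :- (con (pos 4) :* i :* B :- (i :+ con (pos 3)) :* (X :* (X :* B))) :* D :* p) :=
               X :* B :* ((q :- p) :* ((q :- p) :* (q :+ q :+ p))) :- X :* B :* (con (pos 3) :* (D :* D) :* p) :+ con (pos 2) :*
                   (i :* B) :* D :* ((q :- p) :* (q :* q :+ q :* p :+ p :* p)) :+ con (pos 2) :* (R :* (q :* (q :* q)))
               :+ (con (pos 3) :* X :* B :* p :* ((q :* q :- (con (pos 4) :- (X :+ D) :* (X :+ D))) :-
                   (p :* p :- (con (pos 4) :- X :* X))) :+ con (pos 2) :* i :* B :* D :* p :*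
                   (p :* p :- (con (pos 4) :- X :* X)))) ≈-refl p q X B D R i ⟩
        _ ≈⟨ +-cong (+-cong (+-cong (+-cong (≈-refl {x = t₁})
            (neg-cong (*-cong (≈-refl {x = X * B}) (*-cong {y = p}
            (*-cong {y = D * D} (pointwise-≈ {Integers.ιℤ ℝ-ring (pos 3)} {fromℚ (ι 3)} λ _ → refl) ≈-refl) ≈-refl))))
            (*-cong {y = δ * (q * q + q * p + p * p)} (*-cong {y = D} (*-cong {y = i * B} two≈ ≈-refl) ≈-refl) ≈-refl))
            (*-cong {y = R * cube q} two≈ ≈-refl)) vanish ⟩
        t₁ - t₂ + t₃ + t₄ + 0ℝ
          ≈⟨ ℝ-ring.+-identityʳ (t₁ - t₂ + t₃ + t₄) ⟩
        t₁ - t₂ + t₃ + t₄ ∎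
        where
        open import Relation.Binary.Reasoning.Setoid ℝ-ring.setoid
        open SR using (con; _:=_; _:+_; _:*_; _:-_)
        four three expression ι2 ι3 ι4 : ℝ
        four = fromℚ (ι 4)
        three = fromℚ (ι 3)
        ι2 = Integers.ιℤ ℝ-ring (pos 2)
        ι3 = Integers.ιℤ ℝ-ring (pos 3)
        ι4 = Integers.ιℤ ℝ-ring (pos 4)
        expression = (X * B + i * B * D + R) * cube q - X * B * cube p - (four * i * B - (i + three) * (X * (X * B))) * D * p
        two≈ : ι2 ≈ two
        two≈ = pointwise-≈ λ _ → refl
        four≈ : ι4 ≈ fromℚ 4ℚ
        four≈ = pointwise-≈ λ _ → refl
        taylor : fromℚ (pow (x ℚ.+ Δ) (suc k)) ≈ X * B + i * B * D + R
        taylor = pointwise-≈ λ _ → pow-taylor x Δ k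
        first : fromℚ (pow x (suc k)) ≈ X * B
        first = pointwise-≈ λ _ → refl
        slope≈ : fromℚ (slope ℚ.* Δ) ≈ (four * i * B - (i + three) * (X * (X * B))) * D
        slope≈ = pointwise-≈ λ _ → refl
        e₁≈0 : p * p - (ι4 - X * X) ≈ 0ℝ
        e₁≈0 = ≈⇒-≈0 (≈-trans p² (+-cong (≈-sym four≈) ≈-refl))
        e₂≈0 : q * q - (ι4 - (X + D) * (X + D)) ≈ 0ℝ
        e₂≈0 = ≈⇒-≈0 (≈-trans q² (+-cong (≈-sym four≈) ≈-refl))
        vanish : ι3 * X * B * p * ((q * q - (ι4 - (X + D) * (X + D))) - (p * p - (ι4 - X * X))) + ι2 * i * B * D * p *
            (p * p - (ι4 - X * X)) ≈ 0ℝ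
        vanish = ≈-trans (+-cong (*-cong (≈-refl {x = ι3 * X * B * p}) (≈-trans (+-cong e₂≈0 (neg-cong e₁≈0)) (pointwise-≈ λ _ → refl)))
            (*-cong (≈-refl {x = ι2 * i * B * D * p}) e₁≈0))
          (≈-trans (+-cong (ℝ-ring.zeroʳ (ι3 * X * B * p)) (ℝ-ring.zeroʳ (ι2 * i * B * D * p))) (pointwise-≈ λ _ → refl))

      Q : ℚ
      Q = pow 2ℚ k

      ηΔ : ℚ
      ηΔ = η ℚ.* Δ

      B≤ : B BoundedBy Q
      B≤ = bounded-fromℚ (pow-bounded x≤2 k)

      D² : D * D BoundedBy ηΔ
      D² = bounded-cong {fromℚ (Δ ℚ.* Δ)} (pointwise-≈ λ _ → refl)
          (bounded-fromℚ (ℚ.≤-trans (ℚ.≤-reflexive (ℚ.0≤p⇒∣p∣≡p (*-nonNeg 0≤Δ 0≤Δ)))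
        (ℚ.*-monoʳ-≤-nonNeg Δ {{ℚ.nonNegative 0≤Δ}} Δ≤η)))

      R≤ : R BoundedBy taylorBound k ℚ.* ηΔ
      R≤ = bounded-fromℚ (ℚ.≤-trans (remainder-bounded x≤2 x′≤2 0≤Δ k)
          (ℚ.*-monoˡ-≤-nonNeg (taylorBound k) {{ℚ.nonNegative (taylorBound-nonNeg k)}} (ℚ.*-monoʳ-≤-nonNeg Δ {{ℚ.nonNegative 0≤Δ}} Δ≤η)))

      D≤ : D BoundedBy Δ
      D≤ = bounded-fromℚ (ℚ.≤-reflexive (ℚ.0≤p⇒∣p∣≡p 0≤Δ))

      i≤ : i BoundedBy ι (suc k)
      i≤ = bounded-fromℚ (ℚ.≤-reflexive (ℚ.0≤p⇒∣p∣≡p (0≤ι (suc k))))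

      2≤ : two BoundedBy 2ℚ
      2≤ = bounded-fromℚ ℚ.≤-refl

      -- |q - p| (2 q + p) ≤ 2 |q² - p²|.
      δ-sum : δ * (q + q + p) BoundedBy 2ℚ ℚ.* (ι 5 ℚ.* Δ)
      δ-sum = begin
        ∣ δ * (q + q + p) ∣            ≈⟨ ≈-trans (∣-∣-homo-* δ (q + q + p))
            (*-cong (≈-refl {x = ∣ δ ∣}) (0≤⇒∣-∣≈ (≤-trans (≈⇒≤ (pointwise-≈ λ _ → refl))
            (+-mono-≤ {0ℝ + 0ℝ} {q + q} {0ℝ} {p} (+-mono-≤ (root≥0 _) (root≥0 _)) (root≥0 _))))) ⟩
        ∣ δ ∣ * (q + q + p)            ≲⟨ *-mono-≤ (0≤∣-∣ δ) (≤-trans 0≤2 (≈⇒≤ (≈-refl {x = two * (q + p)}))) ≤-refl upper ⟩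
        ∣ δ ∣ * (two * (q + p))        ≈⟨ *-cong (≈-refl {x = ∣ δ ∣}) (≈-sym (0≤⇒∣-∣≈ 0≤2)) ⟩
        ∣ δ ∣ * ∣ two * (q + p) ∣      ≈⟨ ≈-sym (∣-∣-homo-* δ (two * (q + p))) ⟩
        ∣ δ * (two * (q + p)) ∣        ≲⟨ bounded-cong {two * (- fromℚ width)} (≈-sym squares)
            (bounded-* 2≤ (bounded-neg {fromℚ width} (bounded-fromℚ width-bounded))) ⟩
        fromℚ (2ℚ ℚ.* (ι 5 ℚ.* Δ))     ∎
        where
        open ≤-Reasoning
        0≤q+p : 0ℝ ≤ q + p
        0≤q+p = ≤-trans (≈⇒≤ (pointwise-≈ λ _ → refl)) (+-mono-≤ {0ℝ} {q} {0ℝ} {p} (root≥0 _) (root≥0 _))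
        0≤2 : 0ℝ ≤ two * (q + p)
        0≤2 = 0≤*0≤ (fromℚ-mono (ℚ.nonNegative⁻¹ 2ℚ)) 0≤q+p
        upper : q + q + p ≤ two * (q + p)
        upper = ≤-trans (≈⇒≤ (pointwise-≈ λ n → sym (ℚ.+-identityʳ _))) (≤-trans (+-mono-≤ (≤-refl {q + q + p}) (root≥0 (4ℚ ℚ.- x ℚ.* x)))
          (≈⇒≤ (≈-trans (SR.solve 2 (λ p q → q SR.:+ q SR.:+ p SR.:+ p SR.:= SR.con (pos 2) SR.:* (q SR.:+ p)) ≈-refl p q)
              (*-cong {y = q + p} (pointwise-≈ {Integers.ιℤ ℝ-ring (pos 2)} {two} λ _ → refl) ≈-refl))))
        squares : δ * (two * (q + p)) ≈ two * (- fromℚ width)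
        squares = ≈-trans (SR.solve 3 (λ p q t → (q SR.:- p) SR.:* (t SR.:* (q SR.:+ p)) SR.:= t SR.:*
            (q SR.:* q SR.:- p SR.:* p)) ≈-refl p q two)
          (*-cong (≈-refl {x = two}) (≈-trans (+-cong q² (neg-cong p²))
              (pointwise-≈ λ _ → SQ.solve 2 (λ x d → (SQ.con (pos 4) SQ.:- (x SQ.:+ d) SQ.:* (x SQ.:+ d)) SQ.:-
              (SQ.con (pos 4) SQ.:- x SQ.:* x) SQ.:= SQ.:- (SQ.con (pos 2) SQ.:* x SQ.:* d SQ.:+ d SQ.:* d)) refl x Δ)))

    increment-bounded : increment - fromℚ (slope ℚ.* Δ) * p BoundedBy errorBound k ℚ.* (η ℚ.* Δ)
    increment-bounded = bounded-weaken smaller (bounded-cong {fromℚ ½ * (t₁ - t₂ + t₃ + t₄)}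
        (≈-trans (*-cong (≈-refl {x = fromℚ ½}) (≈-sym expand))
            (≈-trans (≈-sym (ℝ-ring.*-assoc (fromℚ ½) two _))
            (≈-trans (*-cong {y = increment - fromℚ (slope ℚ.* Δ) * p} (pointwise-≈ {fromℚ ½ * two} {1ℝ} λ _ → refl) ≈-refl)
            (ℝ-ring.*-identityˡ _))))
        (bounded-* {fromℚ ½} {t₁ - t₂ + t₃ + t₄} {½} (bounded-fromℚ ℚ.≤-refl)
            (bounded-+ {t₁ - t₂ + t₃} {t₄} (bounded-+ {t₁ - t₂} {t₃} (bounded-+ {t₁} { - t₂} b₁ (bounded-neg {t₂} b₂)) b₃) b₄)))
      where
      A≤ : X * B BoundedBy 2ℚ ℚ.* Q
      A≤ = bounded-* {X} {B} (bounded-fromℚ x≤2) B≤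
      b₁ : t₁ BoundedBy 2ℚ ℚ.* Q ℚ.* (η ℚ.* (2ℚ ℚ.* (ι 5 ℚ.* Δ)))
      b₁ = bounded-* {X * B} A≤ (bounded-* {δ} difference-bounded δ-sum)
      b₂ : t₂ BoundedBy 2ℚ ℚ.* Q ℚ.* (ι 3 ℚ.* ηΔ ℚ.* 2ℚ)
      b₂ = bounded-* {X * B} A≤ (bounded-* {fromℚ (ι 3) * (D * D)} {p} (bounded-* {fromℚ (ι 3)} {D * D} (bounded-fromℚ ℚ.≤-refl) D²) p≤2)
      b₃ : t₃ BoundedBy 2ℚ ℚ.* (ι (suc k) ℚ.* Q) ℚ.* Δ ℚ.* (η ℚ.* (2ℚ ℚ.* 2ℚ ℚ.+ 2ℚ ℚ.* 2ℚ ℚ.+ 2ℚ ℚ.* 2ℚ))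
      b₃ = bounded-* {two * (i * B) * D} (bounded-* {two * (i * B)} {D} (bounded-* {two} {i * B} 2≤ (bounded-* {i} {B} i≤ B≤)) D≤)
        (bounded-* {δ} difference-bounded (bounded-+ {q * q + q * p} {p * p}
            (bounded-+ {q * q} {q * p} (bounded-* {q} {q} q≤2 q≤2) (bounded-* {q} {p} q≤2 p≤2)) (bounded-* {p} {p} p≤2 p≤2)))
      b₄ : t₄ BoundedBy 2ℚ ℚ.* (taylorBound k ℚ.* ηΔ ℚ.* (2ℚ ℚ.* (2ℚ ℚ.* 2ℚ)))
      b₄ = bounded-* {two} {R * cube q} 2≤ (bounded-* {R} {cube q} R≤ (bounded-* {q} {q * q} q≤2 (bounded-* {q} {q} q≤2 q≤2)))
      total : ℚ
      total = errorBound k ℚ.* ηΔ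
      smaller : ½ ℚ.* (2ℚ ℚ.* Q ℚ.* (η ℚ.* (2ℚ ℚ.* (ι 5 ℚ.* Δ))) ℚ.+ 2ℚ ℚ.* Q ℚ.* (ι 3 ℚ.* ηΔ ℚ.* 2ℚ) ℚ.+ 2ℚ ℚ.*
          (ι (suc k) ℚ.* Q) ℚ.* Δ ℚ.* (η ℚ.* (2ℚ ℚ.* 2ℚ ℚ.+ 2ℚ ℚ.* 2ℚ ℚ.+ 2ℚ ℚ.* 2ℚ)) ℚ.+ 2ℚ ℚ.*
          (taylorBound k ℚ.* ηΔ ℚ.* (2ℚ ℚ.* (2ℚ ℚ.* 2ℚ)))) ℚ.≤ total
      smaller = ℚ.≤-trans (ℚ.≤-reflexive (trans (cong (½ ℚ.*_) (SQ.solve 5 (λ P η d i t →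
          SQ.con (pos 2) SQ.:* P SQ.:* (η SQ.:* (SQ.con (pos 2) SQ.:* (SQ.con (pos 5) SQ.:* d))) SQ.:+ SQ.con
              (pos 2) SQ.:* P SQ.:* (SQ.con (pos 3) SQ.:* (η SQ.:* d) SQ.:* SQ.con (pos 2)) SQ.:+ SQ.con (pos 2) SQ.:*
              (i SQ.:* P) SQ.:* d SQ.:* (η SQ.:* SQ.con (pos 12)) SQ.:+ SQ.con (pos 2) SQ.:*
              (t SQ.:* (η SQ.:* d) SQ.:* SQ.con (pos 8)) SQ.:=
          (SQ.con (pos 2) SQ.:* P SQ.:* SQ.con (pos 16) SQ.:+ SQ.con (pos 24) SQ.:* (i SQ.:* P) SQ.:+ SQ.con (pos 16) SQ.:* t)
              SQ.:* (η SQ.:* d)) refl Q η Δ (ι (suc k)) (taylorBound k))) refl))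
        (ℚ.≤-trans (ℚ.*-monoʳ-≤-nonNeg total {{ℚ.nonNegative 0≤total}} (half≤1)) (ℚ.≤-reflexive (ℚ.*-identityˡ total)))
        where
        half≤1 : ½ ℚ.≤ 1ℚ
        half≤1 = halfPow-antitone {0} {1} z≤n
        0≤total : 0ℚ ℚ.≤ total
        0≤total = *-nonNeg (errorBound-nonNeg k) (*-nonNeg (ℚ.<⇒≤ 0<η) 0≤Δ)

-- The moments of the semicircle law are the Catalan numbers.

module SemicircleMoments where

  open ≡ using (refl; cong; sym; trans; subst)
  open import Defs
  open WalkSums using (module Sums)
  open RationalFunctions using (module Integers)
  open RecursionSolution using (ι; module ιℚ)
  open CentralBinomial using (0≤ι; 0<ι-suc; module SQ)
  open CoefficientRatios using (catalan)
  open DilationPowers using (catalan-suc; catalan-zero)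
  open RealArithmetic
  open RiemannSums
  open SemicircleIncrements

  open Estimates
  open TestFunction using (fun)
  open ℝ using (seq)
  open Sums ℚ.+-*-commutativeRing using (pow)

  *-⁻¹ : ∀ {x} (0<x : 0ℝ < x) → x * x ⁻¹⟨ 0<x ⟩ ≈ 1ℝ
  *-⁻¹ {x} (ε , 0<ε , ε≤x) ._≈_.close η 0<η = eventually₁ (λ n h → ℚ.≤-trans
      (ℚ.≤-reflexive (cong ℚ.∣_∣ (trans (cong (ℚ._- 1ℚ) (exact n h)) refl))) (ℚ.<⇒≤ 0<η)) ε≤x
    where
    exact : ∀ n → 0ℚ ℚ.+ ε ℚ.≤ seq x n → seq x n ℚ.* recip (ε ℚ.⊔ seq x n) (truncated>0 (seq x) 0<ε n) ≡ 1ℚ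
    exact n h = trans (cong (ℚ._* recip (ε ℚ.⊔ seq x n) (truncated>0 (seq x) 0<ε n))
        (sym (ℚ.p≤q⇒p⊔q≡q (subst (ℚ._≤ seq x n) (ℚ.+-identityˡ ε) h))))
      (p*recip (truncated>0 (seq x) 0<ε n))

  0<4 : 0ℚ ℚ.< 4ℚ
  0<4 = ℚ.positive⁻¹ 4ℚ

  0<2 : 0ℚ ℚ.< 2ℚ
  0<2 = ℚ.positive⁻¹ 2ℚ

  module U = Uniform -2ℚ 4ℚ 0<4
  module W = Uniform (ℚ.- 1ℚ) 2ℚ 0<2

  arcSum : ℕ → ℕ → ℝ
  arcSum k K = ∑ (U.N K) λ i → fromℚ (pow (U.x K i) k ℚ.* U.Δ K) * arc (U.x K i)

  abs≤2 : ∀ {x} → -2ℚ ℚ.≤ x → x ℚ.≤ 2ℚ → ℚ.∣ x ∣ ℚ.≤ 2ℚ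
  abs≤2 {x} h h′ = ∣p∣≤ h′ (ℚ.neg-antimono-≤ h)

  x≤2 : ∀ K i → i ℕ.≤ U.N K → ℚ.∣ U.x K i ∣ ℚ.≤ 2ℚ
  x≤2 K i i≤N = abs≤2 (U.a≤x K i) (U.x≤ K i i≤N)

  module _ (k : ℕ) where

    slopeSum : ℕ → ℝ
    slopeSum K = fromℚ (ι 4 ℚ.* ι (suc k)) * arcSum k K - fromℚ (ι (suc k) ℚ.+ ι 3) * arcSum (suc (suc k)) K

    private
      slope : ℚ → ℚ
      slope x = ι 4 ℚ.* ι (suc k) ℚ.* pow x k ℚ.- (ι (suc k) ℚ.+ ι 3) ℚ.* pow x (suc (suc k))

      slopeSum≈ : ∀ K → slopeSum K ≈ ∑ (U.N K) λ i → fromℚ (slope (U.x K i) ℚ.* U.Δ K) * arc (U.x K i)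
      slopeSum≈ K = ≈-sym (≈-trans (∑-cong (U.N K) (λ i _ → ≈-trans
          (*-cong {y = arc (U.x K i)} (pointwise-≈ {fromℚ (slope (U.x K i) ℚ.* U.Δ K)}
          {a * fromℚ (pow (U.x K i) k ℚ.* U.Δ K) - b * fromℚ (pow (U.x K i) (suc (suc k)) ℚ.* U.Δ K)} λ _ →
            SQ.solve 5 (λ a u b v d → (a SQ.:* u SQ.:- b SQ.:* v) SQ.:* d SQ.:= a SQ.:* (u SQ.:* d) SQ.:- b SQ.:* (v SQ.:* d))
                refl (ι 4 ℚ.* ι (suc k)) (pow (U.x K i) k) (ι (suc k) ℚ.+ ι 3) (pow (U.x K i) (suc (suc k))) (U.Δ K)) ≈-refl)
          (SR.solve 5 (λ a u b v r → (a SR.:* u SR.:- b SR.:* v) SR.:* r SR.:= a SR.:* (u SR.:* r) SR.:+ (SR.:- b) SR.:*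
              (v SR.:* r)) ≈-refl a (fromℚ (pow (U.x K i) k ℚ.* U.Δ K)) b (fromℚ (pow (U.x K i) (suc (suc k)) ℚ.* U.Δ K)) (arc (U.x K i)))))
        (≈-trans (∑-+ (U.N K) (λ i → a * (fromℚ (pow (U.x K i) k ℚ.* U.Δ K) * arc (U.x K i)))
            (λ i → - b * (fromℚ (pow (U.x K i) (suc (suc k)) ℚ.* U.Δ K) * arc (U.x K i))))
          (≈-trans (+-cong (∑-* (U.N K) a (λ i → fromℚ (pow (U.x K i) k ℚ.* U.Δ K) * arc (U.x K i)))
              (∑-* (U.N K) (- b) (λ i → fromℚ (pow (U.x K i) (suc (suc k)) ℚ.* U.Δ K) * arc (U.x K i))))
            (SR.solve 4 (λ a b s t → a SR.:* s SR.:+ (SR.:- b) SR.:* t SR.:= a SR.:* s SR.:- b SR.:* t) ≈-refl a b (arcSum k K)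
                (arcSum (suc (suc k)) K)))))
        where
        a b : ℝ
        a = fromℚ (ι 4 ℚ.* ι (suc k))
        b = fromℚ (ι (suc k) ℚ.+ ι 3)

      H : ℕ → ℕ → ℝ
      H K i = fromℚ (pow (U.x K i) (suc k)) * cube (arc (U.x K i))

      arc-end : ∀ {x} → 4ℚ ℚ.- x ℚ.* x ≡ 0ℚ → arc x ≈ 0ℝ
      arc-end {x} eq = square≈0⇒≈0 (≈-trans (root-square {4ℚ ℚ.- x ℚ.* x} (ℚ.≤-reflexive (sym eq))) (fromℚ-cong eq))

      H-end : ∀ K i → 4ℚ ℚ.- U.x K i ℚ.* U.x K i ≡ 0ℚ → H K i ≈ 0ℝ
      H-end K i eq = ≈-trans (*-cong (≈-refl {x = fromℚ (pow (U.x K i) (suc k))})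
          (≈-trans (*-cong {y = arc (U.x K i) * arc (U.x K i)} (arc-end {U.x K i} eq) ≈-refl)
          (ℝ-ring.zeroˡ (arc (U.x K i) * arc (U.x K i))))) (ℝ-ring.zeroʳ (fromℚ (pow (U.x K i) (suc k))))

      -- The increments of `H` telescope to 0, as the root vanishes at both ends. So the sum of the
      -- slopes is minus the sum of the errors, `N` terms of order η Δ with N Δ = 4.
      slopeSum-bounded : ∀ K {η} → 0ℚ ℚ.< η → U.Δ K ℚ.≤ 1ℚ → U.Δ K ℚ.≤ η → ι 5 ℚ.* U.Δ K ℚ.≤ η ℚ.* η →
                         slopeSum K BoundedBy 4ℚ ℚ.* (errorBound k ℚ.* η)
      slopeSum-bounded K {η} 0<η Δ≤1 Δ≤η 5Δ≤η² = bounded-weaken (ℚ.≤-reflexive collect) (bounded-cong {∑ (U.N K) (λ i → - error i)} flip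
          (∑-bounded (U.N K) (λ i i<N → bounded-neg {error i} (error-bounded i i<N))))
        where
        error : ℕ → ℝ
        error i = (H K (suc i) - H K i) - fromℚ (slope (U.x K i) ℚ.* U.Δ K) * arc (U.x K i)
        error-bounded : ∀ i → i ℕ.< U.N K → error i BoundedBy errorBound k ℚ.* (η ℚ.* U.Δ K)
        error-bounded i i<N = bounded-cong {I.increment - fromℚ (I.slope ℚ.* U.Δ K) * I.p}
          (+-cong (+-cong (ℝ-ring.reflexive (cong (λ y → fromℚ (pow y (suc k)) * cube (arc y)) (sym (U.x-suc K i))))
              (≈-refl {x = - H K i})) (≈-refl {x = - (fromℚ (slope (U.x K i) ℚ.* U.Δ K) * arc (U.x K i))})) I.increment-bounded
          where
          module I = Increment k {U.x K i} {U.Δ K} {η} (x≤2 K i (ℕ.<⇒≤ i<N))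
              (subst (λ y → ℚ.∣ y ∣ ℚ.≤ 2ℚ) (U.x-suc K i) (x≤2 K (suc i) i<N)) (U.0≤Δ K) Δ≤1 0<η Δ≤η 5Δ≤η²
        collect : ι (U.N K) ℚ.* (errorBound k ℚ.* (η ℚ.* U.Δ K)) ≡ 4ℚ ℚ.* (errorBound k ℚ.* η)
        collect = trans (SQ.solve 4 (λ n e η d → n SQ.:* (e SQ.:* (η SQ.:* d)) SQ.:= (n SQ.:* d) SQ.:* (e SQ.:* η)) refl
            (ι (U.N K)) (errorBound k) η (U.Δ K)) (cong (ℚ._* (errorBound k ℚ.* η)) (U.NΔ K))
        slopes : ℕ → ℝ
        slopes i = fromℚ (slope (U.x K i) ℚ.* U.Δ K) * arc (U.x K i)
        flip : ∑ (U.N K) (λ i → - error i) ≈ slopeSum K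
        flip = ≈-trans (∑-cong (U.N K) (λ i _ → SR.solve 3 (λ h h′ s → SR.:- ((h′ SR.:- h) SR.:- s) SR.:= s SR.:+ SR.con
            (ℤ.- pos 1) SR.:* (h′ SR.:- h)) ≈-refl (H K i) (H K (suc i)) (slopes i)))
          (≈-trans (∑-+ (U.N K) slopes (λ i → Integers.ιℤ ℝ-ring (ℤ.- pos 1) * (H K (suc i) - H K i)))
            (≈-trans (+-cong (≈-sym (slopeSum≈ K)) (≈-trans (∑-* (U.N K) (Integers.ιℤ ℝ-ring (ℤ.- pos 1)) (λ i → H K (suc i) - H K i))
                (≈-trans (*-cong (≈-refl {x = Integers.ιℤ ℝ-ring (ℤ.- pos 1)})
                    (≈-trans (∑-telescope (U.N K) (H K)) (≈-trans
                    (+-cong (H-end K (U.N K) (cong (λ y → 4ℚ ℚ.- y ℚ.* y) (U.x-N K)))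
                    (neg-cong (H-end K 0 (cong (λ y → 4ℚ ℚ.- y ℚ.* y) (U.x-zero K))))) (pointwise-≈ {0ℝ - 0ℝ} {0ℝ} λ _ → refl))))
                  (ℝ-ring.zeroʳ (Integers.ιℤ ℝ-ring (ℤ.- pos 1))))))
              (ℝ-ring.+-identityʳ (slopeSum K))))

    slopeSum→0 : Limit slopeSum 0ℝ
    slopeSum→0 ε 0<ε = go (shrink {p = 1ℚ ℚ.+ 4ℚ ℚ.* errorBound k} (0<1+nonNeg (*-nonNeg (ℚ.<⇒≤ 0<4) 0≤e)) 0<ε)
      where
      0≤e : 0ℚ ℚ.≤ errorBound k
      0≤e = errorBound-nonNeg k
      go : (∃[ η ] 0ℚ ℚ.< η × (1ℚ ℚ.+ 4ℚ ℚ.* errorBound k) ℚ.* η ≡ ε) → Eventually λ K → slopeSum K - 0ℝ BoundedBy ε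
      go (η , 0<η , eq) = go₂ (shrink {p = ι 5} (0<ι-suc 4) (*-pos 0<η 0<η))
        where
        go₂ : (∃[ δ ] 0ℚ ℚ.< δ × ι 5 ℚ.* δ ≡ η ℚ.* η) → Eventually λ K → slopeSum K - 0ℝ BoundedBy ε
        go₂ (δ , 0<δ , eq′) = eventually₂ (λ K Δ≤1⊓η Δ≤δ → bounded-weaken small
            (bounded-cong {slopeSum K} (≈-trans (≈-sym (ℝ-ring.+-identityʳ (slopeSum K)))
            (+-cong (≈-refl {x = slopeSum K}) (pointwise-≈ {0ℝ} { - 0ℝ} λ _ → refl)))
            (slopeSum-bounded K 0<η (ℚ.≤-trans Δ≤1⊓η (ℚ.p⊓q≤p 1ℚ η)) (ℚ.≤-trans Δ≤1⊓η (ℚ.p⊓q≤q 1ℚ η))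
                (ℚ.≤-trans (ℚ.*-monoˡ-≤-nonNeg (ι 5) Δ≤δ) (ℚ.≤-reflexive eq′)))))
          (mesh→0 -2ℚ 4ℚ 0<4 (min>0 (ℚ.positive⁻¹ 1ℚ) 0<η)) (mesh→0 -2ℚ 4ℚ 0<4 0<δ)
          where
          small : 4ℚ ℚ.* (errorBound k ℚ.* η) ℚ.≤ ε
          small = begin
            4ℚ ℚ.* (errorBound k ℚ.* η)            ≡⟨ trans (sym (ℚ.*-assoc 4ℚ (errorBound k) η)) (sym (ℚ.+-identityˡ _)) ⟩
            0ℚ ℚ.+ 4ℚ ℚ.* errorBound k ℚ.* η       ≤⟨ ℚ.+-monoˡ-≤ (4ℚ ℚ.* errorBound k ℚ.* η) (ℚ.<⇒≤ 0<η) ⟩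
            η ℚ.+ 4ℚ ℚ.* errorBound k ℚ.* η        ≡⟨ SQ.solve 2
                (λ η c → η SQ.:+ c SQ.:* η SQ.:= (SQ.con (pos 1) SQ.:+ c) SQ.:* η) refl η (4ℚ ℚ.* errorBound k) ⟩
            (1ℚ ℚ.+ 4ℚ ℚ.* errorBound k) ℚ.* η     ≡⟨ eq ⟩
            ε                                      ∎
            where open ℚ.≤-Reasoning

  module _ {π : ℝ} (isπ : IsPi π) where

    scale : ℝ
    scale = fromℚ ½ * π ⁻¹⟨ proj₁ isπ ⟩

    monomial-rational : ∀ k q n → seq (fun (monomial k) (fromℚ q)) n ≡ pow q k
    monomial-rational zero    q n = refl
    monomial-rational (suc k) q n = cong (q ℚ.*_) (monomial-rational k q n)

    leftSum≈arcSum : ∀ k K → U.leftSum K (λ z → fun (monomial k) z * semicircleDensity π (proj₁ isπ) (λ _ → 1ℝ) z) ≈ scale * arcSum k K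
    leftSum≈arcSum k K = ≈-trans (∑-cong (U.N K) (λ i _ → pointwise-≈ λ n →
        trans (cong (λ t → t ℚ.* (½ ℚ.* seq (π ⁻¹⟨ proj₁ isπ ⟩) n ℚ.* 1ℚ ℚ.* seq (arc (U.x K i)) n) ℚ.* U.Δ K)
            (monomial-rational k (U.x K i) n))
          (SQ.solve 5 (λ m h p r d → m SQ.:* (h SQ.:* p SQ.:* SQ.con (pos 1) SQ.:* r) SQ.:* d SQ.:= h SQ.:* p SQ.:*
              (m SQ.:* d SQ.:* r)) refl
            (pow (U.x K i) k) ½ (seq (π ⁻¹⟨ proj₁ isπ ⟩) n) (seq (arc (U.x K i)) n) (U.Δ K))))
      (∑-* (U.N K) scale (λ i → fromℚ (pow (U.x K i) k ℚ.* U.Δ K) * arc (U.x K i)))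

    arc-half : ∀ {y} → 0ℚ ℚ.≤ 1ℚ ℚ.- y ℚ.* y → ∀ {x} → x ≡ 2ℚ ℚ.* y → arc x ≈ fromℚ 2ℚ * root (1ℚ ℚ.- y ℚ.* y)
    arc-half {y} h refl = square-injective (root≥0 _) (0≤*0≤ (fromℚ-mono (ℚ.<⇒≤ 0<2)) (root≥0 _)) (begin
      arc (2ℚ ℚ.* y) * arc (2ℚ ℚ.* y)                    ≈⟨ root-square (subst (0ℚ ℚ.≤_) (sym four) (*-nonNeg (ℚ.<⇒≤ 0<4) h)) ⟩
      fromℚ (4ℚ ℚ.- 2ℚ ℚ.* y ℚ.* (2ℚ ℚ.* y))             ≈⟨ ≈-trans (fromℚ-cong four) (fromℚ-* 4ℚ (1ℚ ℚ.- y ℚ.* y)) ⟩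
      fromℚ 4ℚ * fromℚ (1ℚ ℚ.- y ℚ.* y)                  ≈⟨ *-cong (pointwise-≈ {fromℚ 4ℚ} {fromℚ 2ℚ * fromℚ 2ℚ} λ _ → refl)
          (≈-sym (root-square h)) ⟩
      fromℚ 2ℚ * fromℚ 2ℚ * (r * r)                      ≈⟨ SR.solve 2
          (λ t r → t SR.:* t SR.:* (r SR.:* r) SR.:= t SR.:* r SR.:* (t SR.:* r)) ≈-refl (fromℚ 2ℚ) r ⟩
      fromℚ 2ℚ * r * (fromℚ 2ℚ * r)                      ∎)
      where
      open import Relation.Binary.Reasoning.Setoid ℝ-ring.setoid
      r : ℝ
      r = root (1ℚ ℚ.- y ℚ.* y)
      four : 4ℚ ℚ.- 2ℚ ℚ.* y ℚ.* (2ℚ ℚ.* y) ≡ 4ℚ ℚ.* (1ℚ ℚ.- y ℚ.* y)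
      four = SQ.solve 1 (λ y → SQ.con (pos 4) SQ.:- SQ.con (pos 2) SQ.:* y SQ.:* (SQ.con (pos 2) SQ.:* y) SQ.:= SQ.con
          (pos 4) SQ.:* (SQ.con (pos 1) SQ.:- y SQ.:* y)) refl y

    disc : ℝ → ℝ
    disc x = fromℚ 2ℚ * √ (1ℝ - x * x)

    discSum : ℕ → ℝ
    discSum K = W.leftSum K disc

    -- The substitution z = 2 y maps the uniform partition of [-1 , 1] to that of [-2 , 2], so the
    -- integral of √(4 - z²) is twice the area of the disc.
    arcSum-zero : ∀ K → arcSum 0 K ≈ fromℚ 2ℚ * discSum K
    arcSum-zero K = ≈-trans (∑-cong (U.N K) (λ i i<N → ≈-trans
        (*-cong (≈-refl {x = fromℚ (1ℚ ℚ.* U.Δ K)}) (arc-half {W.x K i} (unit i (ℕ.<⇒≤ i<N)) {U.x K i} (double i)))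
        (pointwise-≈ λ n → SQ.solve 2 (λ h r → SQ.con (pos 1) SQ.:* (SQ.con (pos 4) SQ.:* h) SQ.:*
            (SQ.con (pos 2) SQ.:* r) SQ.:= SQ.con (pos 2) SQ.:* (SQ.con (pos 2) SQ.:* r SQ.:* (SQ.con (pos 2) SQ.:* h))) refl
            (halfPow K) (seq (root (1ℚ ℚ.- W.x K i ℚ.* W.x K i)) n))))
      (∑-* (U.N K) (fromℚ 2ℚ) (λ i → fromℚ 2ℚ * √ (1ℝ - fromℚ (W.x K i) * fromℚ (W.x K i)) * fromℚ (W.Δ K)))
      where
      double : ∀ i → U.x K i ≡ 2ℚ ℚ.* W.x K i
      double i = SQ.solve 2 (λ i h → SQ.con (ℤ.- pos 2) SQ.:+ i SQ.:* (SQ.con (pos 4) SQ.:* h) SQ.:= SQ.con (pos 2) SQ.:*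
          (SQ.con (ℤ.- pos 1) SQ.:+ i SQ.:* (SQ.con (pos 2) SQ.:* h))) refl (ι i) (halfPow K)
      unit : ∀ i → i ℕ.≤ U.N K → 0ℚ ℚ.≤ 1ℚ ℚ.- W.x K i ℚ.* W.x K i
      unit i i≤N = ℚ.≤-trans (ℚ.≤-reflexive (sym (ℚ.+-inverseʳ (W.x K i ℚ.* W.x K i))))
          (ℚ.+-monoˡ-≤ (ℚ.- (W.x K i ℚ.* W.x K i)) (ℚ.≤-trans (p≤∣p∣ (W.x K i ℚ.* W.x K i))
        (ℚ.≤-trans (ℚ.≤-reflexive (sym (∣∣-square (W.x K i)))) (*-mono (ℚ.0≤∣p∣ (W.x K i)) (ℚ.nonNegative⁻¹ 1ℚ) w≤1 w≤1))))
        where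
        w≤1 : ℚ.∣ W.x K i ∣ ℚ.≤ 1ℚ
        w≤1 = ∣p∣≤ (W.x≤ K i i≤N) (ℚ.neg-antimono-≤ (W.a≤x K i))

    module _ {σ : SignedMeasure} (hasDensity : HasDensityOn (fromℚ -2ℚ) (fromℚ 2ℚ) (semicircleDensity π (proj₁ isπ) (λ _ → 1ℝ)) σ) where

      moment-limit : ∀ k → Limit (λ K → scale * arcSum k K) (momentˢ σ k)
      moment-limit k = limit-cong (leftSum≈arcSum k) (converges -2ℚ 4ℚ 0<4
          {f = λ z → fun (monomial k) z * semicircleDensity π (proj₁ isπ) (λ _ → 1ℝ) z} (≈-refl {x = fromℚ -2ℚ})
          (≈-refl {x = fromℚ 2ℚ}) (hasDensity (monomial k)))

      moment-zero : momentˢ σ 0 ≈ 1ℝ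
      moment-zero = ≈-trans (limit-unique (moment-limit 0) (limit-cong
          (λ K → ≈-trans (ℝ-ring.*-assoc scale (fromℚ 2ℚ) (discSum K)) (*-cong (≈-refl {x = scale}) (≈-sym (arcSum-zero K))))
          (limit-* (scale * fromℚ 2ℚ) (converges (ℚ.- 1ℚ) 2ℚ 0<2 {f = disc} (pointwise-≈ {fromℚ (ℚ.- 1ℚ)} { - 1ℝ} λ _ → refl)
              (≈-refl {x = fromℚ 1ℚ}) (proj₂ isπ)))))
        (≈-trans (SR.solve 4 (λ h i t p → h SR.:* i SR.:* t SR.:* p SR.:= (h SR.:* t) SR.:* (p SR.:* i)) ≈-refl (fromℚ ½)
            (π ⁻¹⟨ proj₁ isπ ⟩) (fromℚ 2ℚ) π)
          (≈-trans (*-cong (pointwise-≈ {fromℚ ½ * fromℚ 2ℚ} {1ℝ} λ _ → refl) (*-⁻¹ (proj₁ isπ))) (ℝ-ring.*-identityˡ 1ℝ)))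

      -- A multiple of the slope sums converges to the difference of the two sides and also to 0;
      -- limits are unique.
      moment-suc : ∀ k → fromℚ (ι (suc k) ℚ.+ ι 3) * momentˢ σ (suc (suc k)) ≈ fromℚ (ι 4 ℚ.* ι (suc k)) * momentˢ σ k
      moment-suc k = ≈-sym (-≈0⇒≈ (≈-trans (+-cong (≈-refl {x = a * momentˢ σ k})
          (SR.solve 2 (λ b m → SR.:- (b SR.:* m) SR.:= (SR.:- b) SR.:* m) ≈-refl b (momentˢ σ (suc (suc k)))))
        (≈-trans (limit-unique (limit-+ (limit-* a (moment-limit k)) (limit-* (- b) (moment-limit (suc (suc k)))))
          (limit-cong (λ K → SR.solve 5 (λ c a s b t → c SR.:* (a SR.:* s SR.:- b SR.:* t) SR.:= a SR.:* (c SR.:* s) SR.:+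
              (SR.:- b) SR.:* (c SR.:* t)) ≈-refl scale a (arcSum k K) b (arcSum (suc (suc k)) K))
              (limit-* scale (slopeSum→0 k)))) (ℝ-ring.zeroʳ scale))))
        where
        a b : ℝ
        a = fromℚ (ι 4 ℚ.* ι (suc k))
        b = fromℚ (ι (suc k) ℚ.+ ι 3)

      -- For k = 2 n the recurrence of the moments is twice the recurrence `catalan-suc`.
      moment-catalan : ∀ n → momentˢ σ (2 ℕ.* n) ≈ fromℚ (catalan n)
      moment-catalan zero    = ≈-trans moment-zero (fromℚ-cong (sym catalan-zero))
      moment-catalan (suc n) = subst (λ k → momentˢ σ k ≈ fromℚ (catalan (suc n))) (sym (ℕ.*-suc 2 n)) (begin
        m                                                  ≈⟨ ≈-sym (ℝ-ring.*-identityˡ m) ⟩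
        1ℝ * m                                             ≈⟨ *-cong {y = m}
            (fromℚ-cong (sym (trans (ℚ.*-comm (recip c 0<c) c) (p*recip 0<c)))) ≈-refl ⟩
        fromℚ (recip c 0<c ℚ.* c) * m                      ≈⟨ ≈-trans (*-cong {y = m} (fromℚ-* (recip c 0<c) c) ≈-refl)
            (ℝ-ring.*-assoc (fromℚ (recip c 0<c)) (fromℚ c) m) ⟩
        fromℚ (recip c 0<c) * (fromℚ c * m)                ≈⟨ *-cong (≈-refl {x = fromℚ (recip c 0<c)}) (moment-suc (2 ℕ.* n)) ⟩
        fromℚ (recip c 0<c) * (fromℚ a * momentˢ σ (2 ℕ.* n)) ≈⟨ *-cong (≈-refl {x = fromℚ (recip c 0<c)})
            (*-cong (≈-refl {x = fromℚ a}) (moment-catalan n)) ⟩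
        fromℚ (recip c 0<c) * (fromℚ a * fromℚ (catalan n)) ≈⟨ pointwise-≈
            {fromℚ (recip c 0<c) * (fromℚ a * fromℚ (catalan n))} {fromℚ (recip c 0<c ℚ.* (a ℚ.* catalan n))} (λ _ → refl) ⟩
        fromℚ (recip c 0<c ℚ.* (a ℚ.* catalan n))          ≈⟨ fromℚ-cong
            (trans (cong (recip c 0<c ℚ.*_) (sym ratio)) (trans (sym (ℚ.*-assoc (recip c 0<c) c (catalan (suc n))))
            (trans (cong (ℚ._* catalan (suc n)) (trans (ℚ.*-comm (recip c 0<c) c) (p*recip 0<c))) (ℚ.*-identityˡ (catalan (suc n)))))) ⟩
        fromℚ (catalan (suc n))                            ∎)
        where
        open import Relation.Binary.Reasoning.Setoid ℝ-ring.setoid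
        m : ℝ
        m = momentˢ σ (suc (suc (2 ℕ.* n)))
        a c : ℚ
        a = ι 4 ℚ.* ι (suc (2 ℕ.* n))
        c = ι (suc (2 ℕ.* n)) ℚ.+ ι 3
        0<c : 0ℚ ℚ.< c
        0<c = ℚ.+-mono-<-≤ (0<ι-suc (2 ℕ.* n)) (0≤ι 3)
        ratio : c ℚ.* catalan (suc n) ≡ a ℚ.* catalan n
        ratio = trans (trans (cong (λ t → (1ℚ ℚ.+ t ℚ.+ ι 3) ℚ.* catalan (suc n)) (ιℚ.ι-* 2 n))
            (SQ.solve 3 (λ t n x → (SQ.con (pos 1) SQ.:+ t SQ.:* n SQ.:+ SQ.con (pos 3)) SQ.:* x SQ.:=
            (SQ.con (pos 4) SQ.:+ t SQ.:* n) SQ.:* x) refl (ι 2) (ι n) (catalan (suc n))))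
          (trans (SQ.solve 2 (λ n x → (SQ.con (pos 4) SQ.:+ SQ.con (pos 2) SQ.:* n) SQ.:* x SQ.:= SQ.con (pos 2) SQ.:*
              ((SQ.con (pos 1) SQ.:+ (SQ.con (pos 1) SQ.:+ n)) SQ.:* x)) refl (ι n) (catalan (suc n)))
            (trans (cong (ι 2 ℚ.*_) (catalan-suc n))
              (trans (SQ.solve 2 (λ n x → SQ.con (pos 2) SQ.:*
                  ((SQ.con (pos 4) SQ.:* n SQ.:+ SQ.con (pos 2)) SQ.:* x) SQ.:= SQ.con (pos 4) SQ.:*
                  (SQ.con (pos 1) SQ.:+ SQ.con (pos 2) SQ.:* n) SQ.:* x) refl (ι n) (catalan n))
                (cong (λ t → ι 4 ℚ.* (1ℚ ℚ.+ t) ℚ.* catalan n) (sym (ιℚ.ι-* 2 n))))))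

-- Moments of the correction measures, and tree walks as coefficients of S.

module MomentExpansions where

  open ≡ using (refl; cong; cong₂; sym; trans)
  open import Defs
  open WalkSums using (module Sums)
  open WalkCounting using (module Embedding)
  open ClosedForms using (module Recursion)
  open RecursionSolution
  open CentralBinomial using (module SQ; module ℤℚ; ι-cancel)
  open BivariateSeries using (treeWalks-series)
  open PoleExpansion using (decompose; module Decomposition)
  open CoefficientRatios using (catalanSum)
  open DilationPowers using (toℚᵘ-ι; ιℤ≡/1)
  open CoefficientIdentity using (density)
  open RealArithmetic
  open RiemannSums
  open SemicircleIncrements
  open SemicircleMoments

  open Estimates
  open TestFunction using (fun)
  open ℝ using (seq)
  open ℚ⟦p⟧ using (Series; _⊕_; _⊛_)
  open Decomposition using (shift; degree)
  private
    powℚ : ℚ → ℕ → ℚ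
    powℚ = Sums.pow ℚ.+-*-commutativeRing

  evaluate : List ℤ → ℚ → ℚ
  evaluate []       y = 0ℚ
  evaluate (a ∷ as) y = ℤℚ.ιℤ a ℚ.+ y ℚ.* evaluate as y

  module _ {π : ℝ} (isπ : IsPi π) where

    arcCombination : List ℤ → ℕ → ℕ → ℝ
    arcCombination []       ℓ K = 0ℝ
    arcCombination (a ∷ as) ℓ K = fromℚ (ℤℚ.ιℤ a) * arcSum (2 ℕ.* ℓ) K + arcCombination as (suc ℓ) K

    arcCombination≈ : ∀ as ℓ K → ∑ (U.N K) (λ i → fromℚ (powℚ (U.x K i) (2 ℕ.* ℓ) ℚ.* U.Δ K ℚ.* evaluate as
        (U.x K i ℚ.* U.x K i)) * arc (U.x K i)) ≈ arcCombination as ℓ K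
    arcCombination≈ []       ℓ K = ≈-trans (∑-cong (U.N K) {g = λ i → 0ℝ * arc (U.x K i)}
        (λ i _ → *-cong {y = arc (U.x K i)} (fromℚ-cong (ℚ.*-zeroʳ (powℚ (U.x K i) (2 ℕ.* ℓ) ℚ.* U.Δ K))) ≈-refl))
      (≈-trans (∑-* (U.N K) 0ℝ (λ i → arc (U.x K i))) (ℝ-ring.zeroˡ (∑ (U.N K) λ i → arc (U.x K i))))
    arcCombination≈ (a ∷ as) ℓ K = ≈-trans (∑-cong (U.N K) {g = λ i → s i + t i}
        (λ i _ → pointwise-≈ λ n → split (U.x K i) (seq (arc (U.x K i)) n)))
      (≈-trans (∑-+ (U.N K) s t) (+-cong (∑-* (U.N K) (fromℚ (ℤℚ.ιℤ a))
          (λ i → fromℚ (powℚ (U.x K i) (2 ℕ.* ℓ) ℚ.* U.Δ K) * arc (U.x K i))) (arcCombination≈ as (suc ℓ) K)))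
      where
      s t : ℕ → ℝ
      s i = fromℚ (ℤℚ.ιℤ a) * (fromℚ (powℚ (U.x K i) (2 ℕ.* ℓ) ℚ.* U.Δ K) * arc (U.x K i))
      t i = fromℚ (powℚ (U.x K i) (2 ℕ.* suc ℓ) ℚ.* U.Δ K ℚ.* evaluate as (U.x K i ℚ.* U.x K i)) * arc (U.x K i)
      split : ∀ x r → powℚ x (2 ℕ.* ℓ) ℚ.* U.Δ K ℚ.* (ℤℚ.ιℤ a ℚ.+ x ℚ.* x ℚ.* evaluate as (x ℚ.* x)) ℚ.* r ≡
                      ℤℚ.ιℤ a ℚ.* (powℚ x (2 ℕ.* ℓ) ℚ.* U.Δ K ℚ.* r) ℚ.+ powℚ x (2 ℕ.* suc ℓ) ℚ.* U.Δ K ℚ.* evaluate as (x ℚ.* x) ℚ.* r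
      split x r = trans (SQ.solve 6 (λ m d a x e r → m SQ.:* d SQ.:* (a SQ.:+ x SQ.:* x SQ.:* e) SQ.:* r SQ.:= a SQ.:*
          (m SQ.:* d SQ.:* r) SQ.:+ x SQ.:* (x SQ.:* m) SQ.:* d SQ.:* e SQ.:* r) refl
          (powℚ x (2 ℕ.* ℓ)) (U.Δ K) (ℤℚ.ιℤ a) x (evaluate as (x ℚ.* x)) r)
        (cong (λ k → ℤℚ.ιℤ a ℚ.* (powℚ x (2 ℕ.* ℓ) ℚ.* U.Δ K ℚ.* r) ℚ.+ powℚ x k ℚ.* U.Δ K ℚ.* evaluate as (x ℚ.* x) ℚ.* r)
            (sym (ℕ.*-suc 2 ℓ)))

    evenPolynomial-rational : ∀ as q n → seq (evenPolynomial as (fromℚ q)) n ≡ evaluate as (q ℚ.* q)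
    evenPolynomial-rational []       q n = refl
    evenPolynomial-rational (a ∷ as) q n = cong₂ ℚ._+_ (sym (ιℤ≡/1 a)) (cong (q ℚ.* q ℚ.*_) (evenPolynomial-rational as q n))

    leftSum≈arcCombination : ∀ as ℓ K → U.leftSum K (λ z → fun (monomial (2 ℕ.* ℓ)) z * semicircleDensity π (proj₁ isπ)
        (evenPolynomial as) z) ≈ scale isπ * arcCombination as ℓ K
    leftSum≈arcCombination as ℓ K = ≈-trans (∑-cong (U.N K) {g = λ i → scale isπ * term i} (λ i _ → pointwise-≈ λ n →
        trans (cong₂ (λ t e → t ℚ.* (½ ℚ.* seq (π ⁻¹⟨ proj₁ isπ ⟩) n ℚ.* e ℚ.* seq (arc (U.x K i)) n) ℚ.* U.Δ K)
            (monomial-rational isπ (2 ℕ.* ℓ) (U.x K i) n) (evenPolynomial-rational as (U.x K i) n))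
          (SQ.solve 6 (λ m h p e r d → m SQ.:* (h SQ.:* p SQ.:* e SQ.:* r) SQ.:* d SQ.:= h SQ.:* p SQ.:* (m SQ.:* d SQ.:* e SQ.:* r)) refl
            (powℚ (U.x K i) (2 ℕ.* ℓ)) ½ (seq (π ⁻¹⟨ proj₁ isπ ⟩) n) (evaluate as (U.x K i ℚ.* U.x K i)) (seq (arc (U.x K i)) n) (U.Δ K))))
      (≈-trans (∑-* (U.N K) (scale isπ) term) (*-cong (≈-refl {x = scale isπ}) (arcCombination≈ as ℓ K)))
      where
      term : ℕ → ℝ
      term i = fromℚ (powℚ (U.x K i) (2 ℕ.* ℓ) ℚ.* U.Δ K ℚ.* evaluate as (U.x K i ℚ.* U.x K i)) * arc (U.x K i)

    module _ {σ : SignedMeasure} (hasDensity : HasDensityOn (fromℚ -2ℚ) (fromℚ 2ℚ) (semicircleDensity π (proj₁ isπ) (λ _ → 1ℝ)) σ) where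

      arcCombination-limit : ∀ as ℓ → Limit (λ K → scale isπ * arcCombination as ℓ K) (fromℚ (catalanSum as ℓ))
      arcCombination-limit []       ℓ = limit-cong (λ K → ≈-sym (ℝ-ring.zeroʳ (scale isπ))) limit-zero
      arcCombination-limit (a ∷ as) ℓ ε 0<ε = eventually₁ (λ K → bounded-cong
          (+-cong (≈-refl {x = scale isπ * arcCombination (a ∷ as) ℓ K}) (neg-cong total)))
        (limit-cong (λ K → SR.solve 4 (λ a c s t → a SR.:* (c SR.:* s) SR.:+ c SR.:* t SR.:= c SR.:* (a SR.:* s SR.:+ t)) ≈-refl
            (fromℚ (ℤℚ.ιℤ a)) (scale isπ) (arcSum (2 ℕ.* ℓ) K) (arcCombination as (suc ℓ) K))
          (limit-+ (limit-* (fromℚ (ℤℚ.ιℤ a)) (moment-limit isπ {σ} hasDensity (2 ℕ.* ℓ))) (arcCombination-limit as (suc ℓ))) ε 0<ε)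
        where
        total : fromℚ (ℤℚ.ιℤ a) * momentˢ σ (2 ℕ.* ℓ) + fromℚ (catalanSum as (suc ℓ)) ≈ fromℚ (catalanSum (a ∷ as) ℓ)
        total = ≈-trans (+-cong (*-cong (≈-refl {x = fromℚ (ℤℚ.ιℤ a)}) (moment-catalan isπ {σ} hasDensity ℓ))
            (≈-refl {x = fromℚ (catalanSum as (suc ℓ))})) (pointwise-≈ λ _ → refl)

      -- With density polynomial in z² times that of the semicircle law, the Riemann sums for the
      -- moment are combinations of those for the moments of `σ`. The limits of the latter are
      -- known, and the sums determine the moment.
      moment-catalanSum : ∀ {p τ} as → (∀ z → p z ≡ evenPolynomial as z) → HasDensityOn (fromℚ -2ℚ) (fromℚ 2ℚ)
          (semicircleDensity π (proj₁ isπ) p) τ →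
                          ∀ ℓ → momentˢ τ (2 ℕ.* ℓ) ≈ fromℚ (catalanSum as ℓ)
      moment-catalanSum {p} {τ} as p≡ density ℓ = limit-unique
        (limit-cong (λ K → ≈-trans (U.leftSum-cong K {f₁} {f₂}
            (λ i _ → *-cong (≈-refl {x = fun (monomial (2 ℕ.* ℓ)) (fromℚ (U.x K i))})
            (ℝ-ring.reflexive (cong (λ t → fromℚ ½ * π ⁻¹⟨ proj₁ isπ ⟩ * t * √
            (fromℚ 4ℚ - fromℚ (U.x K i) * fromℚ (U.x K i))) (p≡ (fromℚ (U.x K i)))))))
            (leftSum≈arcCombination as ℓ K))
          (converges -2ℚ 4ℚ 0<4 {f = f₁} (≈-refl {x = fromℚ -2ℚ}) (≈-refl {x = fromℚ 2ℚ}) (density (monomial (2 ℕ.* ℓ)))))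
        (arcCombination-limit as ℓ)
        where
        f₁ f₂ : ℝ → ℝ
        f₁ z = fun (monomial (2 ℕ.* ℓ)) z * semicircleDensity π (proj₁ isπ) p z
        f₂ z = fun (monomial (2 ℕ.* ℓ)) z * semicircleDensity π (proj₁ isπ) (evenPolynomial as) z

  P≡density : ∀ (i : Fin 5) z → P i z ≡ evenPolynomial (density (suc (toℕ i))) z
  P≡density zero                         z = refl
  P≡density (suc zero)                   z = refl
  P≡density (suc (suc zero))             z = refl
  P≡density (suc (suc (suc zero)))       z = refl
  P≡density (suc (suc (suc (suc zero)))) z = refl

  -- The `degree` is such that multiplication by p to the `shift` moves coefficient ℓ - i of `S 1 i`
  -- to the index ℓ + `degree`.
  shift≡ : ∀ {i} → i ℕ.< 6 → shift (decompose i) ≡ degree (decompose i) ℕ.+ i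
  shift≡ = toWitness {a? = ℕ.allUpTo? (λ i → shift (decompose i) ℕ.≟ degree (decompose i) ℕ.+ i) 6} tt

  fraction-ι : ∀ a b .{{_ : ℕ.NonZero b}} → ι b ℚ.* (pos a ℚ./ b) ≡ ι a
  fraction-ι a (suc b) = ℚ.toℚᵘ-injective (ℚᵘ.≃-trans (ℚ.toℚᵘ-homo-* (ι (suc b)) (pos a ℚ./ suc b))
    (ℚᵘ.≃-trans (ℚᵘ.*-cong (toℚᵘ-ι (suc b)) (ℚ.toℚᵘ-fromℚᵘ (ℚᵘ.mkℚᵘ (pos a) b)))
      (ℚᵘ.≃-trans (ℚᵘ.*≡* cross) (ℚᵘ.≃-sym (toℚᵘ-ι a)))))
    where
    cross : pos (suc b) ℤ.* pos a ℤ.* pos 1 ≡ pos a ℤ.* pos (suc (b ℕ.+ 0))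
    cross = trans (ℤ.*-identityʳ (pos (suc b) ℤ.* pos a)) (trans (ℤ.*-comm (pos (suc b)) (pos a))
        (cong (λ n → pos a ℤ.* pos (suc n)) (sym (ℕ.+-identityʳ b))))

  fraction-unique : ∀ a b x .{{_ : ℕ.NonZero b}} → ι a ≡ ι b ℚ.* x → pos a ℚ./ b ≡ x
  fraction-unique a b@(suc b′) x eq = ι-cancel b′ (trans (fraction-ι a b) eq)

  treeWalkRatio : ℕ → ℕ → ℚ
  treeWalkRatio L k = (pos (w (suc k) L) ℚ./ (suc k !)) {{suc k ℕ.!≢0}}

  S-constant : ∀ e → S 1 e 0 ≡ S 0 e 0
  S-constant e = trans (S-recursion 0 e 0 tt) (trans (cong (S 0 e 0 ℚ.+_)
      (ℚ⟦p⟧.variable-⊛-zero (Recursion.splits _⊕_ _⊛_ (Embedding.ι 𝔸) 1 S 0 e))) (ℚ.+-identityʳ (S 0 e 0)))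

  -- For one vertex the conventions for `w 1` are exactly the constant terms of `S 1`, which equal
  -- those of `S 0`; from two vertices on the walks have been counted.
  treeWalkRatio-S : ∀ k e → e ℕ.< 6 → treeWalkRatio (2 ℕ.* (k ℕ.+ e)) k ≡ S 1 e k
  treeWalkRatio-S zero    zero    _   = sym (trans (S-constant 0) (S-zero 0))
  treeWalkRatio-S zero    (suc e) _   = sym (trans (S-constant (suc e)) (S-zero-suc e 0))
  treeWalkRatio-S (suc k) e       e<6 = go (2 ℕ.* (suc k ℕ.+ e)) refl
    where
    go : ∀ L → L ≡ 2 ℕ.* (suc k ℕ.+ e) → treeWalkRatio L (suc k) ≡ S 1 e (suc k)
    go (suc r) eq = fraction-unique (w (suc (suc k)) (suc r)) (suc (suc k) !) (S 1 e (suc k)) {{suc (suc k) ℕ.!≢0}}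
        (treeWalks-series k e r e<6 eq)

-- Both moments as polynomials in 1 / c, and the estimate of their difference.

open ≡ using (refl; cong; cong₂; sym; trans; subst)
open import Defs
open WalkSums using (module Sums)
open RecursionSolution
open CentralBinomial using (module SQ)
open PoleExpansion using (pow-cong; decompose; module Decomposition)
open CoefficientRatios using (catalan; catalanSum; pow-p-⊛; pow-p-⊛-low)
open DilationPowers using (fSeries; module Rℚ; conv-⊛)
open CoefficientIdentity using (density; S-coefficient)
open RealArithmetic
open RiemannSums
open SemicircleMoments
open MomentExpansions

open Estimates
open TestFunction using (fun)
open ℝ using (seq)

open SignedMeasure using (plus; minus)
open Measure using (∫; ∫-cong; ∫-*)
open ℚ⟦p⟧ using (Series; _⊛_)
open Decomposition using (shift; degree)

infixl 6 _+ᴸ_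
infixl 7 _*ᴸ_
infixr 8 _^ᴸ_

scaleᴸ : ℚ → List ℚ → List ℚ
scaleᴸ a = List.map (a ℚ.*_)

_+ᴸ_ _*ᴸ_ : List ℚ → List ℚ → List ℚ
[]       +ᴸ bs       = bs
(a ∷ as) +ᴸ []       = a ∷ as
(a ∷ as) +ᴸ (b ∷ bs) = a ℚ.+ b ∷ as +ᴸ bs
[]       *ᴸ bs = []
(a ∷ as) *ᴸ bs = scaleᴸ a bs +ᴸ (0ℚ ∷ as *ᴸ bs)

_^ᴸ_ : List ℚ → ℕ → List ℚ
as ^ᴸ zero  = 1ℚ ∷ []
as ^ᴸ suc n = as *ᴸ as ^ᴸ n

coefficient : List ℚ → Series
coefficient []       i       = 0ℚ
coefficient (a ∷ as) zero    = a
coefficient (a ∷ as) (suc i) = coefficient as i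

coefficient-+ : ∀ as bs i → coefficient (as +ᴸ bs) i ≡ coefficient as i ℚ.+ coefficient bs i
coefficient-+ []       bs       i       = sym (ℚ.+-identityˡ (coefficient bs i))
coefficient-+ (a ∷ as) []       i       = sym (ℚ.+-identityʳ (coefficient (a ∷ as) i))
coefficient-+ (a ∷ as) (b ∷ bs) zero    = refl
coefficient-+ (a ∷ as) (b ∷ bs) (suc i) = coefficient-+ as bs i

coefficient-scale : ∀ a bs i → coefficient (scaleᴸ a bs) i ≡ a ℚ.* coefficient bs i
coefficient-scale a []       i       = sym (ℚ.*-zeroʳ a)
coefficient-scale a (b ∷ bs) zero    = refl
coefficient-scale a (b ∷ bs) (suc i) = coefficient-scale a bs i

coefficient-* : ∀ as bs i → coefficient (as *ᴸ bs) i ≡ (coefficient as ⊛ coefficient bs) i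
coefficient-* []       bs i       = sym (ℚ⟦p⟧.⊛-zeroˡ (coefficient bs) (λ _ → refl) i)
coefficient-* (a ∷ as) bs zero    = trans (coefficient-+ (scaleᴸ a bs) (0ℚ ∷ as *ᴸ bs) 0)
  (trans (ℚ.+-identityʳ _) (coefficient-scale a bs 0))
coefficient-* (a ∷ as) bs (suc i) = trans (coefficient-+ (scaleᴸ a bs) (0ℚ ∷ as *ᴸ bs) (suc i))
  (cong₂ ℚ._+_ (coefficient-scale a bs (suc i)) (coefficient-* as bs i))

coefficient-^ : ∀ as n i → coefficient (as ^ᴸ n) i ≡ Sums.pow 𝔸 (coefficient as) n i
coefficient-^ as zero    zero    = refl
coefficient-^ as zero    (suc i) = refl
coefficient-^ as (suc n) i       = trans (coefficient-* as (as ^ᴸ n) i)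
  (ℚ⟦p⟧.⊛-cong {a = coefficient as} {b = coefficient (as ^ᴸ n)} (λ _ → refl) (coefficient-^ as n) i)

coefficient-tabulate : ∀ n (M : ℕ → ℚ) i → i ℕ.< n → coefficient (List.tabulate {n = n} (λ j → M (toℕ j))) i ≡ M i
coefficient-tabulate (suc n) M zero    _         = refl
coefficient-tabulate (suc n) M (suc i) (s≤s i<n) = coefficient-tabulate n (λ j → M (suc j)) i i<n

norm : List ℚ → ℚ
norm []       = 0ℚ
norm (a ∷ as) = ℚ.∣ a ∣ ℚ.+ norm as

module _ (x : ℝ) where

  polynomial-+ : ∀ as bs → polynomial (as +ᴸ bs) x ≈ polynomial as x + polynomial bs x
  polynomial-+ []       bs       = ≈-sym (ℝ-ring.+-identityˡ (polynomial bs x))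
  polynomial-+ (a ∷ as) []       = ≈-sym (ℝ-ring.+-identityʳ (polynomial (a ∷ as) x))
  polynomial-+ (a ∷ as) (b ∷ bs) = ≈-trans (+-cong (fromℚ-+ a b) (*-cong (≈-refl {x = x}) (polynomial-+ as bs)))
    (SR.solve 5 (λ a b x s t → a SR.:+ b SR.:+ x SR.:* (s SR.:+ t) SR.:= a SR.:+ x SR.:* s SR.:+ (b SR.:+ x SR.:* t)) ≈-refl
        (fromℚ a) (fromℚ b) x (polynomial as x) (polynomial bs x))

  polynomial-scale : ∀ a bs → polynomial (scaleᴸ a bs) x ≈ fromℚ a * polynomial bs x
  polynomial-scale a []       = ≈-sym (ℝ-ring.zeroʳ (fromℚ a))
  polynomial-scale a (b ∷ bs) = ≈-trans (+-cong (fromℚ-* a b) (*-cong (≈-refl {x = x}) (polynomial-scale a bs)))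
    (SR.solve 4 (λ a b x t → a SR.:* b SR.:+ x SR.:* (a SR.:* t) SR.:= a SR.:* (b SR.:+ x SR.:* t)) ≈-refl (fromℚ a) (fromℚ b) x
        (polynomial bs x))

  polynomial-* : ∀ as bs → polynomial (as *ᴸ bs) x ≈ polynomial as x * polynomial bs x
  polynomial-* []       bs = ≈-sym (ℝ-ring.zeroˡ (polynomial bs x))
  polynomial-* (a ∷ as) bs = ≈-trans (polynomial-+ (scaleᴸ a bs) (0ℚ ∷ as *ᴸ bs))
    (≈-trans (+-cong (polynomial-scale a bs) (≈-trans (ℝ-ring.+-identityˡ (x * polynomial (as *ᴸ bs) x))
        (*-cong (≈-refl {x = x}) (polynomial-* as bs))))
      (SR.solve 4 (λ a x s t → a SR.:* t SR.:+ x SR.:* (s SR.:* t) SR.:= (a SR.:+ x SR.:* s) SR.:* t) ≈-refl (fromℚ a) x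
          (polynomial as x) (polynomial bs x)))

  polynomial-^ : ∀ as n → polynomial (as ^ᴸ n) x ≈ polynomial as x ^ n
  polynomial-^ as zero    = ≈-trans (+-cong (≈-refl {x = 1ℝ}) (ℝ-ring.zeroʳ x)) (ℝ-ring.+-identityʳ 1ℝ)
  polynomial-^ as (suc n) = ≈-trans (polynomial-* as (as ^ᴸ n)) (*-cong (≈-refl {x = polynomial as x}) (polynomial-^ as n))

  polynomial-drop : ∀ n as → (∀ i → i ℕ.< n → coefficient as i ≡ 0ℚ) → polynomial as x ≈ x ^ n * polynomial (List.drop n as) x
  polynomial-drop zero    as       _  = ≈-sym (ℝ-ring.*-identityˡ (polynomial as x))
  polynomial-drop (suc n) []       _  = ≈-sym (ℝ-ring.zeroʳ (x ^ suc n))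
  polynomial-drop (suc n) (a ∷ as) a≡0 = ≈-trans (+-cong (fromℚ-cong (a≡0 0 (s≤s z≤n)))
      (*-cong (≈-refl {x = x}) (polynomial-drop n as (λ i i<n → a≡0 (suc i) (s≤s i<n)))))
    (≈-trans (ℝ-ring.+-identityˡ _) (≈-sym (ℝ-ring.*-assoc x (x ^ n) (polynomial (List.drop n as) x))))

  polynomial-bounded : x BoundedBy 1ℚ → ∀ as → polynomial as x BoundedBy norm as
  polynomial-bounded x≤1 []       = bounded-fromℚ {0ℚ} ℚ.≤-refl
  polynomial-bounded x≤1 (a ∷ as) = bounded-+ {fromℚ a} {x * polynomial as x} (bounded-fromℚ {a} ℚ.≤-refl)
    (bounded-weaken (ℚ.≤-reflexive (ℚ.*-identityˡ (norm as))) (bounded-* {x} {polynomial as x} x≤1 (polynomial-bounded x≤1 as)))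

-- Walks on k + 1 vertices come with the exponent ℓ - k of 1 / c, so the coefficient list begins
-- with the greatest `k`.
reversed : (ℕ → ℚ) → ℕ → List ℚ
reversed a zero    = a 0 ∷ []
reversed a (suc n) = a (suc n) ∷ reversed a n

coefficient-reversed : ∀ a k i → coefficient (reversed a (k ℕ.+ i)) i ≡ a k
coefficient-reversed a zero    zero    = refl
coefficient-reversed a (suc k) zero    = cong (λ j → a (suc j)) (ℕ.+-identityʳ k)
coefficient-reversed a k       (suc i) = trans (cong (λ j → coefficient (reversed a j) (suc i)) (ℕ.+-suc k i)) (coefficient-reversed a k i)

coefficient-reversed-high : ∀ a n i → n ℕ.< i → coefficient (reversed a n) i ≡ 0ℚ
coefficient-reversed-high a zero    (suc i) _         = refl
coefficient-reversed-high a (suc n) (suc i) (s≤s n<i) = coefficient-reversed-high a n i n<i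

polynomial-reversed : ∀ a n x → ∑ (suc n) (λ k → x ^ (n ℕ.∸ k) * fromℚ (a k)) ≈ polynomial (reversed a n) x
polynomial-reversed a zero    x = ≈-trans (ℝ-ring.+-identityˡ (1ℝ * fromℚ (a 0))) (≈-trans (ℝ-ring.*-identityˡ (fromℚ (a 0)))
  (≈-sym (≈-trans (+-cong (≈-refl {x = fromℚ (a 0)}) (ℝ-ring.zeroʳ x)) (ℝ-ring.+-identityʳ (fromℚ (a 0))))))
polynomial-reversed a (suc n) x = ≈-trans (+-cong (≈-trans (∑-cong (suc n) {g = λ k → x * (x ^ (n ℕ.∸ k) * fromℚ (a k))} below)
      (≈-trans (∑-* (suc n) x (λ k → x ^ (n ℕ.∸ k) * fromℚ (a k))) (*-cong (≈-refl {x = x}) (polynomial-reversed a n x))))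
    (≈-trans (*-cong {y = fromℚ (a (suc n))} (ℝ-ring.reflexive (cong (x ^_) (ℕ.n∸n≡0 n))) ≈-refl) (ℝ-ring.*-identityˡ (fromℚ (a (suc n))))))
  (ℝ-ring.+-comm (x * polynomial (reversed a n) x) (fromℚ (a (suc n))))
  where
  below : ∀ k → k ℕ.< suc n → x ^ (suc n ℕ.∸ k) * fromℚ (a k) ≈ x * (x ^ (n ℕ.∸ k) * fromℚ (a k))
  below k (s≤s k≤n) = ≈-trans (*-cong {y = fromℚ (a k)} (ℝ-ring.reflexive (cong (x ^_) (ℕ.+-∸-assoc 1 k≤n))) ≈-refl)
      (ℝ-ring.*-assoc x (x ^ (n ℕ.∸ k)) (fromℚ (a k)))

monomial-scaled : ∀ α n x → fun (monomial n) (α * x) ≈ α ^ n * fun (monomial n) x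
monomial-scaled α zero    x = ≈-sym (ℝ-ring.*-identityˡ 1ℝ)
monomial-scaled α (suc n) x = ≈-trans (*-cong (≈-refl {x = α * x}) (monomial-scaled α n x))
  (SR.solve 4 (λ α x a m → α SR.:* x SR.:* (a SR.:* m) SR.:= α SR.:* a SR.:* (x SR.:* m)) ≈-refl α x (α ^ n) (fun (monomial n) x))

moment-dilate : ∀ α μ n → moment (dilateᵐ α μ) n ≈ α ^ n * moment μ n
moment-dilate α μ n = ≈-trans (∫-cong μ (scaled α (monomial n)) (constᵗ (α ^ n) *ᵗ monomial n) (monomial-scaled α n))
    (∫-* μ (α ^ n) (monomial n))

moment-Λ : ∀ α σ n → momentˢ (Λ α σ) n ≈ α ^ n * momentˢ σ n
moment-Λ α σ n = ≈-trans (+-cong (moment-dilate α (plus σ) n) (neg-cong (moment-dilate α (minus σ) n)))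
  (SR.solve 3 (λ a u v → a SR.:* u SR.:- a SR.:* v SR.:= a SR.:* (u SR.:- v)) ≈-refl (α ^ n) (moment (plus σ) n) (moment (minus σ) n))

moment-+ˢ : ∀ σ τ n → momentˢ (σ +ˢ τ) n ≈ momentˢ σ n + momentˢ τ n
moment-+ˢ σ τ n = SR.solve 4 (λ a b c d → (a SR.:+ b) SR.:- (c SR.:+ d) SR.:= (a SR.:- c) SR.:+ (b SR.:- d)) ≈-refl
  (moment (plus σ) n) (moment (plus τ) n) (moment (minus σ) n) (moment (minus τ) n)

⁺-⁻ : ∀ r → r ⁺ - r ⁻ ≈ r
⁺-⁻ r = pointwise-≈ λ n → positive-part (seq r n)
  where
  positive-part : ∀ q → (0ℚ ℚ.⊔ q) ℚ.- (0ℚ ℚ.⊔ (ℚ.- q)) ≡ q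
  positive-part q with ℚ.≤-total 0ℚ q
  ... | inj₁ 0≤q = trans (cong₂ ℚ._-_ (ℚ.p≤q⇒p⊔q≡q 0≤q) (ℚ.p≥q⇒p⊔q≡p (ℚ.neg-antimono-≤ 0≤q))) (ℚ.+-identityʳ q)
  ... | inj₂ q≤0 = trans (cong₂ ℚ._-_ (ℚ.p≥q⇒p⊔q≡p q≤0) (ℚ.p≤q⇒p⊔q≡q (ℚ.neg-antimono-≤ q≤0)))
                     (SQ.solve 1 (λ q → SQ.con (pos 0) SQ.:- (SQ.:- q) SQ.:= q) refl q)

moment-• : ∀ r σ n → momentˢ (r • σ) n ≈ r * momentˢ σ n
moment-• r σ n = ≈-trans (SR.solve 4 (λ p m u v → (p SR.:* u SR.:+ m SR.:* v) SR.:- (p SR.:* v SR.:+ m SR.:* u) SR.:=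
    (p SR.:- m) SR.:* (u SR.:- v)) ≈-refl
    (r ⁺) (r ⁻) (moment (plus σ) n) (moment (minus σ) n))
  (*-cong {y = momentˢ σ n} (⁺-⁻ r) ≈-refl)

-- The factor `y` collects the powers of `x` already extracted, so that the induction applies to the
-- remaining terms with `y * x`.
moment-∑ˢ : ∀ {n} (σ : Fin n → SignedMeasure) (M : Fin n → ℚ) (r : Fin n → ℝ) x y k → (∀ i → r i ≈ y * x ^ toℕ i) →
            (∀ i → momentˢ (σ i) k ≈ fromℚ (M i)) → momentˢ (∑ˢ (λ i → r i • σ i)) k ≈ y * polynomial (List.tabulate M) x
moment-∑ˢ {zero}  σ M r x y k r≈ m≈ = ≈-trans (ℝ-ring.-‿inverseʳ 0ℝ) (≈-sym (ℝ-ring.zeroʳ y))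
moment-∑ˢ {suc n} σ M r x y k r≈ m≈ = ≈-trans (moment-+ˢ (r zero • σ zero) (∑ˢ (λ i → r (suc i) • σ (suc i))) k)
  (≈-trans (+-cong (≈-trans (moment-• (r zero) (σ zero) k) (*-cong (≈-trans (r≈ zero) (ℝ-ring.*-identityʳ y)) (m≈ zero)))
      (moment-∑ˢ (λ i → σ (suc i)) (λ i → M (suc i)) (λ i → r (suc i)) x (y * x) k
        (λ i → ≈-trans (r≈ (suc i)) (≈-sym (ℝ-ring.*-assoc y x (x ^ toℕ i)))) (λ i → m≈ (suc i))))
    (SR.solve 4 (λ y a x t → y SR.:* a SR.:+ y SR.:* x SR.:* t SR.:= y SR.:* (a SR.:+ x SR.:* t)) ≈-refl y (fromℚ (M zero)) x
        (polynomial (List.tabulate (λ i → M (suc i))) x)))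

fList : List ℚ
fList = 1ℚ ∷ ½ ∷ pos 3 ℚ./ 8 ∷ pos 29 ℚ./ 16 ∷ pos 1987 ℚ./ 128 ∷ pos 47247 ℚ./ 256 ∷ []

coefficient-fList : ∀ i → coefficient fList i ≡ fSeries i
coefficient-fList 0 = refl
coefficient-fList 1 = refl
coefficient-fList 2 = refl
coefficient-fList 3 = refl
coefficient-fList 4 = refl
coefficient-fList 5 = refl
coefficient-fList (suc (suc (suc (suc (suc (suc _)))))) = refl

pow-even : ∀ X n i → Sums.pow 𝔸 X (2 ℕ.* n) i ≡ Sums.pow 𝔸 (X ⊛ X) n i
pow-even X zero    i = refl
pow-even X (suc n) i = trans (cong (λ k → Sums.pow 𝔸 X k i) (ℕ.*-suc 2 n))
  (trans (sym (ℚ⟦p⟧.⊛-assoc X X (Sums.pow 𝔸 X (2 ℕ.* n)) i))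
      (ℚ⟦p⟧.⊛-cong {a = X ⊛ X} {b = Sums.pow 𝔸 X (2 ℕ.* n)} (λ _ → refl) (pow-even X n) i))

module _ (ℓ : ℕ) where

  M : ℕ → ℚ
  M j = catalanSum (density j) ℓ

  treeWalkList semicircleList difference : List ℚ
  treeWalkList   = reversed (treeWalkRatio (2 ℕ.* ℓ)) ℓ
  semicircleList = fList ^ᴸ (2 ℕ.* ℓ) *ᴸ List.tabulate {n = 6} (λ j → M (toℕ j))
  difference     = treeWalkList +ᴸ scaleᴸ (ℚ.- 1ℚ) semicircleList

  semicircle-coefficient : ∀ i → i ℕ.< 6 → coefficient semicircleList i ≡ Rℚ.conv (Sums.pow 𝔸 (fSeries ⊛ fSeries) ℓ) M i
  semicircle-coefficient i i<6 = trans (coefficient-* (fList ^ᴸ (2 ℕ.* ℓ)) (List.tabulate {n = 6} (λ j → M (toℕ j))) i)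
    (trans (ℚ⟦p⟧.⊛-cong≤ i (λ j _ → power j) (λ j j≤i → coefficient-tabulate 6 M j (ℕ.≤-<-trans j≤i i<6)))
      (sym (conv-⊛ (Sums.pow 𝔸 (fSeries ⊛ fSeries) ℓ) M i)))
    where
    power : ∀ j → coefficient (fList ^ᴸ (2 ℕ.* ℓ)) j ≡ Sums.pow 𝔸 (fSeries ⊛ fSeries) ℓ j
    power j = trans (coefficient-^ fList (2 ℕ.* ℓ) j) (trans (pow-cong (λ i _ → coefficient-fList i) (2 ℕ.* ℓ) j tt) (pow-even fSeries ℓ j))

  -- If `i` exceeds ℓ, the list has no such entry, and the index on the right lies below the power
  -- of p; both are 0. Otherwise the entry belongs to ℓ - i + 1 vertices.
  S-shifted : ∀ i → i ℕ.< 6 → coefficient treeWalkList i ≡ (Sums.pow 𝔸 p (shift (decompose i)) ⊛ S 1 i) (ℓ ℕ.+ degree (decompose i))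
  S-shifted i i<6 with i ℕ.≤? ℓ
  ... | no i≰ℓ  = trans (coefficient-reversed-high (treeWalkRatio (2 ℕ.* ℓ)) ℓ i (ℕ.≰⇒> i≰ℓ))
    (sym (pow-p-⊛-low (shift (decompose i)) (S 1 i) _ (subst (ℓ ℕ.+ D ℕ.<_) (sym (shift≡ i<6))
        (subst (ℓ ℕ.+ D ℕ.<_) (ℕ.+-comm i D) (ℕ.+-monoˡ-< D (ℕ.≰⇒> i≰ℓ))))))
    where
    D : ℕ
    D = degree (decompose i)
  ... | yes i≤ℓ = begin
    coefficient (reversed (treeWalkRatio (2 ℕ.* ℓ)) ℓ) i
      ≡⟨ cong (λ l → coefficient (reversed (treeWalkRatio (2 ℕ.* l)) l) i) (sym k+i≡ℓ) ⟩
    coefficient (reversed (treeWalkRatio (2 ℕ.* (k ℕ.+ i))) (k ℕ.+ i)) i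
      ≡⟨ coefficient-reversed (treeWalkRatio (2 ℕ.* (k ℕ.+ i))) k i ⟩
    treeWalkRatio (2 ℕ.* (k ℕ.+ i)) k
      ≡⟨ treeWalkRatio-S k i i<6 ⟩
    S 1 i k
      ≡⟨ pow-p-⊛ (shift (decompose i)) (S 1 i) k ⟨
    (Sums.pow 𝔸 p (shift (decompose i)) ⊛ S 1 i) (shift (decompose i) ℕ.+ k)
      ≡⟨ cong (Sums.pow 𝔸 p (shift (decompose i)) ⊛ S 1 i) index ⟩
    (Sums.pow 𝔸 p (shift (decompose i)) ⊛ S 1 i) (ℓ ℕ.+ degree (decompose i)) ∎
    where
    open ≡-Reasoning
    k D : ℕ
    k = ℓ ℕ.∸ i
    D = degree (decompose i)
    k+i≡ℓ : k ℕ.+ i ≡ ℓ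
    k+i≡ℓ = ℕ.m∸n+n≡m i≤ℓ
    index : shift (decompose i) ℕ.+ k ≡ ℓ ℕ.+ D
    index = trans (cong (ℕ._+ k) (shift≡ i<6)) (trans (ℕ.+-assoc D i k)
        (trans (ℕ.+-comm D (i ℕ.+ k)) (cong (ℕ._+ D) (trans (ℕ.+-comm i k) k+i≡ℓ))))

  difference-coefficient : ∀ i → i ℕ.< 6 → coefficient difference i ≡ 0ℚ
  difference-coefficient i i<6 = trans (coefficient-+ treeWalkList (scaleᴸ (ℚ.- 1ℚ) semicircleList) i)
    (trans (cong₂ ℚ._+_ (trans (S-shifted i i<6) (trans (S-coefficient i i<6 ℓ) (sym (semicircle-coefficient i i<6))))
        (coefficient-scale (ℚ.- 1ℚ) semicircleList i))
      (SQ.solve 1 (λ t → t SQ.:+ SQ.con (ℤ.- pos 1) SQ.:* t SQ.:= SQ.con (pos 0)) refl (coefficient semicircleList i)))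

-- The case ℓ = 0 of `S-coefficient`: the power of f is 1, so the convolution consists of the mass
-- alone, and the coefficient of the series lies below its power of p.
density-mass : ∀ (i : Fin 5) → catalanSum (density (suc (toℕ i))) 0 ≡ 0ℚ
density-mass i = begin
  N                                                        ≡⟨ ℚ.*-identityˡ N ⟨
  1ℚ ℚ.* N                                                 ≡⟨ ℚ⟦p⟧.constant-⊛ 1ℚ (λ j → catalanSum (density j) 0) (suc (toℕ i)) ⟨
  (ℚ⟦p⟧.constant 1ℚ ⊛ (λ j → catalanSum (density j) 0)) (suc (toℕ i)) ≡⟨ conv-⊛ (ℚ⟦p⟧.constant 1ℚ)
      (λ j → catalanSum (density j) 0) (suc (toℕ i)) ⟨
  Rℚ.conv (ℚ⟦p⟧.constant 1ℚ) (λ j → catalanSum (density j) 0) (suc (toℕ i)) ≡⟨ S-coefficient (suc (toℕ i)) i<6 0 ⟨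
  (Sums.pow 𝔸 p (shift δ) ⊛ S 1 (suc (toℕ i))) (degree δ)  ≡⟨ pow-p-⊛-low (shift δ) (S 1 (suc (toℕ i))) (degree δ)
      (subst (degree δ ℕ.<_) (sym (shift≡ i<6)) (ℕ.m<m+n (degree δ) (s≤s z≤n))) ⟩
  0ℚ                                                       ∎
  where
  open ≡-Reasoning
  i<6 : suc (toℕ i) ℕ.< 6
  i<6 = s≤s (Fin.toℕ<n i)
  δ = decompose (suc (toℕ i))
  N : ℚ
  N = catalanSum (density (suc (toℕ i))) 0

module _ {c : ℝ} (c>0 : 0ℝ < c) where

  ⁻¹-nonNeg : 0ℝ ≤ c ⁻¹⟨ c>0 ⟩
  ⁻¹-nonNeg = pointwise-≤ λ n → ℚ.<⇒≤ (0<recip (truncated>0 (seq c) (proj₁ (proj₂ c>0)) n))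

  ⁻¹≤1 : 1ℝ ≤ c → c ⁻¹⟨ c>0 ⟩ ≤ 1ℝ
  ⁻¹≤1 1≤c = ≤-trans (≈⇒≤ (≈-sym (ℝ-ring.*-identityˡ (c ⁻¹⟨ c>0 ⟩))))
    (≤-trans (*-mono-≤ (fromℚ-mono (ℚ.nonNegative⁻¹ 1ℚ)) ⁻¹-nonNeg 1≤c ≤-refl) (≈⇒≤ (*-⁻¹ c>0)))

theorem2 :
    (μ : (c : ℝ) → 0ℝ < c → Measure) →
    (∀ c c>0 → IsProbability (μ c c>0)) →
    (∀ c c>0 ℓ → moment (μ c c>0) (suc (2 ℕ.* ℓ)) ≈ 0ℝ) →
    (∀ c c>0 ℓ → moment (μ c c>0) (2 ℕ.* ℓ) ≈ treeWalkMoment c c>0 ℓ) →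
    (π : ℝ) (isπ : IsPi π) →
    (σ : SignedMeasure) (σᵢ : Fin 5 → SignedMeasure) →
    HasDensityOn (fromℚ (ℚ.- (pos 2 ℚ./ 1))) (fromℚ (pos 2 ℚ./ 1))
      (semicircleDensity π (proj₁ isπ) (λ _ → 1ℝ)) σ →
    (∀ i → HasDensityOn (fromℚ (ℚ.- (pos 2 ℚ./ 1))) (fromℚ (pos 2 ℚ./ 1))
      (semicircleDensity π (proj₁ isπ) (P i)) (σᵢ i)) →
    (∀ i → momentˢ (σᵢ i) 0 ≈ 0ℝ) ×
    (∀ ℓ → ∃[ K ] ∃[ c₀ ] ∀ c (c>0 : 0ℝ < c) → c₀ ≤ c →
      let c⁻¹ = c ⁻¹⟨ c>0 ⟩ in
      ∣ moment (μ c c>0) (2 ℕ.* ℓ)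
        - momentˢ (Λ (f c⁻¹) (σ +ˢ ∑ˢ (λ i → c⁻¹ ^ suc (toℕ i) • σᵢ i))) (2 ℕ.* ℓ) ∣
      ≤ K * c⁻¹ ^ 6)
theorem2 μ _ _ μ-even π isπ σ σᵢ σ-density σᵢ-density =
  (λ i → ≈-trans (corrections i 0) (fromℚ-cong (density-mass i))) ,
  -- For c ≥ 1 the argument 1 / c is at most 1, and a polynomial is then bounded by the sum of the
  -- absolute values of its coefficients. Here it is the quotient of the difference by (1 / c) ^ 6.
  λ ℓ → fromℚ (norm (List.drop 6 (difference ℓ))) , 1ℝ , estimate ℓ
  where
  corrections : ∀ i ℓ → momentˢ (σᵢ i) (2 ℕ.* ℓ) ≈ fromℚ (catalanSum (density (suc (toℕ i))) ℓ)
  corrections i = moment-catalanSum isπ {σ} σ-density {P i} {σᵢ i} (density (suc (toℕ i))) (P≡density i) (σᵢ-density i)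
  principal : ∀ ℓ → momentˢ σ (2 ℕ.* ℓ) ≈ fromℚ (M ℓ 0)
  principal ℓ = ≈-trans (moment-catalan isπ {σ} σ-density ℓ)
      (fromℚ-cong (sym (trans (ℚ.+-identityʳ (1ℚ ℚ.* catalan ℓ)) (ℚ.*-identityˡ (catalan ℓ)))))
  estimate : ∀ ℓ c (c>0 : 0ℝ < c) → 1ℝ ≤ c → let x = c ⁻¹⟨ c>0 ⟩ in
    ∣ moment (μ c c>0) (2 ℕ.* ℓ) - momentˢ (Λ (f x) (σ +ˢ ∑ˢ (λ i → x ^ suc (toℕ i) • σᵢ i))) (2 ℕ.* ℓ) ∣
    ≤ fromℚ (norm (List.drop 6 (difference ℓ))) * x ^ 6
  estimate ℓ c c>0 1≤c = begin
    ∣ moment (μ c c>0) (2 ℕ.* ℓ) - momentˢ (Λ (f x) τ) (2 ℕ.* ℓ) ∣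
      ≈⟨ ∣∣-cong (+-cong (≈-trans (μ-even c c>0 ℓ) (polynomial-reversed (treeWalkRatio (2 ℕ.* ℓ)) ℓ x)) (neg-cong semicircle)) ⟩
    ∣ polynomial (treeWalkList ℓ) x - polynomial (semicircleList ℓ) x ∣
      ≈⟨ ∣∣-cong (≈-trans (≈-sym subtract) (polynomial-drop x 6 (difference ℓ) (difference-coefficient ℓ))) ⟩
    ∣ x ^ 6 * polynomial (List.drop 6 (difference ℓ)) x ∣
      ≈⟨ ≈-trans (∣-∣-homo-* (x ^ 6) _) (*-cong {y = ∣ polynomial (List.drop 6 (difference ℓ)) x ∣}
          (0≤⇒∣-∣≈ (^-nonNeg (⁻¹-nonNeg c>0) 6)) ≈-refl) ⟩
    x ^ 6 * ∣ polynomial (List.drop 6 (difference ℓ)) x ∣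
      ≲⟨ *-mono-≤ (^-nonNeg (⁻¹-nonNeg c>0) 6) (≤-trans (0≤∣-∣ _) bounded) ≤-refl bounded ⟩
    x ^ 6 * fromℚ (norm (List.drop 6 (difference ℓ)))
      ≈⟨ ℝ-ring.*-comm (x ^ 6) _ ⟩
    fromℚ (norm (List.drop 6 (difference ℓ))) * x ^ 6 ∎
    where
    open ≤-Reasoning
    x : ℝ
    x = c ⁻¹⟨ c>0 ⟩
    τ : SignedMeasure
    τ = σ +ˢ ∑ˢ (λ i → x ^ suc (toℕ i) • σᵢ i)
    bounded : polynomial (List.drop 6 (difference ℓ)) x BoundedBy norm (List.drop 6 (difference ℓ))
    bounded = polynomial-bounded x (nonNeg-bounded (⁻¹-nonNeg c>0) (⁻¹≤1 c>0 1≤c)) (List.drop 6 (difference ℓ))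
    semicircle : momentˢ (Λ (f x) τ) (2 ℕ.* ℓ) ≈ polynomial (semicircleList ℓ) x
    semicircle = ≈-trans (moment-Λ (f x) τ (2 ℕ.* ℓ)) (≈-trans (*-cong (≈-sym (polynomial-^ x fList (2 ℕ.* ℓ)))
        (≈-trans (moment-+ˢ σ (∑ˢ (λ i → x ^ suc (toℕ i) • σᵢ i)) (2 ℕ.* ℓ)) (+-cong (principal ℓ)
          (moment-∑ˢ σᵢ (λ i → M ℓ (suc (toℕ i))) (λ i → x ^ suc (toℕ i)) x x (2 ℕ.* ℓ) (λ _ → ≈-refl) (λ i → corrections i ℓ)))))
      (≈-sym (polynomial-* x (fList ^ᴸ (2 ℕ.* ℓ)) (List.tabulate {n = 6} (λ j → M ℓ (toℕ j))))))
    subtract : polynomial (difference ℓ) x ≈ polynomial (treeWalkList ℓ) x - polynomial (semicircleList ℓ) x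
    subtract = ≈-trans (polynomial-+ x (treeWalkList ℓ) (scaleᴸ (ℚ.- 1ℚ) (semicircleList ℓ)))
      (+-cong (≈-refl {x = polynomial (treeWalkList ℓ) x}) (≈-trans (polynomial-scale x (ℚ.- 1ℚ) (semicircleList ℓ))
        (pointwise-≈ λ n → SQ.solve 1 (λ t → SQ.con (ℤ.- pos 1) SQ.:* t SQ.:= SQ.:- t) refl (seq (polynomial (semicircleList ℓ) x) n))))
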